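{- Let $x$ be sufficiently large and let $k\le(\log x)^{1/5}$. Then there is a prime $p_0\gg\log\log x$ such that the following holds. Let $\mathcal{L}=\{L_1,\dots,L_k\}$ be a $\langle P_3\rangle$-admissible set of linear functions whose coefficients $L_i(n)=a_in+b_i$ satisfy $0<a_i\le(\log x)^{1/3}$, $\gcd(2p_0,a_i)=1$ and $0<b_i<x$. Then there is an absolute constant $C>0$ such that \[\#\{n\in[x,2x]:\ \text{at least } k^{1/2}/C \text{ of } L_1(n),\dots,L_k(n)\text{ lie in }\mathcal{S}\}\ge x\exp(-(\log x)^{1/2}).\]
   Context: $\mathcal{S}$ denotes the set of positive integers representable as a sum of two squares. A set $\mathcal{L}=\{L_1,\dots,L_k\}$ of distinct linear functions $L_i(n)=a_in+b_i$ with integer coefficients is called $\langle P_3\rangle$-admissible if for every prime $p\equiv3\pmod4$ there is an integer $n_p$ with $\gcd(\prod_{i=1}^kL_i(n_p),p)=1$, and $a_i,b_i>0$ for all $i$. -}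

module Defs where

open import Data.Nat.Base as ℕ using (ℕ; zero; suc; _!)
open import Data.Nat.Properties using (_!≢0)
open import Data.Nat.Primality using (Prime)
open import Data.Integer.Base as ℤ using (ℤ; +_; 0ℤ; 1ℤ)
open import Data.Integer.GCD using (gcd)
open import Data.Rational.Base as ℚ using (ℚ; 0ℚ; 1ℚ)
open import Data.Fin.Base using (Fin)
open import Data.List.Base using (List; length)
open import Data.List.Relation.Unary.All using (All)
open import Data.List.Relation.Unary.Unique.Propositional using (Unique)
open import Data.Vec.Functional using (foldr)
open import Data.Product.Base using (Σ-syntax; ∃-syntax; _×_)
open import Data.Sum.Base using (_⊎_)
open import Algebra.Definitions.RawSemiring ℚ.+-*-rawSemiring using (_^_)
open import Function.Definitions using (Injective)
open import Relation.Binary.PropositionalEquality using (_≡_)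
open import Relation.Nullary.Negation using (¬_)

-- A real number y is given by the rationals below it (lower q is q < y) and
-- the rationals above it (upper q is y < q).  The operations below act on
-- bare pairs of predicates, so that no proof of locatedness is needed to form
-- an expression; variables ranging over the reals are taken in ℝ.

record Cut : Set₁ where
  field
    lower : ℚ → Set
    upper : ℚ → Set

open Cut public

record IsDedekind (y : Cut) : Set where
  field
    lower-inhabited : ∃[ q ] lower y q
    upper-inhabited : ∃[ q ] upper y q
    lower-closed    : ∀ {q r} → q ℚ.< r → lower y r → lower y q
    upper-closed    : ∀ {q r} → q ℚ.< r → upper y q → upper y r
    lower-open      : ∀ {q} → lower y q → ∃[ r ] (q ℚ.< r × lower y r)
    upper-open      : ∀ {r} → upper y r → ∃[ q ] (q ℚ.< r × upper y q)
    disjoint        : ∀ {q} → ¬ (lower y q × upper y q)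
    located         : ∀ {q r} → q ℚ.< r → lower y q ⊎ upper y r

record ℝ : Set₁ where
  field
    cut        : Cut
    isDedekind : IsDedekind cut

open ℝ public using (cut)

infix 4 _≤ᵣ_ _<ᵣ_
infixl 7 _*ᵣ_ _/ᵣ_
infix 8 -ᵣ_

_≤ᵣ_ : Cut → Cut → Set
u ≤ᵣ v = ∀ q → lower u q → lower v q

_<ᵣ_ : Cut → Cut → Set
u <ᵣ v = ∃[ q ] (upper u q × lower v q)

fromℚ : ℚ → Cut
fromℚ p = record { lower = λ q → q ℚ.< p ; upper = λ q → p ℚ.< q }

fromℤ : ℤ → Cut
fromℤ m = fromℚ (m ℚ./ 1)

fromℕ : ℕ → Cut
fromℕ n = fromℤ (+ n)

0ᵣ : Cut
0ᵣ = fromℚ 0ℚ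

-ᵣ_ : Cut → Cut
-ᵣ y = record { lower = λ q → upper y (ℚ.- q) ; upper = λ q → lower y (ℚ.- q) }

-- Interval multiplication: if a < u < b and c < v < d, then u v lies between
-- the least and the greatest of the four products of endpoints.
_*ᵣ_ : Cut → Cut → Cut
u *ᵣ v = record
  { lower = λ q → ∃[ a ] ∃[ b ] ∃[ c ] ∃[ d ]
      (lower u a × upper u b × lower v c × upper v d ×
       q ℚ.< a ℚ.* c × q ℚ.< a ℚ.* d × q ℚ.< b ℚ.* c × q ℚ.< b ℚ.* d)
  ; upper = λ q → ∃[ a ] ∃[ b ] ∃[ c ] ∃[ d ]
      (lower u a × upper u b × lower v c × upper v d ×
       a ℚ.* c ℚ.< q × a ℚ.* d ℚ.< q × b ℚ.* c ℚ.< q × b ℚ.* d ℚ.< q)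
  }

-- The reciprocal of y, meaningful only for y > 0.
recip⁺ : Cut → Cut
recip⁺ y = record
  { lower = λ q → ∃[ d ] (upper y d × q ℚ.* d ℚ.< 1ℚ)
  ; upper = λ q → ∃[ c ] (0ℚ ℚ.< c × lower y c × 1ℚ ℚ.< q ℚ.* c)
  }

-- Division, meaningful only for a positive divisor.
_/ᵣ_ : Cut → Cut → Cut
u /ᵣ v = u *ᵣ recip⁺ v

-- The nonnegative n-th root y^(1/n), meaningful only for y ≥ 0.
root : (n : ℕ) → .{{ℕ.NonZero n}} → Cut → Cut
root n y = record
  { lower = λ q → q ℚ.< 0ℚ ⊎ (0ℚ ℚ.≤ q × lower y (q ^ n))
  ; upper = λ q → 0ℚ ℚ.< q × upper y (q ^ n)
  }

-- The limit of a convergent sequence of rationals.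
lim : (ℕ → ℚ) → Cut
lim s = record
  { lower = λ q → ∃[ r ] (q ℚ.< r × ∃[ N ] (∀ n → N ℕ.≤ n → r ℚ.≤ s n))
  ; upper = λ q → ∃[ r ] (r ℚ.< q × ∃[ N ] (∀ n → N ℕ.≤ n → s n ℚ.≤ r))
  }

expTerm : ℚ → ℕ → ℚ
expTerm r i = r ^ i ℚ.* (ℚ._/_ 1ℤ (i !) {{i !≢0}})

expPartialSum : ℚ → ℕ → ℚ
expPartialSum r zero    = expTerm r zero
expPartialSum r (suc n) = expPartialSum r n ℚ.+ expTerm r (suc n)

expℚ : ℚ → Cut
expℚ r = lim (expPartialSum r)

-- The extension of expℚ to the reals, by continuity and strict monotonicity.
exp : Cut → Cut
exp y = record
  { lower = λ q → ∃[ r ] (lower y r × lower (expℚ r) q)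
  ; upper = λ q → ∃[ r ] (upper y r × upper (expℚ r) q)
  }

-- The inverse of exp, meaningful only for y > 0:
-- q < log y iff exp q < y, and log y < q iff y < exp q.
log : Cut → Cut
log y = record
  { lower = λ q → expℚ q <ᵣ y
  ; upper = λ q → y <ᵣ expℚ q
  }

-- #{a : P a} ≥ y, for y real.  Stated through a duplicate-free list of elements,
-- since membership in a set with real endpoints is not decidable.
#_≥_ : {A : Set} → (A → Set) → Cut → Set
#_≥_ {A} P y = Σ[ as ∈ List A ] (Unique as × All P as × y ≤ᵣ fromℕ (length as))

infix 4 #_≥_

𝒮 : ℤ → Set
𝒮 m = 0ℤ ℤ.< m × ∃[ u ] ∃[ v ] m ≡ u ℤ.* u ℤ.+ v ℤ.* v

-- The function n ↦ a n + b.  Distinct coefficient pairs give distinct functions,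
-- so propositional equality of records is equality of linear functions.
record LinearFunction : Set where
  constructor _·n+_
  field
    a b : ℤ

open LinearFunction public

_⟨_⟩ : LinearFunction → ℤ → ℤ
L ⟨ n ⟩ = a L ℤ.* n ℤ.+ b L

∏ : {k : ℕ} → (Fin k → ℤ) → ℤ
∏ = foldr ℤ._*_ 1ℤ

record P₃-Admissible {k : ℕ} (L : Fin k → LinearFunction) : Set where
  field
    distinct   : Injective _≡_ _≡_ L
    admissible : ∀ p → Prime p → p ℕ.% 4 ≡ 3 →
                 ∃[ n ] gcd (∏ (λ i → L i ⟨ n ⟩)) (+ p) ≡ 1ℤ
    positive   : ∀ i → 0ℤ ℤ.< a (L i) × 0ℤ ℤ.< b (L i)

{-# OPTIONS --safe #-}
module Submission where

-- The restriction on p₀ is harmless: any prime p₀ > x + 1 will do, and c = 1.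
--
-- Let ℓ ≈ log x and v ≈ ℓ^(1/20), so that k ≤ v⁴ and all aᵢ ≤ v⁷.  Restrict n to a progression modulo 4 ∏ p over the
-- primes p ≡ 3 (mod 4), p ≤ v⁷, on which none of these p divides any Lᵢ(n) (admissibility) and on which Lᵢ(n) ≡ 1 (mod 4)
-- for i in a set I of at least k/4 indices.  A Brun–Hooley sieve (Bonferroni sums truncated block by block) bounds from
-- below, for each i ∈ I, the number of n such that no prime p ≡ 3 (mod 4) below t divides any Lⱼ(n) and none
-- between t and z divides Lᵢ(n); here log z = (log t) 4^J with 4^J ≍ k, and z² ≥ Lᵢ(n).  Such a value Lᵢ(n) ≡ 1 (mod 4)
-- has an even number of prime factors p ≡ 3 (mod 4), hence none, hence is a sum of two squares.  Each lower bound is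
-- ≫ 2^(-J) ≍ k^(-1/2) times the upper bound for the number of n with all Lⱼ(n) free of primes p ≡ 3 (mod 4) below t, so
-- summing over i ∈ I, many such n have ≫ k^(1/2) values Lᵢ(n) in 𝒮.
--
-- The density input is Mertens' theorem for the primes p ≡ 3 (mod 4), obtained from L(1, χ) ≥ 1/2.  To avoid logarithms
-- everything is done with integer exponents of 2, the weight of a prime being ⌊T log₂ p⌋ for a large scale T.

-- The exponent budget shapes the proof. Let N be an integer next to x and ℓ about log₂ N. Sieving k
-- forms at once up to t costs t^(O(k)) in level of distribution, so log t is kept near ℓ/(2^21 k);
-- for values of size about N to be recognised as sums of two squares, one form must be sifted up to
-- z with log₂ z about ℓ/2. Hence log z / log t ≍ k, and as the primes 3 mod 4 have density 1/2,
-- passing from t to z costs the square root of this ratio: the source of k^(1/2). The block of the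
-- largest primes is truncated at no event and each block below at two events more, so the error has
-- exponent about (8/9 + 1) log₂ z = 17ℓ/18. Only the explicit values 3/4 and 3/8 for blocks of
-- ratio 4 keep the accumulated loss below 1. The modulus 4 ∏ p and the density of the sieve by all
-- forms cost at most 2^(v^9), with v^9 below (log x)^(1/2): this gives exp(-(log x)^(1/2)). Cuts
-- have no decidable order, so x is replaced at once by N with |x - N| < 1, and all estimates
-- compare integers or rationals.

module Rationals where

  open import Data.Nat.Base as ℕ using (ℕ; zero; suc)
  import Data.Nat.Properties as ℕₚ
  open import Data.Integer.Base as ℤ using (ℤ; +_)
  import Data.Integer.Properties as ℤₚ
  open import Data.Rational.Base
  open import Data.Rational.Properties
  import Data.Rational.Unnormalised.Base as ℚᵘ
  import Data.Rational.Unnormalised.Properties as ℚᵘₚ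
  open import Data.Maybe.Base using (Maybe; just; nothing)
  open import Data.Sum.Base using (inj₁; inj₂)
  open import Relation.Nullary using (Dec; yes; no; ¬_; contradiction)
  open import Relation.Binary.PropositionalEquality
  open import Tactic.RingSolver.Core.AlmostCommutativeRing using (AlmostCommutativeRing; fromCommutativeRing)
  open import Tactic.RingSolver using (solve-∀)
  open import Level using (0ℓ)

  -- Ordered-field arithmetic and finite sums of rationals

  ℚ-ring : AlmostCommutativeRing 0ℓ 0ℓ
  ℚ-ring = fromCommutativeRing +-*-commutativeRing (λ x → is0 (0ℚ ≟ x))
    where
    is0 : ∀ {x} → Dec (0ℚ ≡ x) → Maybe (0ℚ ≡ x)
    is0 (yes p) = just p
    is0 (no _)  = nothing

  ≤-by : ∀ {a b} d → 0ℚ ≤ d → b ≡ a + d → a ≤ b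
  ≤-by {a} d 0≤d refl = subst (_≤ a + d) (+-identityʳ a) (+-monoʳ-≤ a 0≤d)

  <-by : ∀ {a b} d → 0ℚ < d → b ≡ a + d → a < b
  <-by {a} d 0<d refl = subst (_< a + d) (+-identityʳ a) (+-monoʳ-< a 0<d)

  diff≥0 : ∀ {a b} → a ≤ b → 0ℚ ≤ b - a
  diff≥0 {a} {b} a≤b = subst (_≤ b - a) (+-inverseʳ a) (+-monoˡ-≤ (- a) a≤b)

  diff>0 : ∀ {a b} → a < b → 0ℚ < b - a
  diff>0 {a} {b} a<b = subst (_< b - a) (+-inverseʳ a) (+-monoˡ-< (- a) a<b)

  diff≥0⁻¹ : ∀ {a b} → 0ℚ ≤ b - a → a ≤ b
  diff≥0⁻¹ {a} {b} h = ≤-by (b - a) h (lem a b)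
    where
    lem : ∀ a b → b ≡ a + (b - a)
    lem = solve-∀ ℚ-ring

  +-nonNeg : ∀ {a b} → 0ℚ ≤ a → 0ℚ ≤ b → 0ℚ ≤ a + b
  +-nonNeg p q = +-mono-≤ p q

  *-nonNeg : ∀ {a b} → 0ℚ ≤ a → 0ℚ ≤ b → 0ℚ ≤ a * b
  *-nonNeg {a} {b} p q = subst (_≤ a * b) (*-zeroʳ a) (*-monoˡ-≤-nonNeg a {{nonNegative p}} q)

  *-positive : ∀ {a b} → 0ℚ < a → 0ℚ < b → 0ℚ < a * b
  *-positive {a} {b} p q = subst (_< a * b) (*-zeroʳ a) (*-monoʳ-<-pos a {{positive p}} q)

  *-monoʳ : ∀ {c a b} → 0ℚ ≤ c → a ≤ b → c * a ≤ c * b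
  *-monoʳ {c} p q = *-monoˡ-≤-nonNeg c {{nonNegative p}} q

  *-monoˡ : ∀ {c a b} → 0ℚ ≤ c → a ≤ b → a * c ≤ b * c
  *-monoˡ {c} p q = *-monoʳ-≤-nonNeg c {{nonNegative p}} q

  *-mono : ∀ {a b c d} → 0ℚ ≤ a → a ≤ b → 0ℚ ≤ c → c ≤ d → a * c ≤ b * d
  *-mono 0≤a a≤b 0≤c c≤d = ≤-trans (*-monoʳ 0≤a c≤d) (*-monoˡ (≤-trans 0≤c c≤d) a≤b)

  *-cancelˡ : ∀ {c a b} → 0ℚ < c → c * a ≤ c * b → a ≤ b
  *-cancelˡ {c} p q = *-cancelˡ-≤-pos c {{positive p}} q

  square-nonNeg : ∀ a → 0ℚ ≤ a * a
  square-nonNeg a with ≤-total 0ℚ a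
  ... | inj₁ p = *-nonNeg p p
  ... | inj₂ p = subst (0ℚ ≤_) (lem a) (*-nonNeg q q)
    where
    q = neg-antimono-≤ p
    lem : ∀ a → - a * - a ≡ a * a
    lem = solve-∀ ℚ-ring

  <⇒≱ : ∀ {a b} → a < b → ¬ b ≤ a
  <⇒≱ a<b b≤a = <-irrefl refl (<-≤-trans a<b b≤a)

  square-cancel-≤ : ∀ {a b} → 0ℚ ≤ b → a * a ≤ b * b → a ≤ b
  square-cancel-≤ {a} {b} 0≤b h with ≤-total a b
  ... | inj₁ a≤b = a≤b
  ... | inj₂ b≤a with a ≤? b
  ...   | yes a≤b = a≤b
  ...   | no a≰b = contradiction h (<⇒≱ (≤-<-trans (*-monoʳ 0≤b b≤a)
                     (*-monoˡ-<-pos a {{positive (≤-<-trans 0≤b (≰⇒> a≰b))}} (≰⇒> a≰b))))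

  0≤1 : 0ℚ ≤ 1ℚ
  0≤1 = ≤ᵇ⇒≤ _

  opaque
    -- Opaque so that the fractions of large numerals are not normalised during type checking;
    -- `ι-def` reopens it where a literal is compared.
    ι : ℕ → ℚ
    ι n = + n / 1

    ι-def : ∀ n → ι n ≡ + n / 1
    ι-def n = refl

    private
      uι : ∀ n → toℚᵘ (ι n) ℚᵘ.≃ ℚᵘ.mkℚᵘ (+ n) 0
      uι n = toℚᵘ-fromℚᵘ (ℚᵘ.mkℚᵘ (+ n) 0)

    ι-0 : ι 0 ≡ 0ℚ
    ι-0 = refl

    ι-1 : ι 1 ≡ 1ℚ
    ι-1 = refl

    ι-+ : ∀ m n → ι (m ℕ.+ n) ≡ ι m + ι n
    ι-+ m n = toℚᵘ-injective (ℚᵘₚ.≃-trans (uι (m ℕ.+ n)) (ℚᵘₚ.≃-sym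
      (ℚᵘₚ.≃-trans (toℚᵘ-homo-+ (ι m) (ι n)) (ℚᵘₚ.≃-trans (ℚᵘₚ.+-cong (uι m) (uι n))
        (ℚᵘ.*≡* (cong (ℤ._* + 1) (cong₂ ℤ._+_ (ℤₚ.*-identityʳ (+ m)) (ℤₚ.*-identityʳ (+ n)))))))))

    ι-* : ∀ m n → ι (m ℕ.* n) ≡ ι m * ι n
    ι-* m n = toℚᵘ-injective (ℚᵘₚ.≃-trans (uι (m ℕ.* n)) (ℚᵘₚ.≃-sym
      (ℚᵘₚ.≃-trans (toℚᵘ-homo-* (ι m) (ι n)) (ℚᵘₚ.≃-trans (ℚᵘₚ.*-cong (uι m) (uι n))
        (ℚᵘ.*≡* (cong (ℤ._* + 1) (sym (ℤₚ.pos-* m n))))))))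

    ι-mono : ∀ {m n} → m ℕ.≤ n → ι m ≤ ι n
    ι-mono {m} {n} m≤n = toℚᵘ-cancel-≤ (ℚᵘₚ.≤-respˡ-≃ (ℚᵘₚ.≃-sym (uι m)) (ℚᵘₚ.≤-respʳ-≃ (ℚᵘₚ.≃-sym (uι n))
      (ℚᵘ.*≤* (ℤₚ.*-monoʳ-≤-nonNeg (+ 1) (ℤ.+≤+ m≤n)))))

    ι-cancel : ∀ {m n} → ι m ≤ ι n → m ℕ.≤ n
    ι-cancel {m} {n} h with ℚᵘₚ.≤-respˡ-≃ (uι m) (ℚᵘₚ.≤-respʳ-≃ (uι n) (toℚᵘ-mono-≤ h))
    ... | ℚᵘ.*≤* q = ℤₚ.drop‿+≤+ (subst₂ ℤ._≤_ (ℤₚ.*-identityʳ (+ m)) (ℤₚ.*-identityʳ (+ n)) q)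

  ι-≥0 : ∀ n → 0ℚ ≤ ι n
  ι-≥0 n = subst (_≤ ι n) ι-0 (ι-mono ℕ.z≤n)

  ι-≥1 : ∀ {n} → 1 ℕ.≤ n → 1ℚ ≤ ι n
  ι-≥1 {n} h = subst (_≤ ι n) ι-1 (ι-mono h)

  0<1 : 0ℚ < 1ℚ
  0<1 = positive⁻¹ 1ℚ

  ι->0 : ∀ {n} → 1 ℕ.≤ n → 0ℚ < ι n
  ι->0 h = <-≤-trans 0<1 (ι-≥1 h)

  ι-suc : ∀ n → ι (suc n) ≡ 1ℚ + ι n
  ι-suc n = trans (ι-+ 1 n) (cong (_+ ι n) ι-1)

  ι-mono-< : ∀ {m n} → m ℕ.< n → ι m < ι n
  ι-mono-< {m} {n} h = <-≤-trans (<-by 1ℚ 0<1 (+-comm 1ℚ (ι m))) (subst (_≤ ι n) (ι-suc m) (ι-mono h))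

  opaque
    -- The junk value at 0 keeps `inv` total and frees `inv-*` from side conditions.
    inv : ℕ → ℚ
    inv zero    = 0ℚ
    inv (suc n) = + 1 / suc n

    inv-0 : inv 0 ≡ 0ℚ
    inv-0 = refl

    inv-def : ∀ n → .{{_ : ℕ.NonZero n}} → inv n ≡ + 1 / n
    inv-def (suc n) = refl

    private
      uinv : ∀ n → toℚᵘ (inv (suc n)) ℚᵘ.≃ ℚᵘ.mkℚᵘ (+ 1) n
      uinv n = toℚᵘ-fromℚᵘ (ℚᵘ.mkℚᵘ (+ 1) n)

    opaque
      unfolding ι
      ι*inv′ : ∀ n → ι (suc n) * inv (suc n) ≡ 1ℚ
      ι*inv′ n = toℚᵘ-injective (ℚᵘₚ.≃-trans (toℚᵘ-homo-* (ι (suc n)) (inv (suc n)))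
        (ℚᵘₚ.≃-trans (ℚᵘₚ.*-cong (toℚᵘ-fromℚᵘ (ℚᵘ.mkℚᵘ (+ suc n) 0)) (uinv n))
          (ℚᵘ.*≡* (trans (ℤₚ.*-identityʳ _) (trans (ℤₚ.*-identityʳ _)
            (sym (trans (ℤₚ.*-identityˡ _) (cong +_ (ℕₚ.*-identityˡ (suc n))))))))))

  ι*inv : ∀ {n} → 1 ℕ.≤ n → ι n * inv n ≡ 1ℚ
  ι*inv {suc n} _ = ι*inv′ n

  inv-≥0 : ∀ n → 0ℚ ≤ inv n
  inv-≥0 zero = ≤-reflexive (sym inv-0)
  inv-≥0 (suc n) = *-cancelˡ (ι->0 {suc n} (ℕ.s≤s ℕ.z≤n))
    (subst₂ _≤_ (sym (*-zeroʳ (ι (suc n)))) (sym (ι*inv′ n)) 0≤1)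

  inv-unique : ∀ {n q} → 1 ℕ.≤ n → ι n * q ≡ 1ℚ → q ≡ inv n
  inv-unique {n} {q} h e = begin
    q                       ≡⟨ sym (*-identityˡ q) ⟩
    1ℚ * q                  ≡⟨ cong (_* q) (sym (ι*inv h)) ⟩
    ι n * inv n * q         ≡⟨ lem (ι n) (inv n) q ⟩
    inv n * (ι n * q)       ≡⟨ cong (inv n *_) e ⟩
    inv n * 1ℚ              ≡⟨ *-identityʳ (inv n) ⟩
    inv n                   ∎
    where
    open ≡-Reasoning
    lem : ∀ a b c → a * b * c ≡ b * (a * c)
    lem = solve-∀ ℚ-ring

  inv-* : ∀ m n → inv (m ℕ.* n) ≡ inv m * inv n
  inv-* zero n = trans inv-0 (sym (trans (cong (_* inv n) inv-0) (*-zeroˡ (inv n))))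
  inv-* (suc m) zero = trans (cong inv (ℕₚ.*-zeroʳ m)) (trans inv-0 (sym (trans (cong (inv (suc m) *_) inv-0) (*-zeroʳ (inv (suc m))))))
  inv-* m@(suc _) n@(suc _) = sym (inv-unique (ℕ.s≤s ℕ.z≤n) (begin
    ι (m ℕ.* n) * (inv m * inv n)   ≡⟨ cong (_* (inv m * inv n)) (ι-* m n) ⟩
    ι m * ι n * (inv m * inv n)     ≡⟨ lem (ι m) (ι n) (inv m) (inv n) ⟩
    ι m * inv m * (ι n * inv n)     ≡⟨ cong₂ _*_ (ι*inv {m} (ℕ.s≤s ℕ.z≤n)) (ι*inv {n} (ℕ.s≤s ℕ.z≤n)) ⟩
    1ℚ * 1ℚ                         ≡⟨⟩
    1ℚ                              ∎))
    where
    open ≡-Reasoning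
    lem : ∀ a b c d → a * b * (c * d) ≡ a * c * (b * d)
    lem = solve-∀ ℚ-ring

  inv-anti : ∀ {m n} → 1 ℕ.≤ m → m ℕ.≤ n → inv n ≤ inv m
  inv-anti {m} {n} 1≤m m≤n = *-cancelˡ (*-positive (ι->0 1≤m) (ι->0 1≤n)) (subst₂ _≤_ (sym e₁) (sym e₂) (ι-mono m≤n))
    where
    1≤n = ℕₚ.≤-trans 1≤m m≤n
    lem₁ : ∀ a b c → a * b * c ≡ a * (b * c)
    lem₁ = solve-∀ ℚ-ring
    lem₂ : ∀ a b c → a * b * c ≡ b * (a * c)
    lem₂ = solve-∀ ℚ-ring
    e₁ : ι m * ι n * inv n ≡ ι m
    e₁ = trans (lem₁ (ι m) (ι n) (inv n)) (trans (cong (ι m *_) (ι*inv 1≤n)) (*-identityʳ (ι m)))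
    e₂ : ι m * ι n * inv m ≡ ι n
    e₂ = trans (lem₂ (ι m) (ι n) (inv m)) (trans (cong (ι n *_) (ι*inv 1≤m)) (*-identityʳ (ι n)))

  inv-≤1 : ∀ n → inv n ≤ 1ℚ
  inv-≤1 zero = subst (_≤ 1ℚ) (sym inv-0) 0≤1
  inv-≤1 (suc n) = subst (inv (suc n) ≤_) (sym (inv-unique (ℕ.s≤s ℕ.z≤n) (trans (cong (_* 1ℚ) ι-1) (*-identityˡ 1ℚ)))) (inv-anti (ℕ.s≤s ℕ.z≤n) (ℕ.s≤s ℕ.z≤n))

  ≤-inv : ∀ {n a b} → 1 ℕ.≤ n → ι n * a ≤ b → a ≤ b * inv n
  ≤-inv {n} {a} {b} h p = *-cancelˡ (ι->0 h) (≤-trans p (≤-reflexive (sym (begin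
    ι n * (b * inv n)  ≡⟨ lem (ι n) b (inv n) ⟩
    b * (ι n * inv n)  ≡⟨ cong (b *_) (ι*inv h) ⟩
    b * 1ℚ             ≡⟨ *-identityʳ b ⟩
    b                  ∎))))
    where
    open ≡-Reasoning
    lem : ∀ a b c → a * (b * c) ≡ b * (a * c)
    lem = solve-∀ ℚ-ring

  infixr 8 _^^_
  _^^_ : ℚ → ℕ → ℚ
  a ^^ zero  = 1ℚ
  a ^^ suc n = a * a ^^ n

  ^^-nonNeg : ∀ {a} → 0ℚ ≤ a → ∀ n → 0ℚ ≤ a ^^ n
  ^^-nonNeg h zero    = 0≤1
  ^^-nonNeg h (suc n) = *-nonNeg h (^^-nonNeg h n)

  ^^-mono : ∀ {a b} → 0ℚ ≤ a → a ≤ b → ∀ n → a ^^ n ≤ b ^^ n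
  ^^-mono 0≤a h zero    = ≤-refl
  ^^-mono 0≤a h (suc n) = *-mono 0≤a h (^^-nonNeg 0≤a n) (^^-mono 0≤a h n)

  ι-^ : ∀ m n → ι (m ℕ.^ n) ≡ ι m ^^ n
  ι-^ m zero = ι-1
  ι-^ m (suc n) = trans (ι-* m (m ℕ.^ n)) (cong (ι m *_) (ι-^ m n))

  -- Indices start at 0, so sums over 1, ..., M appear below with summands in `suc i`.
  ∑ : ℕ → (ℕ → ℚ) → ℚ
  ∑ zero    f = 0ℚ
  ∑ (suc n) f = ∑ n f + f n

  ∑-cong : ∀ n {f g} → (∀ i → i ℕ.< n → f i ≡ g i) → ∑ n f ≡ ∑ n g
  ∑-cong zero    h = refl
  ∑-cong (suc n) h = cong₂ _+_ (∑-cong n (λ i i<n → h i (ℕₚ.m<n⇒m<1+n i<n))) (h n ℕₚ.≤-refl)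

  ∑-mono : ∀ n {f g} → (∀ i → i ℕ.< n → f i ≤ g i) → ∑ n f ≤ ∑ n g
  ∑-mono zero    h = ≤-refl
  ∑-mono (suc n) h = +-mono-≤ (∑-mono n (λ i i<n → h i (ℕₚ.m<n⇒m<1+n i<n))) (h n ℕₚ.≤-refl)

  ∑-+ : ∀ n f g → ∑ n (λ i → f i + g i) ≡ ∑ n f + ∑ n g
  ∑-+ zero f g = refl
  ∑-+ (suc n) f g = trans (cong (_+ (f n + g n)) (∑-+ n f g)) (lem (∑ n f) (∑ n g) (f n) (g n))
    where
    lem : ∀ a b c d → a + b + (c + d) ≡ a + c + (b + d)
    lem = solve-∀ ℚ-ring

  ∑-*ˡ : ∀ n c f → ∑ n (λ i → c * f i) ≡ c * ∑ n f
  ∑-*ˡ zero c f = sym (*-zeroʳ c)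
  ∑-*ˡ (suc n) c f = trans (cong (_+ c * f n) (∑-*ˡ n c f)) (sym (*-distribˡ-+ c (∑ n f) (f n)))

  ∑-*ʳ : ∀ n c f → ∑ n (λ i → f i * c) ≡ ∑ n f * c
  ∑-*ʳ n c f = trans (∑-cong n (λ i _ → *-comm (f i) c)) (trans (∑-*ˡ n c f) (*-comm c (∑ n f)))

  ∑-neg : ∀ n f → ∑ n (λ i → - f i) ≡ - ∑ n f
  ∑-neg zero f = refl
  ∑-neg (suc n) f = trans (cong (_+ - f n) (∑-neg n f)) (sym (neg-distrib-+ (∑ n f) (f n)))

  ∑-- : ∀ n f g → ∑ n (λ i → f i - g i) ≡ ∑ n f - ∑ n g
  ∑-- n f g = trans (∑-+ n f (λ i → - g i)) (cong (λ z → ∑ n f + z) (∑-neg n g))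

  ∑-zero : ∀ n → ∑ n (λ _ → 0ℚ) ≡ 0ℚ
  ∑-zero zero = refl
  ∑-zero (suc n) = trans (+-identityʳ _) (∑-zero n)

  ∑-const : ∀ n c → ∑ n (λ _ → c) ≡ ι n * c
  ∑-const zero c = sym (trans (cong (_* c) ι-0) (*-zeroˡ c))
  ∑-const (suc n) c = trans (cong (_+ c) (∑-const n c)) (sym (trans (cong (_* c) (ι-suc n)) (lem (ι n) c)))
    where
    lem : ∀ a c → (1ℚ + a) * c ≡ a * c + c
    lem = solve-∀ ℚ-ring

  ∑-nonNeg : ∀ n {f} → (∀ i → i ℕ.< n → 0ℚ ≤ f i) → 0ℚ ≤ ∑ n f
  ∑-nonNeg n {f} h = subst (_≤ ∑ n f) (∑-zero n) (∑-mono n h)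

  ∑-swap : ∀ m n (f : ℕ → ℕ → ℚ) → ∑ m (λ i → ∑ n (λ j → f i j)) ≡ ∑ n (λ j → ∑ m (λ i → f i j))
  ∑-swap zero n f = sym (∑-zero n)
  ∑-swap (suc m) n f = trans (cong (_+ ∑ n (f m)) (∑-swap m n f)) (sym (∑-+ n (λ j → ∑ m (λ i → f i j)) (f m)))

  ∑-split : ∀ m n f → ∑ (m ℕ.+ n) f ≡ ∑ m f + ∑ n (λ i → f (m ℕ.+ i))
  ∑-split m zero f = trans (cong (λ z → ∑ z f) (ℕₚ.+-identityʳ m)) (sym (+-identityʳ _))
  ∑-split m (suc n) f = trans (cong (λ z → ∑ z f) (ℕₚ.+-suc m n)) (trans (cong (_+ f (m ℕ.+ n)) (∑-split m n f)) (+-assoc (∑ m f) (∑ n (λ i → f (m ℕ.+ i))) (f (m ℕ.+ n))))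

  ∑-extend : ∀ {m n} f → m ℕ.≤ n → (∀ i → 0ℚ ≤ f i) → ∑ m f ≤ ∑ n f
  ∑-extend {m} {n} f m≤n h = subst (λ z → ∑ m f ≤ ∑ z f) (ℕₚ.m+[n∸m]≡n m≤n)
    (≤-by (∑ (n ℕ.∸ m) (λ i → f (m ℕ.+ i))) (∑-nonNeg (n ℕ.∸ m) (λ i _ → h (m ℕ.+ i))) (∑-split m (n ℕ.∸ m) f))

-- The character modulo 4 and alternating sums

module Character where

  open import Data.Nat.Base as ℕ using (ℕ; zero; suc; z≤n; s≤s)
  import Data.Nat.Properties as ℕₚ
  open import Data.Nat.Divisibility using (_∣_; _∣?_; divides)
  open import Data.Rational.Base
  open import Data.Rational.Properties
  open import Data.Product.Base using (_×_; _,_; proj₁; proj₂)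
  open import Data.Sum.Base using (_⊎_; inj₁; inj₂)
  open import Relation.Nullary using (Dec; yes; no; ¬_; contradiction)
  open import Relation.Binary.PropositionalEquality
  open import Tactic.RingSolver using (solve-∀)
  open Rationals

  𝟙 : {A : Set} → Dec A → ℚ
  𝟙 (yes _) = 1ℚ
  𝟙 (no _)  = 0ℚ

  𝟙-yes : {A : Set} (d : Dec A) → A → 𝟙 d ≡ 1ℚ
  𝟙-yes (yes _) a = refl
  𝟙-yes (no ¬a) a = contradiction a ¬a

  𝟙-no : {A : Set} (d : Dec A) → ¬ A → 𝟙 d ≡ 0ℚ
  𝟙-no (yes a) ¬a = contradiction a ¬a
  𝟙-no (no _)  ¬a = refl

  𝟙-≥0 : {A : Set} (d : Dec A) → 0ℚ ≤ 𝟙 d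
  𝟙-≥0 (yes _) = 0≤1
  𝟙-≥0 (no _)  = ≤-refl

  𝟙-≤1 : {A : Set} (d : Dec A) → 𝟙 d ≤ 1ℚ
  𝟙-≤1 (yes _) = ≤-refl
  𝟙-≤1 (no _)  = 0≤1

  1≤suc : ∀ {n} → 1 ℕ.≤ suc n
  1≤suc = s≤s z≤n

  1≤2^ : ∀ n → 1 ℕ.≤ 2 ℕ.^ n
  1≤2^ n = ℕₚ.m^n>0 2 n

  n<2^n : ∀ n → n ℕ.< 2 ℕ.^ n
  n<2^n zero = ℕₚ.≤-refl
  n<2^n (suc n) = ℕₚ.≤-trans (ℕₚ.+-mono-≤ (1≤2^ n) (n<2^n n)) (ℕₚ.≤-reflexive (cong (2 ℕ.^ n ℕ.+_) (sym (ℕₚ.+-identityʳ (2 ℕ.^ n)))))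

  cnt-step : ∀ {A : Set} → Dec A → ℕ → ℕ
  cnt-step (yes _) c = suc c
  cnt-step (no _)  c = c

  -- The number of multiples of q in [1, M].
  cnt : ℕ → ℕ → ℕ
  cnt q zero    = 0
  cnt q (suc M) = cnt-step (q ∣? suc M) (cnt q M)

  cnt-bounds : ∀ q M → 1 ℕ.≤ q → cnt q M ℕ.* q ℕ.≤ M × M ℕ.< suc (cnt q M) ℕ.* q

  -- The bounds for M squeeze the quotient d of M + 1 between `cnt q M` < d ≤ `cnt q M` + 1.
  multiple-suc : ∀ q M → 1 ℕ.≤ q → q ∣ suc M → suc M ≡ suc (cnt q M) ℕ.* q
  multiple-suc q M 1≤q (divides d e) with cnt-bounds q M 1≤q
  ... | lo , hi = trans e (cong (ℕ._* q) (ℕₚ.≤-antisym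
    (ℕₚ.*-cancelʳ-≤ d (suc (cnt q M)) q {{ℕ.>-nonZero 1≤q}} (subst (ℕ._≤ suc (cnt q M) ℕ.* q) e hi))
    (ℕₚ.*-cancelʳ-< q (cnt q M) d (subst (cnt q M ℕ.* q ℕ.<_) e (s≤s lo)))))

  cnt-bounds q zero 1≤q = z≤n , subst (1 ℕ.≤_) (sym (ℕₚ.+-identityʳ q)) 1≤q
  cnt-bounds q (suc M) 1≤q with q ∣? suc M
  ... | yes q∣ = ℕₚ.≤-reflexive (sym e) , subst (ℕ._< suc (suc (cnt q M)) ℕ.* q) (sym e) (ℕₚ.m<n+m (suc (cnt q M) ℕ.* q) 1≤q)
    where e = multiple-suc q M 1≤q q∣
  ... | no q∤ with cnt-bounds q M 1≤q
  ...   | lo , hi = ℕₚ.m≤n⇒m≤1+n lo , ℕₚ.≤∧≢⇒< hi (λ e → q∤ (divides (suc (cnt q M)) e))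

  cnt-≥ : ∀ q M → 1 ℕ.≤ q → ι M * inv q ≤ 1ℚ + ι (cnt q M)
  cnt-≥ q M 1≤q = *-cancelˡ (ι->0 1≤q) (begin
    ι q * (ι M * inv q)      ≡⟨ lem (ι q) (ι M) (inv q) ⟩
    ι M * (ι q * inv q)      ≡⟨ trans (cong (ι M *_) (ι*inv 1≤q)) (*-identityʳ (ι M)) ⟩
    ι M                      ≤⟨ ι-mono (ℕₚ.<⇒≤ (proj₂ (cnt-bounds q M 1≤q))) ⟩
    ι (suc (cnt q M) ℕ.* q)  ≡⟨ trans (ι-* (suc (cnt q M)) q) (trans (cong (_* ι q) (ι-suc (cnt q M))) (*-comm (1ℚ + ι (cnt q M)) (ι q))) ⟩
    ι q * (1ℚ + ι (cnt q M)) ∎)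
    where
    open ≤-Reasoning
    lem : ∀ a b c → a * (b * c) ≡ b * (a * c)
    lem = solve-∀ ℚ-ring

  cnt-≤ : ∀ q M → 1 ℕ.≤ q → ι (cnt q M) ≤ ι M * inv q
  cnt-≤ q M 1≤q = ≤-inv 1≤q (≤-trans (≤-reflexive (sym (trans (ι-* (cnt q M) q) (*-comm (ι (cnt q M)) (ι q)))))
    (ι-mono (proj₁ (cnt-bounds q M 1≤q))))

  inv-cnt : ∀ q M → 1 ℕ.≤ q → 1 ℕ.≤ M → inv (suc (cnt q M)) ≤ ι q * inv M
  inv-cnt q M 1≤q 1≤M = ≤-inv 1≤M (*-cancelˡ (ι->0 {suc (cnt q M)} 1≤suc) (begin
    ι c * (ι M * inv c)  ≡⟨ lem (ι c) (ι M) (inv c) ⟩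
    ι M * (ι c * inv c)  ≡⟨ trans (cong (ι M *_) (ι*inv {c} 1≤suc)) (*-identityʳ (ι M)) ⟩
    ι M                  ≤⟨ ι-mono (ℕₚ.<⇒≤ (proj₂ (cnt-bounds q M 1≤q))) ⟩
    ι (c ℕ.* q)          ≡⟨ ι-* c q ⟩
    ι c * ι q            ∎))
    where
    open ≤-Reasoning
    c = suc (cnt q M)
    lem : ∀ a b c → a * (b * c) ≡ b * (a * c)
    lem = solve-∀ ℚ-ring

  ∑-multiples : ∀ q M (g : ℕ → ℚ) → 1 ℕ.≤ q →
    ∑ M (λ m → 𝟙 (q ∣? suc m) * g (suc m)) ≡ ∑ (cnt q M) (λ e → g (suc e ℕ.* q))
  ∑-multiples q zero g 1≤q = refl
  ∑-multiples q (suc M) g 1≤q with q ∣? suc M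
  ... | yes q∣ = cong₂ _+_ (∑-multiples q M g 1≤q) (trans (*-identityˡ (g (suc M))) (cong g (multiple-suc q M 1≤q q∣)))
  ... | no q∤  = trans (cong₂ _+_ (∑-multiples q M g 1≤q) (*-zeroˡ (g (suc M)))) (+-identityʳ (∑ (cnt q M) (λ e → g (suc e ℕ.* q))))

  cnt-double : ∀ q M → 1 ℕ.≤ q → 2 ℕ.* cnt q M ℕ.≤ cnt q (2 ℕ.* M)
  cnt-double q M 1≤q = ℕₚ.≤-pred (ℕₚ.*-cancelʳ-< q (2 ℕ.* cnt q M) (suc (cnt q (2 ℕ.* M)))
    (ℕₚ.≤-<-trans (subst (ℕ._≤ 2 ℕ.* M) (sym (ℕₚ.*-assoc 2 (cnt q M) q)) (ℕₚ.*-monoʳ-≤ 2 (proj₁ (cnt-bounds q M 1≤q))))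
      (proj₂ (cnt-bounds q (2 ℕ.* M) 1≤q))))

  cnt-small : ∀ q M → M ℕ.< q → cnt q M ≡ 0
  cnt-small q M M<q = ℕₚ.n<1⇒n≡0 (ℕₚ.*-cancelʳ-< q (cnt q M) 1
    (ℕₚ.≤-<-trans (proj₁ (cnt-bounds q M (ℕₚ.≤-trans (s≤s z≤n) M<q))) (subst (M ℕ.<_) (sym (ℕₚ.+-identityʳ q)) M<q)))

  cnt-pos : ∀ q M → 1 ℕ.≤ q → q ℕ.≤ M → 1 ℕ.≤ cnt q M
  cnt-pos q M 1≤q q≤M = ℕₚ.≤-pred (ℕₚ.*-cancelʳ-< q 1 (suc (cnt q M))
    (ℕₚ.≤-<-trans (subst (ℕ._≤ M) (sym (ℕₚ.+-identityʳ q)) q≤M) (proj₂ (cnt-bounds q M 1≤q))))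

  χ : ℕ → ℚ
  χ 0 = 0ℚ
  χ 1 = 1ℚ
  χ 2 = 0ℚ
  χ 3 = - 1ℚ
  χ (suc (suc (suc (suc n)))) = χ n

  χ-+4 : ∀ j n → χ (j ℕ.* 4 ℕ.+ n) ≡ χ n
  χ-+4 zero n = refl
  χ-+4 (suc j) n = χ-+4 j n

  χ-bounds : ∀ n → - 1ℚ ≤ χ n × χ n ≤ 1ℚ
  χ-bounds 0 = ≤ᵇ⇒≤ _ , ≤ᵇ⇒≤ _
  χ-bounds 1 = ≤ᵇ⇒≤ _ , ≤ᵇ⇒≤ _
  χ-bounds 2 = ≤ᵇ⇒≤ _ , ≤ᵇ⇒≤ _
  χ-bounds 3 = ≤ᵇ⇒≤ _ , ≤ᵇ⇒≤ _
  χ-bounds (suc (suc (suc (suc n)))) = χ-bounds n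

  χ-double : ∀ n → χ (2 ℕ.* n) ≡ 0ℚ
  χ-double n = go n (2 ℕ.* n) (ℕₚ.*-comm 2 n)
    where
    go : ∀ n m → m ≡ n ℕ.* 2 → χ m ≡ 0ℚ
    go 0 .0 refl = refl
    go 1 .2 refl = refl
    go (suc (suc n)) .(suc (suc n) ℕ.* 2) refl = go n (n ℕ.* 2) refl

  χ-triple : ∀ n → χ (3 ℕ.* n) ≡ - χ n
  χ-triple n = go n (3 ℕ.* n) (ℕₚ.*-comm 3 n)
    where
    go : ∀ n m → m ≡ n ℕ.* 3 → χ m ≡ - χ n
    go 0 .0 refl = refl
    go 1 .3 refl = refl
    go 2 .6 refl = refl
    go 3 .9 refl = refl
    go (suc (suc (suc (suc n)))) .(suc (suc (suc (suc n))) ℕ.* 3) refl = go n (n ℕ.* 3) refl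

  χ-* : ∀ m n → χ (m ℕ.* n) ≡ χ m * χ n
  χ-* 0 n = sym (*-zeroˡ (χ n))
  χ-* 1 n = trans (cong χ (ℕₚ.+-identityʳ n)) (sym (*-identityˡ (χ n)))
  χ-* 2 n = trans (χ-double n) (sym (*-zeroˡ (χ n)))
  χ-* 3 n = trans (χ-triple n) (lem (χ n))
    where
    lem : ∀ a → - a ≡ - 1ℚ * a
    lem = solve-∀ ℚ-ring
  χ-* (suc (suc (suc (suc m)))) n = trans (cong χ e) (trans (χ-+4 n (m ℕ.* n)) (χ-* m n))
    where
    e : n ℕ.+ (n ℕ.+ (n ℕ.+ (n ℕ.+ m ℕ.* n))) ≡ n ℕ.* 4 ℕ.+ m ℕ.* n
    e = trans (ℕₚ.*-distribʳ-+ n 4 m) (cong (ℕ._+ m ℕ.* n) (ℕₚ.*-comm 4 n))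

  ∑-head : ∀ n f → ∑ (suc n) f ≡ f 0 + ∑ n (λ i → f (suc i))
  ∑-head zero f = +-comm 0ℚ (f 0)
  ∑-head (suc n) f = trans (cong (_+ f (suc n)) (∑-head n f)) (+-assoc (f 0) (∑ n (λ i → f (suc i))) (f (suc n)))

  tail : (ℕ → ℚ) → ℕ → ℕ → ℚ
  tail f M n = ∑ n (λ i → χ (M ℕ.+ i) * f (M ℕ.+ i))

  tail-step : ∀ f M n → tail f M (suc n) ≡ χ M * f M + tail f (suc M) n
  tail-step f M n = trans (∑-head n (λ i → χ (M ℕ.+ i) * f (M ℕ.+ i)))
    (cong₂ _+_ (cong (λ z → χ z * f z) (ℕₚ.+-identityʳ M)) (∑-cong n (λ i _ → cong (λ z → χ z * f z) (ℕₚ.+-suc M i))))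

  module Alternating (f : ℕ → ℚ) (ε : ℚ) (0≤ε : 0ℚ ≤ ε) (f≥0 : ∀ n → 0ℚ ≤ f n) (M₀ M₁ : ℕ)
    (mono : ∀ n → M₀ ℕ.≤ n → n ℕ.< M₁ → f (suc n) ≤ f n + ε) where

    -- Leibniz's criterion with slack: f may rise by ε per step, so the bounds weaken by ε with
    -- every term. `Up` belongs to the residues whose next nonzero value of χ is +1, `Dn` to those
    -- where it is -1; along M, M + 1, ... the four residue cases follow one another cyclically.
    Up Dn : ℕ → ℕ → Set
    Up M n = - (ι n * ε) ≤ tail f M n × tail f M n ≤ f M + ι n * ε
    Dn M n = - (f M + ι n * ε) ≤ tail f M n × tail f M n ≤ ι n * ε

    private
      module _ (M n : ℕ) (M₀≤ : M₀ ℕ.≤ M) (<M₁ : M ℕ.< M₁) where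
        t = tail f (suc M) n
        e = ι n * ε
        eq : ∀ {c} → χ M ≡ c → tail f M (suc n) ≡ c * f M + t
        eq refl = tail-step f M n
        ee : ι (suc n) * ε ≡ ε + e
        ee = trans (cong (_* ε) (ι-suc n)) (lem (ι n) ε)
          where
          lem : ∀ a b → (1ℚ + a) * b ≡ b + a * b
          lem = solve-∀ ℚ-ring
        slope : f (suc M) ≤ f M + ε
        slope = mono M M₀≤ <M₁

        up1 : χ M ≡ 1ℚ → Dn (suc M) n → Up M (suc n)
        up1 h (lo , hi) = subst₂ _≤_ (cong -_ (sym ee)) (sym (eq h)) (diff≥0⁻¹ (subst (0ℚ ≤_) (l1 (f M) (f (suc M)) e t ε)
            (+-nonNeg (diff≥0 lo) (diff≥0 slope))))
          , subst₂ _≤_ (sym (eq h)) (cong (f M +_) (sym ee)) (diff≥0⁻¹ (subst (0ℚ ≤_) (l2 (f M) e t ε) (+-nonNeg (diff≥0 hi) 0≤ε)))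
          where
          l1 : ∀ a b e t ε → (t - - (b + e)) + (a + ε - b) ≡ (1ℚ * a + t) - - (ε + e)
          l1 = solve-∀ ℚ-ring
          l2 : ∀ a e t ε → (e - t) + ε ≡ (a + (ε + e)) - (1ℚ * a + t)
          l2 = solve-∀ ℚ-ring

        dn3 : χ M ≡ - 1ℚ → Up (suc M) n → Dn M (suc n)
        dn3 h (lo , hi) = subst₂ _≤_ (cong (λ z → - (f M + z)) (sym ee)) (sym (eq h)) (diff≥0⁻¹ (subst (0ℚ ≤_) (l1 (f M) e t ε)
            (+-nonNeg (diff≥0 lo) 0≤ε)))
          , subst₂ _≤_ (sym (eq h)) (sym ee) (diff≥0⁻¹ (subst (0ℚ ≤_) (l2 (f M) (f (suc M)) e t ε) (+-nonNeg (diff≥0 hi) (diff≥0 slope))))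
          where
          l1 : ∀ a e t ε → (t - - e) + ε ≡ (- 1ℚ * a + t) - - (a + (ε + e))
          l1 = solve-∀ ℚ-ring
          l2 : ∀ a b e t ε → ((b + e) - t) + (a + ε - b) ≡ (ε + e) - (- 1ℚ * a + t)
          l2 = solve-∀ ℚ-ring

        dn2 : χ M ≡ 0ℚ → Dn (suc M) n → Dn M (suc n)
        dn2 h (lo , hi) = subst₂ _≤_ (cong (λ z → - (f M + z)) (sym ee)) (sym (eq h)) (diff≥0⁻¹ (subst (0ℚ ≤_) (l1 (f M) (f (suc M)) e t ε)
            (+-nonNeg (diff≥0 lo) (diff≥0 slope))))
          , subst₂ _≤_ (sym (eq h)) (sym ee) (diff≥0⁻¹ (subst (0ℚ ≤_) (l2 (f M) e t ε) (+-nonNeg (diff≥0 hi) 0≤ε)))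
          where
          l1 : ∀ a b e t ε → (t - - (b + e)) + (a + ε - b) ≡ (0ℚ * a + t) - - (a + (ε + e))
          l1 = solve-∀ ℚ-ring
          l2 : ∀ a e t ε → (e - t) + ε ≡ (ε + e) - (0ℚ * a + t)
          l2 = solve-∀ ℚ-ring

        up0 : χ M ≡ 0ℚ → Up (suc M) n → Up M (suc n)
        up0 h (lo , hi) = subst₂ _≤_ (cong -_ (sym ee)) (sym (eq h)) (diff≥0⁻¹ (subst (0ℚ ≤_) (l1 (f M) e t ε)
            (+-nonNeg (diff≥0 lo) 0≤ε)))
          , subst₂ _≤_ (sym (eq h)) (cong (f M +_) (sym ee)) (diff≥0⁻¹ (subst (0ℚ ≤_) (l2 (f M) (f (suc M)) e t ε) (+-nonNeg (diff≥0 hi) (diff≥0 slope))))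
          where
          l1 : ∀ a e t ε → (t - - e) + ε ≡ (0ℚ * a + t) - - (ε + e)
          l1 = solve-∀ ℚ-ring
          l2 : ∀ a b e t ε → ((b + e) - t) + (a + ε - b) ≡ (a + (ε + e)) - (0ℚ * a + t)
          l2 = solve-∀ ℚ-ring

      base-Up : ∀ M → Up M 0
      base-Up M rewrite trans (cong (_* ε) ι-0) (*-zeroˡ ε) = ≤-refl , subst (0ℚ ≤_) (sym (+-identityʳ (f M))) (f≥0 M)

      base-Dn : ∀ M → Dn M 0
      base-Dn M rewrite trans (cong (_* ε) ι-0) (*-zeroˡ ε) | +-identityʳ (f M) = neg-antimono-≤ (f≥0 M) , ≤-refl

    Case : ℕ → ℕ → Set
    Case M n = (χ M ≡ 0ℚ × χ (suc M) ≡ 1ℚ → Up M n) × (χ M ≡ 1ℚ → Up M n) ×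
               (χ M ≡ 0ℚ × χ (suc M) ≡ - 1ℚ → Dn M n) × (χ M ≡ - 1ℚ → Dn M n)

    private
      χ-next1 : ∀ M → χ M ≡ 1ℚ → χ (suc M) ≡ 0ℚ × χ (suc (suc M)) ≡ - 1ℚ
      χ-next1 1 h = refl , refl
      χ-next1 (suc (suc (suc (suc M)))) h = χ-next1 M h

      χ-next3 : ∀ M → χ M ≡ - 1ℚ → χ (suc M) ≡ 0ℚ × χ (suc (suc M)) ≡ 1ℚ
      χ-next3 3 h = refl , refl
      χ-next3 (suc (suc (suc (suc M)))) h = χ-next3 M h

    bounds : ∀ n M → M₀ ℕ.≤ M → M ℕ.+ n ℕ.≤ M₁ → Case M n
    bounds zero M _ _ = (λ _ → base-Up M) , (λ _ → base-Up M) , (λ _ → base-Dn M) , (λ _ → base-Dn M)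
    bounds (suc n) M M₀≤ ≤M₁ with bounds n (suc M) (ℕₚ.m≤n⇒m≤1+n M₀≤) (subst (ℕ._≤ M₁) (ℕₚ.+-suc M n) ≤M₁)
    ... | c0 , c1 , c2 , c3 =
        (λ (p , q) → up0 M n M₀≤ lt p (c1 q)) , (λ p → up1 M n M₀≤ lt p (c2 (χ-next1 M p)))
      , (λ (p , q) → dn2 M n M₀≤ lt p (c3 q)) , (λ p → dn3 M n M₀≤ lt p (c0 (χ-next3 M p)))
      where
      lt : M ℕ.< M₁
      lt = ℕₚ.≤-trans (s≤s (ℕₚ.m≤m+n M n)) (subst (ℕ._≤ M₁) (ℕₚ.+-suc M n) ≤M₁)

    private
      widen-Up : ∀ M n → Up M n → - (f M + ι n * ε) ≤ tail f M n × tail f M n ≤ f M + ι n * ε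
      widen-Up M n (lo , hi) = ≤-trans (neg-antimono-≤ (≤-by (f M) (f≥0 M) (+-comm (f M) (ι n * ε)))) lo , hi

      widen-Dn : ∀ M n → Dn M n → - (f M + ι n * ε) ≤ tail f M n × tail f M n ≤ f M + ι n * ε
      widen-Dn M n (lo , hi) = lo , ≤-trans hi (≤-by (f M) (f≥0 M) (+-comm (f M) (ι n * ε)))

      χ-cases : ∀ M → (χ M ≡ 0ℚ × χ (suc M) ≡ 1ℚ ⊎ χ M ≡ 1ℚ) ⊎ (χ M ≡ 0ℚ × χ (suc M) ≡ - 1ℚ ⊎ χ M ≡ - 1ℚ)
      χ-cases 0 = inj₁ (inj₁ (refl , refl))
      χ-cases 1 = inj₁ (inj₂ refl)
      χ-cases 2 = inj₂ (inj₁ (refl , refl))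
      χ-cases 3 = inj₂ (inj₂ refl)
      χ-cases (suc (suc (suc (suc M)))) = χ-cases M

    tail-bound : ∀ M n → M₀ ℕ.≤ M → M ℕ.+ n ℕ.≤ M₁ →
      - (f M + ι n * ε) ≤ tail f M n × tail f M n ≤ f M + ι n * ε
    tail-bound M n p q with bounds n M p q | χ-cases M
    ... | c0 , c1 , c2 , c3 | inj₁ (inj₁ h) = widen-Up M n (c0 h)
    ... | c0 , c1 , c2 , c3 | inj₁ (inj₂ h) = widen-Up M n (c1 h)
    ... | c0 , c1 , c2 , c3 | inj₂ (inj₁ h) = widen-Dn M n (c2 h)
    ... | c0 , c1 , c2 , c3 | inj₂ (inj₂ h) = widen-Dn M n (c3 h)

-- Chebyshev and Mertens estimates with integer logarithms

module WeightedMertens where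

  open import Data.Nat.Base as ℕ using (ℕ; zero; suc; z≤n; s≤s)
  import Data.Nat.Properties as ℕₚ
  open import Data.Nat.Divisibility using (_∣?_; ∣-refl)
  import Data.Integer.Base as ℤ
  open import Data.Rational.Base
  open import Data.Rational.Properties
  open import Data.Product.Base using (_×_; _,_; proj₁; proj₂; ∃-syntax)
  open import Data.Sum.Base using (_⊎_; inj₁; inj₂)
  open import Relation.Nullary using (yes; no)
  open import Relation.Binary.PropositionalEquality
  open import Tactic.RingSolver using (solve-∀)
  open Rationals
  open Character

  2^-cancel-≤ : ∀ {a b} → 2 ℕ.^ a ℕ.≤ 2 ℕ.^ b → a ℕ.≤ b
  2^-cancel-≤ {a} {b} h = ℕₚ.≮⇒≥ (λ b<a → ℕₚ.<⇒≱ (ℕₚ.^-monoʳ-< 2 (s≤s (s≤s z≤n)) b<a) h)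

  -- Bernoulli's inequality (1 - 1/n)^j ≥ 1 - j/n for n = m + 1, cleared of denominators.
  ^-bernoulli : ∀ m j → j ℕ.≤ suc m → suc m ℕ.^ j ℕ.* (suc m ℕ.∸ j) ℕ.≤ m ℕ.^ j ℕ.* suc m
  ^-bernoulli m zero _ = ℕₚ.≤-refl
  ^-bernoulli m (suc j) (s≤s j≤m) = begin
    n ℕ.^ suc j ℕ.* (n ℕ.∸ suc j)       ≡⟨ cong (ℕ._* (m ℕ.∸ j)) (ℕₚ.*-comm n (n ℕ.^ j)) ⟩
    n ℕ.^ j ℕ.* n ℕ.* (m ℕ.∸ j)         ≡⟨ ℕₚ.*-assoc (n ℕ.^ j) n (m ℕ.∸ j) ⟩
    n ℕ.^ j ℕ.* (n ℕ.* (m ℕ.∸ j))       ≤⟨ ℕₚ.*-monoʳ-≤ (n ℕ.^ j) key ⟩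
    n ℕ.^ j ℕ.* ((n ℕ.∸ j) ℕ.* m)       ≡⟨ sym (ℕₚ.*-assoc (n ℕ.^ j) (n ℕ.∸ j) m) ⟩
    n ℕ.^ j ℕ.* (n ℕ.∸ j) ℕ.* m         ≤⟨ ℕₚ.*-monoˡ-≤ m (^-bernoulli m j (ℕₚ.m≤n⇒m≤1+n j≤m)) ⟩
    m ℕ.^ j ℕ.* n ℕ.* m                 ≡⟨ ℕₚ.*-assoc (m ℕ.^ j) n m ⟩
    m ℕ.^ j ℕ.* (n ℕ.* m)               ≡⟨ cong (m ℕ.^ j ℕ.*_) (ℕₚ.*-comm n m) ⟩
    m ℕ.^ j ℕ.* (m ℕ.* n)               ≡⟨ sym (ℕₚ.*-assoc (m ℕ.^ j) m n) ⟩
    m ℕ.^ j ℕ.* m ℕ.* n                 ≡⟨ cong (ℕ._* n) (ℕₚ.*-comm (m ℕ.^ j) m) ⟩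
    m ℕ.^ suc j ℕ.* n                   ∎
    where
    open ℕₚ.≤-Reasoning
    n = suc m
    key : n ℕ.* (m ℕ.∸ j) ℕ.≤ (n ℕ.∸ j) ℕ.* m
    key = begin
      m ℕ.∸ j ℕ.+ m ℕ.* (m ℕ.∸ j)   ≤⟨ ℕₚ.+-monoˡ-≤ (m ℕ.* (m ℕ.∸ j)) (ℕₚ.m∸n≤m m j) ⟩
      m ℕ.+ m ℕ.* (m ℕ.∸ j)         ≡⟨ cong (m ℕ.+_) (ℕₚ.*-comm m (m ℕ.∸ j)) ⟩
      suc (m ℕ.∸ j) ℕ.* m           ≡⟨ cong (ℕ._* m) (sym (ℕₚ.+-∸-assoc 1 j≤m)) ⟩
      (n ℕ.∸ j) ℕ.* m               ∎

  -- (1 + 1/m)^m ≤ 4, from Bernoulli's inequality for the exponent ⌈m/2⌉.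
  suc-^-≤ : ∀ m → suc m ℕ.^ m ℕ.≤ 4 ℕ.* m ℕ.^ m
  suc-^-≤ m = split (halve m)
    where
    open ℕₚ.≤-Reasoning
    n = suc m
    halve : ∀ m → (∃[ j ] m ≡ j ℕ.+ j) ⊎ (∃[ j ] suc m ≡ j ℕ.+ j)
    halve zero = inj₁ (0 , refl)
    halve (suc m) with halve m
    ... | inj₁ (j , e) = inj₂ (suc j , cong suc (trans (cong suc e) (sym (ℕₚ.+-suc j j))))
    ... | inj₂ (j , e) = inj₁ (j , e)
    half : ∀ j → j ℕ.+ j ℕ.≤ n → n ℕ.^ j ℕ.≤ 2 ℕ.* m ℕ.^ j
    half j h = ℕₚ.*-cancelʳ-≤ (n ℕ.^ j) (2 ℕ.* m ℕ.^ j) n (begin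
      n ℕ.^ j ℕ.* n                   ≤⟨ ℕₚ.*-monoʳ-≤ (n ℕ.^ j) n≤ ⟩
      n ℕ.^ j ℕ.* (2 ℕ.* (n ℕ.∸ j))   ≡⟨ trans (sym (ℕₚ.*-assoc (n ℕ.^ j) 2 _)) (trans (cong (ℕ._* (n ℕ.∸ j)) (ℕₚ.*-comm (n ℕ.^ j) 2)) (ℕₚ.*-assoc 2 (n ℕ.^ j) _)) ⟩
      2 ℕ.* (n ℕ.^ j ℕ.* (n ℕ.∸ j))   ≤⟨ ℕₚ.*-monoʳ-≤ 2 (^-bernoulli m j (ℕₚ.≤-trans (ℕₚ.m≤m+n j j) h)) ⟩
      2 ℕ.* (m ℕ.^ j ℕ.* n)           ≡⟨ sym (ℕₚ.*-assoc 2 (m ℕ.^ j) n) ⟩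
      2 ℕ.* m ℕ.^ j ℕ.* n             ∎)
      where
      n≤ : n ℕ.≤ 2 ℕ.* (n ℕ.∸ j)
      n≤ = begin
        n                              ≡⟨ sym (ℕₚ.m∸n+n≡m (ℕₚ.≤-trans (ℕₚ.m≤m+n j j) h)) ⟩
        n ℕ.∸ j ℕ.+ j                  ≤⟨ ℕₚ.+-monoʳ-≤ (n ℕ.∸ j) (ℕₚ.m+n≤o⇒m≤o∸n j h) ⟩
        n ℕ.∸ j ℕ.+ (n ℕ.∸ j)          ≡⟨ cong (n ℕ.∸ j ℕ.+_) (sym (ℕₚ.+-identityʳ (n ℕ.∸ j))) ⟩
        2 ℕ.* (n ℕ.∸ j)                ∎
    dbl : ∀ j → j ℕ.+ j ℕ.≤ n → n ℕ.^ (j ℕ.+ j) ℕ.≤ 4 ℕ.* m ℕ.^ (j ℕ.+ j)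
    dbl j h = begin
      n ℕ.^ (j ℕ.+ j)                      ≡⟨ ℕₚ.^-distribˡ-+-* n j j ⟩
      n ℕ.^ j ℕ.* n ℕ.^ j                  ≤⟨ ℕₚ.*-mono-≤ (half j h) (half j h) ⟩
      2 ℕ.* m ℕ.^ j ℕ.* (2 ℕ.* m ℕ.^ j)    ≡⟨ ℕₚ.[m*n]*[o*p]≡[m*o]*[n*p] 2 (m ℕ.^ j) 2 (m ℕ.^ j) ⟩
      4 ℕ.* (m ℕ.^ j ℕ.* m ℕ.^ j)          ≡⟨ cong (4 ℕ.*_) (sym (ℕₚ.^-distribˡ-+-* m j j)) ⟩
      4 ℕ.* m ℕ.^ (j ℕ.+ j)                ∎
    split : (∃[ j ] m ≡ j ℕ.+ j) ⊎ (∃[ j ] suc m ≡ j ℕ.+ j) → n ℕ.^ m ℕ.≤ 4 ℕ.* m ℕ.^ m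
    split (inj₁ (j , e)) = subst (λ z → n ℕ.^ z ℕ.≤ 4 ℕ.* m ℕ.^ z) (sym e) (dbl j (subst (ℕ._≤ n) e (ℕₚ.n≤1+n m)))
    split (inj₂ (j , e)) = ℕₚ.*-cancelˡ-≤ n (begin
      n ℕ.* n ℕ.^ m            ≤⟨ subst (λ z → n ℕ.^ z ℕ.≤ 4 ℕ.* m ℕ.^ z) (sym e) (dbl j (ℕₚ.≤-reflexive (sym e))) ⟩
      4 ℕ.* (m ℕ.* m ℕ.^ m)    ≤⟨ ℕₚ.*-monoʳ-≤ 4 (ℕₚ.*-monoˡ-≤ (m ℕ.^ m) (ℕₚ.n≤1+n m)) ⟩
      4 ℕ.* (n ℕ.* m ℕ.^ m)    ≡⟨ trans (sym (ℕₚ.*-assoc 4 n (m ℕ.^ m))) (trans (cong (ℕ._* m ℕ.^ m) (ℕₚ.*-comm 4 n)) (ℕₚ.*-assoc n 4 (m ℕ.^ m))) ⟩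
      n ℕ.* (4 ℕ.* m ℕ.^ m)    ∎)

  8ℚ 9ℚ : ℚ
  8ℚ = (ℤ.+ 8) / 1
  9ℚ = (ℤ.+ 9) / 1

  P : ℕ → ℚ
  P A = ι (2 ℕ.^ A)

  P≥0 : ∀ A → 0ℚ ≤ P A
  P≥0 A = ι-≥0 (2 ℕ.^ A)

  P>0 : ∀ A → 0ℚ < P A
  P>0 A = ι->0 (1≤2^ A)

  ι-2 : ι 2 ≡ 1ℚ + 1ℚ
  ι-2 = trans (ι-+ 1 1) (cong₂ _+_ ι-1 ι-1)

  P-suc : ∀ A → P (suc A) ≡ (1ℚ + 1ℚ) * P A
  P-suc A = trans (ι-* 2 (2 ℕ.^ A)) (cong (_* P A) ι-2)

  -- Λ plays the role of the von Mangoldt function, scaled by T′ and with the logarithms rounded to integers.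
  module Mertens (B T′ : ℕ) (Λ : ℕ → ℚ) (Λ≥0 : ∀ q → 0ℚ ≤ Λ q) (D : ℕ → ℕ)
    (D-sum : ∀ m M → 1 ℕ.≤ m → m ℕ.≤ M → M ℕ.≤ 2 ℕ.^ B → ∑ M (λ i → 𝟙 (suc i ∣? m) * Λ (suc i)) ≡ ι (D m))
    (D-lo : ∀ m → 1 ℕ.≤ m → m ℕ.≤ 2 ℕ.^ B → m ℕ.^ T′ ℕ.≤ 2 ℕ.^ D m)
    (D-hi : ∀ m → 1 ℕ.≤ m → m ℕ.≤ 2 ℕ.^ B → 2 ℕ.^ D m ℕ.≤ m ℕ.^ suc T′)
    -- Rounding errors are at most B per term, so even 2^B of them together stay below `τ`.
    (T′-big : suc B ℕ.* 2 ℕ.^ B ℕ.≤ T′) where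

    τ = ι T′

    τ≥0 : 0ℚ ≤ τ
    τ≥0 = ι-≥0 T′

    sB≤T′ : suc B ℕ.≤ T′
    sB≤T′ = ℕₚ.≤-trans (ℕₚ.m≤m*n (suc B) (2 ℕ.^ B) {{ℕ.>-nonZero (1≤2^ B)}}) T′-big

    1≤τ : 1ℚ ≤ τ
    1≤τ = ι-≥1 (ℕₚ.≤-trans (s≤s z≤n) sB≤T′)

    D-lo′ : ∀ m j → 2 ℕ.^ j ℕ.≤ m → m ℕ.≤ 2 ℕ.^ B → T′ ℕ.* j ℕ.≤ D m
    D-lo′ m j h m≤ = 2^-cancel-≤ (begin
      2 ℕ.^ (T′ ℕ.* j)    ≡⟨ cong (2 ℕ.^_) (ℕₚ.*-comm T′ j) ⟩
      2 ℕ.^ (j ℕ.* T′)    ≡⟨ sym (ℕₚ.^-*-assoc 2 j T′) ⟩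
      (2 ℕ.^ j) ℕ.^ T′    ≤⟨ ℕₚ.^-monoˡ-≤ T′ h ⟩
      m ℕ.^ T′            ≤⟨ D-lo m (ℕₚ.≤-trans (1≤2^ j) h) m≤ ⟩
      2 ℕ.^ D m           ∎)
      where open ℕₚ.≤-Reasoning

    D-hi′ : ∀ m j → 1 ℕ.≤ m → m ℕ.≤ 2 ℕ.^ j → m ℕ.≤ 2 ℕ.^ B → D m ℕ.≤ j ℕ.* suc T′
    D-hi′ m j 1≤m h m≤ = 2^-cancel-≤ (begin
      2 ℕ.^ D m             ≤⟨ D-hi m 1≤m m≤ ⟩
      m ℕ.^ suc T′          ≤⟨ ℕₚ.^-monoˡ-≤ (suc T′) h ⟩
      (2 ℕ.^ j) ℕ.^ suc T′  ≡⟨ ℕₚ.^-*-assoc 2 j (suc T′) ⟩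
      2 ℕ.^ (j ℕ.* suc T′)  ∎)
      where open ℕₚ.≤-Reasoning

    G ψ X Xχ : ℕ → ℚ
    G M = ∑ M (λ m → ι (D (suc m)))
    ψ M = ∑ M (λ i → Λ (suc i))
    X M = ∑ M (λ i → Λ (suc i) * inv (suc i))
    Xχ M = ∑ M (λ i → χ (suc i) * (Λ (suc i) * inv (suc i)))

    2^≤ : ∀ {A} → A ℕ.≤ B → 2 ℕ.^ A ℕ.≤ 2 ℕ.^ B
    2^≤ = ℕₚ.^-monoʳ-≤ 2

    -- Interchange of summation in m = q e. The outer range may exceed M because `cnt q M` is 0 for
    -- q > M; `ψ-step` needs G(M) and G(2M) expanded over the same range.
    double-sum : ∀ M M′ (g : ℕ → ℚ) → M ℕ.≤ M′ → M′ ℕ.≤ 2 ℕ.^ B →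
      ∑ M (λ m → ι (D (suc m)) * g (suc m)) ≡ ∑ M′ (λ i → Λ (suc i) * ∑ (cnt (suc i) M) (λ e → g (suc e ℕ.* suc i)))
    double-sum M M′ g M≤ ≤N = begin
      ∑ M (λ m → ι (D (suc m)) * g (suc m))
        ≡⟨ ∑-cong M (λ m m< → trans (cong (_* g (suc m)) (sym (D-sum (suc m) M′ 1≤suc (ℕₚ.≤-trans m< M≤) ≤N)))
             (sym (∑-*ʳ M′ (g (suc m)) (λ i → 𝟙 (suc i ∣? suc m) * Λ (suc i))))) ⟩
      ∑ M (λ m → ∑ M′ (λ i → 𝟙 (suc i ∣? suc m) * Λ (suc i) * g (suc m)))
        ≡⟨ ∑-swap M M′ (λ m i → 𝟙 (suc i ∣? suc m) * Λ (suc i) * g (suc m)) ⟩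
      ∑ M′ (λ i → ∑ M (λ m → 𝟙 (suc i ∣? suc m) * Λ (suc i) * g (suc m)))
        ≡⟨ ∑-cong M′ (λ i _ → trans (∑-cong M (λ m _ → lem (𝟙 (suc i ∣? suc m)) (Λ (suc i)) (g (suc m))))
             (trans (∑-*ˡ M (Λ (suc i)) (λ m → 𝟙 (suc i ∣? suc m) * g (suc m))) (cong (Λ (suc i) *_) (∑-multiples (suc i) M g 1≤suc)))) ⟩
      ∑ M′ (λ i → Λ (suc i) * ∑ (cnt (suc i) M) (λ e → g (suc e ℕ.* suc i))) ∎
      where
      open ≡-Reasoning
      lem : ∀ a b c → a * b * c ≡ b * (a * c)
      lem = solve-∀ ℚ-ring

    G-id : ∀ M M′ → M ℕ.≤ M′ → M′ ℕ.≤ 2 ℕ.^ B → G M ≡ ∑ M′ (λ i → Λ (suc i) * ι (cnt (suc i) M))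
    G-id M M′ p q = trans (∑-cong M (λ m _ → sym (*-identityʳ (ι (D (suc m)))))) (trans (double-sum M M′ (λ _ → 1ℚ) p q)
      (∑-cong M′ (λ i _ → cong (Λ (suc i) *_) (trans (∑-const (cnt (suc i) M) 1ℚ) (*-identityʳ (ι (cnt (suc i) M)))))))

    G-hi : ∀ A → A ℕ.≤ B → G (2 ℕ.^ A) ≤ P A * (ι A * (1ℚ + τ))
    G-hi A A≤B = ≤-trans (∑-mono (2 ℕ.^ A) (λ m m< → ≤-trans (ι-mono (D-hi′ (suc m) A 1≤suc m< (ℕₚ.≤-trans m< (2^≤ A≤B))))
        (≤-reflexive (trans (ι-* A (suc T′)) (cong (ι A *_) (ι-suc T′))))))
      (≤-reflexive (∑-const (2 ℕ.^ A) (ι A * (1ℚ + τ))))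

    2^suc : ∀ A → 2 ℕ.^ suc A ≡ 2 ℕ.^ A ℕ.+ 2 ℕ.^ A
    2^suc A = cong (2 ℕ.^ A ℕ.+_) (ℕₚ.+-identityʳ (2 ℕ.^ A))

    -- Dyadic form of Stirling's lower bound: every m in (2^A, 2^(A+1)] has log₂ m ≥ A.
    G-lo : ∀ A → A ℕ.≤ B → P A * (τ * (ι A - (1ℚ + 1ℚ))) ≤ G (2 ℕ.^ A)
    G-lo zero _ = begin
      P 0 * (τ * (ι 0 - (1ℚ + 1ℚ)))   ≡⟨ cong₂ (λ a b → a * (τ * (b - (1ℚ + 1ℚ)))) ι-1 ι-0 ⟩
      1ℚ * (τ * (0ℚ - (1ℚ + 1ℚ)))     ≡⟨ lem τ ⟩
      - (τ + τ)                       ≤⟨ neg-antimono-≤ (+-nonNeg τ≥0 τ≥0) ⟩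
      0ℚ                              ≤⟨ ∑-nonNeg 1 {λ m → ι (D (suc m))} (λ i _ → ι-≥0 (D (suc i))) ⟩
      G 1                             ∎
      where
      open ≤-Reasoning
      lem : ∀ t → 1ℚ * (t * (0ℚ - (1ℚ + 1ℚ))) ≡ - (t + t)
      lem = solve-∀ ℚ-ring
    G-lo (suc A) sA≤B = begin
      P (suc A) * (τ * (ι (suc A) - (1ℚ + 1ℚ)))            ≡⟨ cong₂ (λ a b → a * (τ * (b - (1ℚ + 1ℚ)))) (P-suc A) (ι-suc A) ⟩
      (1ℚ + 1ℚ) * P A * (τ * (1ℚ + ι A - (1ℚ + 1ℚ)))       ≡⟨ lem (P A) τ (ι A) ⟩
      P A * (τ * (ι A - (1ℚ + 1ℚ))) + P A * (τ * ι A)      ≤⟨ +-mono-≤ (G-lo A (ℕₚ.<⇒≤ sA≤B)) upper ⟩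
      G (2 ℕ.^ A) + ∑ (2 ℕ.^ A) (λ i → ι (D (suc (2 ℕ.^ A ℕ.+ i)))) ≡⟨ sym (∑-split (2 ℕ.^ A) (2 ℕ.^ A) (λ m → ι (D (suc m)))) ⟩
      G (2 ℕ.^ A ℕ.+ 2 ℕ.^ A)                              ≡⟨ cong G (sym (2^suc A)) ⟩
      G (2 ℕ.^ suc A)                                      ∎
      where
      open ≤-Reasoning
      lem : ∀ p t a → (1ℚ + 1ℚ) * p * (t * (1ℚ + a - (1ℚ + 1ℚ))) ≡ p * (t * (a - (1ℚ + 1ℚ))) + p * (t * a)
      lem = solve-∀ ℚ-ring
      upper : P A * (τ * ι A) ≤ ∑ (2 ℕ.^ A) (λ i → ι (D (suc (2 ℕ.^ A ℕ.+ i))))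
      upper = ≤-trans (≤-reflexive (sym (∑-const (2 ℕ.^ A) (τ * ι A)))) (∑-mono (2 ℕ.^ A) (λ i i< →
        ≤-trans (≤-reflexive (sym (ι-* T′ A))) (ι-mono (D-lo′ (suc (2 ℕ.^ A ℕ.+ i)) A (ℕₚ.m≤n⇒m≤1+n (ℕₚ.m≤m+n (2 ℕ.^ A) i))
          (ℕₚ.≤-trans (subst (suc (2 ℕ.^ A ℕ.+ i) ℕ.≤_) (sym (2^suc A)) (ℕₚ.+-monoʳ-< (2 ℕ.^ A) i<)) (2^≤ sA≤B))))))

    -- Chebyshev's argument, with G(2M) - 2 G(M) in the role of the logarithm of a central binomial
    -- coefficient: ⌊2M/q⌋ - 2⌊M/q⌋ is never negative and is at least 1 for M < q ≤ 2M.
    ψ-step : ∀ M → M ℕ.+ M ℕ.≤ 2 ℕ.^ B → ψ (M ℕ.+ M) ≤ ψ M + (G (M ℕ.+ M) - (1ℚ + 1ℚ) * G M)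
    ψ-step M 2M≤ = ≤-trans (≤-reflexive (∑-split M M (λ i → Λ (suc i)))) (+-monoʳ-≤ (ψ M) (begin
      ∑ M (λ i → Λ (suc (M ℕ.+ i)))
        ≤⟨ ∑-mono M (λ i i< → ≤-trans (≤-reflexive (sym (*-identityʳ (Λ (suc (M ℕ.+ i))))))
             (*-monoʳ (Λ≥0 (suc (M ℕ.+ i))) (big i i<))) ⟩
      ∑ M (λ i → h (M ℕ.+ i))
        ≤⟨ ≤-by (∑ M h) (∑-nonNeg M (λ i _ → *-nonNeg (Λ≥0 (suc i)) (diff≥0 (dbl i)))) (trans (∑-split M M h) (+-comm (∑ M h) _)) ⟩
      ∑ (M ℕ.+ M) h
        ≡⟨ ∑-cong (M ℕ.+ M) (λ i _ → lem (Λ (suc i)) (ι (cnt (suc i) (M ℕ.+ M))) (ι (cnt (suc i) M))) ⟩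
      ∑ (M ℕ.+ M) (λ i → Λ (suc i) * ι (cnt (suc i) (M ℕ.+ M)) - (1ℚ + 1ℚ) * (Λ (suc i) * ι (cnt (suc i) M)))
        ≡⟨ ∑-- (M ℕ.+ M) (λ i → Λ (suc i) * ι (cnt (suc i) (M ℕ.+ M))) (λ i → (1ℚ + 1ℚ) * (Λ (suc i) * ι (cnt (suc i) M))) ⟩
      ∑ (M ℕ.+ M) (λ i → Λ (suc i) * ι (cnt (suc i) (M ℕ.+ M))) - ∑ (M ℕ.+ M) (λ i → (1ℚ + 1ℚ) * (Λ (suc i) * ι (cnt (suc i) M)))
        ≡⟨ cong₂ _-_ (sym (G-id (M ℕ.+ M) (M ℕ.+ M) ℕₚ.≤-refl 2M≤))
             (trans (∑-*ˡ (M ℕ.+ M) (1ℚ + 1ℚ) (λ i → Λ (suc i) * ι (cnt (suc i) M)))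
               (cong ((1ℚ + 1ℚ) *_) (sym (G-id M (M ℕ.+ M) (ℕₚ.m≤m+n M M) 2M≤)))) ⟩
      G (M ℕ.+ M) - (1ℚ + 1ℚ) * G M ∎))
      where
      open ≤-Reasoning
      h : ℕ → ℚ
      h i = Λ (suc i) * (ι (cnt (suc i) (M ℕ.+ M)) - (1ℚ + 1ℚ) * ι (cnt (suc i) M))
      lem : ∀ l a b → l * (a - (1ℚ + 1ℚ) * b) ≡ l * a - (1ℚ + 1ℚ) * (l * b)
      lem = solve-∀ ℚ-ring
      2M : 2 ℕ.* M ≡ M ℕ.+ M
      2M = cong (M ℕ.+_) (ℕₚ.+-identityʳ M)
      dbl : ∀ i → (1ℚ + 1ℚ) * ι (cnt (suc i) M) ≤ ι (cnt (suc i) (M ℕ.+ M))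
      dbl i = ≤-trans (≤-reflexive (sym (trans (ι-* 2 (cnt (suc i) M)) (cong (_* ι (cnt (suc i) M)) ι-2))))
        (ι-mono (subst (λ z → 2 ℕ.* cnt (suc i) M ℕ.≤ cnt (suc i) z) 2M (cnt-double (suc i) M 1≤suc)))
      big : ∀ i → i ℕ.< M → 1ℚ ≤ ι (cnt (suc (M ℕ.+ i)) (M ℕ.+ M)) - (1ℚ + 1ℚ) * ι (cnt (suc (M ℕ.+ i)) M)
      big i i< = ≤-trans (ι-≥1 (cnt-pos (suc (M ℕ.+ i)) (M ℕ.+ M) 1≤suc (ℕₚ.+-monoʳ-< M i<)))
        (≤-reflexive (sym (trans (cong (λ z → ι (cnt (suc (M ℕ.+ i)) (M ℕ.+ M)) - (1ℚ + 1ℚ) * z)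
          (trans (cong ι (cnt-small (suc (M ℕ.+ i)) M (s≤s (ℕₚ.m≤m+n M i)))) ι-0)) (l0 (ι (cnt (suc (M ℕ.+ i)) (M ℕ.+ M)))))))
        where
        l0 : ∀ a → a - (1ℚ + 1ℚ) * 0ℚ ≡ a
        l0 = solve-∀ ℚ-ring

    -- The constant 8 reproduces itself: the step adds at most 2 · 2^A (3τ + A + 1), and A + 1 ≤ τ.
    ψ-bound : ∀ A → A ℕ.≤ B → ψ (2 ℕ.^ A) ≤ 8ℚ * (τ * P A)
    ψ-bound zero _ = begin
      ψ 1                     ≡⟨ cong (0ℚ +_) (sym (trans (cong (_* Λ 1) (𝟙-yes (1 ∣? 1) ∣-refl)) (*-identityˡ (Λ 1)))) ⟩
      0ℚ + 𝟙 (1 ∣? 1) * Λ 1   ≡⟨ D-sum 1 1 ℕₚ.≤-refl ℕₚ.≤-refl (1≤2^ B) ⟩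
      ι (D 1)                 ≤⟨ ι-mono (D-hi′ 1 0 ℕₚ.≤-refl ℕₚ.≤-refl (1≤2^ B)) ⟩
      ι 0                     ≡⟨ ι-0 ⟩
      0ℚ                      ≤⟨ *-nonNeg {8ℚ} (≤ᵇ⇒≤ _) (*-nonNeg τ≥0 (P≥0 0)) ⟩
      8ℚ * (τ * P 0)   ∎
      where open ≤-Reasoning
    ψ-bound (suc A) sA≤B = begin
      ψ (2 ℕ.^ suc A)                           ≡⟨ cong ψ (2^suc A) ⟩
      ψ (2 ℕ.^ A ℕ.+ 2 ℕ.^ A)                   ≤⟨ ψ-step (2 ℕ.^ A) (subst (ℕ._≤ 2 ℕ.^ B) (2^suc A) (2^≤ sA≤B)) ⟩
      ψ (2 ℕ.^ A) + (G (2 ℕ.^ A ℕ.+ 2 ℕ.^ A) - (1ℚ + 1ℚ) * G (2 ℕ.^ A))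
        ≤⟨ +-mono-≤ (ψ-bound A A≤B) (+-mono-≤ (≤-trans (≤-reflexive (cong G (sym (2^suc A)))) (G-hi (suc A) sA≤B))
             (neg-antimono-≤ (*-monoʳ {1ℚ + 1ℚ} (≤ᵇ⇒≤ _) (G-lo A A≤B)))) ⟩
      8ℚ * (τ * P A) + (P (suc A) * (ι (suc A) * (1ℚ + τ)) - (1ℚ + 1ℚ) * (P A * (τ * (ι A - (1ℚ + 1ℚ)))))
        ≡⟨ cong₂ (λ p a → 8ℚ * (τ * P A) + (p * (a * (1ℚ + τ)) - (1ℚ + 1ℚ) * (P A * (τ * (ι A - (1ℚ + 1ℚ)))))) (P-suc A) (ι-suc A) ⟩
      8ℚ * (τ * P A) + ((1ℚ + 1ℚ) * P A * ((1ℚ + ι A) * (1ℚ + τ)) - (1ℚ + 1ℚ) * (P A * (τ * (ι A - (1ℚ + 1ℚ)))))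
        ≤⟨ ≤-by ((1ℚ + 1ℚ) * P A * (τ - (1ℚ + ι A))) (*-nonNeg (*-nonNeg {1ℚ + 1ℚ} (≤ᵇ⇒≤ _) (P≥0 A)) (diff≥0 small)) (lem (P A) τ (ι A)) ⟩
      8ℚ * (τ * ((1ℚ + 1ℚ) * P A))       ≡⟨ cong (λ z → 8ℚ * (τ * z)) (sym (P-suc A)) ⟩
      8ℚ * (τ * P (suc A))               ∎
      where
      open ≤-Reasoning
      A≤B = ℕₚ.<⇒≤ sA≤B
      small : 1ℚ + ι A ≤ τ
      small = ≤-trans (≤-reflexive (sym (ι-suc A))) (ι-mono (ℕₚ.≤-trans (ℕₚ.m≤n⇒m≤1+n sA≤B) sB≤T′))
      lem : ∀ p t a → 8ℚ * (t * ((1ℚ + 1ℚ) * p)) ≡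
        8ℚ * (t * p) + ((1ℚ + 1ℚ) * p * ((1ℚ + a) * (1ℚ + t)) - (1ℚ + 1ℚ) * (p * (t * (a - (1ℚ + 1ℚ))))) + (1ℚ + 1ℚ) * p * (t - (1ℚ + a))
      lem = solve-∀ ℚ-ring

    X-lo : ∀ A → A ℕ.≤ B → τ * (ι A - (1ℚ + 1ℚ)) ≤ X (2 ℕ.^ A)
    X-lo A A≤B = *-cancelˡ (P>0 A) (begin
      P A * (τ * (ι A - (1ℚ + 1ℚ)))      ≤⟨ G-lo A A≤B ⟩
      G M                                ≡⟨ G-id M M ℕₚ.≤-refl (2^≤ A≤B) ⟩
      ∑ M (λ i → Λ (suc i) * ι (cnt (suc i) M)) ≤⟨ ∑-mono M (λ i _ → *-monoʳ (Λ≥0 (suc i)) (cnt-≤ (suc i) M 1≤suc)) ⟩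
      ∑ M (λ i → Λ (suc i) * (P A * inv (suc i))) ≡⟨ ∑-cong M (λ i _ → lem (Λ (suc i)) (P A) (inv (suc i))) ⟩
      ∑ M (λ i → P A * (Λ (suc i) * inv (suc i))) ≡⟨ ∑-*ˡ M (P A) (λ i → Λ (suc i) * inv (suc i)) ⟩
      P A * X M                          ∎)
      where
      open ≤-Reasoning
      M = 2 ℕ.^ A
      lem : ∀ a b c → a * (b * c) ≡ b * (a * c)
      lem = solve-∀ ℚ-ring

    -- Replacing M/q by 1 + ⌊M/q⌋ costs ψ(M) ≤ 8τM; the ninth unit absorbs the rounding term A ≤ τ.
    X-hi : ∀ A → A ℕ.≤ B → X (2 ℕ.^ A) ≤ τ * (ι A + 9ℚ)
    X-hi A A≤B = *-cancelˡ (P>0 A) (begin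
      P A * X M                                   ≡⟨ sym (∑-*ˡ M (P A) (λ i → Λ (suc i) * inv (suc i))) ⟩
      ∑ M (λ i → P A * (Λ (suc i) * inv (suc i))) ≡⟨ ∑-cong M (λ i _ → lem (P A) (Λ (suc i)) (inv (suc i))) ⟩
      ∑ M (λ i → Λ (suc i) * (P A * inv (suc i))) ≤⟨ ∑-mono M (λ i _ → *-monoʳ (Λ≥0 (suc i)) (cnt-≥ (suc i) M 1≤suc)) ⟩
      ∑ M (λ i → Λ (suc i) * (1ℚ + ι (cnt (suc i) M))) ≡⟨ ∑-cong M (λ i _ → lem₂ (Λ (suc i)) (ι (cnt (suc i) M))) ⟩
      ∑ M (λ i → Λ (suc i) + Λ (suc i) * ι (cnt (suc i) M)) ≡⟨ ∑-+ M (λ i → Λ (suc i)) (λ i → Λ (suc i) * ι (cnt (suc i) M)) ⟩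
      ψ M + ∑ M (λ i → Λ (suc i) * ι (cnt (suc i) M)) ≡⟨ cong (ψ M +_) (sym (G-id M M ℕₚ.≤-refl (2^≤ A≤B))) ⟩
      ψ M + G M                                   ≤⟨ +-mono-≤ (ψ-bound A A≤B) (G-hi A A≤B) ⟩
      8ℚ * (τ * P A) + P A * (ι A * (1ℚ + τ)) ≤⟨ ≤-by (P A * (τ - ι A)) (*-nonNeg (P≥0 A) (diff≥0 (ι-mono (ℕₚ.≤-trans A≤B (ℕₚ.≤-trans (ℕₚ.n≤1+n B) sB≤T′))))) (lem₃ (P A) τ (ι A)) ⟩
      P A * (τ * (ι A + 9ℚ))               ∎)
      where
      open ≤-Reasoning
      M = 2 ℕ.^ A
      lem : ∀ a b c → a * (b * c) ≡ b * (a * c)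
      lem = solve-∀ ℚ-ring
      lem₂ : ∀ a b → a * (1ℚ + b) ≡ a + a * b
      lem₂ = solve-∀ ℚ-ring
      lem₃ : ∀ p t a → p * (t * (a + 9ℚ)) ≡ 8ℚ * (t * p) + p * (a * (1ℚ + t)) + p * (t - a)
      lem₃ = solve-∀ ℚ-ring

    S : ℕ → ℚ
    S M = ∑ M (λ e → χ (suc e) * inv (suc e))

    S-tail : ∀ c M → c ℕ.≤ M → S M ≡ S c + tail inv (suc c) (M ℕ.∸ c)
    S-tail c M c≤M = trans (cong S (sym (ℕₚ.m+[n∸m]≡n c≤M))) (∑-split c (M ℕ.∸ c) (λ e → χ (suc e) * inv (suc e)))

    S-near : ∀ c M → c ℕ.≤ M → S c - inv (suc c) ≤ S M × S M ≤ S c + inv (suc c)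
    S-near c M c≤M = ≤-trans (+-monoʳ-≤ (S c) (≤-trans (≤-reflexive (cong -_ (sym simp))) (proj₁ bd))) (≤-reflexive (sym (S-tail c M c≤M)))
                   , ≤-trans (≤-reflexive (S-tail c M c≤M)) (+-monoʳ-≤ (S c) (≤-trans (proj₂ bd) (≤-reflexive simp)))
      where
      module Alt = Alternating inv 0ℚ ≤-refl inv-≥0 1 (suc M)
        (λ n 1≤n _ → ≤-trans (inv-anti 1≤n (ℕₚ.n≤1+n n)) (≤-reflexive (sym (+-identityʳ (inv n)))))
      bd = Alt.tail-bound (suc c) (M ℕ.∸ c) 1≤suc (ℕₚ.≤-reflexive (cong suc (ℕₚ.m+[n∸m]≡n c≤M)))
      simp : inv (suc c) + ι (M ℕ.∸ c) * 0ℚ ≡ inv (suc c)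
      simp = trans (cong (_+_ (inv (suc c))) (*-zeroʳ (ι (M ℕ.∸ c)))) (+-identityʳ (inv (suc c)))

    -- One term with the alternating error 1/2: an effective form of L(1, χ) ≠ 0.
    S≥½ : ∀ M → 1 ℕ.≤ M → ½ ≤ S M
    S≥½ M 1≤M = ≤-trans (≤-reflexive e) (proj₁ (S-near 1 M 1≤M))
      where
      e : ½ ≡ S 1 - inv 2
      e = sym (cong₂ (λ a b → 0ℚ + 1ℚ * a - b) (inv-def 1) (inv-def 2))

    N = 2 ℕ.^ B

    -- The cut-off makes the sequence total while the bounds on D reach only to N; the drop to 0
    -- respects the monotonicity required by `Alternating`.
    f : ℕ → ℚ
    f m = 𝟙 (m ℕₚ.≤? N) * (ι (D m) * inv m)

    Df≥0 : ∀ m → 0ℚ ≤ ι (D m) * inv m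
    Df≥0 m = *-nonNeg (ι-≥0 (D m)) (inv-≥0 m)

    f≥0 : ∀ m → 0ℚ ≤ f m
    f≥0 m = *-nonNeg (𝟙-≥0 (m ℕₚ.≤? N)) (Df≥0 m)

    f-eq : ∀ m → m ℕ.≤ N → f m ≡ ι (D m) * inv m
    f-eq m h = trans (cong (_* (ι (D m) * inv m)) (𝟙-yes (m ℕₚ.≤? N) h)) (*-identityˡ (ι (D m) * inv m))

    f-small : ∀ m → 1 ℕ.≤ m → m ℕ.≤ 4 → f m ≤ (1ℚ + 1ℚ) * (1ℚ + τ)
    f-small m 1≤m m≤4 with m ℕₚ.≤? N
    ... | no _ = ≤-trans (≤-reflexive (*-zeroˡ (ι (D m) * inv m))) (*-nonNeg {1ℚ + 1ℚ} (≤ᵇ⇒≤ _) (+-nonNeg 0≤1 τ≥0))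
    ... | yes m≤N = begin
      1ℚ * (ι (D m) * inv m)    ≡⟨ *-identityˡ (ι (D m) * inv m) ⟩
      ι (D m) * inv m           ≤⟨ *-monoʳ (ι-≥0 (D m)) (inv-≤1 m) ⟩
      ι (D m) * 1ℚ              ≡⟨ *-identityʳ (ι (D m)) ⟩
      ι (D m)                   ≤⟨ ι-mono (D-hi′ m 2 1≤m m≤4 m≤N) ⟩
      ι (2 ℕ.* suc T′)          ≡⟨ trans (ι-* 2 (suc T′)) (cong₂ _*_ ι-2 (ι-suc T′)) ⟩
      (1ℚ + 1ℚ) * (1ℚ + τ)      ∎
      where open ≤-Reasoning

    -- That log m / m decreases: (m + 1)^m ≤ 4 m^m ≤ m^(m+1) for m ≥ 4. Going from the exponent T′ +
    -- 1 of `D-hi` to the exponent T′ of `D-lo` loses a factor m ≤ 2^B, hence the slack B.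
    D-slope : ∀ m → 4 ℕ.≤ m → suc m ℕ.≤ N → m ℕ.* D (suc m) ℕ.≤ suc m ℕ.* (D m ℕ.+ B)
    D-slope m 4≤m sm≤ = 2^-cancel-≤ (begin
      2 ℕ.^ (m ℕ.* D (suc m))                   ≡⟨ trans (cong (2 ℕ.^_) (ℕₚ.*-comm m (D (suc m)))) (sym (ℕₚ.^-*-assoc 2 (D (suc m)) m)) ⟩
      (2 ℕ.^ D (suc m)) ℕ.^ m                   ≤⟨ ℕₚ.^-monoˡ-≤ m (D-hi (suc m) 1≤suc sm≤) ⟩
      (suc m ℕ.^ suc T′) ℕ.^ m                  ≡⟨ trans (ℕₚ.^-*-assoc (suc m) (suc T′) m) (trans (cong (suc m ℕ.^_) (ℕₚ.*-comm (suc T′) m)) (sym (ℕₚ.^-*-assoc (suc m) m (suc T′)))) ⟩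
      (suc m ℕ.^ m) ℕ.^ suc T′                  ≤⟨ ℕₚ.^-monoˡ-≤ (suc T′) (ℕₚ.≤-trans (suc-^-≤ m) (ℕₚ.*-monoˡ-≤ (m ℕ.^ m) 4≤m)) ⟩
      (m ℕ.^ suc m) ℕ.^ suc T′                  ≡⟨ trans (ℕₚ.^-*-assoc m (suc m) (suc T′)) (trans (cong (m ℕ.^_) (ℕₚ.*-comm (suc m) (suc T′))) (sym (ℕₚ.^-*-assoc m (suc T′) (suc m)))) ⟩
      (m ℕ.* m ℕ.^ T′) ℕ.^ suc m                ≤⟨ ℕₚ.^-monoˡ-≤ (suc m) (ℕₚ.*-mono-≤ m≤N (D-lo m 1≤m m≤N)) ⟩
      (2 ℕ.^ B ℕ.* 2 ℕ.^ D m) ℕ.^ suc m         ≡⟨ cong (ℕ._^ suc m) (trans (ℕₚ.*-comm (2 ℕ.^ B) (2 ℕ.^ D m)) (sym (ℕₚ.^-distribˡ-+-* 2 (D m) B))) ⟩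
      (2 ℕ.^ (D m ℕ.+ B)) ℕ.^ suc m             ≡⟨ trans (ℕₚ.^-*-assoc 2 (D m ℕ.+ B) (suc m)) (cong (2 ℕ.^_) (ℕₚ.*-comm (D m ℕ.+ B) (suc m))) ⟩
      2 ℕ.^ (suc m ℕ.* (D m ℕ.+ B))             ∎)
      where
      open ℕₚ.≤-Reasoning
      m≤N = ℕₚ.<⇒≤ sm≤
      1≤m = ℕₚ.≤-trans (s≤s z≤n) 4≤m

    f-mono : ∀ n → 4 ℕ.≤ n → f (suc n) ≤ f n + ι B
    f-mono n 4≤n with suc n ℕₚ.≤? N
    ... | no _ = ≤-trans (≤-reflexive (*-zeroˡ (ι (D (suc n)) * inv (suc n)))) (+-nonNeg (f≥0 n) (ι-≥0 B))
    ... | yes sn≤ = begin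
      1ℚ * (ι (D (suc n)) * inv (suc n)) ≡⟨ *-identityˡ (ι (D (suc n)) * inv (suc n)) ⟩
      ι (D (suc n)) * inv (suc n)
        ≤⟨ *-cancelˡ (*-positive (ι->0 1≤n) (ι->0 {suc n} 1≤suc)) (begin
             ι n * ι (suc n) * (ι (D (suc n)) * inv (suc n)) ≡⟨ lem (ι n) (ι (suc n)) (ι (D (suc n))) (inv (suc n)) ⟩
             ι n * ι (D (suc n)) * (ι (suc n) * inv (suc n)) ≡⟨ trans (cong (ι n * ι (D (suc n)) *_) (ι*inv {suc n} 1≤suc)) (*-identityʳ (ι n * ι (D (suc n)))) ⟩
             ι n * ι (D (suc n))                             ≡⟨ sym (ι-* n (D (suc n))) ⟩
             ι (n ℕ.* D (suc n))                             ≤⟨ ι-mono (D-slope n 4≤n sn≤) ⟩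
             ι (suc n ℕ.* (D n ℕ.+ B))                       ≡⟨ trans (ι-* (suc n) (D n ℕ.+ B)) (cong (ι (suc n) *_) (ι-+ (D n) B)) ⟩
             ι (suc n) * (ι (D n) + ι B)                     ≡⟨ trans (sym (*-identityʳ (ι (suc n) * (ι (D n) + ι B)))) (cong (ι (suc n) * (ι (D n) + ι B) *_) (sym (ι*inv 1≤n))) ⟩
             ι (suc n) * (ι (D n) + ι B) * (ι n * inv n)     ≡⟨ lem₂ (ι (suc n)) (ι (D n) + ι B) (ι n) (inv n) ⟩
             ι n * ι (suc n) * ((ι (D n) + ι B) * inv n)     ∎) ⟩
      (ι (D n) + ι B) * inv n            ≡⟨ *-distribʳ-+ (inv n) (ι (D n)) (ι B) ⟩
      ι (D n) * inv n + ι B * inv n      ≤⟨ +-monoʳ-≤ (ι (D n) * inv n) (≤-trans (*-monoʳ (ι-≥0 B) (inv-≤1 n)) (≤-reflexive (*-identityʳ (ι B)))) ⟩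
      ι (D n) * inv n + ι B              ≡⟨ cong (_+ ι B) (sym (f-eq n (ℕₚ.<⇒≤ sn≤))) ⟩
      f n + ι B                          ∎
      where
      open ≤-Reasoning
      1≤n = ℕₚ.≤-trans (s≤s z≤n) 4≤n
      lem : ∀ a b c d → a * b * (c * d) ≡ a * c * (b * d)
      lem = solve-∀ ℚ-ring
      lem₂ : ∀ a b c d → a * b * (c * d) ≡ c * a * (b * d)
      lem₂ = solve-∀ ℚ-ring

    χ-abs : ∀ n {z} → 0ℚ ≤ z → - z ≤ χ n * z × χ n * z ≤ z
    χ-abs n {z} h = ≤-trans (≤-reflexive (lem z)) (*-monoˡ h (proj₁ (χ-bounds n)))
                  , ≤-trans (*-monoˡ h (proj₂ (χ-bounds n))) (≤-reflexive (*-identityˡ z))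
      where
      lem : ∀ z → - z ≡ - 1ℚ * z
      lem = solve-∀ ℚ-ring

    head-bound : ∀ n → n ℕ.≤ 3 → - (ι n * ((1ℚ + 1ℚ) * (1ℚ + τ))) ≤ tail f 1 n × tail f 1 n ≤ ι n * ((1ℚ + 1ℚ) * (1ℚ + τ))
    head-bound n n≤3 = ≤-trans (≤-reflexive (trans (cong -_ (sym (∑-const n c))) (sym (∑-neg n (λ _ → c)))))
        (∑-mono n (λ i i< → ≤-trans (neg-antimono-≤ (sm i i<)) (proj₁ (χ-abs (suc i) (f≥0 (suc i))))))
      , ≤-trans (∑-mono n (λ i i< → ≤-trans (proj₂ (χ-abs (suc i) (f≥0 (suc i)))) (sm i i<))) (≤-reflexive (∑-const n c))
      where
      c = (1ℚ + 1ℚ) * (1ℚ + τ)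
      sm : ∀ i → i ℕ.< n → f (suc i) ≤ c
      sm i i< = f-small (suc i) 1≤suc (ℕₚ.≤-trans i< (ℕₚ.≤-trans n≤3 (ℕₚ.n≤1+n 3)))

    17ℚ : ℚ
    17ℚ = (ℤ.+ 17) / 1

    ι-3 : ι 3 ≡ 1ℚ + 1ℚ + 1ℚ
    ι-3 = trans (ι-+ 2 1) (cong₂ _+_ ι-2 ι-1)

    c≤ : (1ℚ + 1ℚ) * (1ℚ + τ) ≤ (1ℚ + 1ℚ + 1ℚ + 1ℚ) * τ
    c≤ = ≤-by ((1ℚ + 1ℚ) * (τ - 1ℚ)) (*-nonNeg {1ℚ + 1ℚ} (≤ᵇ⇒≤ _) (diff≥0 1≤τ)) (lem τ)
      where
      lem : ∀ t → (1ℚ + 1ℚ + 1ℚ + 1ℚ) * t ≡ (1ℚ + 1ℚ) * (1ℚ + t) + (1ℚ + 1ℚ) * (t - 1ℚ)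
      lem = solve-∀ ℚ-ring

    -- 17 = 3 · 4 + 4 + 1: three head terms before f becomes monotone, the leading term of the
    -- alternating tail, and its accumulated slack.
    Y-bound : ∀ M → M ℕ.≤ N → - (17ℚ * τ) ≤ tail f 1 M × tail f 1 M ≤ 17ℚ * τ
    Y-bound M M≤N with ℕₚ.≤-total M 3
    ... | inj₁ M≤3 = ≤-trans (neg-antimono-≤ le) (proj₁ (head-bound M M≤3)) , ≤-trans (proj₂ (head-bound M M≤3)) le
      where
      lem : ∀ t → 17ℚ * t ≡ (1ℚ + 1ℚ + 1ℚ) * ((1ℚ + 1ℚ + 1ℚ + 1ℚ) * t) + (1ℚ + 1ℚ + 1ℚ + 1ℚ + 1ℚ) * t
      lem = solve-∀ ℚ-ring
      le : ι M * ((1ℚ + 1ℚ) * (1ℚ + τ)) ≤ 17ℚ * τ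
      le = ≤-trans (*-mono (ι-≥0 M) (≤-trans (ι-mono M≤3) (≤-reflexive ι-3)) (*-nonNeg {1ℚ + 1ℚ} (≤ᵇ⇒≤ _) (+-nonNeg 0≤1 τ≥0)) c≤)
        (≤-by ((1ℚ + 1ℚ + 1ℚ + 1ℚ + 1ℚ) * τ) (*-nonNeg {1ℚ + 1ℚ + 1ℚ + 1ℚ + 1ℚ} (≤ᵇ⇒≤ _) τ≥0) (lem τ))
    ... | inj₂ 3≤M = lower , upper
      where
      n = M ℕ.∸ 3
      module Alt = Alternating f (ι B) (ι-≥0 B) f≥0 4 (4 ℕ.+ n) (λ k 4≤k _ → f-mono k 4≤k)
      bd = Alt.tail-bound 4 n ℕₚ.≤-refl ℕₚ.≤-refl
      hd = head-bound 3 ℕₚ.≤-refl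
      eq : tail f 1 M ≡ tail f 1 3 + tail f 4 n
      eq = trans (cong (tail f 1) (sym (ℕₚ.m+[n∸m]≡n 3≤M))) (∑-split 3 n (λ i → χ (1 ℕ.+ i) * f (1 ℕ.+ i)))
      nB : ι n * ι B ≤ τ
      nB = ≤-trans (≤-reflexive (sym (ι-* n B))) (ι-mono (ℕₚ.≤-trans (ℕₚ.*-mono-≤ (ℕₚ.≤-trans (ℕₚ.m∸n≤m M 3) M≤N) (ℕₚ.n≤1+n B))
        (subst (ℕ._≤ T′) (ℕₚ.*-comm (suc B) N) T′-big)))
      lem : ∀ t → (1ℚ + 1ℚ + 1ℚ) * ((1ℚ + 1ℚ + 1ℚ + 1ℚ) * t) + ((1ℚ + 1ℚ + 1ℚ + 1ℚ) * t + t) ≡ 17ℚ * t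
      lem = solve-∀ ℚ-ring
      hd≤ : ι 3 * ((1ℚ + 1ℚ) * (1ℚ + τ)) ≤ (1ℚ + 1ℚ + 1ℚ) * ((1ℚ + 1ℚ + 1ℚ + 1ℚ) * τ)
      hd≤ = *-mono (ι-≥0 3) (≤-reflexive ι-3) (*-nonNeg {1ℚ + 1ℚ} (≤ᵇ⇒≤ _) (+-nonNeg 0≤1 τ≥0)) c≤
      tl≤ : f 4 + ι n * ι B ≤ (1ℚ + 1ℚ + 1ℚ + 1ℚ) * τ + τ
      tl≤ = +-mono-≤ (≤-trans (f-small 4 1≤suc ℕₚ.≤-refl) c≤) nB
      tot : ι 3 * ((1ℚ + 1ℚ) * (1ℚ + τ)) + (f 4 + ι n * ι B) ≤ 17ℚ * τ
      tot = ≤-trans (+-mono-≤ hd≤ tl≤) (≤-reflexive (lem τ))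
      upper : tail f 1 M ≤ 17ℚ * τ
      upper = ≤-trans (≤-reflexive eq) (≤-trans (+-mono-≤ (proj₂ hd) (proj₂ bd)) tot)
      lower : - (17ℚ * τ) ≤ tail f 1 M
      lower = ≤-trans (neg-antimono-≤ tot) (≤-trans (≤-reflexive (neg-distrib-+ (ι 3 * ((1ℚ + 1ℚ) * (1ℚ + τ))) (f 4 + ι n * ι B)))
        (≤-trans (+-mono-≤ (proj₁ hd) (proj₁ bd)) (≤-reflexive (sym eq))))

    -- Complete multiplicativity of χ twists the convolution D = Λ * 1, leaving partial sums of L(1,
    -- χ) of length ⌊M/q⌋ inside.
    Y-id : ∀ M → M ℕ.≤ N → tail f 1 M ≡ ∑ M (λ i → χ (suc i) * (Λ (suc i) * inv (suc i)) * S (cnt (suc i) M))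
    Y-id M M≤N = trans (∑-cong M (λ i i< → trans (cong (χ (suc i) *_) (f-eq (suc i) (ℕₚ.≤-trans i< M≤N))) (lem₁ (χ (suc i)) (ι (D (suc i))) (inv (suc i)))))
      (trans (double-sum M M (λ m → χ m * inv m) ℕₚ.≤-refl M≤N) (∑-cong M (λ i _ →
        trans (cong (Λ (suc i) *_) (trans (∑-cong (cnt (suc i) M) (λ e _ → trans (cong₂ _*_ (χ-* (suc e) (suc i)) (inv-* (suc e) (suc i)))
            (lem₂ (χ (suc e)) (χ (suc i)) (inv (suc e)) (inv (suc i)))))
          (∑-*ʳ (cnt (suc i) M) (χ (suc i) * inv (suc i)) (λ e → χ (suc e) * inv (suc e)))))
          (lem₃ (Λ (suc i)) (S (cnt (suc i) M)) (χ (suc i)) (inv (suc i))))))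
      where
      lem₁ : ∀ a b c → a * (b * c) ≡ b * (a * c)
      lem₁ = solve-∀ ℚ-ring
      lem₂ : ∀ a b c d → a * b * (c * d) ≡ a * c * (b * d)
      lem₂ = solve-∀ ℚ-ring
      lem₃ : ∀ l s c i → l * (s * (c * i)) ≡ c * (l * i) * s
      lem₃ = solve-∀ ℚ-ring

    cnt-≤M : ∀ i M → cnt (suc i) M ℕ.≤ M
    cnt-≤M i M = ℕₚ.≤-trans (ℕₚ.m≤m*n (cnt (suc i) M) (suc i)) (proj₁ (cnt-bounds (suc i) M 1≤suc))

    -- All inner sums S(⌊M/q⌋) are replaced by S(M): the alternating tail after c = ⌊M/q⌋ terms is
    -- at most 1/(c + 1) ≤ q/M, so the total error is at most ψ(M)/M ≤ 8τ.
    Y-near : ∀ A → A ℕ.≤ B → tail f 1 (2 ℕ.^ A) - 8ℚ * τ ≤ S (2 ℕ.^ A) * Xχ (2 ℕ.^ A) × S (2 ℕ.^ A) * Xχ (2 ℕ.^ A) ≤ tail f 1 (2 ℕ.^ A) + 8ℚ * τ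
    Y-near A A≤B = lower , upper
      where
      open ≤-Reasoning
      M = 2 ℕ.^ A
      u : ℕ → ℚ
      u i = Λ (suc i) * inv (suc i)
      err : ℕ → ℚ
      err i = Λ (suc i) * inv M
      c : ℕ → ℕ
      c i = cnt (suc i) M
      g : ℕ → ℚ
      g i = χ (suc i) * u i * S (c i)
      sx : S M * Xχ M ≡ ∑ M (λ i → χ (suc i) * u i * S M)
      sx = trans (*-comm (S M) (Xχ M)) (sym (∑-*ʳ M (S M) (λ i → χ (suc i) * u i)))
      u≥0 : ∀ i → 0ℚ ≤ u i
      u≥0 i = *-nonNeg (Λ≥0 (suc i)) (inv-≥0 (suc i))
      cancel : ∀ i → u i * (ι (suc i) * inv M) ≡ err i
      cancel i = trans (lem (Λ (suc i)) (inv (suc i)) (ι (suc i)) (inv M)) (trans (cong (Λ (suc i) * inv M *_) (ι*inv {suc i} 1≤suc)) (*-identityʳ (err i)))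
        where
        lem : ∀ l a b d → l * a * (b * d) ≡ l * d * (b * a)
        lem = solve-∀ ℚ-ring
      d : ℕ → ℚ
      d i = S M - S (c i)
      d-bd : ∀ i → - (ι (suc i) * inv M) ≤ d i × d i ≤ ι (suc i) * inv M
      d-bd i = ≤-trans (neg-antimono-≤ ic) (diff≥0⁻¹ (subst (0ℚ ≤_) (l1 (S M) (S (c i)) (inv (suc (c i)))) (diff≥0 (proj₁ near))))
             , ≤-trans (diff≥0⁻¹ (subst (0ℚ ≤_) (l2 (S M) (S (c i)) (inv (suc (c i)))) (diff≥0 (proj₂ near)))) ic
        where
        near = S-near (c i) M (cnt-≤M i M)
        ic = inv-cnt (suc i) M 1≤suc (1≤2^ A)
        l1 : ∀ a b e → a - (b - e) ≡ (a - b) - (- e)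
        l1 = solve-∀ ℚ-ring
        l2 : ∀ a b e → (b + e) - a ≡ e - (a - b)
        l2 = solve-∀ ℚ-ring
      key : ∀ i → - err i ≤ χ (suc i) * u i * d i × χ (suc i) * u i * d i ≤ err i
      key i = ≤-trans (neg-antimono-≤ (proj₂ ab)) (≤-trans (proj₁ both) ≤-refl) , ≤-trans (proj₂ both) (proj₂ ab)
        where
        z = u i * (ι (suc i) * inv M)
        ab : err i ≤ err i × z ≤ err i
        ab = ≤-refl , ≤-reflexive (cancel i)
        both : - z ≤ χ (suc i) * u i * d i × χ (suc i) * u i * d i ≤ z
        both with ≤-total 0ℚ (d i)
        ... | inj₁ 0≤d = ≤-trans (neg-antimono-≤ (*-monoʳ (u≥0 i) (proj₂ (d-bd i)))) (≤-trans (proj₁ ca) (≤-reflexive (sym (*-assoc (χ (suc i)) (u i) (d i)))))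
                       , ≤-trans (≤-reflexive (*-assoc (χ (suc i)) (u i) (d i))) (≤-trans (proj₂ ca) (*-monoʳ (u≥0 i) (proj₂ (d-bd i))))
          where ca = χ-abs (suc i) (*-nonNeg (u≥0 i) 0≤d)
        ... | inj₂ d≤0 = ≤-trans (neg-antimono-≤ (*-monoʳ (u≥0 i) nd)) (≤-trans (neg-antimono-≤ (proj₂ ca)) (≤-reflexive (lem (χ (suc i)) (u i) (d i))))
                       , ≤-trans (≤-reflexive (sym (lem (χ (suc i)) (u i) (d i)))) (≤-trans (neg-antimono-≤ (proj₁ ca)) (≤-trans (≤-reflexive (nn (u i * - d i))) (*-monoʳ (u≥0 i) nd)))
          where
          ca = χ-abs (suc i) (*-nonNeg (u≥0 i) (neg-antimono-≤ d≤0))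
          lem : ∀ x y w → - (x * (y * - w)) ≡ x * y * w
          lem = solve-∀ ℚ-ring
          nn : ∀ y → - - y ≡ y
          nn = solve-∀ ℚ-ring
          nd : - d i ≤ ι (suc i) * inv M
          nd = ≤-trans (neg-antimono-≤ (proj₁ (d-bd i))) (≤-reflexive (nn (ι (suc i) * inv M)))
      Σerr : ∑ M err ≤ 8ℚ * τ
      Σerr = begin
        ∑ M err                      ≡⟨ ∑-*ʳ M (inv M) (λ i → Λ (suc i)) ⟩
        ψ M * inv M                  ≤⟨ *-monoˡ (inv-≥0 M) (ψ-bound A A≤B) ⟩
        8ℚ * (τ * P A) * inv M       ≡⟨ lem 8ℚ τ (P A) (inv M) ⟩
        8ℚ * τ * (P A * inv M)       ≡⟨ trans (cong (8ℚ * τ *_) (ι*inv (1≤2^ A))) (*-identityʳ (8ℚ * τ)) ⟩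
        8ℚ * τ                       ∎
        where
        lem : ∀ e t p i → e * (t * p) * i ≡ e * t * (p * i)
        lem = solve-∀ ℚ-ring
      split : ∑ M (λ i → χ (suc i) * u i * S M) ≡ tail f 1 M + ∑ M (λ i → χ (suc i) * u i * d i)
      split = trans (∑-cong M (λ i _ → lem (χ (suc i) * u i) (S M) (S (c i)))) (trans (∑-+ M g (λ i → χ (suc i) * u i * d i))
        (cong (_+ ∑ M (λ i → χ (suc i) * u i * d i)) (sym (Y-id M (2^≤ A≤B)))))
        where
        lem : ∀ a s t → a * s ≡ a * t + a * (s - t)
        lem = solve-∀ ℚ-ring
      upper : S M * Xχ M ≤ tail f 1 M + 8ℚ * τ
      upper = ≤-trans (≤-reflexive (trans sx split)) (+-monoʳ-≤ (tail f 1 M) (≤-trans (∑-mono M (λ i _ → proj₂ (key i))) Σerr))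
      lower : tail f 1 M - 8ℚ * τ ≤ S M * Xχ M
      lower = ≤-trans (+-monoʳ-≤ (tail f 1 M) (≤-trans (neg-antimono-≤ Σerr) (≤-trans (≤-reflexive (sym (∑-neg M err))) (∑-mono M (λ i _ → proj₁ (key i))))))
        (≤-reflexive (sym (trans sx split)))

    50ℚ : ℚ
    50ℚ = (ℤ.+ 50) / 1

    -- Dividing by S ≥ 1/2 doubles 25 = 17 + 8.
    Xχ-bound : ∀ A → A ℕ.≤ B → - (50ℚ * τ) ≤ Xχ (2 ℕ.^ A) × Xχ (2 ℕ.^ A) ≤ 50ℚ * τ
    Xχ-bound A A≤B = lower , upper
      where
      M = 2 ℕ.^ A
      x = Xχ M
      s = S M
      s≥½ = S≥½ M (1≤2^ A)
      yb = Y-bound M (2^≤ A≤B)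
      yn = Y-near A A≤B
      25ℚ : ℚ
      25ℚ = (ℤ.+ 25) / 1
      up : s * x ≤ 25ℚ * τ
      up = ≤-trans (proj₂ yn) (≤-trans (+-monoˡ-≤ (8ℚ * τ) (proj₂ yb)) (≤-reflexive (lem τ)))
        where
        lem : ∀ t → 17ℚ * t + 8ℚ * t ≡ 25ℚ * t
        lem = solve-∀ ℚ-ring
      lo : - (25ℚ * τ) ≤ s * x
      lo = ≤-trans (≤-reflexive (lem τ)) (≤-trans (+-monoˡ-≤ (- (8ℚ * τ)) (proj₁ yb)) (proj₁ yn))
        where
        lem : ∀ t → - (25ℚ * t) ≡ - (17ℚ * t) - 8ℚ * t
        lem = solve-∀ ℚ-ring
      50τ≥0 : 0ℚ ≤ 50ℚ * τ
      50τ≥0 = *-nonNeg {50ℚ} (≤ᵇ⇒≤ _) τ≥0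
      half : ∀ t → ½ * (50ℚ * t) ≡ 25ℚ * t
      half = solve-∀ ℚ-ring
      upper : x ≤ 50ℚ * τ
      upper with ≤-total 0ℚ x
      ... | inj₂ x≤0 = ≤-trans x≤0 50τ≥0
      ... | inj₁ 0≤x = *-cancelˡ {½} (positive⁻¹ ½) (≤-trans (*-monoˡ 0≤x s≥½) (≤-trans up (≤-reflexive (sym (half τ)))))
      lower : - (50ℚ * τ) ≤ x
      lower with ≤-total 0ℚ x
      ... | inj₁ 0≤x = ≤-trans (neg-antimono-≤ 50τ≥0) 0≤x
      ... | inj₂ x≤0 = *-cancelˡ {½} (positive⁻¹ ½) (≤-trans (≤-reflexive (hn τ)) (≤-trans lo (flip (*-monoˡ (neg-antimono-≤ x≤0) s≥½))))
        where
        hn : ∀ t → ½ * - (50ℚ * t) ≡ - (25ℚ * t)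
        hn = solve-∀ ℚ-ring
        n1 : ∀ a b → - (a * - b) ≡ a * b
        n1 = solve-∀ ℚ-ring
        flip : ½ * - x ≤ s * - x → s * x ≤ ½ * x
        flip h = subst₂ _≤_ (n1 s x) (n1 ½ x) (neg-antimono-≤ h)

    -- 111 = 9 + 2 + 50 + 50, from `X-hi`, `X-lo` and the two uses of `Xχ-bound`.
    111ℚ : ℚ
    111ℚ = (ℤ.+ 111) / 1

    -- The weights 1 - χ vanish on primes p ≡ 1 (mod 4) and equal 2 on primes p ≡ 3 (mod 4).
    block-bound : ∀ A → A ℕ.≤ B →
      ∑ (2 ℕ.^ B ℕ.∸ 2 ℕ.^ A) (λ i → (1ℚ - χ (suc (2 ℕ.^ A ℕ.+ i))) * (Λ (suc (2 ℕ.^ A ℕ.+ i)) * inv (suc (2 ℕ.^ A ℕ.+ i)))) ≤ τ * (ι B - ι A + 111ℚ)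
    block-bound A A≤B = begin
      ∑ (N ℕ.∸ M) (λ i → h (M ℕ.+ i))   ≡⟨ lem₁ (∑ M h) (∑ (N ℕ.∸ M) (λ i → h (M ℕ.+ i))) ⟩
      (∑ M h + ∑ (N ℕ.∸ M) (λ i → h (M ℕ.+ i))) - ∑ M h ≡⟨ cong (_- ∑ M h) (trans (sym (∑-split M (N ℕ.∸ M) h)) (cong (λ z → ∑ z h) (ℕₚ.m+[n∸m]≡n (2^≤ A≤B)))) ⟩
      ∑ N h - ∑ M h                     ≡⟨ cong₂ _-_ (dec N) (dec M) ⟩
      (X N - Xχ N) - (X M - Xχ M)       ≤⟨ +-mono-≤ (+-mono-≤ (X-hi B ℕₚ.≤-refl) (neg-antimono-≤ (proj₁ (Xχ-bound B ℕₚ.≤-refl))))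
                                             (neg-antimono-≤ (+-mono-≤ (X-lo A A≤B) (neg-antimono-≤ (proj₂ (Xχ-bound A A≤B))))) ⟩
      (τ * (ι B + 9ℚ) - - (50ℚ * τ)) - (τ * (ι A - (1ℚ + 1ℚ)) - 50ℚ * τ) ≡⟨ lem₂ τ (ι A) (ι B) ⟩
      τ * (ι B - ι A + 111ℚ)            ∎
      where
      open ≤-Reasoning
      M = 2 ℕ.^ A
      h : ℕ → ℚ
      h i = (1ℚ - χ (suc i)) * (Λ (suc i) * inv (suc i))
      lem₁ : ∀ a b → b ≡ (a + b) - a
      lem₁ = solve-∀ ℚ-ring
      lem₂ : ∀ t a b → (t * (b + 9ℚ) - - (50ℚ * t)) - (t * (a - (1ℚ + 1ℚ)) - 50ℚ * t) ≡ t * (b - a + 111ℚ)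
      lem₂ = solve-∀ ℚ-ring
      lem₃ : ∀ c u → (1ℚ - c) * u ≡ u - c * u
      lem₃ = solve-∀ ℚ-ring
      dec : ∀ K → ∑ K h ≡ X K - Xχ K
      dec K = trans (∑-cong K (λ i _ → lem₃ (χ (suc i)) (Λ (suc i) * inv (suc i))))
        (∑-- K (λ i → Λ (suc i) * inv (suc i)) (λ i → χ (suc i) * (Λ (suc i) * inv (suc i))))

-- Reciprocals of the primes congruent to 3 modulo 4

module MertensModFour where

  open import Data.Nat.Base as ℕ using (ℕ; zero; suc; z≤n; s≤s)
  import Data.Nat.Properties as ℕₚ
  import Algebra.Properties.CommutativeSemigroup ℕₚ.+-commutativeSemigroup as CM
  open import Data.Nat.Divisibility
  open import Data.Nat.Primality
  open import Data.Nat.Primality.Factorisation using (factorise; PrimeFactorisation)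
  open import Data.Nat.ListAction using (product)
  open import Data.List.Base using ([]; _∷_)
  open import Data.List.Relation.Unary.All using (All; []; _∷_)
  open import Data.Rational.Base using (ℚ; 0ℚ; 1ℚ; _+_; _*_; _-_; -_; _≤_; _<_)
  open import Data.Rational.Properties
  open import Data.Product.Base using (_×_; _,_; proj₁; proj₂; ∃-syntax)
  open import Data.Sum.Base using (inj₁; inj₂)
  open import Relation.Nullary using (Dec; yes; no; ¬_; contradiction)
  open import Relation.Nullary.Decidable using (_×-dec_)
  open import Relation.Binary.PropositionalEquality
  open import Tactic.RingSolver using (solve-∀)
  open Rationals
  open Character
  open WeightedMertens

  P3 : ℕ → Set
  P3 q = Prime q × q ℕ.% 4 ≡ 3

  P3? : ∀ q → Dec (P3 q)
  P3? q = prime? q ×-dec (q ℕ.% 4 ℕₚ.≟ 3)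

  π3 : ℕ → ℚ
  π3 q = 𝟙 (P3? q) * inv q

  π3≥0 : ∀ q → 0ℚ ≤ π3 q
  π3≥0 q = *-nonNeg (𝟙-≥0 (P3? q)) (inv-≥0 q)

  χ-3 : ∀ q → q ℕ.% 4 ≡ 3 → χ q ≡ - 1ℚ
  χ-3 3 refl = refl
  χ-3 (suc (suc (suc (suc q)))) h = χ-3 q h

  ∑ₙ : ℕ → (ℕ → ℕ) → ℕ
  ∑ₙ zero    f = 0
  ∑ₙ (suc n) f = ∑ₙ n f ℕ.+ f n

  ∑ₙ-cong : ∀ n {f g} → (∀ i → i ℕ.< n → f i ≡ g i) → ∑ₙ n f ≡ ∑ₙ n g
  ∑ₙ-cong zero    h = refl
  ∑ₙ-cong (suc n) h = cong₂ ℕ._+_ (∑ₙ-cong n (λ i i< → h i (ℕₚ.m<n⇒m<1+n i<))) (h n ℕₚ.≤-refl)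

  ∑ₙ-+ : ∀ n f g → ∑ₙ n (λ i → f i ℕ.+ g i) ≡ ∑ₙ n f ℕ.+ ∑ₙ n g
  ∑ₙ-+ zero f g = refl
  ∑ₙ-+ (suc n) f g = trans (cong (ℕ._+ (f n ℕ.+ g n)) (∑ₙ-+ n f g)) (CM.interchange (∑ₙ n f) (∑ₙ n g) (f n) (g n))

  ∑ₙ-zero : ∀ n → ∑ₙ n (λ _ → 0) ≡ 0
  ∑ₙ-zero zero = refl
  ∑ₙ-zero (suc n) = trans (ℕₚ.+-identityʳ _) (∑ₙ-zero n)

  ∑ₙ-shift : ∀ n g → ∑ₙ n g ℕ.+ g n ≡ g 0 ℕ.+ ∑ₙ n (λ i → g (suc i))
  ∑ₙ-shift zero g = ℕₚ.+-comm 0 (g 0)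
  ∑ₙ-shift (suc n) g = trans (cong (ℕ._+ g (suc n)) (∑ₙ-shift n g)) (ℕₚ.+-assoc (g 0) _ _)

  ι-∑ₙ : ∀ n f → ι (∑ₙ n f) ≡ ∑ n (λ i → ι (f i))
  ι-∑ₙ zero f = ι-0
  ι-∑ₙ (suc n) f = trans (ι-+ (∑ₙ n f) (f n)) (cong (_+ ι (f n)) (ι-∑ₙ n f))

  bit : {A : Set} → Dec A → ℕ
  bit (yes _) = 1
  bit (no _)  = 0

  bit-cong : {A B : Set} (d : Dec A) (e : Dec B) → (A → B) → (B → A) → bit d ≡ bit e
  bit-cong (yes a) (yes b) f g = refl
  bit-cong (yes a) (no ¬b) f g = contradiction (f a) ¬b
  bit-cong (no ¬a) (yes b) f g = contradiction (g b) ¬a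
  bit-cong (no ¬a) (no ¬b) f g = refl

  bit-no : {A : Set} (d : Dec A) → ¬ A → bit d ≡ 0
  bit-no (yes a) ¬a = contradiction a ¬a
  bit-no (no _)  ¬a = refl

  bit-yes : {A : Set} (d : Dec A) → A → bit d ≡ 1
  bit-yes (yes _) a = refl
  bit-yes (no ¬a) a = contradiction a ¬a

  ι-bit : {A : Set} (d : Dec A) → ι (bit d) ≡ 𝟙 d
  ι-bit (yes _) = ι-1
  ι-bit (no _)  = ι-0

  ∑ₙ-pick : ∀ n x c → x ℕ.< n → ∑ₙ n (λ i → bit (i ℕₚ.≟ x) ℕ.* c) ≡ c
  ∑ₙ-pick (suc n) x c x<sn with n ℕₚ.≟ x
  ... | yes refl = trans (cong₂ ℕ._+_ (trans (∑ₙ-cong n (λ i i< → cong (ℕ._* c) (bit-no (i ℕₚ.≟ n) (ℕₚ.<⇒≢ i<)))) (∑ₙ-zero n)) (ℕₚ.+-identityʳ c)) refl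
  ... | no n≢x = trans (ℕₚ.+-identityʳ _) (∑ₙ-pick n x c (ℕₚ.≤∧≢⇒< (ℕₚ.≤-pred x<sn) (λ e → n≢x (sym e))))

  lg : ∀ n → 1 ℕ.≤ n → ∃[ c ] (2 ℕ.^ c ℕ.≤ n × n ℕ.< 2 ℕ.^ suc c)
  lg (suc zero) _ = 0 , ℕₚ.≤-refl , ℕₚ.≤-refl
  lg (suc (suc n)) _ with lg (suc n) (s≤s z≤n)
  ... | c , lo , hi with suc (suc n) ℕₚ.<? 2 ℕ.^ suc c
  ...   | yes lt = c , ℕₚ.m≤n⇒m≤1+n lo , lt
  ...   | no ge = suc c , ℕₚ.≮⇒≥ ge , ℕₚ.<-≤-trans (s≤s hi) (subst (suc (2 ℕ.^ suc c) ℕ.≤_) (sym (2^suc′ (suc c))) (ℕₚ.+-monoˡ-≤ (2 ℕ.^ suc c) (1≤2^ (suc c))))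
    where
    2^suc′ : ∀ A → 2 ℕ.^ suc A ≡ 2 ℕ.^ A ℕ.+ 2 ℕ.^ A
    2^suc′ A = cong (2 ℕ.^ A ℕ.+_) (ℕₚ.+-identityʳ (2 ℕ.^ A))

  ^-distribʳ-* : ∀ n a b → (a ℕ.* b) ℕ.^ n ≡ a ℕ.^ n ℕ.* b ℕ.^ n
  ^-distribʳ-* zero a b = refl
  ^-distribʳ-* (suc n) a b = trans (cong (a ℕ.* b ℕ.*_) (^-distribʳ-* n a b)) (ℕₚ.[m*n]*[o*p]≡[m*o]*[n*p] a b (a ℕ.^ n) (b ℕ.^ n))

  prime≥2 : ∀ {p} → Prime p → 2 ℕ.≤ p
  prime≥2 pp = ℕ.nonTrivial⇒n>1 _ {{prime⇒nonTrivial pp}}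

  prime-∣-prime : ∀ {p q} → Prime p → Prime q → p ∣ q → p ≡ q
  prime-∣-prime {p} {q} pp pq p∣q with prime⇒irreducible pq p∣q
  ... | inj₁ refl = contradiction (prime≥2 pp) (ℕₚ.<⇒≱ (s≤s (s≤s z≤n)))
  ... | inj₂ e = e

  prime-power-cancel : ∀ {p q} → Prime q → ¬ q ∣ p → ∀ i m → q ℕ.^ i ∣ p ℕ.* m → q ℕ.^ i ∣ m
  prime-power-cancel pq q∤p zero m _ = 1∣ m
  prime-power-cancel {p} {q} pq q∤p (suc i) m h with euclidsLemma p m pq (∣-trans (m∣m*n (q ℕ.^ i)) h)
  ... | inj₁ q∣p = contradiction q∣p q∤p
  ... | inj₂ (divides m″ refl) = subst (q ℕ.^ suc i ∣_) (ℕₚ.*-comm q m″) (*-monoʳ-∣ q (prime-power-cancel pq q∤p i m″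
        (*-cancelˡ-∣ q {{prime⇒nonZero pq}} (subst (q ℕ.^ suc i ∣_) e h))))
    where
    e : p ℕ.* (m″ ℕ.* q) ≡ q ℕ.* (p ℕ.* m″)
    e = trans (sym (ℕₚ.*-assoc p m″ q)) (ℕₚ.*-comm (p ℕ.* m″) q)

  ∑-pickℚ : ∀ M x (f : ℕ → ℚ) → x ℕ.< M → ∑ M (λ j → f j * 𝟙 (x ℕₚ.≟ j)) ≡ f x
  ∑-none : ∀ M x (f : ℕ → ℚ) → M ℕ.≤ x → ∑ M (λ j → f j * 𝟙 (x ℕₚ.≟ j)) ≡ 0ℚ
  ∑-none M x f M≤x = trans (∑-cong M (λ j j< → trans (cong (f j *_) (𝟙-no (x ℕₚ.≟ j) (λ e → ℕₚ.<⇒≱ j< (subst (M ℕ.≤_) e M≤x)))) (*-zeroʳ (f j)))) (∑-zero M)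
  ∑-pickℚ (suc M) x f x< with x ℕₚ.≟ M
  ... | yes refl = trans (cong₂ _+_ (∑-none M M f ℕₚ.≤-refl) (*-identityʳ (f M))) (+-identityˡ (f M))
  ... | no x≢M = trans (cong₂ _+_ (∑-pickℚ M x f (ℕₚ.≤∧≢⇒< (ℕₚ.≤-pred x<) x≢M)) (*-zeroʳ (f M))) (+-identityʳ (f x))

  module Concrete (B T′ : ℕ) (T′-big : suc B ℕ.* 2 ℕ.^ B ℕ.≤ T′) where

    N = 2 ℕ.^ B
    T = suc T′

    wt : ∀ p → Dec (Prime p) → ℕ
    wt p (yes pp) = proj₁ (lg (p ℕ.^ T) (ℕₚ.m^n>0 p {{prime⇒nonZero pp}} T))
    wt p (no _)   = 0

    w : ℕ → ℕ
    w p = wt p (prime? p)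

    -- Rounding down loses a factor less than 2 ≤ p, paid by the one factor p that separates p^T
    -- from p^T′.
    w-lo : ∀ p → Prime p → p ℕ.^ T′ ℕ.≤ 2 ℕ.^ w p
    w-lo p pp with prime? p
    ... | no ¬p = contradiction pp ¬p
    ... | yes pr with lg (p ℕ.^ T) (ℕₚ.m^n>0 p {{prime⇒nonZero pr}} T)
    ...   | c , lo , hi = ℕₚ.*-cancelˡ-≤ p {{prime⇒nonZero pp}} (ℕₚ.≤-trans (ℕₚ.<⇒≤ hi) (ℕₚ.*-monoˡ-≤ (2 ℕ.^ c) (prime≥2 pp)))

    w-hi : ∀ p → Prime p → 2 ℕ.^ w p ℕ.≤ p ℕ.^ T
    w-hi p pp with prime? p
    ... | no ¬p = contradiction pp ¬p
    ... | yes pr with lg (p ℕ.^ T) (ℕₚ.m^n>0 p {{prime⇒nonZero pr}} T)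
    ...   | c , lo , hi = lo

    w-no : ∀ p → ¬ Prime p → w p ≡ 0
    w-no p ¬p with prime? p
    ... | yes pp = contradiction pp ¬p
    ... | no _ = refl

    -- The p-adic valuation for 1 ≤ m ≤ 2^B: no higher exponent than B can occur there.
    v : ℕ → ℕ → ℕ
    v p m = ∑ₙ B (λ i → bit (p ℕ.^ suc i ∣? m))

    D : ℕ → ℕ
    D m = ∑ₙ (suc N) (λ p → w p ℕ.* v p m)

    v-other : ∀ {p q} m → Prime q → ¬ q ∣ p → v q (p ℕ.* m) ≡ v q m
    v-other {p} {q} m pq q∤p = ∑ₙ-cong B (λ i _ → bit-cong (q ℕ.^ suc i ∣? p ℕ.* m) (q ℕ.^ suc i ∣? m)
      (prime-power-cancel pq q∤p (suc i) m) (∣n⇒∣m*n p))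

    -- Lowering all exponents by one brings in p^0, which divides m, and loses p^B, which exceeds m.
    v-same : ∀ {p} m → Prime p → 1 ℕ.≤ m → p ℕ.* m ℕ.≤ N → v p (p ℕ.* m) ≡ suc (v p m)
    v-same {p} m pp 1≤m pm≤N = trans (∑ₙ-cong B (λ i _ → bit-cong (p ℕ.^ suc i ∣? p ℕ.* m) (p ℕ.^ i ∣? m)
        (*-cancelˡ-∣ p {{prime⇒nonZero pp}}) (*-monoʳ-∣ p)))
      (trans (sym (ℕₚ.+-identityʳ _)) (trans (cong (∑ₙ B g ℕ.+_) (sym (bit-no (p ℕ.^ B ∣? m) p^B∤m)))
        (trans (∑ₙ-shift B g) (cong (ℕ._+ v p m) (bit-yes (1 ∣? m) (1∣ m))))))
      where
      g : ℕ → ℕ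
      g i = bit (p ℕ.^ i ∣? m)
      m<N : m ℕ.< N
      m<N = ℕₚ.≤-trans (ℕₚ.+-monoˡ-≤ m 1≤m) (ℕₚ.≤-trans (ℕₚ.≤-reflexive (cong (m ℕ.+_) (sym (ℕₚ.+-identityʳ m)))) (ℕₚ.≤-trans (ℕₚ.*-monoˡ-≤ m (prime≥2 pp)) pm≤N))
      p^B∤m : ¬ p ℕ.^ B ∣ m
      p^B∤m h = ℕₚ.<⇒≱ (ℕₚ.<-≤-trans m<N (ℕₚ.^-monoˡ-≤ B (prime≥2 pp))) (∣⇒≤ {{ℕ.>-nonZero 1≤m}} h)

    D-cons : ∀ p m → Prime p → 1 ℕ.≤ m → p ℕ.* m ℕ.≤ N → D (p ℕ.* m) ≡ D m ℕ.+ w p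
    D-cons p m pp 1≤m pm≤N = trans (∑ₙ-cong (suc N) (λ q _ → pt q))
      (trans (∑ₙ-+ (suc N) (λ q → w q ℕ.* v q m) (λ q → bit (q ℕₚ.≟ p) ℕ.* w p)) (cong (D m ℕ.+_) (∑ₙ-pick (suc N) p (w p) (s≤s p≤N))))
      where
      p≤N : p ℕ.≤ N
      p≤N = ℕₚ.≤-trans (ℕₚ.m≤m*n p m {{ℕ.>-nonZero 1≤m}}) pm≤N
      pt : ∀ q → w q ℕ.* v q (p ℕ.* m) ≡ w q ℕ.* v q m ℕ.+ bit (q ℕₚ.≟ p) ℕ.* w p
      pt q with q ℕₚ.≟ p
      ... | yes refl = trans (cong (w p ℕ.*_) (v-same m pp 1≤m pm≤N)) (trans (ℕₚ.*-suc (w p) (v p m)) (trans (ℕₚ.+-comm (w p) _) (cong (w p ℕ.* v p m ℕ.+_) (sym (ℕₚ.+-identityʳ (w p))))))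
      ... | no q≢p = trans (rest (prime? q)) (sym (ℕₚ.+-identityʳ _))
        where
        rest : Dec (Prime q) → w q ℕ.* v q (p ℕ.* m) ≡ w q ℕ.* v q m
        rest (yes pq) = cong (w q ℕ.*_) (v-other m pq (λ q∣p → q≢p (prime-∣-prime pq pp q∣p)))
        rest (no ¬pq) = trans (cong (ℕ._* v q (p ℕ.* m)) (w-no q ¬pq)) (cong (ℕ._* v q m) (sym (w-no q ¬pq)))

    D-1 : D 1 ≡ 0
    D-1 = trans (∑ₙ-cong (suc N) (λ p _ → pt p (prime? p))) (∑ₙ-zero (suc N))
      where
      pt : ∀ p → Dec (Prime p) → w p ℕ.* v p 1 ≡ 0
      pt p (no ¬p) = cong (ℕ._* v p 1) (w-no p ¬p)
      pt p (yes pp) = trans (cong (w p ℕ.*_) (trans (∑ₙ-cong B (λ i _ → bit-no (p ℕ.^ suc i ∣? 1) (λ h →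
        ℕₚ.<⇒≱ (prime≥2 pp) (∣⇒≤ (∣-trans (m∣m*n (p ℕ.^ i)) h))))) (∑ₙ-zero B))) (ℕₚ.*-zeroʳ (w p))

    product≥1 : ∀ ps → All Prime ps → 1 ℕ.≤ product ps
    product≥1 [] [] = ℕₚ.≤-refl
    product≥1 (p ∷ ps) (pp ∷ pps) = ℕₚ.*-mono-≤ (ℕₚ.<⇒≤ (prime≥2 pp)) (product≥1 ps pps)

    D-bounds : ∀ ps → All Prime ps → product ps ℕ.≤ N →
      product ps ℕ.^ T′ ℕ.≤ 2 ℕ.^ D (product ps) × 2 ℕ.^ D (product ps) ℕ.≤ product ps ℕ.^ T
    D-bounds [] [] _ = subst (λ z → 1 ℕ.^ T′ ℕ.≤ 2 ℕ.^ z × 2 ℕ.^ z ℕ.≤ 1 ℕ.^ T) (sym D-1)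
      (ℕₚ.≤-reflexive (ℕₚ.^-zeroˡ T′) , ℕₚ.≤-reflexive (sym (ℕₚ.^-zeroˡ T)))
    D-bounds (p ∷ ps) (pp ∷ pps) h with D-bounds ps pps (ℕₚ.≤-trans (ℕₚ.m≤n*m (product ps) p {{prime⇒nonZero pp}}) h)
    ... | lo , hi rewrite D-cons p (product ps) pp (product≥1 ps pps) h | ℕₚ.^-distribˡ-+-* 2 (D (product ps)) (w p)
        | ℕₚ.*-comm (2 ℕ.^ D (product ps)) (2 ℕ.^ w p) =
        subst (ℕ._≤ 2 ℕ.^ w p ℕ.* 2 ℕ.^ D (product ps)) (sym (^-distribʳ-* T′ p (product ps))) (ℕₚ.*-mono-≤ (w-lo p pp) lo)
      , subst (2 ℕ.^ w p ℕ.* 2 ℕ.^ D (product ps) ℕ.≤_) (sym (^-distribʳ-* T p (product ps))) (ℕₚ.*-mono-≤ (w-hi p pp) hi)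

    D-bounds′ : ∀ m → 1 ℕ.≤ m → m ℕ.≤ N → m ℕ.^ T′ ℕ.≤ 2 ℕ.^ D m × 2 ℕ.^ D m ℕ.≤ m ℕ.^ T
    D-bounds′ m 1≤m m≤N = subst (λ z → z ℕ.^ T′ ℕ.≤ 2 ℕ.^ D z × 2 ℕ.^ D z ℕ.≤ z ℕ.^ T) (sym e)
      (D-bounds (F.factors) F.factorsPrime (subst (ℕ._≤ N) e m≤N))
      where
      instance _ = ℕ.>-nonZero 1≤m
      module F = PrimeFactorisation (factorise m)
      e = F.isFactorisation

    Λ : ℕ → ℚ
    Λ q = ∑ (suc N) (λ p → ∑ B (λ i → ι (w p) * 𝟙 (p ℕ.^ suc i ℕₚ.≟ q)))

    Λ-term≥0 : ∀ q p i → 0ℚ ≤ ι (w p) * 𝟙 (p ℕ.^ suc i ℕₚ.≟ q)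
    Λ-term≥0 q p i = *-nonNeg (ι-≥0 (w p)) (𝟙-≥0 (p ℕ.^ suc i ℕₚ.≟ q))

    Λ≥0 : ∀ q → 0ℚ ≤ Λ q
    Λ≥0 q = ∑-nonNeg (suc N) (λ p _ → ∑-nonNeg B (λ i _ → Λ-term≥0 q p i))

    pick-div : ∀ m M x → 1 ℕ.≤ m → m ℕ.≤ M → ∑ M (λ j → 𝟙 (suc j ∣? m) * 𝟙 (x ℕₚ.≟ suc j)) ≡ 𝟙 (x ∣? m)
    -- The sums over p include p = 0, whose powers give x = 0.
    pick-div m M zero 1≤m m≤M = trans (∑-cong M (λ j _ → trans (cong (𝟙 (suc j ∣? m) *_) (𝟙-no (0 ℕₚ.≟ suc j) (λ ()))) (*-zeroʳ (𝟙 (suc j ∣? m)))))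
      (trans (∑-zero M) (sym (𝟙-no (0 ∣? m) (λ h → ℕₚ.<⇒≢ 1≤m (sym (0∣⇒≡0 h))))))
    pick-div m M (suc x) 1≤m m≤M = trans (∑-cong M (λ j _ → cong (𝟙 (suc j ∣? m) *_) (same (x ℕₚ.≟ j) (suc x ℕₚ.≟ suc j)))) (go (x ℕₚ.<? M))
      where
      same : ∀ {j} (d : Dec (x ≡ j)) (e : Dec (suc x ≡ suc j)) → 𝟙 e ≡ 𝟙 d
      same (yes p) e = 𝟙-yes e (cong suc p)
      same (no ¬p) e = 𝟙-no e (λ q → ¬p (ℕₚ.suc-injective q))
      go : Dec (x ℕ.< M) → ∑ M (λ j → 𝟙 (suc j ∣? m) * 𝟙 (x ℕₚ.≟ j)) ≡ 𝟙 (suc x ∣? m)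
      go (yes x<M) = ∑-pickℚ M x (λ j → 𝟙 (suc j ∣? m)) x<M
      go (no x≮M) = trans (∑-none M x (λ j → 𝟙 (suc j ∣? m)) (ℕₚ.≮⇒≥ x≮M))
        (sym (𝟙-no (suc x ∣? m) (λ h → x≮M (ℕₚ.≤-trans (∣⇒≤ {{ℕ.>-nonZero 1≤m}} h) m≤M))))

    D-sum : ∀ m M → 1 ℕ.≤ m → m ℕ.≤ M → M ℕ.≤ N → ∑ M (λ j → 𝟙 (suc j ∣? m) * Λ (suc j)) ≡ ι (D m)
    D-sum m M 1≤m m≤M _ = begin
      ∑ M (λ j → 𝟙 (suc j ∣? m) * Λ (suc j))
        ≡⟨ ∑-cong M (λ j _ → trans (sym (∑-*ˡ (suc N) (𝟙 (suc j ∣? m)) (λ p → ∑ B (λ i → ι (w p) * 𝟙 (p ℕ.^ suc i ℕₚ.≟ suc j)))))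
             (∑-cong (suc N) (λ p _ → sym (∑-*ˡ B (𝟙 (suc j ∣? m)) (λ i → ι (w p) * 𝟙 (p ℕ.^ suc i ℕₚ.≟ suc j)))))) ⟩
      ∑ M (λ j → ∑ (suc N) (λ p → ∑ B (λ i → t j p i)))
        ≡⟨ ∑-swap M (suc N) (λ j p → ∑ B (λ i → t j p i)) ⟩
      ∑ (suc N) (λ p → ∑ M (λ j → ∑ B (λ i → t j p i)))
        ≡⟨ ∑-cong (suc N) (λ p _ → trans (∑-swap M B (λ j i → t j p i)) (inner p)) ⟩
      ∑ (suc N) (λ p → ι (w p ℕ.* v p m))
        ≡⟨ sym (ι-∑ₙ (suc N) (λ p → w p ℕ.* v p m)) ⟩
      ι (D m) ∎
      where
      open ≡-Reasoning
      t : ℕ → ℕ → ℕ → ℚ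
      t j p i = 𝟙 (suc j ∣? m) * (ι (w p) * 𝟙 (p ℕ.^ suc i ℕₚ.≟ suc j))
      lem : ∀ a b c → a * (b * c) ≡ b * (a * c)
      lem = solve-∀ ℚ-ring
      inner : ∀ p → ∑ B (λ i → ∑ M (λ j → t j p i)) ≡ ι (w p ℕ.* v p m)
      inner p = begin
        ∑ B (λ i → ∑ M (λ j → t j p i))
          ≡⟨ ∑-cong B (λ i _ → trans (∑-cong M (λ j _ → lem (𝟙 (suc j ∣? m)) (ι (w p)) (𝟙 (p ℕ.^ suc i ℕₚ.≟ suc j))))
               (trans (∑-*ˡ M (ι (w p)) (λ j → 𝟙 (suc j ∣? m) * 𝟙 (p ℕ.^ suc i ℕₚ.≟ suc j))) (cong (ι (w p) *_) (pick-div m M (p ℕ.^ suc i) 1≤m m≤M)))) ⟩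
        ∑ B (λ i → ι (w p) * 𝟙 (p ℕ.^ suc i ∣? m))
          ≡⟨ ∑-*ˡ B (ι (w p)) (λ i → 𝟙 (p ℕ.^ suc i ∣? m)) ⟩
        ι (w p) * ∑ B (λ i → 𝟙 (p ℕ.^ suc i ∣? m))
          ≡⟨ cong (ι (w p) *_) (sym (trans (ι-∑ₙ B (λ i → bit (p ℕ.^ suc i ∣? m))) (∑-cong B (λ i _ → ι-bit (p ℕ.^ suc i ∣? m))))) ⟩
        ι (w p) * ι (v p m)
          ≡⟨ sym (ι-* (w p) (v p m)) ⟩
        ι (w p ℕ.* v p m) ∎

    term≤∑ : ∀ n (f : ℕ → ℚ) x → x ℕ.< n → (∀ i → 0ℚ ≤ f i) → f x ≤ ∑ n f
    term≤∑ n f x x<n f≥0 = ≤-trans (≤-by (∑ x f) (∑-nonNeg x (λ i _ → f≥0 i)) (+-comm (∑ x f) (f x))) (∑-extend f x<n f≥0)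

    Λ-prime : ∀ p → Prime p → p ℕ.≤ N → 1 ℕ.≤ B → ι (w p) ≤ Λ p
    Λ-prime p pp p≤N 1≤B = ≤-trans (≤-reflexive (sym (trans (cong (ι (w p) *_) (𝟙-yes (p ℕ.^ 1 ℕₚ.≟ p) (ℕₚ.*-identityʳ p))) (*-identityʳ (ι (w p))))))
      (≤-trans (term≤∑ B (λ i → ι (w p) * 𝟙 (p ℕ.^ suc i ℕₚ.≟ p)) 0 1≤B (λ i → Λ-term≥0 p p i))
        (term≤∑ (suc N) (λ p′ → ∑ B (λ i → ι (w p′) * 𝟙 (p′ ℕ.^ suc i ℕₚ.≟ p))) p (s≤s p≤N) (λ p′ → ∑-nonNeg B (λ i _ → Λ-term≥0 p p′ i))))

    open Mertens B T′ Λ Λ≥0 D D-sum (λ m p q → proj₁ (D-bounds′ m p q)) (λ m p q → proj₂ (D-bounds′ m p q)) T′-big public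
      using (block-bound; 111ℚ; 1≤τ; τ)

    -- On a prime q ≡ 3 (mod 4) the factor 1 - χ is 2 and the weight is at least T′ A; elsewhere
    -- nonnegativity of the right side suffices.
    Λ-P3 : ∀ A q → 1 ℕ.≤ B → 2 ℕ.^ A ℕ.≤ q → q ℕ.≤ N → (1ℚ + 1ℚ) * τ * ι A * π3 q ≤ (1ℚ - χ q) * (Λ q * inv q)
    Λ-P3 A q 1≤B lo q≤N with P3? q
    ... | no _ = ≤-trans (≤-reflexive (trans (cong ((1ℚ + 1ℚ) * τ * ι A *_) (*-zeroˡ (inv q))) (*-zeroʳ ((1ℚ + 1ℚ) * τ * ι A))))
          (*-nonNeg (diff≥0 (proj₂ (χ-bounds q))) (*-nonNeg (Λ≥0 q) (inv-≥0 q)))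
    ... | yes (pq , q3) = ≤-trans (≤-reflexive (lem₁ τ (ι A) (inv q)))
          (≤-trans (*-monoʳ {1ℚ - - 1ℚ} (Data.Rational.Properties.≤ᵇ⇒≤ _) (*-monoˡ (inv-≥0 q) bd))
            (≤-reflexive (cong (λ z → (1ℚ - z) * (Λ q * inv q)) (sym (χ-3 q q3)))))
      where
      lem₁ : ∀ t a i → (1ℚ + 1ℚ) * t * a * (1ℚ * i) ≡ (1ℚ - - 1ℚ) * (t * a * i)
      lem₁ = solve-∀ ℚ-ring
      bd : τ * ι A ≤ Λ q
      bd = ≤-trans (≤-reflexive (sym (ι-* T′ A))) (≤-trans (ι-mono (2^-cancel-≤ (ℕₚ.≤-trans
        (ℕₚ.≤-reflexive (trans (cong (2 ℕ.^_) (ℕₚ.*-comm T′ A)) (sym (ℕₚ.^-*-assoc 2 A T′))))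
        (ℕₚ.≤-trans (ℕₚ.^-monoˡ-≤ T′ lo) (w-lo q pq))))) (Λ-prime q pq q≤N 1≤B))

    P3-sum′ : ∀ A → A ℕ.≤ B → 1 ℕ.≤ B → (1ℚ + 1ℚ) * ι A * ∑ (N ℕ.∸ 2 ℕ.^ A) (λ i → π3 (suc (2 ℕ.^ A ℕ.+ i))) ≤ ι B - ι A + 111ℚ
    P3-sum′ A A≤B 1≤B = *-cancelˡ {τ} (<-≤-trans 0<1 1≤τ) (begin
      τ * ((1ℚ + 1ℚ) * ι A * ∑ K g)                ≡⟨ lem τ (ι A) (∑ K g) ⟩
      (1ℚ + 1ℚ) * τ * ι A * ∑ K g                  ≡⟨ sym (∑-*ˡ K ((1ℚ + 1ℚ) * τ * ι A) g) ⟩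
      ∑ K (λ i → (1ℚ + 1ℚ) * τ * ι A * g i)        ≤⟨ ∑-mono K (λ i i< → Λ-P3 A (suc (2 ℕ.^ A ℕ.+ i)) 1≤B (ℕₚ.m≤n⇒m≤1+n (ℕₚ.m≤m+n (2 ℕ.^ A) i))
           (subst (suc (2 ℕ.^ A ℕ.+ i) ℕ.≤_) (ℕₚ.m+[n∸m]≡n (ℕₚ.^-monoʳ-≤ 2 A≤B)) (ℕₚ.+-monoʳ-< (2 ℕ.^ A) i<))) ⟩
      ∑ K (λ i → (1ℚ - χ (suc (2 ℕ.^ A ℕ.+ i))) * (Λ (suc (2 ℕ.^ A ℕ.+ i)) * inv (suc (2 ℕ.^ A ℕ.+ i)))) ≤⟨ block-bound A A≤B ⟩
      τ * (ι B - ι A + 111ℚ)                       ∎)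
      where
      open ≤-Reasoning
      K = N ℕ.∸ 2 ℕ.^ A
      g : ℕ → ℚ
      g i = π3 (suc (2 ℕ.^ A ℕ.+ i))
      lem : ∀ t a s → t * ((1ℚ + 1ℚ) * a * s) ≡ (1ℚ + 1ℚ) * t * a * s
      lem = solve-∀ ℚ-ring

  -- The scale has cancelled. The bound (B - A + 111)/(2A) is close to the truth when B - A is large
  -- against 111 and small against A, so longer ranges are cut into such pieces.
  P3-sum : ∀ A B → A ℕ.≤ B →
    (1ℚ + 1ℚ) * ι A * ∑ (2 ℕ.^ B ℕ.∸ 2 ℕ.^ A) (λ i → π3 (suc (2 ℕ.^ A ℕ.+ i))) ≤ ι (B ℕ.∸ A ℕ.+ 111)
  P3-sum A zero z≤n = ≤-trans (≤-reflexive (*-zeroʳ ((1ℚ + 1ℚ) * ι 0))) (ι-≥0 111)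
  P3-sum A B@(suc _) A≤B = ≤-trans (C.P3-sum′ A A≤B (s≤s z≤n)) (≤-reflexive (trans (cong₂ _+_ (sym e) (sym (ι-def 111))) (sym (ι-+ (B ℕ.∸ A) 111))))
    where
    module C = Concrete B (suc B ℕ.* 2 ℕ.^ B) ℕₚ.≤-refl
    lem : ∀ a b → a ≡ (a + b) - b
    lem = solve-∀ ℚ-ring
    e : ι (B ℕ.∸ A) ≡ ι B - ι A
    e = trans (lem (ι (B ℕ.∸ A)) (ι A)) (cong (_- ι A) (trans (sym (ι-+ (B ℕ.∸ A) A)) (cong ι (ℕₚ.m∸n+n≡m A≤B))))

-- Sums of two squares

module TwoSquares where

  open import Data.Nat.Base
  open import Data.Nat.Properties
  open import Data.Nat.Divisibility
  open import Data.Nat.DivMod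
  open import Data.Nat.Primality
  open import Data.Nat.Primality.Factorisation using (factorise)
  open import Data.Nat.ListAction using (product)
  open import Data.Nat.Tactic.RingSolver using (solve-∀)
  import Data.Integer.Base as ℤ
  import Data.Integer.Properties as ℤₚ
  import Data.Integer.Tactic.RingSolver as ℤ-Solver
  open import Data.List.Base using (List; []; _∷_; _++_; length; filter; upTo; cartesianProduct)
  open import Data.List.Membership.Propositional using (_∈_; lose)
  open import Data.List.Membership.Propositional.Properties
  open import Data.List.Relation.Unary.All as All using (All; []; _∷_)
  import Data.List.Relation.Unary.All.Properties as Allₚ
  open import Data.List.Relation.Unary.Any using (Any; any?; here; there)
  open import Data.List.Relation.Unary.AllPairs using ([]; _∷_)
  open import Data.List.Relation.Unary.Unique.Propositional using (Unique)
  import Data.List.Relation.Unary.Unique.Propositional.Properties as Uₚ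
  open import Data.Product.Base using (_×_; _,_; proj₁; proj₂; ∃-syntax)
  open import Data.Sum.Base using (_⊎_; inj₁; inj₂)
  open import Data.Empty using (⊥; ⊥-elim)
  open import Relation.Nullary using (Dec; yes; no; ¬_; contradiction)
  open import Relation.Binary.Definitions using (tri<; tri≈; tri>)
  open import Relation.Binary.PropositionalEquality
  open MertensModFour using (P3; prime≥2)

  Even : ℕ → Set
  Even n = ∃[ k ] n ≡ k + k

  ¬even-suc : ∀ {n} → Even n → ¬ Even (suc n)
  ¬even-suc {n} (j , e) (k , e′) = go j k (trans (cong suc (sym e)) e′)
    where
    go : ∀ j k → suc (j + j) ≢ k + k
    go zero (suc k) h = 0≢1+n (trans (suc-injective h) (+-suc k k))
    go (suc j) (suc k) h = go j k (suc-injective (trans (sym (cong suc (+-suc j j))) (trans (suc-injective h) (+-suc k k))))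

  module Involution {A : Set} (f : A → A) where

    unique-insert : ∀ (us : List A) {v vs} → Unique (us ++ v ∷ vs) → ¬ v ∈ us ++ vs × Unique (us ++ vs)
    unique-insert [] (v∉ ∷ u) = (λ h → All.lookup v∉ h refl) , u
    unique-insert (w ∷ us) {v} {vs} (w∉ ∷ u) with unique-insert us u
    ... | v∉′ , u′ = (λ { (here e) → All.lookup w∉ (∈-++⁺ʳ us (here refl)) (sym e) ; (there h) → v∉′ h })
                   , Allₚ.++⁺ (Allₚ.++⁻ˡ us w∉) (All.tail (Allₚ.++⁻ʳ us w∉)) ∷ u′

    ∈-drop : ∀ (us : List A) {v vs x} → x ≢ v → x ∈ us ++ v ∷ vs → x ∈ us ++ vs
    ∈-drop us x≢v h with ∈-++⁻ us h
    ... | inj₁ p = ∈-++⁺ˡ p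
    ... | inj₂ (here e) = contradiction e x≢v
    ... | inj₂ (there p) = ∈-++⁺ʳ us p

    ∈-add : ∀ (us : List A) {v vs x} → x ∈ us ++ vs → x ∈ us ++ v ∷ vs
    ∈-add us h with ∈-++⁻ us h
    ... | inj₁ p = ∈-++⁺ˡ p
    ... | inj₂ p = ∈-++⁺ʳ us (there p)

    length-insert : ∀ (us : List A) {v vs} → length (us ++ v ∷ vs) ≡ suc (length (us ++ vs))
    length-insert [] = refl
    length-insert (_ ∷ us) = cong suc (length-insert us)

    -- Deleting x together with f x leaves a shorter list on which f is still a fixed-point-free
    -- involution.
    even : ∀ n xs → length xs ≡ n → Unique xs → (∀ {x} → x ∈ xs → f x ∈ xs) → (∀ {x} → x ∈ xs → f (f x) ≡ x) →
      (∀ {x} → x ∈ xs → f x ≢ x) → Even n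
    even zero xs e u cl inv nf = 0 , refl
    even (suc n) (x ∷ xs) e (x∉ ∷ u) cl inv nf with cl (here refl)
    ... | here fx≡x = contradiction fx≡x (nf (here refl))
    ... | there fx∈ with ∈-∃++ fx∈
    ...   | us , vs , refl = done n (suc-injective e)
      where
      fx∉ = proj₁ (unique-insert us u)
      done : ∀ n → length (us ++ f x ∷ vs) ≡ n → Even (suc n)
      done zero e′ = contradiction (trans (sym (length-insert us {f x} {vs})) e′) λ ()
      done (suc n) e′ with even n (us ++ vs) (suc-injective (trans (sym (length-insert us {f x} {vs})) e′)) (proj₂ (unique-insert us u))
        (λ {y} y∈ → closed y∈ (cl (there (∈-add us y∈)))) (λ y∈ → inv (there (∈-add us y∈))) (λ y∈ → nf (there (∈-add us y∈)))
        where
        closed : ∀ {y} → y ∈ us ++ vs → f y ∈ x ∷ us ++ f x ∷ vs → f y ∈ us ++ vs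
        closed {y} y∈ (here fy≡x) = contradiction (subst (_∈ us ++ vs) (trans (sym (inv (there (∈-add us y∈)))) (cong f fy≡x)) y∈) fx∉
        closed {y} y∈ (there fy∈) = ∈-drop us (λ fy≡fx → All.lookup x∉ (∈-add us y∈)
          (trans (sym (inv (here refl))) (trans (cong f (sym fy≡fx)) (inv (there (∈-add us y∈)))))) fy∈
      ... | k , refl = suc k , cong suc (sym (+-suc k k))

  cases4 : ∀ n → n % 4 ≡ 0 ⊎ n % 4 ≡ 1 ⊎ n % 4 ≡ 2 ⊎ n % 4 ≡ 3
  cases4 n with n % 4 | m%n<n n 4
  ... | 0 | _ = inj₁ refl
  ... | 1 | _ = inj₂ (inj₁ refl)
  ... | 2 | _ = inj₂ (inj₂ (inj₁ refl))
  ... | 3 | _ = inj₂ (inj₂ (inj₂ refl))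
  ... | suc (suc (suc (suc _))) | s≤s (s≤s (s≤s (s≤s ())))

  prime≢square : ∀ {p} x → Prime p → x * x ≢ p
  prime≢square x pp refl with prime⇒irreducible pp (m∣m*n {x} x)
  ... | inj₁ refl = contradiction (prime≥2 pp) (<⇒≱ (s≤s (s≤s z≤n)))
  ... | inj₂ e = contradiction (*-cancelˡ-≡ 1 x x {{nz}} (trans (*-identityʳ x) e)) λ { refl → contradiction (prime≥2 pp) (<⇒≱ (s≤s (s≤s z≤n))) }
    where nz = ≢-nonZero {x} (λ { refl → contradiction (prime≥2 pp) (<⇒≱ (s≤s z≤n)) })

  -- Zagier's involution on the solutions of x² + 4yz = p.
  module Zagier (p k : ℕ) (pp : Prime p) (p≡ : p ≡ 1 + 4 * k) where

    Triple = ℕ × ℕ × ℕ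

    Sol : Triple → Set
    Sol (x , y , z) = x * x + 4 * (y * z) ≡ p

    x≢0 : ∀ {x y z} → Sol (x , y , z) → 1 ≤ x
    x≢0 {zero} {y} {z} s = contradiction (trans (sym p≡) (sym s)) (go k (y * z))
      where
      go : ∀ a b → 1 + 4 * a ≢ 4 * b
      go a b h = 1+n≢0 {0} (trans (sym (trans (cong (_% 4) (cong (1 +_) (*-comm 4 a))) ([m+kn]%n≡m%n 1 a 4))) (trans (cong (_% 4) h) (m*n%m≡0 b)))
        where
        m*n%m≡0 : ∀ b → (4 * b) % 4 ≡ 0
        m*n%m≡0 b = trans (cong (_% 4) (*-comm 4 b)) (m*n%n≡0 b 4)
    x≢0 {suc x} s = s≤s z≤n

    y≢0 : ∀ {x y z} → Sol (x , y , z) → 1 ≤ y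
    y≢0 {x} {zero} s = contradiction (trans (sym (+-identityʳ (x * x))) s) (prime≢square x pp)
    y≢0 {y = suc y} s = s≤s z≤n

    z≢0 : ∀ {x y z} → Sol (x , y , z) → 1 ≤ z
    z≢0 {x} {y} {zero} s = contradiction (trans (sym (trans (cong (λ t → x * x + 4 * t) (*-zeroʳ y)) (+-identityʳ (x * x)))) s) (prime≢square x pp)
    z≢0 {z = suc z} s = s≤s z≤n

    -- The boundaries may go to the `no` branches: x + z = y would make p the square of x + 2z, and
    -- x = 2y would make it divisible by 4.
    step : ∀ (t : Triple) → let (x , y , z) = t in Dec (x + z < y) → Dec (x < 2 * y) → Triple
    step (x , y , z) (yes _) _       = x + 2 * z , z , y ∸ (x + z)
    step (x , y , z) (no _)  (yes _) = 2 * y ∸ x , y , (x + z) ∸ y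
    step (x , y , z) (no _)  (no _)  = x ∸ 2 * y , (x + z) ∸ y , y

    f : Triple → Triple
    f t@(x , y , z) = step t (x + z <? y) (x <? 2 * y)

    f₁ : ∀ {x y z} → x + z < y → f (x , y , z) ≡ (x + 2 * z , z , y ∸ (x + z))
    f₁ {x} {y} {z} h with x + z <? y
    ... | yes _ = refl
    ... | no ¬h = contradiction h ¬h

    f₂ : ∀ {x y z} → ¬ x + z < y → x < 2 * y → f (x , y , z) ≡ (2 * y ∸ x , y , (x + z) ∸ y)
    f₂ {x} {y} {z} h g with x + z <? y | x <? 2 * y
    ... | yes h′ | _ = contradiction h′ h
    ... | no _ | yes _ = refl
    ... | no _ | no ¬g = contradiction g ¬g

    f₃ : ∀ {x y z} → ¬ x + z < y → ¬ x < 2 * y → f (x , y , z) ≡ (x ∸ 2 * y , (x + z) ∸ y , y)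
    f₃ {x} {y} {z} h g with x + z <? y | x <? 2 * y
    ... | yes h′ | _ = contradiction h′ h
    ... | no _ | yes g′ = contradiction g′ g
    ... | no _ | no _ = refl

    -- Differences are named rather than subtracted, so that the identities to come are polynomial
    -- and within reach of the ring solver.
    data Cases : Triple → Set where
      c₁ : ∀ x z w → 1 ≤ w → Cases (x , x + z + w , z)
      c₂ : ∀ x y z w v → x + z ≡ y + w → 1 ≤ w → 2 * y ≡ x + v → 1 ≤ v → Cases (x , y , z)
      c₃ : ∀ u y z → 1 ≤ u → Cases (2 * y + u , y , z)

    pos-diff : ∀ {a b} → a < b → ∃[ d ] (1 ≤ d × b ≡ a + d)
    pos-diff {a} {b} h = b ∸ a , m<n⇒0<n∸m h , sym (m+[n∸m]≡n (<⇒≤ h))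

    cases : ∀ t → Sol t → Cases t
    cases (x , y , z) s with <-cmp (x + z) y
    ... | tri< lt _ _ with pos-diff lt
    ...   | w , 1≤w , refl = c₁ x z w 1≤w
    cases (x , y , z) s | tri≈ _ refl _ = contradiction (trans (lem x z) s) (prime≢square (x + 2 * z) pp)
      where
      lem : ∀ x z → (x + 2 * z) * (x + 2 * z) ≡ x * x + 4 * ((x + z) * z)
      lem = solve-∀
    cases (x , y , z) s | tri> _ _ gt with <-cmp x (2 * y) | pos-diff gt
    ... | tri< lt _ _ | w , 1≤w , e with pos-diff lt
    ...   | v , 1≤v , e′ = c₂ x y z w v e 1≤w e′ 1≤v
    cases (x , y , z) s | tri> _ _ gt | tri≈ _ refl _ | _ = contradiction (trans (trans (sym p≡) (sym s)) (lem y z)) (go k (y * y + y * z))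
      where
      lem : ∀ y z → 2 * y * (2 * y) + 4 * (y * z) ≡ 4 * (y * y + y * z)
      lem = solve-∀
      go : ∀ a b → 1 + 4 * a ≢ 4 * b
      go a b h = 1+n≢0 {0} (trans (sym (trans (cong (_% 4) (cong (1 +_) (*-comm 4 a))) ([m+kn]%n≡m%n 1 a 4)))
        (trans (cong (_% 4) (trans h (*-comm 4 b))) (m*n%n≡0 b 4)))
    cases (x , y , z) s | tri> _ _ gt | tri> _ _ lt | _ with pos-diff lt
    ... | u , 1≤u , refl = c₃ u y z 1≤u

    f-c₁ : ∀ x z w → 1 ≤ w → f (x , x + z + w , z) ≡ (x + 2 * z , z , w)
    f-c₁ x z w 1≤w = trans (f₁ (m<m+n (x + z) 1≤w)) (cong (λ t → x + 2 * z , z , t) (m+n∸m≡n (x + z) w))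

    f-c₂ : ∀ x y z w v → x + z ≡ y + w → 1 ≤ w → 2 * y ≡ x + v → 1 ≤ v → f (x , y , z) ≡ (v , y , w)
    f-c₂ x y z w v e 1≤w e′ 1≤v = trans (f₂ (λ h → <⇒≱ h (subst (y ≤_) (sym e) (m≤m+n y w))) (subst (x <_) (sym e′) (m<m+n x 1≤v)))
      (cong₂ (λ s t → s , y , t) (trans (cong (_∸ x) e′) (m+n∸m≡n x v)) (trans (cong (_∸ y) e) (m+n∸m≡n y w)))

    f-c₃ : ∀ u y z → f (2 * y + u , y , z) ≡ (u , u + y + z , y)
    f-c₃ u y z = trans (f₃ (λ h → <⇒≱ h (≤-trans (m≤m+n y (y + (u + z))) (≤-reflexive (lem y u z)))) (λ h → <⇒≱ h (m≤m+n (2 * y) u)))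
      (cong₂ (λ s t → s , t , y) (m+n∸m≡n (2 * y) u) (trans (cong (_∸ y) (lem₂ y u z)) (m+n∸m≡n y (u + y + z))))
      where
      lem : ∀ y u z → y + (y + (u + z)) ≡ 2 * y + u + z
      lem = solve-∀
      lem₂ : ∀ y u z → 2 * y + u + z ≡ y + (u + y + z)
      lem₂ = solve-∀

    f-sol : ∀ t → Sol t → Sol (f t)
    f-sol t s with cases t s
    ... | c₁ x z w 1≤w = subst Sol (sym (f-c₁ x z w 1≤w)) (trans (lem x z w) s)
      where
      lem : ∀ x z w → (x + 2 * z) * (x + 2 * z) + 4 * (z * w) ≡ x * x + 4 * ((x + z + w) * z)
      lem = solve-∀
    ... | c₂ x y z w v e 1≤w e′ 1≤v = subst Sol (sym (f-c₂ x y z w v e 1≤w e′ 1≤v)) (trans key s)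
      where
      key : v * v + 4 * (y * w) ≡ x * x + 4 * (y * z)
      -- Adding 4y² lets the equations x + z = y + w and 2y = x + v be substituted without
      -- subtraction.
      key = +-cancelʳ-≡ (4 * (y * y)) _ _ (begin
        v * v + 4 * (y * w) + 4 * (y * y)     ≡⟨ a1 v y w ⟩
        v * v + 4 * y * (y + w)               ≡⟨ cong (λ t → v * v + 4 * y * t) (sym e) ⟩
        v * v + 4 * y * (x + z)               ≡⟨ a2 v y x z ⟩
        v * v + 2 * (2 * y) * x + 4 * (y * z) ≡⟨ cong (λ t → v * v + 2 * t * x + 4 * (y * z)) e′ ⟩
        v * v + 2 * (x + v) * x + 4 * (y * z) ≡⟨ a3 v x (4 * (y * z)) ⟩
        x * x + 4 * (y * z) + (x + v) * (x + v) ≡⟨ cong (x * x + 4 * (y * z) +_) (trans (cong₂ _*_ (sym e′) (sym e′)) (a4 y)) ⟩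
        x * x + 4 * (y * z) + 4 * (y * y)     ∎)
        where
        open ≡-Reasoning
        a1 : ∀ v y w → v * v + 4 * (y * w) + 4 * (y * y) ≡ v * v + 4 * y * (y + w)
        a1 = solve-∀
        a2 : ∀ v y x z → v * v + 4 * y * (x + z) ≡ v * v + 2 * (2 * y) * x + 4 * (y * z)
        a2 = solve-∀
        a3 : ∀ v x t → v * v + 2 * (x + v) * x + t ≡ x * x + t + (x + v) * (x + v)
        a3 = solve-∀
        a4 : ∀ y → 2 * y * (2 * y) ≡ 4 * (y * y)
        a4 = solve-∀
    ... | c₃ u y z 1≤u = subst Sol (sym (f-c₃ u y z)) (trans (lem u y z) s)
      where
      lem : ∀ u y z → u * u + 4 * ((u + y + z) * y) ≡ (2 * y + u) * (2 * y + u) + 4 * (y * z)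
      lem = solve-∀

    f-inv : ∀ t → Sol t → f (f t) ≡ t
    f-inv t s with cases t s
    ... | c₁ x z w 1≤w = trans (cong f (trans (f-c₁ x z w 1≤w) (cong (λ r → r , z , w) (+-comm x (2 * z)))))
        (f-c₃ x z w)
    ... | c₂ x y z w v e 1≤w e′ 1≤v = trans (cong f (f-c₂ x y z w v e 1≤w e′ 1≤v))
        (f-c₂ v y w z x vw (z≢0 {x} {y} s) (trans e′ (+-comm x v)) (x≢0 {x} {y} s))
      where
      vw : v + w ≡ y + z
      vw = +-cancelˡ-≡ (x + y) _ _ (begin
        x + y + (v + w)     ≡⟨ b1 x y v w ⟩
        (x + v) + (y + w)   ≡⟨ cong₂ _+_ (sym e′) (sym e) ⟩
        2 * y + (x + z)     ≡⟨ b2 x y z ⟩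
        x + y + (y + z)     ∎)
        where
        open ≡-Reasoning
        b1 : ∀ x y v w → x + y + (v + w) ≡ (x + v) + (y + w)
        b1 = solve-∀
        b2 : ∀ x y z → 2 * y + (x + z) ≡ x + y + (y + z)
        b2 = solve-∀
    ... | c₃ u y z 1≤u = trans (cong f (f-c₃ u y z)) (trans (f-c₁ u y z (z≢0 {2 * y + u} {y} s)) (cong (λ r → r , y , z) (+-comm u (2 * y))))

    -- The outer branches change x. In the middle one x = y, and x (x + 4z) = p forces x = 1.
    f-fixed : ∀ t → Sol t → f t ≡ t → t ≡ (1 , 1 , k)
    f-fixed t s h with cases t s
    ... | c₁ x z w 1≤w = ⊥-elim (<⇒≢ (m<m+n x {2 * z} (≤-trans (z≢0 {x} {x + z + w} s) (m≤m+n z (z + 0)))) (sym (cong proj₁ (trans (sym (f-c₁ x z w 1≤w)) h))))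
    ... | c₃ u y z 1≤u = ⊥-elim (<⇒≢ (m<n+m u {2 * y} (≤-trans (y≢0 {2 * y + u} s) (m≤m+n y (y + 0)))) (cong proj₁ (trans (sym (f-c₃ u y z)) h)))
    ... | c₂ x y z w v e 1≤w e′ 1≤v = fin x≡1
      where
      v≡x : v ≡ x
      v≡x = cong proj₁ (trans (sym (f-c₂ x y z w v e 1≤w e′ 1≤v)) h)
      y≡x : y ≡ x
      y≡x = *-cancelˡ-≡ y x 2 (trans e′ (trans (cong (x +_) v≡x) (cong (x +_) (sym (+-identityʳ x)))))
      p′ : x * (x + 4 * z) ≡ p
      p′ = trans (lem x z) (trans (cong (λ r → x * x + 4 * (r * z)) (sym y≡x)) s)
        where
        lem : ∀ x z → x * (x + 4 * z) ≡ x * x + 4 * (x * z)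
        lem = solve-∀
      x≡1 : x ≡ 1
      x≡1 with prime⇒irreducible pp (subst (x ∣_) p′ (m∣m*n (x + 4 * z)))
      ... | inj₁ q = q
      ... | inj₂ q = ⊥-elim (<⇒≢ (≤-trans (s≤s (x≢0 {x} {y} s)) (+-monoʳ-< 0 (m<m+n x {4 * z} (≤-trans (z≢0 {x} {y} s) (m≤m+n z (3 * z))))))
              (sym (*-cancelˡ-≡ (x + 4 * z) 1 x {{>-nonZero (x≢0 {x} {y} s)}} (trans p′ (trans (sym q) (sym (*-identityʳ x)))))))
      fin : x ≡ 1 → (x , y , z) ≡ (1 , 1 , k)
      fin refl with y≡x
      ... | refl = cong (λ r → 1 , 1 , r) (*-cancelˡ-≡ z k 4 (suc-injective (trans (cong suc (cong (4 *_) (sym (+-identityʳ z)))) (trans s p≡))))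

    r₀ = upTo (suc p)
    box = cartesianProduct r₀ (cartesianProduct r₀ r₀)

    sol? : ∀ t → Dec (Sol t)
    sol? (x , y , z) = x * x + 4 * (y * z) ≟ p

    S = filter sol? box

    uS : Unique S
    uS = Uₚ.filter⁺ sol? (Uₚ.cartesianProduct⁺ (Uₚ.upTo⁺ (suc p)) (Uₚ.cartesianProduct⁺ (Uₚ.upTo⁺ (suc p)) (Uₚ.upTo⁺ (suc p))))

    ∈S : ∀ t → Sol t → t ∈ S
    ∈S (x , y , z) s = ∈-filter⁺ sol? (∈-cartesianProduct⁺ (∈-upTo⁺ (s≤s bx)) (∈-cartesianProduct⁺ (∈-upTo⁺ (s≤s by)) (∈-upTo⁺ (s≤s bz)))) s
      where
      bx : x ≤ p
      bx = ≤-trans (m≤m*n x x {{>-nonZero (x≢0 {x} {y} s)}}) (≤-trans (m≤m+n (x * x) _) (≤-reflexive s))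
      4yz : y * z ≤ p
      4yz = ≤-trans (m≤n*m (y * z) 4) (≤-trans (m≤n+m (4 * (y * z)) (x * x)) (≤-reflexive s))
      by : y ≤ p
      by = ≤-trans (m≤m*n y z {{>-nonZero (z≢0 {x} {y} s)}}) 4yz
      bz : z ≤ p
      bz = ≤-trans (m≤n*m z y {{>-nonZero (y≢0 {x} {y} {z} s)}}) 4yz

    S∈ : ∀ {t} → t ∈ S → Sol t
    S∈ {t} h = proj₂ (∈-filter⁻ sol? {t} {box} h)

    swap : Triple → Triple
    swap (x , y , z) = x , z , y

    sol₀ : Sol (1 , 1 , k)
    sol₀ = trans (cong (λ r → 1 + 4 * r) (+-identityʳ k)) (sym p≡)

    S-odd : ∃[ n ] (length S ≡ suc n × Even n)
    S-odd with ∈-∃++ (∈S (1 , 1 , k) sol₀)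
    ... | us , vs , e = length (us ++ vs) , trans (cong length e) (F.length-insert us) ,
        F.even _ (us ++ vs) refl (proj₂ uq) (λ {x} h → F.∈-drop us (λ q → proj₁ uq (subst (_∈ us ++ vs) (trans (sym (f-inv x (mem h))) (trans (cong f q) fix₀)) h))
            (subst (f x ∈_) e (∈S (f x) (f-sol x (mem h))))) (λ {x} h → f-inv x (mem h))
          (λ {x} h q → proj₁ uq (subst (_∈ us ++ vs) (f-fixed x (mem h) q) h))
      where
      module F = Involution f
      uq = F.unique-insert us (subst Unique e uS)
      mem : ∀ {x} → x ∈ us ++ vs → Sol x
      mem {x} h = S∈ (subst (x ∈_) (sym e) (F.∈-add us h))
      fix₀ : f (1 , 1 , k) ≡ (1 , 1 , k)
      fix₀ = trans (f-c₂ 1 1 k k 1 refl (z≢0 {1} {1} sol₀) refl (s≤s z≤n)) refl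

    -- Without a solution y = z the swap would pair off a list of odd length.
    diagonal : ∃[ x ] ∃[ y ] Sol (x , y , y)
    diagonal = decide (any? (λ (x , y , z) → y ≟ z) S) S-odd
      where
      module G = Involution swap
      sw : ∀ t → Sol t → Sol (swap t)
      sw (x , y , z) s = trans (cong (λ r → x * x + 4 * r) (*-comm z y)) s
      find : ∀ {xs} → Any (λ (x , y , z) → y ≡ z) xs → ∃[ t ] (t ∈ xs × proj₁ (proj₂ t) ≡ proj₂ (proj₂ t))
      find (here {x = t} e) = t , here refl , e
      find (there h) = let t , m , e = find h in t , there m , e
      found : ∃[ t ] (t ∈ S × proj₁ (proj₂ t) ≡ proj₂ (proj₂ t)) → ∃[ x ] ∃[ y ] Sol (x , y , y)
      found ((x , y , z) , m , e) = x , y , subst (λ r → Sol (x , y , r)) (sym e) (S∈ m)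
      decide : Dec (Any (λ (x , y , z) → y ≡ z) S) → ∃[ n ] (length S ≡ suc n × Even n) → ∃[ x ] ∃[ y ] Sol (x , y , y)
      decide (yes h) _ = found (find h)
      decide (no ¬h) (n , e , ev) = ⊥-elim (¬even-suc ev (subst Even e (G.even _ S refl uS (λ {x} h → ∈S (swap x) (sw x (S∈ h))) (λ _ → refl)
        (λ {x} h q → ¬h (lose h (sym (cong (λ t → proj₁ (proj₂ t)) q)))))))

  prime-two-squares : ∀ p → Prime p → p % 4 ≡ 1 → ∃[ x ] ∃[ y ] p ≡ x * x + y * y
  prime-two-squares p pp e = read (Zagier.diagonal p (p / 4) pp (trans (m≡m%n+[m/n]*n p 4) (cong₂ _+_ e (*-comm (p / 4) 4))))
    where
    lem : ∀ x y → x * x + 4 * (y * y) ≡ x * x + 2 * y * (2 * y)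
    lem = solve-∀
    read : ∃[ x ] ∃[ y ] x * x + 4 * (y * y) ≡ p → ∃[ x ] ∃[ y ] p ≡ x * x + y * y
    read (x , y , s) = x , 2 * y , trans (sym s) (lem x y)

  -- Over ℤ, because the product identity contains a difference.
  SumSq : ℕ → Set
  SumSq m = ∃[ u ] ∃[ v ] ℤ.+ m ≡ u ℤ.* u ℤ.+ v ℤ.* v

  sumSq-* : ∀ m n → SumSq m → SumSq n → SumSq (m * n)
  sumSq-* m n (a , b , e) (c , d , e′) = a ℤ.* c ℤ.- b ℤ.* d , a ℤ.* d ℤ.+ b ℤ.* c ,
    trans (ℤₚ.pos-* m n) (trans (cong₂ ℤ._*_ e e′) (lem a b c d))
    where
    lem : ∀ a b c d → (a ℤ.* a ℤ.+ b ℤ.* b) ℤ.* (c ℤ.* c ℤ.+ d ℤ.* d) ≡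
      (a ℤ.* c ℤ.- b ℤ.* d) ℤ.* (a ℤ.* c ℤ.- b ℤ.* d) ℤ.+ (a ℤ.* d ℤ.+ b ℤ.* c) ℤ.* (a ℤ.* d ℤ.+ b ℤ.* c)
    lem = ℤ-Solver.solve-∀

  product-two-squares : ∀ ps → All (λ p → Prime p × p % 4 ≡ 1) ps → SumSq (product ps)
  product-two-squares [] [] = ℤ.1ℤ , ℤ.0ℤ , refl
  product-two-squares (p ∷ ps) ((pp , e) ∷ h) = cons (prime-two-squares p pp e)
    where
    cons : ∃[ x ] ∃[ y ] p ≡ x * x + y * y → SumSq (p * product ps)
    cons (x , y , q) = sumSq-* p (product ps) (ℤ.+ x , ℤ.+ y , trans (cong ℤ.+_ q) (trans (ℤₚ.pos-+ (x * x) (y * y)) (cong₂ ℤ._+_ (ℤₚ.pos-* x x) (ℤₚ.pos-* y y)))) (product-two-squares ps h)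

  %4-* : ∀ a b {c d} → a % 4 ≡ c → b % 4 ≡ d → (a * b) % 4 ≡ (c * d) % 4
  %4-* a b refl refl = %-distribˡ-* a b 4

  -- Products of the residues 0, 1, 2 are never 3 modulo 4, so a factor 3 occurs in the head or in
  -- the tail.
  P3-factor : ∀ ps → All Prime ps → product ps % 4 ≡ 3 → ∃[ r ] (P3 r × r ∣ product ps)
  P3-factor [] [] ()
  P3-factor (p ∷ ps) (pp ∷ pps) h with cases4 p | cases4 (product ps)
  ... | inj₂ (inj₂ (inj₂ e)) | _ = p , (pp , e) , m∣m*n (product ps)
  ... | _ | inj₂ (inj₂ (inj₂ e)) with P3-factor ps pps e
  ...   | r , r3 , r∣ = r , r3 , ∣n⇒∣m*n p r∣
  P3-factor (p ∷ ps) (pp ∷ pps) h | inj₁ e | inj₁ e′ = contradiction (trans (sym h) (%4-* p (product ps) e e′)) λ ()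
  P3-factor (p ∷ ps) (pp ∷ pps) h | inj₁ e | inj₂ (inj₁ e′) = contradiction (trans (sym h) (%4-* p (product ps) e e′)) λ ()
  P3-factor (p ∷ ps) (pp ∷ pps) h | inj₁ e | inj₂ (inj₂ (inj₁ e′)) = contradiction (trans (sym h) (%4-* p (product ps) e e′)) λ ()
  P3-factor (p ∷ ps) (pp ∷ pps) h | inj₂ (inj₁ e) | inj₁ e′ = contradiction (trans (sym h) (%4-* p (product ps) e e′)) λ ()
  P3-factor (p ∷ ps) (pp ∷ pps) h | inj₂ (inj₁ e) | inj₂ (inj₁ e′) = contradiction (trans (sym h) (%4-* p (product ps) e e′)) λ ()
  P3-factor (p ∷ ps) (pp ∷ pps) h | inj₂ (inj₁ e) | inj₂ (inj₂ (inj₁ e′)) = contradiction (trans (sym h) (%4-* p (product ps) e e′)) λ ()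
  P3-factor (p ∷ ps) (pp ∷ pps) h | inj₂ (inj₂ (inj₁ e)) | inj₁ e′ = contradiction (trans (sym h) (%4-* p (product ps) e e′)) λ ()
  P3-factor (p ∷ ps) (pp ∷ pps) h | inj₂ (inj₂ (inj₁ e)) | inj₂ (inj₁ e′) = contradiction (trans (sym h) (%4-* p (product ps) e e′)) λ ()
  P3-factor (p ∷ ps) (pp ∷ pps) h | inj₂ (inj₂ (inj₁ e)) | inj₂ (inj₂ (inj₁ e′)) = contradiction (trans (sym h) (%4-* p (product ps) e e′)) λ ()

  P3-divisor : ∀ n → n % 4 ≡ 3 → ∃[ r ] (P3 r × r ∣ n)
  P3-divisor n@(suc _) h with factorise n
  ... | record { factors = ps ; isFactorisation = e ; factorsPrime = pps } with P3-factor ps pps (trans (cong (_% 4) (sym e)) h)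
  ...   | r , r3 , r∣ = r , r3 , subst (r ∣_) (sym e) r∣

  product-member : ∀ {p} ps → p ∈ ps → p ∣ product ps
  product-member (p ∷ ps) (here refl) = m∣m*n (product ps)
  product-member (q ∷ ps) (there h) = ∣n⇒∣m*n q (product-member ps h)

  -- A number m ≡ 1 (mod 4) has an even number of prime factors ≡ 3 (mod 4), so at least one of them is at most √m.
  sifted⇒sumSq : ∀ m z → m % 4 ≡ 1 → m ≤ z * z → (∀ p → P3 p → p ≤ z → ¬ p ∣ m) → SumSq m
  sifted⇒sumSq m@(suc _) z m1 m≤ sift with factorise m
  ... | record { factors = ps ; isFactorisation = e ; factorsPrime = pps } = subst SumSq (sym e) (product-two-squares ps (All.tabulate good))
    where
    good : ∀ {p} → p ∈ ps → Prime p × p % 4 ≡ 1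
    good {p} p∈ = pp , one (cases4 p)
      where
      pp = All.lookup pps p∈
      p∣m : p ∣ m
      p∣m = subst (p ∣_) (sym e) (product-member ps p∈)
      m′ = quotient p∣m
      m≡ : m ≡ p * m′
      m≡ = m∣n⇒n≡m*quotient p∣m
      one : p % 4 ≡ 0 ⊎ p % 4 ≡ 1 ⊎ p % 4 ≡ 2 ⊎ p % 4 ≡ 3 → p % 4 ≡ 1
      even-bad : ∀ c → p % 4 ≡ c → (∀ d → d < 4 → (c * d) % 4 ≢ 1) → ⊥
      even-bad c pc bad = bad (m′ % 4) (m%n<n m′ 4) (trans (sym (%4-* p m′ pc refl)) (trans (cong (_% 4) (sym m≡)) m1))
      one (inj₁ p0) = ⊥-elim (even-bad 0 p0 (λ { d _ () }))
      one (inj₂ (inj₁ p1)) = p1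
      one (inj₂ (inj₂ (inj₁ p2))) = ⊥-elim (even-bad 2 p2 (λ { 0 _ () ; 1 _ () ; 2 _ () ; 3 _ () ; (suc (suc (suc (suc _)))) (s≤s (s≤s (s≤s (s≤s ())))) }))
      one (inj₂ (inj₂ (inj₂ p3))) = ⊥-elim (bad (P3-divisor m′ m′3))
        where
        m′3 : m′ % 4 ≡ 3
        m′3 with cases4 m′
        ... | inj₁ q = contradiction (trans (sym m1) (trans (cong (_% 4) m≡) (%4-* p m′ p3 q))) λ ()
        ... | inj₂ (inj₁ q) = contradiction (trans (sym m1) (trans (cong (_% 4) m≡) (%4-* p m′ p3 q))) λ ()
        ... | inj₂ (inj₂ (inj₁ q)) = contradiction (trans (sym m1) (trans (cong (_% 4) m≡) (%4-* p m′ p3 q))) λ ()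
        ... | inj₂ (inj₂ (inj₂ q)) = q
        z<p : z < p
        z<p = ≰⇒> (λ p≤z → sift p (pp , p3) p≤z p∣m)
        1≤m′ : 1 ≤ m′
        1≤m′ = n≢0⇒n>0 (λ q → contradiction (trans (sym m′3) (cong (_% 4) q)) λ ())
        m′≤z : m′ ≤ z
        m′≤z = ≮⇒≥ (λ z<m′ → <⇒≱ (≤-<-trans (*-monoʳ-≤ z (<⇒≤ z<m′)) (*-monoˡ-< m′ {{>-nonZero 1≤m′}} z<p)) (subst (_≤ z * z) m≡ m≤))
        bad : ∃[ r ] (P3 r × r ∣ m′) → ⊥
        bad (r , r3 , r∣) = sift r r3 (≤-trans (∣⇒≤ {{>-nonZero 1≤m′}} r∣) m′≤z) (subst (r ∣_) (sym m≡) (∣n⇒∣m*n p r∣))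

-- The Brun-Hooley sieve and the equidistribution of its weights

module BrunHooley where

  open import Data.Nat.Base as ℕ using (ℕ; zero; suc; z≤n; s≤s)
  import Data.Nat.Properties as ℕₚ
  open import Data.Nat.DivMod
  open import Data.Nat.Divisibility
  open import Data.Nat.Primality
  open import Data.Nat.Coprimality using (Coprime; coprime-Bézout)
  open import Data.Nat.GCD using (module Bézout)
  import Data.Nat.Tactic.RingSolver as ℕ-Solver
  open import Data.List.Base using (List; []; _∷_)
  open import Data.List.Relation.Unary.All using ([]; _∷_)
  open import Data.Rational.Base using (ℚ; 0ℚ; 1ℚ; ½; _+_; _*_; _-_; -_; _≤_; _<_)
  open import Data.Rational.Properties
  open import Data.Product.Base using (_×_; _,_; proj₁; proj₂; ∃-syntax)
  open import Data.Sum.Base using (inj₁; inj₂)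
  open import Relation.Nullary using (Dec; yes; no; ¬_; contradiction)
  open import Relation.Binary.PropositionalEquality
  open import Tactic.RingSolver using (solve-∀)
  open Rationals
  open Character using (𝟙; 𝟙-yes; 𝟙-no; ∑-head)
  open WeightedMertens using (ι-2)
  open MertensModFour using (bit; ∑-pickℚ; prime≥2; prime-∣-prime)

  -- Bonferroni inequalities.  U β (suc r) l is the inclusion-exclusion sum truncated at r events, E β r l the r-th
  -- elementary symmetric function, V β l the full product.

  U E : (ℕ → ℚ) → ℕ → ℕ → ℚ
  U β zero    l       = 0ℚ
  U β (suc r) zero    = 1ℚ
  U β (suc r) (suc l) = U β (suc r) l - β l * U β r l
  E β zero    l       = 1ℚ
  E β (suc r) zero    = 0ℚ
  E β (suc r) (suc l) = E β (suc r) l + β l * E β r l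

  V : (ℕ → ℚ) → ℕ → ℚ
  V β zero    = 1ℚ
  V β (suc l) = V β l * (1ℚ - β l)

  Unit : (ℕ → ℚ) → Set
  Unit β = ∀ i → 0ℚ ≤ β i × β i ≤ 1ℚ

  V-unit : ∀ {β} → Unit β → ∀ l → 0ℚ ≤ V β l × V β l ≤ 1ℚ
  V-unit u zero = 0≤1 , ≤-refl
  V-unit {β} u (suc l) with V-unit u l | u l
  ... | p , q | p′ , q′ = *-nonNeg p (diff≥0 q′) ,
    ≤-trans (*-mono p q (diff≥0 q′) (≤-by (β l) p′ (lem (β l)))) ≤-refl
    where
    lem : ∀ b → 1ℚ ≡ 1ℚ - b + b
    lem = solve-∀ ℚ-ring

  sgn : ℕ → ℚ
  sgn zero    = - 1ℚ
  sgn (suc r) = - sgn r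

  -- The errors U - V satisfy the recurrence of U, so their signs alternate by induction. Weights in
  -- [0, 1] are allowed because the inequality is applied both to 0-1 events and to their densities.
  bonferroni : ∀ {β} → Unit β → ∀ r l → 0ℚ ≤ sgn r * (U β r l - V β l) × sgn r * (U β r l - V β l) ≤ E β r l
  bonferroni {β} u zero l with V-unit u l
  ... | p , q = subst (0ℚ ≤_) (lem (V β l)) p , ≤-trans (≤-reflexive (sym (lem (V β l)))) q
    where
    lem : ∀ v → v ≡ - 1ℚ * (0ℚ - v)
    lem = solve-∀ ℚ-ring
  bonferroni {β} u (suc r) zero = ≤-reflexive (sym (lem (sgn (suc r)))) , ≤-reflexive (lem (sgn (suc r)))
    where
    lem : ∀ s → s * (1ℚ - 1ℚ) ≡ 0ℚ
    lem = solve-∀ ℚ-ring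
  bonferroni {β} u (suc r) (suc l) with bonferroni u (suc r) l | bonferroni u r l
  ... | p , q | p′ , q′ = subst (0ℚ ≤_) (sym e) (+-nonNeg p (*-nonNeg (proj₁ (u l)) p′))
                        , ≤-trans (≤-reflexive e) (+-mono-≤ q (*-monoʳ (proj₁ (u l)) q′))
    where
    lem : ∀ s u′ u″ v b → - s * (u′ - b * u″ - v * (1ℚ - b)) ≡ - s * (u′ - v) + b * (s * (u″ - v))
    lem = solve-∀ ℚ-ring
    e = lem (sgn r) (U β (suc r) l) (U β r l) (V β l) (β l)

  sgn-odd : ∀ r → sgn (suc (r ℕ.+ r)) ≡ 1ℚ
  sgn-odd zero = refl
  sgn-odd (suc r) = trans (cong (λ z → - - sgn z) (ℕₚ.+-suc r r)) (trans (lem (sgn (suc (r ℕ.+ r)))) (sgn-odd r))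
    where
    lem : ∀ s → - - s ≡ s
    lem = solve-∀ ℚ-ring

  E-nonNeg : ∀ {β} → Unit β → ∀ r l → 0ℚ ≤ E β r l
  E-nonNeg u zero l = 0≤1
  E-nonNeg u (suc r) zero = ≤-refl
  E-nonNeg u (suc r) (suc l) = +-nonNeg (E-nonNeg u (suc r) l) (*-nonNeg (proj₁ (u l)) (E-nonNeg u r l))

  T-bounds : ∀ {β} → Unit β → ∀ r l → let T = U β (suc (r ℕ.+ r)) l in V β l ≤ T × T ≤ V β l + E β (suc (r ℕ.+ r)) l
  T-bounds {β} u r l with bonferroni u (suc (r ℕ.+ r)) l
  ... | p , q rewrite sgn-odd r = diff≥0⁻¹ (subst (0ℚ ≤_) (lem T (V β l)) p) ,
    ≤-trans (≤-reflexive (lem′ T (V β l))) (+-monoʳ-≤ (V β l) q)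
    where
    T = U β (suc (r ℕ.+ r)) l
    lem : ∀ t v → 1ℚ * (t - v) ≡ t - v
    lem = solve-∀ ℚ-ring
    lem′ : ∀ t v → t ≡ v + 1ℚ * (t - v)
    lem′ = solve-∀ ℚ-ring

  -- A block sifts by the integers in (lo, lo + len], truncating at 2 r events.
  record Block : Set where
    constructor block
    field
      r lo len : ℕ

    hi : ℕ
    hi = lo ℕ.+ len

  open Block public

  local : (ℕ → ℚ) → Block → ℕ → ℚ
  local w B i = w (suc (lo B ℕ.+ i))

  T⟨_⟩ E⟨_⟩ V⟨_⟩ : Block → (ℕ → ℚ) → ℚ
  T⟨ B ⟩ w = U (local w B) (suc (r B ℕ.+ r B)) (len B)
  E⟨ B ⟩ w = E (local w B) (suc (r B ℕ.+ r B)) (len B)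
  V⟨ B ⟩ w = V (local w B) (len B)

  -- Expanded, `Low` is Hooley's lower bound: the product of all T minus, for each block, its E
  -- times the T of the other blocks.
  Up Low None : List Block → (ℕ → ℚ) → ℚ
  Up []       w = 1ℚ
  Up (B ∷ Bs) w = T⟨ B ⟩ w * Up Bs w
  Low []       w = 1ℚ
  Low (B ∷ Bs) w = T⟨ B ⟩ w * Low Bs w - E⟨ B ⟩ w * Up Bs w
  None []       w = 1ℚ
  None (B ∷ Bs) w = V⟨ B ⟩ w * None Bs w

  module _ {w : ℕ → ℚ} (u : Unit w) where

    lu : ∀ B → Unit (local w B)
    lu B i = u (suc (lo B ℕ.+ i))

    None≥0 : ∀ Bs → 0ℚ ≤ None Bs w
    None≥0 [] = 0≤1
    None≥0 (B ∷ Bs) = *-nonNeg (proj₁ (V-unit (lu B) (len B))) (None≥0 Bs)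

    V≤T : ∀ B → V⟨ B ⟩ w ≤ T⟨ B ⟩ w
    V≤T B = proj₁ (T-bounds (lu B) (r B) (len B))

    T≥0 : ∀ B → 0ℚ ≤ T⟨ B ⟩ w
    T≥0 B = ≤-trans (proj₁ (V-unit (lu B) (len B))) (V≤T B)

    None≤Up : ∀ Bs → None Bs w ≤ Up Bs w
    None≤Up [] = ≤-refl
    None≤Up (B ∷ Bs) = *-mono (proj₁ (V-unit (lu B) (len B))) (V≤T B) (None≥0 Bs) (None≤Up Bs)

    Up≥0 : ∀ Bs → 0ℚ ≤ Up Bs w
    Up≥0 Bs = ≤-trans (None≥0 Bs) (None≤Up Bs)

    -- In each block T - E ≤ V, and lowering `Up` to `None` in the subtracted term only enlarges the
    -- expression.
    Low≤None : ∀ Bs → Low Bs w ≤ None Bs w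
    Low≤None [] = ≤-refl
    Low≤None (B ∷ Bs) = begin
      T * L - e * Up′                   ≤⟨ +-mono-≤ (*-monoʳ (T≥0 B) (Low≤None Bs)) (neg-antimono-≤ (*-monoʳ (E-nonNeg (lu B) (suc (r B ℕ.+ r B)) (len B)) (None≤Up Bs))) ⟩
      T * N′ - e * N′                   ≤⟨ ≤-by ((v + e - T) * N′) (*-nonNeg (diff≥0 (proj₂ (T-bounds (lu B) (r B) (len B)))) (None≥0 Bs)) (lem T e v N′) ⟩
      v * N′                            ∎
      where
      open ≤-Reasoning
      T = T⟨ B ⟩ w
      e = E⟨ B ⟩ w
      v = V⟨ B ⟩ w
      L = Low Bs w
      N′ = None Bs w
      Up′ = Up Bs w
      lem : ∀ t e v n → v * n ≡ t * n - e * n + (v + e - t) * n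
      lem = solve-∀ ℚ-ring

    -- Σθ bounds the total relative loss of the lower bound.
    data Loss : List Block → ℚ → Set where
      []  : Loss [] 0ℚ
      _∷_ : ∀ {B Bs θ Θ} → E⟨ B ⟩ w ≤ θ * T⟨ B ⟩ w → Loss Bs Θ → Loss (B ∷ Bs) (θ + Θ)

    Loss⇒Low : ∀ {Bs Θ} → Loss Bs Θ → (1ℚ - Θ) * Up Bs w ≤ Low Bs w
    Loss⇒Low [] = ≤-refl
    Loss⇒Low {B ∷ Bs} (_∷_ {θ = θ} {Θ = Θ} h hs) = begin
      (1ℚ - (θ + Θ)) * (T * Up′)                  ≡⟨ lem T Up′ θ Θ ⟩
      T * ((1ℚ - Θ) * Up′) - θ * T * Up′          ≤⟨ +-mono-≤ (*-monoʳ (T≥0 B) (Loss⇒Low hs)) (neg-antimono-≤ (*-monoˡ (Up≥0 Bs) h)) ⟩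
      T * Low Bs w - E⟨ B ⟩ w * Up′               ∎
      where
      open ≤-Reasoning
      T = T⟨ B ⟩ w
      Up′ = Up Bs w
      lem : ∀ t u a b → (1ℚ - (a + b)) * (t * u) ≡ t * ((1ℚ - b) * u) - a * t * u
      lem = solve-∀ ℚ-ring


  Within : ℚ → ℚ → Set
  Within x e = - e ≤ x × x ≤ e

  W-+ : ∀ {x y e f} → Within x e → Within y f → Within (x + y) (e + f)
  W-+ {x} {y} {e} {f} (a , b) (c , d) = ≤-trans (≤-reflexive (neg-distrib-+ e f)) (+-mono-≤ a c) , +-mono-≤ b d

  W-neg : ∀ {x e} → Within x e → Within (- x) e
  W-neg {x} {e} (a , b) = neg-antimono-≤ b , ≤-trans (neg-antimono-≤ a) (≤-reflexive (lem e))
    where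
    lem : ∀ s → - - s ≡ s
    lem = solve-∀ ℚ-ring

  W-mono : ∀ {x e f} → e ≤ f → Within x e → Within x f
  W-mono h (a , b) = ≤-trans (neg-antimono-≤ h) a , ≤-trans b h

  W-* : ∀ {c x e} → 0ℚ ≤ c → Within x e → Within (c * x) (c * e)
  W-* {c} {x} {e} h (a , b) = ≤-trans (≤-reflexive (lem c e)) (*-monoʳ h a) , *-monoʳ h b
    where
    lem : ∀ c e → - (c * e) ≡ c * - e
    lem = solve-∀ ℚ-ring

  -- Both e - cx and e + cx are half a sum of two products of nonnegative factors, so no signs are
  -- distinguished.
  W-unit : ∀ {c x e} → Within c 1ℚ → Within x e → Within (c * x) e
  W-unit {c} {x} {e} (a , b) (p , q) = diff≥0⁻¹ (subst (0ℚ ≤_) (lem₁ c x e) (half (*-nonNeg (diff≥0 b) (diff≥0 q)) (*-nonNeg (diff≥0 a) (diff≥0 p))))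
                                    , diff≥0⁻¹ (subst (0ℚ ≤_) (lem₂ c x e) (half (*-nonNeg (diff≥0 b) (diff≥0 p)) (*-nonNeg (diff≥0 a) (diff≥0 q))))
    where
    half : ∀ {u v} → 0ℚ ≤ u → 0ℚ ≤ v → 0ℚ ≤ ½ * (u + v)
    half h g = *-nonNeg {½} (≤ᵇ⇒≤ _) (+-nonNeg h g)
    lem₁ : ∀ c x e → ½ * ((1ℚ - c) * (e - x) + (c - - 1ℚ) * (x - - e)) ≡ c * x - - e
    lem₁ = solve-∀ ℚ-ring
    lem₂ : ∀ c x e → ½ * ((1ℚ - c) * (x - - e) + (c - - 1ℚ) * (e - x)) ≡ e - c * x
    lem₂ = solve-∀ ℚ-ring

  W-∑ : ∀ n {x e : ℕ → ℚ} → (∀ i → i ℕ.< n → Within (x i) (e i)) → Within (∑ n x) (∑ n e)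
  W-∑ n {x} {e} h = ≤-trans (≤-reflexive (sym (∑-neg n e))) (∑-mono n (λ i i< → proj₁ (h i i<))) , ∑-mono n (λ i i< → proj₂ (h i i<))

  W-0 : Within 0ℚ 0ℚ
  W-0 = ≤-refl , ≤-refl


  %-multiple : ∀ a k p .{{_ : ℕ.NonZero p}} → (a ℕ.+ k ℕ.* p) ℕ.% p ≡ a ℕ.% p
  %-multiple a k p = [m+kn]%n≡m%n a k p

  prime-coprime : ∀ {p m} → Prime p → ¬ p ∣ m → Coprime p m
  prime-coprime pp p∤m (d∣p , d∣m) with prime⇒irreducible pp d∣p
  ... | inj₁ d≡1 = d≡1
  ... | inj₂ refl = contradiction d∣m p∤m

  inverse-mod : ∀ {p m} → Prime p → ¬ p ∣ m → ∃[ u ] ∃[ k ] m ℕ.* u ≡ 1 ℕ.+ k ℕ.* p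
  inverse-mod {p} {m} pp p∤m with coprime-Bézout (prime-coprime pp p∤m)
  ... | Bézout.-+ x y e = y , x , trans (ℕₚ.*-comm m y) (sym e)
  ... | Bézout.+- x y e = square (y ℕ.* m) refl
    where
    -- Here m y ≡ -1, so m (y m y) ≡ 1.
    square : ∀ s → y ℕ.* m ≡ s → ∃[ u ] ∃[ k ] m ℕ.* u ≡ 1 ℕ.+ k ℕ.* p
    square zero e′ = contradiction (∣⇒≤ p∣1) (ℕₚ.<⇒≱ (prime≥2 pp))
      where
      p∣1 : p ∣ 1
      p∣1 = divides x (trans (cong suc (sym e′)) e)
    square (suc s) e′ = y ℕ.* (m ℕ.* y) , s ℕ.* x , (begin
      m ℕ.* (y ℕ.* (m ℕ.* y))       ≡⟨ l1 m y ⟩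
      (y ℕ.* m) ℕ.* (y ℕ.* m)       ≡⟨ cong₂ ℕ._*_ e′ e′ ⟩
      suc s ℕ.* suc s               ≡⟨ l2 s ⟩
      1 ℕ.+ s ℕ.* suc (suc s)       ≡⟨ cong (λ z → 1 ℕ.+ s ℕ.* z) (trans (cong suc (sym e′)) e) ⟩
      1 ℕ.+ s ℕ.* (x ℕ.* p)         ≡⟨ cong suc (sym (ℕₚ.*-assoc s x p)) ⟩
      1 ℕ.+ s ℕ.* x ℕ.* p           ∎)
      where
      open ≡-Reasoning
      l1 : ∀ m y → m ℕ.* (y ℕ.* (m ℕ.* y)) ≡ (y ℕ.* m) ℕ.* (y ℕ.* m)
      l1 = ℕ-Solver.solve-∀
      l2 : ∀ s → suc s ℕ.* suc s ≡ 1 ℕ.+ s ℕ.* suc (suc s)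
      l2 = ℕ-Solver.solve-∀

  linear-mod : ∀ {p m} .{{_ : ℕ.NonZero p}} → Prime p → ¬ p ∣ m → ∀ r c → c ℕ.< p → ∃[ t ] (t ℕ.< p × (r ℕ.+ m ℕ.* t) ℕ.% p ≡ c)
  linear-mod {p} {m} pp p∤m r c c<p with inverse-mod pp p∤m
  ... | u , k , e = t , m%n<n (u ℕ.* d) p , trans (sym (%-multiple (r ℕ.+ m ℕ.* t) (m ℕ.* q) p)) (trans (cong (ℕ._% p) key)
      (trans (%-multiple c (r ℕ.+ k ℕ.* d) p) (m<n⇒m%n≡m c<p)))
    where
    p₁ = p ℕ.∸ 1
    p≡ : p ≡ suc p₁
    p≡ = sym (ℕₚ.m+[n∸m]≡n (ℕ.>-nonZero⁻¹ p))
    -- Stands for c - r modulo p, written without subtraction.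
    d = c ℕ.+ p₁ ℕ.* r
    t = (u ℕ.* d) ℕ.% p
    q = (u ℕ.* d) ℕ./ p
    open ≡-Reasoning
    key : r ℕ.+ m ℕ.* t ℕ.+ m ℕ.* q ℕ.* p ≡ c ℕ.+ (r ℕ.+ k ℕ.* d) ℕ.* p
    key = begin
      r ℕ.+ m ℕ.* t ℕ.+ m ℕ.* q ℕ.* p      ≡⟨ l1 r m t q p ⟩
      r ℕ.+ m ℕ.* (t ℕ.+ q ℕ.* p)          ≡⟨ cong (λ z → r ℕ.+ m ℕ.* z) (sym (m≡m%n+[m/n]*n (u ℕ.* d) p)) ⟩
      r ℕ.+ m ℕ.* (u ℕ.* d)                ≡⟨ cong (r ℕ.+_) (sym (ℕₚ.*-assoc m u d)) ⟩
      r ℕ.+ m ℕ.* u ℕ.* d                  ≡⟨ cong (λ z → r ℕ.+ z ℕ.* d) e ⟩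
      r ℕ.+ (1 ℕ.+ k ℕ.* p) ℕ.* d          ≡⟨ l2 r k p d ⟩
      r ℕ.+ d ℕ.+ k ℕ.* d ℕ.* p            ≡⟨ cong (ℕ._+ k ℕ.* d ℕ.* p) (l3 r c p₁) ⟩
      c ℕ.+ r ℕ.* suc p₁ ℕ.+ k ℕ.* d ℕ.* p ≡⟨ cong (λ z → c ℕ.+ r ℕ.* z ℕ.+ k ℕ.* d ℕ.* p) (sym p≡) ⟩
      c ℕ.+ r ℕ.* p ℕ.+ k ℕ.* d ℕ.* p      ≡⟨ l4 c r p k d ⟩
      c ℕ.+ (r ℕ.+ k ℕ.* d) ℕ.* p          ∎
      where
      l1 : ∀ r m t q p → r ℕ.+ m ℕ.* t ℕ.+ m ℕ.* q ℕ.* p ≡ r ℕ.+ m ℕ.* (t ℕ.+ q ℕ.* p)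
      l1 = ℕ-Solver.solve-∀
      l2 : ∀ r k p d → r ℕ.+ (1 ℕ.+ k ℕ.* p) ℕ.* d ≡ r ℕ.+ d ℕ.+ k ℕ.* d ℕ.* p
      l2 = ℕ-Solver.solve-∀
      l3 : ∀ r c p₁ → r ℕ.+ (c ℕ.+ p₁ ℕ.* r) ≡ c ℕ.+ r ℕ.* suc p₁
      l3 = ℕ-Solver.solve-∀
      l4 : ∀ c r p k d → c ℕ.+ r ℕ.* p ℕ.+ k ℕ.* d ℕ.* p ≡ c ℕ.+ (r ℕ.+ k ℕ.* d) ℕ.* p
      l4 = ℕ-Solver.solve-∀

  ∣-of-%≡ : ∀ {p} .{{_ : ℕ.NonZero p}} a b → a ℕ.≤ b → a ℕ.% p ≡ b ℕ.% p → p ∣ b ℕ.∸ a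
  ∣-of-%≡ {p} a b a≤b e = divides (b ℕ./ p ℕ.∸ a ℕ./ p) (begin
    b ℕ.∸ a                                            ≡⟨ cong₂ ℕ._∸_ (m≡m%n+[m/n]*n b p) (trans (m≡m%n+[m/n]*n a p) (cong (ℕ._+ a ℕ./ p ℕ.* p) e)) ⟩
    (b ℕ.% p ℕ.+ b ℕ./ p ℕ.* p) ℕ.∸ (b ℕ.% p ℕ.+ a ℕ./ p ℕ.* p) ≡⟨ ℕₚ.[m+n]∸[m+o]≡n∸o (b ℕ.% p) _ _ ⟩
    b ℕ./ p ℕ.* p ℕ.∸ a ℕ./ p ℕ.* p                    ≡⟨ sym (ℕₚ.*-distribʳ-∸ p (b ℕ./ p) (a ℕ./ p)) ⟩
    (b ℕ./ p ℕ.∸ a ℕ./ p) ℕ.* p                        ∎)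
    where open ≡-Reasoning

  linear-mod-inj-≤ : ∀ {p m} .{{_ : ℕ.NonZero p}} → Prime p → ¬ p ∣ m → ∀ r s t → s ℕ.≤ t → t ℕ.< p →
    (r ℕ.+ m ℕ.* s) ℕ.% p ≡ (r ℕ.+ m ℕ.* t) ℕ.% p → s ≡ t
  linear-mod-inj-≤ {p} {m} pp p∤m r s t s≤t t<p e with euclidsLemma m (t ℕ.∸ s) pp (subst (p ∣_)
      (trans (ℕₚ.[m+n]∸[m+o]≡n∸o r _ _) (sym (ℕₚ.*-distribˡ-∸ m t s)))
      (∣-of-%≡ (r ℕ.+ m ℕ.* s) (r ℕ.+ m ℕ.* t) (ℕₚ.+-monoʳ-≤ r (ℕₚ.*-monoʳ-≤ m s≤t)) e))
  ... | inj₁ p∣m = contradiction p∣m p∤m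
  ... | inj₂ p∣d with t ℕ.∸ s in eq
  ...   | zero = ℕₚ.≤-antisym s≤t (ℕₚ.m∸n≡0⇒m≤n eq)
  ...   | suc d = contradiction (∣⇒≤ p∣d) (ℕₚ.<⇒≱ (ℕₚ.≤-<-trans (subst (ℕ._≤ t) eq (ℕₚ.m∸n≤m t s)) t<p))

  linear-mod-inj : ∀ {p m} .{{_ : ℕ.NonZero p}} → Prime p → ¬ p ∣ m → ∀ r s t → s ℕ.< p → t ℕ.< p →
    (r ℕ.+ m ℕ.* s) ℕ.% p ≡ (r ℕ.+ m ℕ.* t) ℕ.% p → s ≡ t
  linear-mod-inj pp p∤m r s t s<p t<p e with ℕₚ.≤-total s t
  ... | inj₁ s≤t = linear-mod-inj-≤ pp p∤m r s t s≤t t<p e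
  ... | inj₂ t≤s = sym (linear-mod-inj-≤ pp p∤m r t s t≤s s<p (sym e))

  Periodic : ℕ → (ℕ → ℚ) → Set
  Periodic p g = ∀ n k → g (n ℕ.+ k ℕ.* p) ≡ g n

  periodic-% : ∀ {p g} .{{_ : ℕ.NonZero p}} → Periodic p g → ∀ n → g n ≡ g (n ℕ.% p)
  periodic-% {p} {g} per n = trans (cong g (m≡m%n+[m/n]*n n p)) (per (n ℕ.% p) (n ℕ./ p))

  ∑-permute : ∀ {p m} → Prime p → ¬ p ∣ m → ∀ r (g : ℕ → ℚ) → Periodic p g → ∑ p (λ t → g (r ℕ.+ m ℕ.* t)) ≡ ∑ p g
  ∑-permute {p} {m} pp p∤m r g per = begin
    ∑ p (λ t → g (r ℕ.+ m ℕ.* t))                               ≡⟨ ∑-cong p (λ t _ → trans (periodic-% per (r ℕ.+ m ℕ.* t)) (sym (∑-pickℚ p (σ t) g (m%n<n (r ℕ.+ m ℕ.* t) p)))) ⟩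
    ∑ p (λ t → ∑ p (λ c → g c * 𝟙 (σ t ℕₚ.≟ c)))                ≡⟨ ∑-swap p p (λ t c → g c * 𝟙 (σ t ℕₚ.≟ c)) ⟩
    ∑ p (λ c → ∑ p (λ t → g c * 𝟙 (σ t ℕₚ.≟ c)))                ≡⟨ ∑-cong p (λ c c< → trans (∑-*ˡ p (g c) (λ t → 𝟙 (σ t ℕₚ.≟ c))) (trans (cong (g c *_) (one c c<)) (*-identityʳ (g c)))) ⟩
    ∑ p g                                                       ∎
    where
    open ≡-Reasoning
    instance _ = prime⇒nonZero pp
    σ : ℕ → ℕ
    σ t = (r ℕ.+ m ℕ.* t) ℕ.% p
    one : ∀ c → c ℕ.< p → ∑ p (λ t → 𝟙 (σ t ℕₚ.≟ c)) ≡ 1ℚ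
    one c c<p = unique (linear-mod pp p∤m r c c<p)
      where
      unique : ∃[ t ] (t ℕ.< p × σ t ≡ c) → ∑ p (λ t → 𝟙 (σ t ℕₚ.≟ c)) ≡ 1ℚ
      unique (t₀ , t₀<p , e) = trans (∑-cong p (λ t t<p → trans (same t t<p (σ t ℕₚ.≟ c) (t₀ ℕₚ.≟ t)) (sym (*-identityˡ (𝟙 (t₀ ℕₚ.≟ t)))))) (∑-pickℚ p t₀ (λ _ → 1ℚ) t₀<p)
        where
        same : ∀ t → t ℕ.< p → (d : Dec (σ t ≡ c)) (d′ : Dec (t₀ ≡ t)) → 𝟙 d ≡ 𝟙 d′
        same t t<p d (yes refl) = 𝟙-yes d e
        same t t<p d (no t₀≢t) = 𝟙-no d (λ h → t₀≢t (linear-mod-inj pp p∤m r t₀ t t₀<p t<p (trans e (sym h))))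

  ∑-truncate : ∀ q c (g : ℕ → ℚ) → c ℕ.≤ q → ∑ c g ≡ ∑ q (λ i → ∑ (bit (i ℕₚ.<? c)) (λ j → g (i ℕ.+ j ℕ.* q)))
  ∑-truncate q c g c≤q = trans (go q c≤q) (∑-cong q (λ i _ → pt i (i ℕₚ.<? c)))
    where
    pt : ∀ i (d : Dec (i ℕ.< c)) → 𝟙 d * g i ≡ ∑ (bit d) (λ j → g (i ℕ.+ j ℕ.* q))
    pt i (yes _) = trans (*-identityˡ (g i)) (trans (cong g (sym (ℕₚ.+-identityʳ i))) (sym (+-identityˡ (g (i ℕ.+ 0)))))
    pt i (no _) = *-zeroˡ (g i)
    go : ∀ q → c ℕ.≤ q → ∑ c g ≡ ∑ q (λ i → 𝟙 (i ℕₚ.<? c) * g i)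
    go zero z≤n = refl
    go (suc q) c≤ with q ℕₚ.<? c
    ... | yes q<c = subst (λ z → ∑ z g ≡ ∑ q (λ i → 𝟙 (i ℕₚ.<? c) * g i) + 1ℚ * g q) (ℕₚ.≤-antisym q<c c≤)
          (cong₂ _+_ (∑-cong q (λ i i< → sym (trans (cong (_* g i) (𝟙-yes (i ℕₚ.<? c) (ℕₚ.<-trans i< q<c))) (*-identityˡ (g i))))) (sym (*-identityˡ (g q))))
    ... | no q≮c = trans (go q (ℕₚ.≮⇒≥ q≮c)) (sym (trans (cong (∑ q (λ i → 𝟙 (i ℕₚ.<? c) * g i) +_) (*-zeroˡ (g q))) (+-identityʳ (∑ q (λ i → 𝟙 (i ℕₚ.<? c) * g i)))))

  -- Each class i modulo q is met a times, and once more exactly when i < c.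
  ∑-residues : ∀ q a c (g : ℕ → ℚ) → c ℕ.≤ q →
    ∑ (a ℕ.* q ℕ.+ c) g ≡ ∑ q (λ i → ∑ (a ℕ.+ bit (i ℕₚ.<? c)) (λ j → g (i ℕ.+ j ℕ.* q)))
  ∑-residues q zero c g c≤q = ∑-truncate q c g c≤q
  ∑-residues q (suc a) c g c≤q = begin
    ∑ (q ℕ.+ a ℕ.* q ℕ.+ c) g                                   ≡⟨ cong (λ z → ∑ z g) (ℕₚ.+-assoc q (a ℕ.* q) c) ⟩
    ∑ (q ℕ.+ (a ℕ.* q ℕ.+ c)) g                                 ≡⟨ ∑-split q (a ℕ.* q ℕ.+ c) g ⟩
    ∑ q g + ∑ (a ℕ.* q ℕ.+ c) (λ i → g (q ℕ.+ i))               ≡⟨ cong (∑ q g +_) (∑-residues q a c (λ i → g (q ℕ.+ i)) c≤q) ⟩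
    ∑ q g + ∑ q (λ i → ∑ (l i) (λ j → g (q ℕ.+ (i ℕ.+ j ℕ.* q)))) ≡⟨ sym (∑-+ q g (λ i → ∑ (l i) (λ j → g (q ℕ.+ (i ℕ.+ j ℕ.* q))))) ⟩
    ∑ q (λ i → g i + ∑ (l i) (λ j → g (q ℕ.+ (i ℕ.+ j ℕ.* q)))) ≡⟨ ∑-cong q (λ i _ → trans (cong₂ _+_ (cong g (sym (ℕₚ.+-identityʳ i))) (∑-cong (l i) (λ j _ → cong g (sh q i (j ℕ.* q)))))
                                                                       (sym (∑-head (l i) (λ j → g (i ℕ.+ j ℕ.* q))))) ⟩
    ∑ q (λ i → ∑ (suc (l i)) (λ j → g (i ℕ.+ j ℕ.* q)))         ∎
    where
    open ≡-Reasoning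
    l : ℕ → ℕ
    l i = a ℕ.+ bit (i ℕₚ.<? c)
    sh : ∀ q i x → q ℕ.+ (i ℕ.+ x) ≡ i ℕ.+ (q ℕ.+ x)
    sh = ℕ-Solver.solve-∀

  -- The sieve weights are equidistributed in arithmetic progressions whose modulus m avoids the sifting primes in (w₀, Y].
  module Equidistribution (w₀ κ : ℕ) (1≤κ : 1 ℕ.≤ κ) where

    Avoids : ℕ → ℕ → Set
    Avoids Y m = ∀ p → Prime p → w₀ ℕ.< p → p ℕ.≤ Y → ¬ p ∣ m

    -- Uniformity in m carries the induction: fixing a residue modulo a new prime q > Y turns m into
    -- m q, which still avoids the primes up to Y. The bound on the mean pays for rounding len/q to
    -- an integer.
    record Good (F : ℕ → ℚ) (Y : ℕ) (μ η : ℚ) : Set where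
      constructor good
      field
        mean : Within μ η
        dist : ∀ m r len → Avoids Y m → Within (∑ len (λ t → F (r ℕ.+ m ℕ.* t)) - μ * ι len) η

    Good-cong : ∀ {F F′ Y μ μ′ η} → (∀ n → F n ≡ F′ n) → μ ≡ μ′ → Good F Y μ η → Good F′ Y μ′ η
    Good-cong {F} {F′} {μ = μ} {η = η} e refl (good a h) = good a λ m r len av →
      subst (λ z → Within (z - μ * ι len) η) (∑-cong len (λ t _ → e (r ℕ.+ m ℕ.* t))) (h m r len av)

    Good-mono : ∀ {F Y Y′ μ η η′} → Y ℕ.≤ Y′ → η ≤ η′ → Good F Y μ η → Good F Y′ μ η′
    Good-mono YY ee (good a h) = good (W-mono ee a) λ m r len av → W-mono ee (h m r len (λ p pp w<p p≤Y → av p pp w<p (ℕₚ.≤-trans p≤Y YY)))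

    Good-+ : ∀ {F F′ Y μ μ′ η η′} → Good F Y μ η → Good F′ Y μ′ η′ → Good (λ n → F n + F′ n) Y (μ + μ′) (η + η′)
    Good-+ {F} {F′} {μ = μ} {μ′} {η} {η′} (good a h) (good a′ h′) = good (W-+ a a′) λ m r len av →
      subst (λ z → Within z (η + η′)) (trans (lem (∑ len (λ t → F (r ℕ.+ m ℕ.* t))) (∑ len (λ t → F′ (r ℕ.+ m ℕ.* t))) μ μ′ (ι len))
        (cong (_- (μ + μ′) * ι len) (sym (∑-+ len (λ t → F (r ℕ.+ m ℕ.* t)) (λ t → F′ (r ℕ.+ m ℕ.* t))))))
        (W-+ (h m r len av) (h′ m r len av))
      where
      lem : ∀ x y a b l → (x - a * l) + (y - b * l) ≡ (x + y) - (a + b) * l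
      lem = solve-∀ ℚ-ring

    Good-neg : ∀ {F Y μ η} → Good F Y μ η → Good (λ n → - F n) Y (- μ) η
    Good-neg {F} {μ = μ} {η} (good a h) = good (W-neg a) λ m r len av →
      subst (λ z → Within z η) (trans (lem (∑ len (λ t → F (r ℕ.+ m ℕ.* t))) μ (ι len)) (cong (_- - μ * ι len) (sym (∑-neg len (λ t → F (r ℕ.+ m ℕ.* t))))))
        (W-neg (h m r len av))
      where
      lem : ∀ x a l → - (x - a * l) ≡ - x - - a * l
      lem = solve-∀ ℚ-ring

    Good-0 : ∀ Y → Good (λ _ → 0ℚ) Y 0ℚ 0ℚ
    Good-0 Y = good W-0 λ m r len _ → subst (λ z → Within z 0ℚ) (trans (lem (ι len)) (cong (_- 0ℚ * ι len) (sym (∑-zero len)))) W-0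
      where
      lem : ∀ l → 0ℚ ≡ 0ℚ - 0ℚ * l
      lem = solve-∀ ℚ-ring

    Good-1 : ∀ Y → Good (λ _ → 1ℚ) Y 1ℚ 1ℚ
    Good-1 Y = good (≤ᵇ⇒≤ _ , ≤-refl) λ m r len _ → subst (λ z → Within z 1ℚ) (trans (lem (ι len)) (cong (_- 1ℚ * ι len) (sym (∑-const len 1ℚ)))) (W-mono 0≤1 W-0)
      where
      lem : ∀ l → 0ℚ ≡ l * 1ℚ - 1ℚ * l
      lem = solve-∀ ℚ-ring

    -- `never` covers the q that are not sieving primes, so that blocks can run over all integers.
    data Event (q : ℕ) (b : ℕ → ℚ) (δ : ℚ) : Set where
      never : (∀ n → b n ≡ 0ℚ) → δ ≡ 0ℚ → Event q b δ
      mod   : ∀ ν → Prime q → w₀ ℕ.< q → Periodic q b → Unit b → ν ℕ.≤ κ → ∑ q b ≡ ι ν → δ ≡ ι ν * inv q → Event q b δ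

    2κ : ℚ
    2κ = (1ℚ + 1ℚ) * ι κ

    2κ≥0 : 0ℚ ≤ 2κ
    2κ≥0 = *-nonNeg {1ℚ + 1ℚ} (≤ᵇ⇒≤ _) (ι-≥0 κ)

    W⇒0≤ : ∀ {x e} → Within x e → 0ℚ ≤ e
    W⇒0≤ {x} {e} (a , b) = *-cancelˡ {1ℚ + 1ℚ} (positive⁻¹ (1ℚ + 1ℚ)) (≤-trans (≤-reflexive (*-zeroʳ (1ℚ + 1ℚ)))
      (≤-trans (diff≥0 (≤-trans a b)) (≤-reflexive (lem e))))
      where
      lem : ∀ e → e - - e ≡ (1ℚ + 1ℚ) * e
      lem = solve-∀ ℚ-ring

    Event-unit : ∀ {q b δ} → Event q b δ → (∀ ν → ν ℕ.≤ κ → ι ν * inv q ≤ 1ℚ) → 0ℚ ≤ δ × δ ≤ 1ℚ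
    Event-unit (never _ e) h = ≤-reflexive (sym e) , ≤-trans (≤-reflexive e) 0≤1
    Event-unit {q} (mod ν _ _ _ _ ν≤ _ e) h = ≤-trans (*-nonNeg (ι-≥0 ν) (inv-≥0 q)) (≤-reflexive (sym e)) , ≤-trans (≤-reflexive e) (h ν ν≤)

    -- Each residue class contributes an error η from F and at most |μ| ≤ η from rounding, weighted
    -- by b; the weights add up to ν ≤ κ.
    Good-event : ∀ {F Y μ η q b δ} → Good F Y μ η → Y ℕ.< q → κ ℕ.≤ w₀ → Event q b δ → Good (λ n → b n * F n) q (δ * μ) (2κ * η)
    Good-event {F} {Y} {μ} {η} {q} {b} {δ} (good a h) Y<q κ≤w (never b0 δ0) =
      Good-cong (λ n → sym (trans (cong (_* F n) (b0 n)) (*-zeroˡ (F n)))) (sym (trans (cong (_* μ) δ0) (*-zeroˡ μ)))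
        (Good-mono z≤n (*-nonNeg 2κ≥0 (W⇒0≤ a)) (Good-0 0))
    Good-event {F} {Y} {μ} {η} {q} {b} {δ} (good a h) Y<q κ≤w ev@(mod ν pq w<q per ub ν≤ ∑b δ≡) = good bound main
      where
      instance _ = prime⇒nonZero pq
      1≤q : 1 ℕ.≤ q
      1≤q = ℕ.>-nonZero⁻¹ q
      η≥0 = W⇒0≤ a
      1≤2κ : 1ℚ ≤ 2κ
      1≤2κ = ≤-trans (ι-≥1 1≤κ) (≤-by (ι κ) (ι-≥0 κ) (lem (ι κ)))
        where
        lem : ∀ x → (1ℚ + 1ℚ) * x ≡ x + x
        lem = solve-∀ ℚ-ring
      δu : 0ℚ ≤ δ × δ ≤ 1ℚ
      δu = Event-unit ev (λ ν ν≤ → ≤-trans (*-monoˡ (inv-≥0 q) (ι-mono (ℕₚ.≤-trans ν≤ (ℕₚ.≤-trans κ≤w (ℕₚ.<⇒≤ w<q))))) (≤-reflexive (ι*inv 1≤q)))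
      bound : Within (δ * μ) (2κ * η)
      bound = W-mono (≤-trans (≤-reflexive (sym (*-identityˡ η))) (*-monoˡ η≥0 1≤2κ)) (W-unit (≤-trans (≤ᵇ⇒≤ _) (proj₁ δu) , proj₂ δu) a)
      main : ∀ m r len → Avoids q m → Within (∑ len (λ t → b (r ℕ.+ m ℕ.* t) * F (r ℕ.+ m ℕ.* t)) - δ * μ * ι len) (2κ * η)
      main m r len av = subst (λ z → Within z (2κ * η)) total (W-mono err≤ (W-∑ q (λ i _ → piece i)))
        where
        c = len ℕ.% q
        A = len ℕ./ q
        l : ℕ → ℕ
        l i = A ℕ.+ bit (i ℕₚ.<? c)
        β : ℕ → ℚ
        β i = b (r ℕ.+ m ℕ.* i)
        x = μ * (ι len * inv q)
        FS : ℕ → ℚ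
        FS i = ∑ (l i) (λ j → F (r ℕ.+ m ℕ.* i ℕ.+ (m ℕ.* q) ℕ.* j))
        q∤m : ¬ q ∣ m
        q∤m = av q pq w<q ℕₚ.≤-refl
        av′ : Avoids Y (m ℕ.* q)
        av′ p pp w<p p≤Y p∣mq with euclidsLemma m q pp p∣mq
        ... | inj₁ p∣m = av p pp w<p (ℕₚ.≤-trans p≤Y (ℕₚ.<⇒≤ Y<q)) p∣m
        ... | inj₂ p∣q = ℕₚ.<⇒≢ (ℕₚ.≤-<-trans p≤Y Y<q) (prime-∣-prime pp pq p∣q)
        len/q : ι len * inv q ≡ ι A + ι c * inv q
        len/q = trans (cong (_* inv q) (trans (cong ι (m≡m%n+[m/n]*n len q)) (trans (ι-+ c (A ℕ.* q)) (cong (ι c +_) (ι-* A q)))))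
          (trans (lem (ι c) (ι A) (ι q) (inv q)) (trans (cong (λ z → ι A * z + ι c * inv q) (ι*inv 1≤q)) (cong (_+ ι c * inv q) (*-identityʳ (ι A)))))
          where
          lem : ∀ c a q i → (c + a * q) * i ≡ a * (q * i) + c * i
          lem = solve-∀ ℚ-ring
        c/q : 0ℚ ≤ ι c * inv q × ι c * inv q ≤ 1ℚ
        c/q = *-nonNeg (ι-≥0 c) (inv-≥0 q) , ≤-trans (*-monoˡ (inv-≥0 q) (ι-mono (ℕₚ.<⇒≤ (m%n<n len q)))) (≤-reflexive (ι*inv 1≤q))
        frac : ∀ i → Within (ι (l i) - ι len * inv q) 1ℚ
        frac i = subst (λ z → Within z 1ℚ) (sym eq) (bitc (i ℕₚ.<? c))
          where
          lem : ∀ a e d → a + e - (a + d) ≡ e - d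
          lem = solve-∀ ℚ-ring
          eq : ι (l i) - ι len * inv q ≡ ι (bit (i ℕₚ.<? c)) - ι c * inv q
          eq = trans (cong₂ _-_ (ι-+ A (bit (i ℕₚ.<? c))) len/q) (lem (ι A) (ι (bit (i ℕₚ.<? c))) (ι c * inv q))
          bitc : ∀ {P : Set} (d : Dec P) → Within (ι (bit d) - ι c * inv q) 1ℚ
          bitc (yes _) rewrite ι-1 = ≤-trans (≤-trans (≤ᵇ⇒≤ { - 1ℚ} {0ℚ} _) (diff≥0 (proj₂ c/q))) ≤-refl , ≤-by (ι c * inv q) (proj₁ c/q) (l1 (ι c * inv q))
            where
            l1 : ∀ d → 1ℚ ≡ 1ℚ - d + d
            l1 = solve-∀ ℚ-ring
          bitc (no _) rewrite ι-0 = ≤-trans (neg-antimono-≤ (proj₂ c/q)) (≤-reflexive (l2 (ι c * inv q))) , ≤-trans (≤-trans (≤-reflexive (sym (l2 (ι c * inv q)))) (neg-antimono-≤ (proj₁ c/q))) 0≤1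
            where
            l2 : ∀ d → - d ≡ 0ℚ - d
            l2 = solve-∀ ℚ-ring
        piece : ∀ i → Within (β i * (FS i - x)) (β i * (η + η))
        piece i = W-* (proj₁ (ub (r ℕ.+ m ℕ.* i))) (subst (λ z → Within z (η + η)) (lem (FS i) μ (ι (l i)) (ι len * inv q))
          (W-+ (h (m ℕ.* q) (r ℕ.+ m ℕ.* i) (l i) av′) (W-unit (frac i) a)))
          where
          lem : ∀ f u l d → (f - u * l) + (l - d) * u ≡ f - u * d
          lem = solve-∀ ℚ-ring
        ∑β : ∑ q β ≡ ι ν
        ∑β = trans (∑-permute pq q∤m r b per) ∑b
        err≤ : ∑ q (λ i → β i * (η + η)) ≤ 2κ * η
        err≤ = ≤-trans (≤-reflexive (trans (∑-*ʳ q (η + η) β) (cong (_* (η + η)) ∑β)))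
          (≤-trans (*-monoˡ (+-nonNeg η≥0 η≥0) (ι-mono ν≤)) (≤-reflexive (lem (ι κ) η)))
          where
          lem : ∀ k e → k * (e + e) ≡ (1ℚ + 1ℚ) * k * e
          lem = solve-∀ ℚ-ring
        total : ∑ q (λ i → β i * (FS i - x)) ≡ ∑ len (λ t → b (r ℕ.+ m ℕ.* t) * F (r ℕ.+ m ℕ.* t)) - δ * μ * ι len
        total = begin
          ∑ q (λ i → β i * (FS i - x))          ≡⟨ ∑-cong q (λ i _ → l1 (β i) (FS i) x) ⟩
          ∑ q (λ i → β i * FS i - β i * x)      ≡⟨ ∑-- q (λ i → β i * FS i) (λ i → β i * x) ⟩
          ∑ q (λ i → β i * FS i) - ∑ q (λ i → β i * x) ≡⟨ cong₂ _-_ (sym lhs) (trans (∑-*ʳ q x β) (trans (cong (_* x) ∑β) (trans (l2 (ι ν) μ (ι len) (inv q)) (cong (λ z → z * μ * ι len) (sym δ≡))))) ⟩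
          ∑ len g - δ * μ * ι len               ∎
          where
          open ≡-Reasoning
          g : ℕ → ℚ
          g t = b (r ℕ.+ m ℕ.* t) * F (r ℕ.+ m ℕ.* t)
          l1 : ∀ b f x → b * (f - x) ≡ b * f - b * x
          l1 = solve-∀ ℚ-ring
          l2 : ∀ n u l i → n * (u * (l * i)) ≡ n * i * u * l
          l2 = solve-∀ ℚ-ring
          arg : ∀ r m i j q → r ℕ.+ m ℕ.* (i ℕ.+ j ℕ.* q) ≡ r ℕ.+ m ℕ.* i ℕ.+ (m ℕ.* q) ℕ.* j
          arg = ℕ-Solver.solve-∀
          arg′ : ∀ r m i j q → r ℕ.+ m ℕ.* (i ℕ.+ j ℕ.* q) ≡ r ℕ.+ m ℕ.* i ℕ.+ (m ℕ.* j) ℕ.* q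
          arg′ = ℕ-Solver.solve-∀
          lhs : ∑ len g ≡ ∑ q (λ i → β i * FS i)
          lhs = trans (cong (λ z → ∑ z g) (trans (m≡m%n+[m/n]*n len q) (ℕₚ.+-comm c (A ℕ.* q)))) (trans (∑-residues q A c g (ℕₚ.<⇒≤ (m%n<n len q)))
            (∑-cong q (λ i _ → trans (∑-cong (l i) (λ j _ → cong₂ _*_ (trans (cong b (arg′ r m i j q)) (per (r ℕ.+ m ℕ.* i) (m ℕ.* j))) (cong F (arg r m i j q))))
              (∑-*ˡ (l i) (β i) (λ j → F (r ℕ.+ m ℕ.* i ℕ.+ (m ℕ.* q) ℕ.* j))))))

    -- C(l)^r dominates the sum, over all choices of at most r of l events, of a factor 2κ per
    -- chosen event.
    C : ℕ → ℕ
    C l = suc (2 ℕ.* κ ℕ.* l)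

    C-suc : ∀ l → C (suc l) ≡ C l ℕ.+ 2 ℕ.* κ
    C-suc l = cong suc (trans (ℕₚ.*-suc (2 ℕ.* κ) l) (ℕₚ.+-comm (2 ℕ.* κ) (2 ℕ.* κ ℕ.* l)))

    C≥1 : ∀ l r → 1 ℕ.≤ C l ℕ.^ r
    C≥1 l r = ℕₚ.m^n>0 (C l) r

    C-step : ∀ η l r → 0ℚ ≤ η → η * ι (C l ℕ.^ suc r) + 2κ * (η * ι (C l ℕ.^ r)) ≤ η * ι (C (suc l) ℕ.^ suc r)
    C-step η l r η≥0 = ≤-trans (≤-reflexive eq) (*-monoʳ η≥0 (ι-mono (begin
      (C l ℕ.+ 2 ℕ.* κ) ℕ.* C l ℕ.^ r     ≡⟨ cong (ℕ._* C l ℕ.^ r) (sym (C-suc l)) ⟩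
      C (suc l) ℕ.* C l ℕ.^ r             ≤⟨ ℕₚ.*-monoʳ-≤ (C (suc l)) (ℕₚ.^-monoˡ-≤ r (s≤s (ℕₚ.*-monoʳ-≤ (2 ℕ.* κ) (ℕₚ.n≤1+n l)))) ⟩
      C (suc l) ℕ.^ suc r                 ∎)))
      where
      open ℕₚ.≤-Reasoning
      x = ι (C l ℕ.^ r)
      lem : ∀ e c k x → e * (c * x) + (1ℚ + 1ℚ) * k * (e * x) ≡ e * ((c + (1ℚ + 1ℚ) * k) * x)
      lem = solve-∀ ℚ-ring
      eq : η * ι (C l ℕ.^ suc r) + 2κ * (η * x) ≡ η * ι ((C l ℕ.+ 2 ℕ.* κ) ℕ.* C l ℕ.^ r)
      eq = trans (cong (λ z → η * z + 2κ * (η * x)) (ι-* (C l) (C l ℕ.^ r))) (trans (lem η (ι (C l)) (ι κ) x) (cong (η *_) (sym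
        (trans (ι-* (C l ℕ.+ 2 ℕ.* κ) (C l ℕ.^ r)) (cong (_* x) (trans (ι-+ (C l) (2 ℕ.* κ)) (cong (ι (C l) +_) (trans (ι-* 2 κ) (cong (_* ι κ) ι-2)))))))))

    η≤ηC : ∀ {η} l r → 0ℚ ≤ η → η ≤ η * ι (C l ℕ.^ r)
    η≤ηC {η} l r h = ≤-trans (≤-reflexive (sym (*-identityʳ η))) (*-monoʳ h (ι-≥1 (C≥1 l r)))

    -- Blocks are disjoint and listed from the top, so every event added during the induction has a
    -- modulus beyond all earlier ones.
    data Chain : ℕ → List Block → Set where
      []  : Chain 0 []
      _∷_ : ∀ {Y B Bs} → Y ℕ.≤ lo B → Chain Y Bs → Chain (hi B) (B ∷ Bs)

    costUp costLow : List Block → ℕ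
    costUp []       = 1
    costUp (B ∷ Bs) = C (len B) ℕ.^ (r B ℕ.+ r B) ℕ.* costUp Bs
    costLow []       = 1
    costLow (B ∷ Bs) = C (len B) ℕ.^ (r B ℕ.+ r B) ℕ.* costLow Bs ℕ.+ C (len B) ℕ.^ suc (r B ℕ.+ r B) ℕ.* costUp Bs

    -- κ ≤ w₀ keeps every density ν/q below 1, as the events have q > w₀.
    module _ (κ≤w₀ : κ ℕ.≤ w₀) (b : ℕ → ℕ → ℚ) (δ : ℕ → ℚ) (ev : ∀ q → Event q (b q) (δ q)) where

      module _ {F : ℕ → ℚ} {Y : ℕ} {μ η : ℚ} (G : Good F Y μ η) (lo : ℕ) (Y≤lo : Y ℕ.≤ lo) where

        bl : ℕ → ℕ → ℚ
        bl n i = b (suc (lo ℕ.+ i)) n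

        δl : ℕ → ℚ
        δl i = δ (suc (lo ℕ.+ i))

        η≥0 : 0ℚ ≤ η
        η≥0 = W⇒0≤ (Good.mean G)

        at : ∀ {F′ μ′ η′} l → Good F′ (suc (lo ℕ.+ l)) μ′ η′ → Good F′ (lo ℕ.+ suc l) μ′ η′
        at {F′} {μ′} {η′} l = subst (λ z → Good F′ z μ′ η′) (sym (ℕₚ.+-suc lo l))

        Good-U : ∀ r l → Good (λ n → U (bl n) (suc r) l * F n) (lo ℕ.+ l) (U δl (suc r) l * μ) (η * ι (C l ℕ.^ r))
        Good-U r zero = Good-cong (λ n → sym (*-identityˡ (F n))) (sym (*-identityˡ μ)) (Good-mono (ℕₚ.≤-trans Y≤lo (ℕₚ.m≤m+n lo 0)) (η≤ηC 0 r η≥0) G)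
        Good-U zero (suc l) = Good-cong (λ n → lem (U (bl n) 1 l) (bl n l) (F n)) (lem (U δl 1 l) (δl l) μ)
          (at l (Good-mono (ℕₚ.n≤1+n (lo ℕ.+ l)) ≤-refl (Good-U 0 l)))
          where
          lem : ∀ u b f → u * f ≡ (u - b * 0ℚ) * f
          lem = solve-∀ ℚ-ring
        Good-U (suc r) (suc l) = Good-cong (λ n → lem (U (bl n) (suc (suc r)) l) (bl n l) (U (bl n) (suc r) l) (F n))
            (lem (U δl (suc (suc r)) l) (δl l) (U δl (suc r) l) μ)
          (at l (Good-mono ℕₚ.≤-refl (C-step η l r η≥0)
            (Good-+
              (Good-mono (ℕₚ.n≤1+n (lo ℕ.+ l)) ≤-refl (Good-U (suc r) l))
              (Good-neg (Good-event (Good-U r l) ℕₚ.≤-refl κ≤w₀ (ev (suc (lo ℕ.+ l))))))))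
          where
          lem : ∀ u b v f → u * f + - (b * (v * f)) ≡ (u - b * v) * f
          lem = solve-∀ ℚ-ring

        Good-E : ∀ r l → Good (λ n → E (bl n) r l * F n) (lo ℕ.+ l) (E δl r l * μ) (η * ι (C l ℕ.^ r))
        Good-E zero l = Good-cong (λ n → sym (*-identityˡ (F n))) (sym (*-identityˡ μ)) (Good-mono (ℕₚ.≤-trans Y≤lo (ℕₚ.m≤m+n lo l)) (η≤ηC l 0 η≥0) G)
        Good-E (suc r) zero = Good-cong (λ n → sym (*-zeroˡ (F n))) (sym (*-zeroˡ μ))
          (Good-mono ℕₚ.≤-refl (*-nonNeg η≥0 (ι-≥0 (C 0 ℕ.^ suc r))) (Good-0 (lo ℕ.+ 0)))
        Good-E (suc r) (suc l) = Good-cong (λ n → lem (E (bl n) (suc r) l) (bl n l) (E (bl n) r l) (F n))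
            (lem (E δl (suc r) l) (δl l) (E δl r l) μ)
          (at l (Good-mono ℕₚ.≤-refl (C-step η l r η≥0)
            (Good-+
              (Good-mono (ℕₚ.n≤1+n (lo ℕ.+ l)) ≤-refl (Good-E (suc r) l))
              (Good-event (Good-E r l) ℕₚ.≤-refl κ≤w₀ (ev (suc (lo ℕ.+ l)))))))
          where
          lem : ∀ u b v f → u * f + b * (v * f) ≡ (u + b * v) * f
          lem = solve-∀ ℚ-ring

      weight : ℕ → ℕ → ℚ
      weight n q = b q n

      Good-Up : ∀ {Y Bs} → Chain Y Bs → Good (λ n → Up Bs (weight n)) Y (Up Bs δ) (ι (costUp Bs))
      Good-Up [] = Good-mono ℕₚ.≤-refl (≤-reflexive (sym ι-1)) (Good-1 0)
      Good-Up {Bs = B ∷ Bs} (Y≤ ∷ ch) = Good-mono ℕₚ.≤-refl (≤-reflexive (eq (costUp Bs) (C (len B) ℕ.^ (r B ℕ.+ r B))))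
        (Good-U (Good-Up ch) (lo B) Y≤ (r B ℕ.+ r B) (len B))
        where
        eq : ∀ x y → ι x * ι y ≡ ι (y ℕ.* x)
        eq x y = trans (sym (ι-* x y)) (cong ι (ℕₚ.*-comm x y))

      Good-Low : ∀ {Y Bs} → Chain Y Bs → Good (λ n → Low Bs (weight n)) Y (Low Bs δ) (ι (costLow Bs))
      Good-Low [] = Good-mono ℕₚ.≤-refl (≤-reflexive (sym ι-1)) (Good-1 0)
      Good-Low {Bs = B ∷ Bs} (Y≤ ∷ ch) = Good-mono ℕₚ.≤-refl (≤-reflexive eq)
        (Good-+
          (Good-U (Good-Low ch) (lo B) Y≤ (r B ℕ.+ r B) (len B))
          (Good-neg (Good-E (Good-Up ch) (lo B) Y≤ (suc (r B ℕ.+ r B)) (len B))))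
        where
        x = C (len B) ℕ.^ (r B ℕ.+ r B)
        y = C (len B) ℕ.^ suc (r B ℕ.+ r B)
        eq : ι (costLow Bs) * ι x + ι (costUp Bs) * ι y ≡ ι (x ℕ.* costLow Bs ℕ.+ y ℕ.* costUp Bs)
        eq = sym (trans (ι-+ (x ℕ.* costLow Bs) (y ℕ.* costUp Bs)) (cong₂ _+_ (trans (ι-* x (costLow Bs)) (*-comm (ι x) (ι (costLow Bs)))) (trans (ι-* y (costUp Bs)) (*-comm (ι y) (ι (costUp Bs))))))

-- Truncated exponential series

module TruncatedExp where

  open import Data.Nat.Base as ℕ using (ℕ; zero; suc; z≤n; s≤s; _!)
  import Data.Nat.Properties as ℕₚ
  open import Data.Rational.Base using (ℚ; 0ℚ; 1ℚ; ½; _+_; _*_; _-_; -_; _≤_; _<_)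
  open import Data.Rational.Properties
  open import Relation.Binary.PropositionalEquality
  import Data.Nat.Tactic.RingSolver as ℕ-Solver
  open import Tactic.RingSolver using (solve-∀)
  open Rationals
  open Character using (1≤suc; 1≤2^; ∑-head)
  open WeightedMertens using (suc-^-≤; ι-2)

  1≤! : ∀ n → 1 ℕ.≤ n !
  1≤! n = ℕ.>-nonZero⁻¹ (n !) {{n ℕₚ.!≢0}}

  t : ℚ → ℕ → ℚ
  t a i = a ^^ i * inv (i !)

  ex : ℚ → ℕ → ℚ
  ex a N = ∑ (suc N) (t a)

  t-0 : ∀ a → t a 0 ≡ 1ℚ
  t-0 a = trans (*-identityˡ (inv 1)) (inv-def 1)

  t-suc : ∀ a i → ι (suc i) * t a (suc i) ≡ a * t a i
  t-suc a i = begin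
    ι (suc i) * (a * a ^^ i * inv (suc i ℕ.* i !))          ≡⟨ cong (λ z → ι (suc i) * (a * a ^^ i * z)) (inv-* (suc i) (i !)) ⟩
    ι (suc i) * (a * a ^^ i * (inv (suc i) * inv (i !)))    ≡⟨ lem (ι (suc i)) a (a ^^ i) (inv (suc i)) (inv (i !)) ⟩
    ι (suc i) * inv (suc i) * (a * (a ^^ i * inv (i !)))    ≡⟨ trans (cong (_* (a * t a i)) (ι*inv {suc i} 1≤suc)) (*-identityˡ (a * t a i)) ⟩
    a * t a i                                               ∎
    where
    open ≡-Reasoning
    lem : ∀ s a p j k → s * (a * p * (j * k)) ≡ s * j * (a * (p * k))
    lem = solve-∀ ℚ-ring

  t-nonNeg : ∀ {a} → 0ℚ ≤ a → ∀ i → 0ℚ ≤ t a i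
  t-nonNeg h i = *-nonNeg (^^-nonNeg h i) (inv-≥0 (i !))

  ex-mono-N : ∀ {a M N} → 0ℚ ≤ a → M ℕ.≤ N → ex a M ≤ ex a N
  ex-mono-N {a} h M≤N = ∑-extend (t a) (s≤s M≤N) (t-nonNeg h)

  ex≥1 : ∀ {a} → 0ℚ ≤ a → ∀ N → 1ℚ ≤ ex a N
  ex≥1 {a} h N = ≤-trans (≤-reflexive (sym (trans (+-identityˡ (t a 0)) (t-0 a)))) (ex-mono-N {a} {0} {N} h z≤n)

  ex-mono : ∀ {a b} → 0ℚ ≤ a → a ≤ b → ∀ N → ex a N ≤ ex b N
  ex-mono h ab N = ∑-mono (suc N) (λ i _ → *-monoˡ (inv-≥0 (i !)) (^^-mono h ab i))


  conv : ℚ → ℚ → ℕ → ℚ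
  conv a b m = ∑ (suc m) (λ i → t a i * t b (m ℕ.∸ i))

  -- Write m + 1 as i + (m + 1 - i) inside the sum and apply `t-suc` to either factor. This yields
  -- the binomial theorem without binomial coefficients.
  conv-suc : ∀ a b m → ι (suc m) * conv a b (suc m) ≡ (a + b) * conv a b m
  conv-suc a b m = begin
    ι (suc m) * conv a b (suc m)
      ≡⟨ sym (∑-*ˡ (suc (suc m)) (ι (suc m)) (λ i → t a i * t b (suc m ℕ.∸ i))) ⟩
    ∑ (suc (suc m)) (λ i → ι (suc m) * (t a i * t b (suc m ℕ.∸ i)))
      ≡⟨ ∑-cong (suc (suc m)) (λ i i< → trans (cong (_* (t a i * t b (suc m ℕ.∸ i))) (trans (cong ι (sym (ℕₚ.m+[n∸m]≡n (ℕₚ.≤-pred i<)))) (ι-+ i (suc m ℕ.∸ i))))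
           (l1 (ι i) (ι (suc m ℕ.∸ i)) (t a i) (t b (suc m ℕ.∸ i)))) ⟩
    ∑ (suc (suc m)) (λ i → f i + g i)
      ≡⟨ ∑-+ (suc (suc m)) f g ⟩
    ∑ (suc (suc m)) f + ∑ (suc (suc m)) g
      ≡⟨ cong₂ _+_ fs gs ⟩
    a * conv a b m + b * conv a b m
      ≡⟨ sym (*-distribʳ-+ (conv a b m) a b) ⟩
    (a + b) * conv a b m ∎
    where
    open ≡-Reasoning
    f g : ℕ → ℚ
    f i = ι i * t a i * t b (suc m ℕ.∸ i)
    g i = t a i * (ι (suc m ℕ.∸ i) * t b (suc m ℕ.∸ i))
    l1 : ∀ i j x y → (i + j) * (x * y) ≡ i * x * y + x * (j * y)
    l1 = solve-∀ ℚ-ring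
    fs : ∑ (suc (suc m)) f ≡ a * conv a b m
    fs = trans (∑-head (suc m) f) (trans (cong₂ _+_ (trans (cong (λ z → z * t a 0 * t b (suc m)) ι-0) (l0 (t a 0) (t b (suc m))))
        (∑-cong (suc m) (λ i _ → trans (cong (_* t b (m ℕ.∸ i)) (t-suc a i)) (*-assoc a (t a i) (t b (m ℕ.∸ i))))))
      (trans (+-identityˡ _) (∑-*ˡ (suc m) a (λ i → t a i * t b (m ℕ.∸ i)))))
      where
      l0 : ∀ x y → 0ℚ * x * y ≡ 0ℚ
      l0 = solve-∀ ℚ-ring
    gs : ∑ (suc (suc m)) g ≡ b * conv a b m
    gs = trans (cong₂ _+_ (∑-cong (suc m) (λ i i< → inner i (ℕₚ.≤-pred i<))) last) (trans (+-identityʳ _) (∑-*ˡ (suc m) b (λ i → t a i * t b (m ℕ.∸ i))))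
      where
      l2 : ∀ x b y → x * (b * y) ≡ b * (x * y)
      l2 = solve-∀ ℚ-ring
      inner : ∀ i → i ℕ.≤ m → g i ≡ b * (t a i * t b (m ℕ.∸ i))
      inner i i≤m = trans (cong (λ z → t a i * (ι z * t b z)) (ℕₚ.+-∸-assoc 1 i≤m)) (trans (cong (t a i *_) (t-suc b (m ℕ.∸ i))) (l2 (t a i) b (t b (m ℕ.∸ i))))
      last : g (suc m) ≡ 0ℚ
      last = trans (cong (λ z → t a (suc m) * (ι z * t b z)) (ℕₚ.n∸n≡0 (suc m))) (trans (cong (λ z → t a (suc m) * (z * t b 0)) ι-0) (l3 (t a (suc m)) (t b 0)))
        where
        l3 : ∀ x y → x * (0ℚ * y) ≡ 0ℚ
        l3 = solve-∀ ℚ-ring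

  conv≡ : ∀ a b m → conv a b m ≡ t (a + b) m
  conv≡ a b zero = trans (cong (0ℚ +_) (cong₂ _*_ (t-0 a) (t-0 b))) (sym (t-0 (a + b)))
  conv≡ a b (suc m) = begin
    conv a b (suc m)                              ≡⟨ sym (c (conv a b (suc m))) ⟩
    inv (suc m) * (ι (suc m) * conv a b (suc m))  ≡⟨ cong (inv (suc m) *_) (trans (conv-suc a b m) (trans (cong ((a + b) *_) (conv≡ a b m)) (sym (t-suc (a + b) m)))) ⟩
    inv (suc m) * (ι (suc m) * t (a + b) (suc m)) ≡⟨ c (t (a + b) (suc m)) ⟩
    t (a + b) (suc m)                             ∎
    where
    open ≡-Reasoning
    lem : ∀ i s x → i * (s * x) ≡ s * i * x
    lem = solve-∀ ℚ-ring
    c : ∀ x → inv (suc m) * (ι (suc m) * x) ≡ x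
    c x = trans (lem (inv (suc m)) (ι (suc m)) x) (trans (cong (_* x) (ι*inv {suc m} 1≤suc)) (*-identityˡ x))

  triangle : ∀ n (F : ℕ → ℕ → ℚ) → ∑ n (λ m → ∑ (suc m) (λ i → F i (m ℕ.∸ i))) ≡ ∑ n (λ i → ∑ (n ℕ.∸ i) (F i))
  triangle zero F = refl
  triangle (suc n) F = begin
    ∑ n (λ m → ∑ (suc m) (λ i → F i (m ℕ.∸ i))) + (∑ n (λ i → F i (n ℕ.∸ i)) + F n (n ℕ.∸ n))
      ≡⟨ cong (_+ (∑ n (λ i → F i (n ℕ.∸ i)) + F n (n ℕ.∸ n))) (triangle n F) ⟩
    ∑ n (λ i → ∑ (n ℕ.∸ i) (F i)) + (∑ n (λ i → F i (n ℕ.∸ i)) + F n (n ℕ.∸ n))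
      ≡⟨ sym (+-assoc (∑ n (λ i → ∑ (n ℕ.∸ i) (F i))) (∑ n (λ i → F i (n ℕ.∸ i))) (F n (n ℕ.∸ n))) ⟩
    ∑ n (λ i → ∑ (n ℕ.∸ i) (F i)) + ∑ n (λ i → F i (n ℕ.∸ i)) + F n (n ℕ.∸ n)
      ≡⟨ cong₂ _+_ (trans (sym (∑-+ n (λ i → ∑ (n ℕ.∸ i) (F i)) (λ i → F i (n ℕ.∸ i)))) (∑-cong n (λ i i< → cong (λ z → ∑ z (F i)) (sym (ℕₚ.+-∸-assoc 1 (ℕₚ.<⇒≤ i<)))))) last ⟩
    ∑ n (λ i → ∑ (suc n ℕ.∸ i) (F i)) + ∑ (suc n ℕ.∸ n) (F n) ∎
    where
    open ≡-Reasoning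
    last : F n (n ℕ.∸ n) ≡ ∑ (suc n ℕ.∸ n) (F n)
    last = trans (cong (F n) (ℕₚ.n∸n≡0 n)) (trans (sym (+-identityˡ (F n 0))) (cong (λ z → ∑ z (F n)) (sym (trans (ℕₚ.+-∸-assoc 1 (ℕₚ.≤-refl {n})) (cong suc (ℕₚ.n∸n≡0 n))))))

  ex-+ : ∀ a b N → ex (a + b) N ≡ ∑ (suc N) (λ i → t a i * ∑ (suc N ℕ.∸ i) (t b))
  ex-+ a b N = trans (∑-cong (suc N) (λ m _ → sym (conv≡ a b m))) (trans (triangle (suc N) (λ i j → t a i * t b j))
    (∑-cong (suc N) (λ i _ → ∑-*ˡ (suc N ℕ.∸ i) (t a i) (t b))))

  -- The left side is the triangular part of the square of terms on the right.
  ex-+-≤ : ∀ {a b} → 0ℚ ≤ a → 0ℚ ≤ b → ∀ N → ex (a + b) N ≤ ex a N * ex b N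
  ex-+-≤ {a} {b} ha hb N = ≤-trans (≤-reflexive (ex-+ a b N)) (≤-trans (∑-mono (suc N) (λ i _ → *-monoʳ (t-nonNeg ha i) (∑-extend (t b) (ℕₚ.m∸n≤m (suc N) i) (t-nonNeg hb))))
    (≤-reflexive (∑-*ʳ (suc N) (ex b N) (t a))))

  1^^ : ∀ n → 1ℚ ^^ n ≡ 1ℚ
  1^^ zero = refl
  1^^ (suc n) = trans (*-identityˡ (1ℚ ^^ n)) (1^^ n)

  2^≤! : ∀ n → 2 ℕ.^ n ℕ.≤ (suc n) !
  2^≤! zero = ℕₚ.≤-refl
  2^≤! (suc n) = ℕₚ.*-mono-≤ {2} {suc (suc n)} (s≤s (s≤s z≤n)) (2^≤! n)

  -- Comparison with a geometric series through (N + 1)! ≥ 2^N; its remainder is kept for the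
  -- induction.
  ex-1 : ∀ N → ex 1ℚ N ≤ 1ℚ + (1ℚ + 1ℚ) - (1ℚ + 1ℚ) * inv (2 ℕ.^ N)
  ex-1 zero = ≤-trans (≤-reflexive (trans (+-identityˡ (t 1ℚ 0)) (t-0 1ℚ))) (≤-reflexive (cong (λ z → 1ℚ + (1ℚ + 1ℚ) - (1ℚ + 1ℚ) * z) (sym (inv-def 1))))
  ex-1 (suc N) = begin
    ex 1ℚ N + t 1ℚ (suc N)                                    ≤⟨ +-mono-≤ (ex-1 N) term ⟩
    1ℚ + (1ℚ + 1ℚ) - (1ℚ + 1ℚ) * inv (2 ℕ.^ N) + inv (2 ℕ.^ N) ≡⟨ lem (inv (2 ℕ.^ N)) ⟩
    1ℚ + (1ℚ + 1ℚ) - (1ℚ + 1ℚ) * (½ * inv (2 ℕ.^ N))          ≡⟨ cong (λ z → 1ℚ + (1ℚ + 1ℚ) - (1ℚ + 1ℚ) * z) (sym half) ⟩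
    1ℚ + (1ℚ + 1ℚ) - (1ℚ + 1ℚ) * inv (2 ℕ.^ suc N)            ∎
    where
    open ≤-Reasoning
    lem : ∀ x → 1ℚ + (1ℚ + 1ℚ) - (1ℚ + 1ℚ) * x + x ≡ 1ℚ + (1ℚ + 1ℚ) - (1ℚ + 1ℚ) * (½ * x)
    lem = solve-∀ ℚ-ring
    half : inv (2 ℕ.^ suc N) ≡ ½ * inv (2 ℕ.^ N)
    half = trans (inv-* 2 (2 ℕ.^ N)) (cong (_* inv (2 ℕ.^ N)) (inv-def 2))
    term : t 1ℚ (suc N) ≤ inv (2 ℕ.^ N)
    term = ≤-trans (≤-reflexive (trans (cong (_* inv (suc N !)) (1^^ (suc N))) (*-identityˡ (inv (suc N !))))) (inv-anti (1≤2^ N) (2^≤! N))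

  4ℚ : ℚ
  4ℚ = 1ℚ + 1ℚ + (1ℚ + 1ℚ)

  ι-4 : ι 4 ≡ 4ℚ
  ι-4 = trans (ι-+ 2 2) (cong₂ _+_ ι-2 ι-2)

  ex-1≤4 : ∀ N → ex 1ℚ N ≤ 4ℚ
  ex-1≤4 N = ≤-trans (ex-1 N) (≤-by (1ℚ + (1ℚ + 1ℚ) * inv (2 ℕ.^ N)) (+-nonNeg 0≤1 (*-nonNeg {1ℚ + 1ℚ} (≤ᵇ⇒≤ _) (inv-≥0 (2 ℕ.^ N)))) (lem (inv (2 ℕ.^ N))))
    where
    lem : ∀ x → 1ℚ + 1ℚ + (1ℚ + 1ℚ) ≡ 1ℚ + (1ℚ + 1ℚ) - (1ℚ + 1ℚ) * x + (1ℚ + (1ℚ + 1ℚ) * x)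
    lem = solve-∀ ℚ-ring

  ex-0 : ∀ N → ex 0ℚ N ≡ 1ℚ
  ex-0 zero = trans (+-identityˡ (t 0ℚ 0)) (t-0 0ℚ)
  ex-0 (suc N) = trans (cong₂ _+_ (ex-0 N) (trans (cong (_* inv (suc N !)) (*-zeroˡ (0ℚ ^^ N))) (*-zeroˡ (inv (suc N !))))) (+-identityʳ 1ℚ)

  ex-≤4^ : ∀ n N → ex (ι n) N ≤ ι (4 ℕ.^ n)
  ex-≤4^ zero N = ≤-reflexive (trans (cong (λ z → ex z N) ι-0) (trans (ex-0 N) (sym ι-1)))
  ex-≤4^ (suc n) N = ≤-trans (≤-reflexive (cong (λ z → ex z N) (ι-suc n))) (≤-trans (ex-+-≤ 0≤1 (ι-≥0 n) N)
    (≤-trans (*-mono (≤-trans 0≤1 (ex≥1 0≤1 N)) (ex-1≤4 N) (≤-trans 0≤1 (ex≥1 (ι-≥0 n) N)) (ex-≤4^ n N))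
      (≤-reflexive (trans (cong (_* ι (4 ℕ.^ n)) (sym ι-4)) (sym (ι-* 4 (4 ℕ.^ n)))))))

  -- From the first two terms of e(x).
  ex-step : ∀ {a x} → 0ℚ ≤ a → 0ℚ ≤ x → ∀ N → (1ℚ + x) * ex a N ≤ ex (a + x) (suc N)
  ex-step {a} {x} ha hx N = begin
    (1ℚ + x) * ex a N                              ≡⟨ cong (_* ex a N) (sym first2) ⟩
    ∑ 2 (t x) * ex a N                             ≡⟨ sym (∑-*ʳ 2 (ex a N) (t x)) ⟩
    ∑ 2 (λ i → t x i * ex a N)                     ≤⟨ ∑-mono 2 (λ i i< → *-monoʳ (t-nonNeg hx i) (∑-extend (t a) (le i i<) (t-nonNeg ha))) ⟩
    ∑ 2 (λ i → t x i * ∑ (suc (suc N) ℕ.∸ i) (t a)) ≤⟨ ∑-extend {2} {suc (suc N)} (λ i → t x i * ∑ (suc (suc N) ℕ.∸ i) (t a)) (s≤s (s≤s z≤n)) (λ i → *-nonNeg (t-nonNeg hx i) (∑-nonNeg (suc (suc N) ℕ.∸ i) (λ j _ → t-nonNeg ha j))) ⟩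
    ∑ (suc (suc N)) (λ i → t x i * ∑ (suc (suc N) ℕ.∸ i) (t a)) ≡⟨ sym (ex-+ x a (suc N)) ⟩
    ex (x + a) (suc N)                             ≡⟨ cong (λ z → ex z (suc N)) (+-comm x a) ⟩
    ex (a + x) (suc N)                             ∎
    where
    open ≤-Reasoning
    t-1 : t x 1 ≡ x
    t-1 = trans (cong (x * 1ℚ *_) (inv-def 1)) (trans (*-identityʳ (x * 1ℚ)) (*-identityʳ x))
    first2 : ∑ 2 (t x) ≡ 1ℚ + x
    first2 = cong₂ _+_ (trans (+-identityˡ (t x 0)) (t-0 x)) t-1
    le : ∀ i → i ℕ.< 2 → suc N ℕ.≤ suc (suc N) ℕ.∸ i
    le 0 _ = ℕₚ.n≤1+n (suc N)
    le 1 _ = ℕₚ.≤-refl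
    le (suc (suc _)) (s≤s (s≤s ()))

  ∏⁺ : ℕ → (ℕ → ℚ) → ℚ
  ∏⁺ zero    x = 1ℚ
  ∏⁺ (suc l) x = ∏⁺ l x * (1ℚ + x l)

  ∏⁺-≤ : ∀ l x → (∀ i → 0ℚ ≤ x i) → ∏⁺ l x ≤ ex (∑ l x) l
  ∏⁺-≤ zero x h = ≤-reflexive (sym (ex-0 0))
  ∏⁺-≤ (suc l) x h = ≤-trans (*-monoˡ (+-nonNeg 0≤1 (h l)) (∏⁺-≤ l x h))
    (≤-trans (≤-reflexive (*-comm (ex (∑ l x) l) (1ℚ + x l))) (ex-step (∑-nonNeg l (λ i _ → h i)) (h l) l))

  -- Weak Stirling: each step uses (1 + 1/n)^n ≤ 4.
  self-power : ∀ n → n ℕ.^ n ℕ.≤ 4 ℕ.^ n ℕ.* n !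
  self-power zero = ℕₚ.≤-refl
  self-power (suc n) = begin
    suc n ℕ.* suc n ℕ.^ n               ≤⟨ ℕₚ.*-monoʳ-≤ (suc n) (suc-^-≤ n) ⟩
    suc n ℕ.* (4 ℕ.* n ℕ.^ n)           ≤⟨ ℕₚ.*-monoʳ-≤ (suc n) (ℕₚ.*-monoʳ-≤ 4 (self-power n)) ⟩
    suc n ℕ.* (4 ℕ.* (4 ℕ.^ n ℕ.* n !)) ≡⟨ lem (suc n) (4 ℕ.^ n) (n !) ⟩
    4 ℕ.* 4 ℕ.^ n ℕ.* (suc n ℕ.* n !)   ∎
    where
    open ℕₚ.≤-Reasoning
    lem : ∀ a b c → a ℕ.* (4 ℕ.* (b ℕ.* c)) ≡ 4 ℕ.* b ℕ.* (a ℕ.* c)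
    lem = ℕ-Solver.solve-∀

-- Densities of the sieve over the primes congruent to 3 modulo 4

module SiftingDensity where

  open import Data.Nat.Base as ℕ using (ℕ; zero; suc; z≤n; s≤s; _!)
  import Data.Nat.Properties as ℕₚ
  import Data.Nat.Tactic.RingSolver as ℕ-Solver
  import Data.Integer.Base as ℤ
  open import Data.Rational.Base using (ℚ; 0ℚ; 1ℚ; ½; _+_; _*_; _-_; -_; _≤_; _<_; _/_)
  open import Data.Rational.Properties
  open import Data.Product.Base using (_×_; _,_; proj₁; proj₂)
  open import Relation.Binary.PropositionalEquality
  open import Tactic.RingSolver using (solve-∀)
  open Rationals
  open Character using (𝟙-≥0; 𝟙-≤1)
  open WeightedMertens using (ι-2)
  open MertensModFour using (π3; π3≥0; P3?; P3-sum)
  open BrunHooley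
  open TruncatedExp

  pow-step : ∀ {a b} → 0ℚ ≤ a → 0ℚ ≤ b → ∀ n → a ^^ suc n + ι (suc n) * (b * a ^^ n) ≤ (a + b) ^^ suc n
  pow-step {a} {b} ha hb zero = ≤-reflexive (trans (cong (λ z → a * 1ℚ + z * (b * 1ℚ)) ι-1) (lem a b))
    where
    lem : ∀ a b → a * 1ℚ + 1ℚ * (b * 1ℚ) ≡ (a + b) * 1ℚ
    lem = solve-∀ ℚ-ring
  pow-step {a} {b} ha hb (suc n) = begin
    a ^^ suc (suc n) + ι (suc (suc n)) * (b * a ^^ suc n)   ≡⟨ cong (λ z → a ^^ suc (suc n) + z * (b * a ^^ suc n)) (ι-suc (suc n)) ⟩
    a * (a * p) + (1ℚ + m) * (b * (a * p))                  ≤⟨ ≤-by (m * (b * (b * p))) (*-nonNeg (ι-≥0 (suc n)) (*-nonNeg hb (*-nonNeg hb (^^-nonNeg ha n)))) (lem a b p m) ⟩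
    (a + b) * (a * p + m * (b * p))                         ≤⟨ *-monoʳ (+-nonNeg ha hb) (pow-step ha hb n) ⟩
    (a + b) ^^ suc (suc n)                                  ∎
    where
    open ≤-Reasoning
    p = a ^^ n
    m = ι (suc n)
    lem : ∀ a b p m → (a + b) * (a * p + m * (b * p)) ≡ a * (a * p) + (1ℚ + m) * (b * (a * p)) + m * (b * (b * p))
    lem = solve-∀ ℚ-ring

  -- The r-th power of the sum contains every squarefree product of degree r exactly r! times.
  E-bound : ∀ {β} → (∀ i → 0ℚ ≤ β i) → ∀ r l → ι (r !) * E β r l ≤ (∑ l β) ^^ r
  E-bound h zero l = ≤-reflexive (trans (cong (_* 1ℚ) ι-1) (*-identityˡ 1ℚ))
  E-bound h (suc r) zero = ≤-reflexive (trans (*-zeroʳ (ι (suc r !))) (sym (*-zeroˡ (0ℚ ^^ r))))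
  E-bound {β} h (suc r) (suc l) = begin
    ι (suc r !) * (E β (suc r) l + β l * E β r l)     ≡⟨ *-distribˡ-+ (ι (suc r !)) (E β (suc r) l) (β l * E β r l) ⟩
    ι (suc r !) * E β (suc r) l + ι (suc r !) * (β l * E β r l) ≡⟨ cong (λ z → ι (suc r !) * E β (suc r) l + z * (β l * E β r l)) (ι-* (suc r) (r !)) ⟩
    ι (suc r !) * E β (suc r) l + ι (suc r) * ι (r !) * (β l * E β r l) ≡⟨ cong (ι (suc r !) * E β (suc r) l +_) (lem (ι (suc r)) (ι (r !)) (β l) (E β r l)) ⟩
    ι (suc r !) * E β (suc r) l + ι (suc r) * (β l * (ι (r !) * E β r l)) ≤⟨ +-mono-≤ (E-bound h (suc r) l) (*-monoʳ (ι-≥0 (suc r)) (*-monoʳ (h l) (E-bound h r l))) ⟩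
    S ^^ suc r + ι (suc r) * (β l * S ^^ r)           ≤⟨ pow-step (∑-nonNeg l (λ i _ → h i)) (h l) r ⟩
    (S + β l) ^^ suc r                                ∎
    where
    open ≤-Reasoning
    S = ∑ l β
    lem : ∀ a b c d → a * b * (c * d) ≡ a * (c * (b * d))
    lem = solve-∀ ℚ-ring

  V-lower : ∀ {β} → Unit β → ∀ l → 1ℚ - ∑ l β ≤ V β l
  V-lower u zero = ≤-refl
  V-lower {β} u (suc l) = begin
    1ℚ - (∑ l β + β l)          ≡⟨ lem (∑ l β) (β l) ⟩
    (1ℚ - ∑ l β) - β l * 1ℚ     ≤⟨ +-mono-≤ (V-lower u l) (neg-antimono-≤ (*-monoʳ (proj₁ (u l)) (proj₂ (V-unit u l)))) ⟩
    V β l - β l * V β l         ≡⟨ lem₂ (V β l) (β l) ⟩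
    V β l * (1ℚ - β l)          ∎
    where
    open ≤-Reasoning
    lem : ∀ s b → 1ℚ - (s + b) ≡ (1ℚ - s) - b * 1ℚ
    lem = solve-∀ ℚ-ring
    lem₂ : ∀ v b → v - b * v ≡ v * (1ℚ - b)
    lem₂ = solve-∀ ℚ-ring

  V-split : ∀ β m n → V β (m ℕ.+ n) ≡ V β m * V (λ i → β (m ℕ.+ i)) n
  V-split β m zero = trans (cong (V β) (ℕₚ.+-identityʳ m)) (sym (*-identityʳ (V β m)))
  V-split β m (suc n) = trans (cong (V β) (ℕₚ.+-suc m n)) (trans (cong (_* (1ℚ - β (m ℕ.+ n))) (V-split β m n)) (*-assoc (V β m) (V (λ i → β (m ℕ.+ i)) n) (1ℚ - β (m ℕ.+ n))))

  V-anti : ∀ {β γ} → Unit γ → ∀ l → (∀ i → i ℕ.< l → β i ≤ γ i) → V γ l ≤ V β l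
  V-anti u zero h = ≤-refl
  V-anti u (suc l) h = *-mono (proj₁ (V-unit u l)) (V-anti u l (λ i i< → h i (ℕₚ.m<n⇒m<1+n i<))) (diff≥0 (proj₂ (u l))) (+-monoʳ-≤ 1ℚ (neg-antimono-≤ (h l ℕₚ.≤-refl)))

  -- (1 - b)(1 + 2b) = 1 + b (1 - 2b), which is at least 1 for 0 ≤ b ≤ 1/2.
  V-∏⁺ : ∀ {β} → (∀ i → 0ℚ ≤ β i × β i ≤ ½) → ∀ l → 1ℚ ≤ V β l * ∏⁺ l (λ i → (1ℚ + 1ℚ) * β i)
  V-∏⁺ h zero = ≤-refl
  V-∏⁺ {β} h (suc l) = ≤-trans (V-∏⁺ h l) (≤-by (v * p * (b * (1ℚ - (1ℚ + 1ℚ) * b))) (*-nonNeg (≤-trans 0≤1 (V-∏⁺ h l)) (*-nonNeg (proj₁ (h l)) (diff≥0 {(1ℚ + 1ℚ) * b} {1ℚ} (≤-trans (*-monoʳ {1ℚ + 1ℚ} (≤ᵇ⇒≤ _) (proj₂ (h l))) (≤ᵇ⇒≤ _))))) (lem v p b))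
    where
    v = V β l
    p = ∏⁺ l (λ i → (1ℚ + 1ℚ) * β i)
    b = β l
    lem : ∀ v p b → v * (1ℚ - b) * (p * (1ℚ + (1ℚ + 1ℚ) * b)) ≡ v * p + v * p * (b * (1ℚ - (1ℚ + 1ℚ) * b))
    lem = solve-∀ ℚ-ring

  ½≤1 : ½ ≤ 1ℚ
  ½≤1 = ≤ᵇ⇒≤ _

  V-exp : ∀ {β} → (∀ i → 0ℚ ≤ β i × β i ≤ ½) → ∀ l S → ∑ l β ≤ ι S → 1ℚ ≤ V β l * ι (4 ℕ.^ (2 ℕ.* S))
  V-exp {β} h l S ∑≤ = ≤-trans (V-∏⁺ h l) (*-monoʳ (proj₁ (V-unit (λ i → proj₁ (h i) , ≤-trans (proj₂ (h i)) ½≤1) l)) (begin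
    ∏⁺ l (λ i → (1ℚ + 1ℚ) * β i)      ≤⟨ ∏⁺-≤ l (λ i → (1ℚ + 1ℚ) * β i) (λ i → *-nonNeg {1ℚ + 1ℚ} (≤ᵇ⇒≤ _) (proj₁ (h i))) ⟩
    ex (∑ l (λ i → (1ℚ + 1ℚ) * β i)) l ≡⟨ cong (λ z → ex z l) (∑-*ˡ l (1ℚ + 1ℚ) β) ⟩
    ex ((1ℚ + 1ℚ) * ∑ l β) l           ≤⟨ ex-mono (*-nonNeg {1ℚ + 1ℚ} (≤ᵇ⇒≤ _) (∑-nonNeg l (λ i _ → proj₁ (h i)))) (≤-trans (*-monoʳ {1ℚ + 1ℚ} (≤ᵇ⇒≤ _) ∑≤) (≤-reflexive (sym (trans (ι-* 2 S) (cong (_* ι S) ι-2))))) l ⟩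
    ex (ι (2 ℕ.* S)) l                 ≤⟨ ex-≤4^ (2 ℕ.* S) l ⟩
    ι (4 ℕ.^ (2 ℕ.* S))                ∎))
    where open ≤-Reasoning

  -- Sums and products over the primes p ≡ 3 (mod 4) in (2^A, 2^B].

  width : ℕ → ℕ → ℕ
  width A B = 2 ℕ.^ B ℕ.∸ 2 ℕ.^ A

  from : (ℕ → ℚ) → ℕ → ℕ → ℚ
  from δ A i = δ (suc (2 ℕ.^ A ℕ.+ i))

  mass : ℕ → ℕ → ℚ
  mass A B = ∑ (width A B) (from π3 A)

  V3 : ℕ → ℕ → ℚ
  V3 A B = V (from π3 A) (width A B)

  π3-unit : Unit π3
  π3-unit q = π3≥0 q , ≤-trans (*-mono (𝟙-≥0 (P3? q)) (𝟙-≤1 (P3? q)) (inv-≥0 q) (inv-≤1 q)) (≤-reflexive (*-identityˡ 1ℚ))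

  from-unit : ∀ A → Unit (from π3 A)
  from-unit A i = π3-unit (suc (2 ℕ.^ A ℕ.+ i))

  width-+ : ∀ {A B C} → A ℕ.≤ B → B ℕ.≤ C → width A C ≡ width A B ℕ.+ width B C
  width-+ {A} {B} {C} A≤B B≤C = sym (begin
    (2 ℕ.^ B ℕ.∸ 2 ℕ.^ A) ℕ.+ (2 ℕ.^ C ℕ.∸ 2 ℕ.^ B) ≡⟨ ℕₚ.+-comm (2 ℕ.^ B ℕ.∸ 2 ℕ.^ A) _ ⟩
    (2 ℕ.^ C ℕ.∸ 2 ℕ.^ B) ℕ.+ (2 ℕ.^ B ℕ.∸ 2 ℕ.^ A) ≡⟨ sym (ℕₚ.+-∸-assoc (2 ℕ.^ C ℕ.∸ 2 ℕ.^ B) (ℕₚ.^-monoʳ-≤ 2 A≤B)) ⟩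
    (2 ℕ.^ C ℕ.∸ 2 ℕ.^ B) ℕ.+ 2 ℕ.^ B ℕ.∸ 2 ℕ.^ A   ≡⟨ cong (ℕ._∸ 2 ℕ.^ A) (ℕₚ.m∸n+n≡m (ℕₚ.^-monoʳ-≤ 2 B≤C)) ⟩
    2 ℕ.^ C ℕ.∸ 2 ℕ.^ A                             ∎)
    where open ≡-Reasoning

  from-shift : ∀ δ {A B} → A ℕ.≤ B → ∀ i → from δ A (width A B ℕ.+ i) ≡ from δ B i
  from-shift δ {A} {B} A≤B i = cong (λ z → δ (suc z)) (trans (sym (ℕₚ.+-assoc (2 ℕ.^ A) (width A B) i)) (cong (ℕ._+ i) (ℕₚ.m+[n∸m]≡n (ℕₚ.^-monoʳ-≤ 2 A≤B))))

  V-cong : ∀ {β γ} l → (∀ i → i ℕ.< l → β i ≡ γ i) → V β l ≡ V γ l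
  V-cong zero h = refl
  V-cong (suc l) h = cong₂ (λ x y → x * (1ℚ - y)) (V-cong l (λ i i< → h i (ℕₚ.m<n⇒m<1+n i<))) (h l ℕₚ.≤-refl)

  ∑-range : ∀ δ {A B C} → A ℕ.≤ B → B ℕ.≤ C → ∑ (width A C) (from δ A) ≡ ∑ (width A B) (from δ A) + ∑ (width B C) (from δ B)
  ∑-range δ {A} {B} {C} A≤B B≤C = trans (cong (λ z → ∑ z (from δ A)) (width-+ A≤B B≤C)) (trans (∑-split (width A B) (width B C) (from δ A))
    (cong (∑ (width A B) (from δ A) +_) (∑-cong (width B C) (λ i _ → from-shift δ A≤B i))))

  V-range : ∀ δ {A B C} → A ℕ.≤ B → B ℕ.≤ C → V (from δ A) (width A C) ≡ V (from δ A) (width A B) * V (from δ B) (width B C)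
  V-range δ {A} {B} {C} A≤B B≤C = trans (cong (V (from δ A)) (width-+ A≤B B≤C)) (trans (V-split (from δ A) (width A B) (width B C))
    (cong (V (from δ A) (width A B) *_) (V-cong (width B C) (λ i _ → from-shift δ A≤B i))))

  mass≥0 : ∀ A B → 0ℚ ≤ mass A B
  mass≥0 A B = ∑-nonNeg (width A B) (λ i _ → proj₁ (from-unit A i))

  V3≥0 : ∀ A B → 0ℚ ≤ V3 A B
  V3≥0 A B = proj₁ (V-unit (from-unit A) (width A B))

  V3-lower : ∀ A B → 1ℚ - mass A B ≤ V3 A B
  V3-lower A B = V-lower (from-unit A) (width A B)

  mass-bound : ∀ A B → A ℕ.≤ B → ι (2 ℕ.* A) * mass A B ≤ ι (B ℕ.∸ A ℕ.+ 111)
  mass-bound A B A≤B = ≤-trans (≤-reflexive (cong (_* mass A B) (trans (ι-* 2 A) (cong (_* ι A) ι-2)))) (P3-sum A B A≤B)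

  -- (A + 111)/(2A) ≤ 56, with equality of the bounds at A = 1.
  mass-doubling : ∀ A → 1 ℕ.≤ A → mass A (2 ℕ.* A) ≤ ι 56
  mass-doubling A 1≤A = *-cancelˡ {ι (2 ℕ.* A)} (ι->0 (ℕₚ.≤-trans 1≤A (ℕₚ.m≤m+n A (A ℕ.+ 0)))) (≤-trans (mass-bound A (2 ℕ.* A) (ℕₚ.m≤m+n A (A ℕ.+ 0)))
    (≤-trans (ι-mono (ℕₚ.≤-trans (ℕₚ.+-monoˡ-≤ 111 (ℕₚ.≤-reflexive (trans (ℕₚ.m+n∸m≡n A (A ℕ.+ 0)) (ℕₚ.+-identityʳ A)))) (ℕₚ.≤-trans (ℕₚ.+-monoʳ-≤ A (ℕₚ.*-monoʳ-≤ 111 1≤A)) (ℕₚ.≤-reflexive (lem A)))))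
      (≤-reflexive (ι-* (2 ℕ.* A) 56))))
    where
    lem : ∀ A → A ℕ.+ 111 ℕ.* A ≡ 2 ℕ.* A ℕ.* 56
    lem = ℕ-Solver.solve-∀

  -- The density 1/2 with one per cent to spare: (u + 111)/(2um) ≤ c₀/m once 111 is at most u/100,
  -- that is, u ≥ 11100.
  c₀ : ℚ
  c₀ = (ℤ.+ 101) / 200

  mass-piece : ∀ u m → 11100 ℕ.≤ u → 1 ℕ.≤ m → mass (u ℕ.* m) (u ℕ.* suc m) ≤ c₀ * inv m
  mass-piece u m big 1≤m = *-cancelˡ {ι (200 ℕ.* u ℕ.* m)} (ι->0 (ℕₚ.*-mono-≤ (ℕₚ.*-mono-≤ {1} {200} (s≤s z≤n) 1≤u) 1≤m)) (begin
    ι (200 ℕ.* u ℕ.* m) * x                        ≡⟨ cong (_* x) (trans (cong ι (l1 u m)) (ι-* 100 (2 ℕ.* (u ℕ.* m)))) ⟩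
    ι 100 * ι (2 ℕ.* (u ℕ.* m)) * x                ≡⟨ *-assoc (ι 100) (ι (2 ℕ.* (u ℕ.* m))) x ⟩
    ι 100 * (ι (2 ℕ.* (u ℕ.* m)) * x)              ≤⟨ *-monoʳ (ι-≥0 100) (mass-bound (u ℕ.* m) (u ℕ.* suc m) (ℕₚ.*-monoʳ-≤ u (ℕₚ.n≤1+n m))) ⟩
    ι 100 * ι (u ℕ.* suc m ℕ.∸ u ℕ.* m ℕ.+ 111)    ≡⟨ trans (cong (λ z → ι 100 * ι (z ℕ.+ 111)) (trans (cong (ℕ._∸ u ℕ.* m) (ℕₚ.*-suc u m)) (ℕₚ.m+n∸n≡m u (u ℕ.* m)))) (sym (ι-* 100 (u ℕ.+ 111))) ⟩
    ι (100 ℕ.* (u ℕ.+ 111))                        ≤⟨ ι-mono (ℕₚ.≤-trans (ℕₚ.≤-reflexive (ℕₚ.*-distribˡ-+ 100 u 111)) (ℕₚ.≤-trans (ℕₚ.+-monoʳ-≤ (100 ℕ.* u) big) (ℕₚ.≤-reflexive (ℕₚ.+-comm (100 ℕ.* u) u)))) ⟩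
    ι (101 ℕ.* u)                                  ≡⟨ ι-* 101 u ⟩
    ι 101 * ι u                                    ≡⟨ trans (sym (*-identityʳ (ι 101 * ι u))) (cong (ι 101 * ι u *_) (sym (ι*inv 1≤m))) ⟩
    ι 101 * ι u * (ι m * inv m)                    ≡⟨ cong (λ z → z * ι u * (ι m * inv m)) (trans (ι-def 101) (trans e (cong (_* c₀) (sym (ι-def 200))))) ⟩
    ι 200 * c₀ * ι u * (ι m * inv m)               ≡⟨ l2 (ι 200) c₀ (ι u) (ι m) (inv m) ⟩
    ι 200 * ι u * ι m * (c₀ * inv m)               ≡⟨ cong (_* (c₀ * inv m)) (sym (trans (ι-* (200 ℕ.* u) m) (cong (_* ι m) (ι-* 200 u)))) ⟩
    ι (200 ℕ.* u ℕ.* m) * (c₀ * inv m)             ∎)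
    where
    open ≤-Reasoning
    1≤u = ℕₚ.≤-trans {1} {11100} (s≤s z≤n) big
    x = mass (u ℕ.* m) (u ℕ.* suc m)
    e : (ℤ.+ 101) / 1 ≡ (ℤ.+ 200) / 1 * c₀
    e = refl
    l1 : ∀ u m → 200 ℕ.* u ℕ.* m ≡ 100 ℕ.* (2 ℕ.* (u ℕ.* m))
    l1 = ℕ-Solver.solve-∀
    l2 : ∀ a c u m i → a * c * u * (m * i) ≡ a * u * m * (c * i)
    l2 = solve-∀ ℚ-ring

  mass-pieces : ∀ u a n → 11100 ℕ.≤ u → 1 ℕ.≤ a → mass (u ℕ.* a) (u ℕ.* (a ℕ.+ n)) ≤ ∑ n (λ j → c₀ * inv (a ℕ.+ j))
  mass-pieces u a zero big 1≤a = ≤-reflexive (trans (cong (λ z → mass (u ℕ.* a) (u ℕ.* z)) (ℕₚ.+-identityʳ a)) (cong (λ z → ∑ z (from π3 (u ℕ.* a))) (ℕₚ.n∸n≡0 (2 ℕ.^ (u ℕ.* a)))))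
  mass-pieces u a (suc n) big 1≤a = ≤-trans (≤-reflexive (trans (cong (λ z → mass (u ℕ.* a) (u ℕ.* z)) (ℕₚ.+-suc a n))
      (∑-range π3 (ℕₚ.*-monoʳ-≤ u (ℕₚ.m≤m+n a n)) (ℕₚ.*-monoʳ-≤ u (ℕₚ.n≤1+n (a ℕ.+ n))))))
    (+-mono-≤ (mass-pieces u a n big 1≤a) (mass-piece u (a ℕ.+ n) big (ℕₚ.≤-trans 1≤a (ℕₚ.m≤m+n a n))))

  -- Literal fractions in place of the opaque `inv`, so that the numerical comparisons can be
  -- decided by evaluation.
  lit-sum : ℕ → ℕ → ℚ
  lit-sum a n = ∑ n (λ j → c₀ * ((ℤ.+ 1) / suc (a ℕ.+ j)))

  mass-lit : ∀ u a n → 11100 ℕ.≤ u → mass (u ℕ.* suc a) (u ℕ.* (suc a ℕ.+ n)) ≤ lit-sum a n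
  mass-lit u a n big = ≤-trans (mass-pieces u (suc a) n big (s≤s z≤n)) (≤-reflexive (∑-cong n (λ j _ → cong (c₀ *_) (inv-def (suc (a ℕ.+ j))))))

  ¾ ⅜ : ℚ
  ¾ = (ℤ.+ 3) / 4
  ⅜ = (ℤ.+ 3) / 8

  -- (101/200)(1/4 + ... + 1/15) is barely below 3/4.
  mass-4 : ∀ u → 11100 ℕ.≤ u → mass (u ℕ.* 4) (u ℕ.* 16) ≤ ¾
  mass-4 u big = ≤-trans (mass-lit u 3 12 big) (≤ᵇ⇒≤ _)

  -- The range is halved at 8u: 1 - mass on the whole range would give only 1/4, while the product
  -- of the two halves reaches 3/8.
  V3-4 : ∀ u → 11100 ℕ.≤ u → ⅜ ≤ V3 (u ℕ.* 4) (u ℕ.* 16)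
  V3-4 u big = begin
    ⅜                                                    ≤⟨ ≤ᵇ⇒≤ _ ⟩
    (1ℚ - lit-sum 3 4) * (1ℚ - lit-sum 7 8)              ≤⟨ *-mono {1ℚ - lit-sum 3 4} {1ℚ - mass (u ℕ.* 4) (u ℕ.* 8)} {1ℚ - lit-sum 7 8} {1ℚ - mass (u ℕ.* 8) (u ℕ.* 16)} (≤ᵇ⇒≤ _) (+-monoʳ-≤ 1ℚ (neg-antimono-≤ (mass-lit u 3 4 big))) (≤ᵇ⇒≤ _) (+-monoʳ-≤ 1ℚ (neg-antimono-≤ (mass-lit u 7 8 big))) ⟩
    (1ℚ - mass (u ℕ.* 4) (u ℕ.* 8)) * (1ℚ - mass (u ℕ.* 8) (u ℕ.* 16)) ≤⟨ *-mono h₁ (V3-lower (u ℕ.* 4) (u ℕ.* 8)) h₂ (V3-lower (u ℕ.* 8) (u ℕ.* 16)) ⟩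
    V3 (u ℕ.* 4) (u ℕ.* 8) * V3 (u ℕ.* 8) (u ℕ.* 16)     ≡⟨ sym (V-range π3 (ℕₚ.*-monoʳ-≤ u (ℕₚ.m≤m+n 4 4)) (ℕₚ.*-monoʳ-≤ u (ℕₚ.m≤m+n 8 8))) ⟩
    V3 (u ℕ.* 4) (u ℕ.* 16)                              ∎
    where
    open ≤-Reasoning
    h₁ : 0ℚ ≤ 1ℚ - mass (u ℕ.* 4) (u ℕ.* 8)
    h₁ = ≤-trans {0ℚ} {1ℚ - lit-sum 3 4} (≤ᵇ⇒≤ _) (+-monoʳ-≤ 1ℚ (neg-antimono-≤ (mass-lit u 3 4 big)))
    h₂ : 0ℚ ≤ 1ℚ - mass (u ℕ.* 8) (u ℕ.* 16)
    h₂ = ≤-trans {0ℚ} {1ℚ - lit-sum 7 8} (≤ᵇ⇒≤ _) (+-monoʳ-≤ 1ℚ (neg-antimono-≤ (mass-lit u 7 8 big)))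

  -- The product over (2^4u, 2^(4+n)u] is at least of order n^(-1/2): the pieces (2^mu, 2^(m+1)u] satisfy
  -- (1 - mass)^2 ≥ (m - 2)/(m - 1), and these bounds telescope.
  V3-telescope : ∀ u n → 111 ℕ.* (4 ℕ.+ n) ℕ.≤ u →
    1ℚ + 1ℚ ≤ V3 (u ℕ.* 4) (u ℕ.* (4 ℕ.+ n)) * V3 (u ℕ.* 4) (u ℕ.* (4 ℕ.+ n)) * ι (2 ℕ.+ n)
  V3-telescope u zero big = ≤-reflexive (sym (trans (cong (λ z → V (from π3 (u ℕ.* 4)) z * V (from π3 (u ℕ.* 4)) z * ι 2) (ℕₚ.n∸n≡0 (2 ℕ.^ (u ℕ.* 4)))) (trans (*-identityˡ (ι 2)) ι-2)))
  V3-telescope u (suc n) big = ≤-trans (V3-telescope u n (ℕₚ.≤-trans (ℕₚ.*-monoʳ-≤ 111 (ℕₚ.n≤1+n (4 ℕ.+ n))) big)) (begin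
    v * v * ι (2 ℕ.+ n)                        ≤⟨ *-monoʳ (square-nonNeg v) step ⟩
    v * v * ((1ℚ - x) * (1ℚ - x) * ι (3 ℕ.+ n)) ≤⟨ *-monoʳ (square-nonNeg v) (*-monoˡ (ι-≥0 (3 ℕ.+ n)) (*-mono 0≤1-x (V3-lower (u ℕ.* m) (u ℕ.* suc m)) 0≤1-x (V3-lower (u ℕ.* m) (u ℕ.* suc m)))) ⟩
    v * v * (y * y * ι (3 ℕ.+ n))              ≡⟨ l3 v y (ι (3 ℕ.+ n)) ⟩
    v * y * (v * y) * ι (3 ℕ.+ n)              ≡⟨ cong (λ z → z * z * ι (3 ℕ.+ n)) (sym (V-range π3 (ℕₚ.*-monoʳ-≤ u (ℕₚ.m≤m+n 4 n)) (ℕₚ.*-monoʳ-≤ u (ℕₚ.n≤1+n m)))) ⟩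
    V3 (u ℕ.* 4) (u ℕ.* suc m) * V3 (u ℕ.* 4) (u ℕ.* suc m) * ι (3 ℕ.+ n) ≡⟨ cong (λ z → V3 (u ℕ.* 4) (u ℕ.* z) * V3 (u ℕ.* 4) (u ℕ.* z) * ι (3 ℕ.+ n)) (sym (ℕₚ.+-suc 4 n)) ⟩
    V3 (u ℕ.* 4) (u ℕ.* (4 ℕ.+ suc n)) * V3 (u ℕ.* 4) (u ℕ.* (4 ℕ.+ suc n)) * ι (3 ℕ.+ n) ∎)
    where
    open ≤-Reasoning
    m = 4 ℕ.+ n
    v = V3 (u ℕ.* 4) (u ℕ.* m)
    x = mass (u ℕ.* m) (u ℕ.* suc m)
    y = V3 (u ℕ.* m) (u ℕ.* suc m)
    l3 : ∀ v y i → v * v * (y * y * i) ≡ v * y * (v * y) * i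
    l3 = solve-∀ ℚ-ring
    1≤u : 1 ℕ.≤ u
    1≤u = ℕₚ.≤-trans (s≤s z≤n) big
    -- The mass of the m-th piece is at most 1/(2(m - 1)): weakening m to m - 1 absorbs the constant
    -- 111 because u ≥ 111 m.
    key : ι (2 ℕ.* (3 ℕ.+ n)) * x ≤ 1ℚ
    key = *-cancelˡ {ι (u ℕ.* m)} (ι->0 (ℕₚ.*-mono-≤ 1≤u (s≤s (z≤n {3 ℕ.+ n})))) (begin
      ι (u ℕ.* m) * (ι (2 ℕ.* (3 ℕ.+ n)) * x)          ≡⟨ trans (sym (*-assoc (ι (u ℕ.* m)) (ι (2 ℕ.* (3 ℕ.+ n))) x)) (cong (_* x) (trans (sym (ι-* (u ℕ.* m) (2 ℕ.* (3 ℕ.+ n)))) (trans (cong ι (q1 (u ℕ.* m) (3 ℕ.+ n))) (ι-* (3 ℕ.+ n) (2 ℕ.* (u ℕ.* m)))))) ⟩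
      ι (3 ℕ.+ n) * ι (2 ℕ.* (u ℕ.* m)) * x            ≡⟨ *-assoc (ι (3 ℕ.+ n)) (ι (2 ℕ.* (u ℕ.* m))) x ⟩
      ι (3 ℕ.+ n) * (ι (2 ℕ.* (u ℕ.* m)) * x)          ≤⟨ *-monoʳ (ι-≥0 (3 ℕ.+ n)) (mass-bound (u ℕ.* m) (u ℕ.* suc m) (ℕₚ.*-monoʳ-≤ u (ℕₚ.n≤1+n m))) ⟩
      ι (3 ℕ.+ n) * ι (u ℕ.* suc m ℕ.∸ u ℕ.* m ℕ.+ 111) ≡⟨ trans (cong (λ z → ι (3 ℕ.+ n) * ι (z ℕ.+ 111)) (trans (cong (ℕ._∸ u ℕ.* m) (ℕₚ.*-suc u m)) (ℕₚ.m+n∸n≡m u (u ℕ.* m)))) (sym (ι-* (3 ℕ.+ n) (u ℕ.+ 111))) ⟩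
      ι ((3 ℕ.+ n) ℕ.* (u ℕ.+ 111))                    ≤⟨ ι-mono (ℕₚ.≤-trans (ℕₚ.≤-reflexive (q2 n u)) (ℕₚ.≤-trans (ℕₚ.+-monoʳ-≤ ((3 ℕ.+ n) ℕ.* u) (ℕₚ.≤-trans (ℕₚ.*-monoʳ-≤ 111 (ℕₚ.m≤n+m (3 ℕ.+ n) 2)) big)) (ℕₚ.≤-reflexive (q3 n u)))) ⟩
      ι (u ℕ.* m)                                      ≡⟨ sym (*-identityʳ (ι (u ℕ.* m))) ⟩
      ι (u ℕ.* m) * 1ℚ                                 ∎)
      where
      q1 : ∀ a b → a ℕ.* (2 ℕ.* b) ≡ b ℕ.* (2 ℕ.* a)
      q1 = ℕ-Solver.solve-∀
      q2 : ∀ n u → (3 ℕ.+ n) ℕ.* (u ℕ.+ 111) ≡ (3 ℕ.+ n) ℕ.* u ℕ.+ 111 ℕ.* (3 ℕ.+ n)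
      q2 = ℕ-Solver.solve-∀
      q3 : ∀ n u → (3 ℕ.+ n) ℕ.* u ℕ.+ u ≡ u ℕ.* (4 ℕ.+ n)
      q3 = ℕ-Solver.solve-∀
    2x : (1ℚ + 1ℚ) * x * ι (3 ℕ.+ n) ≤ 1ℚ
    2x = ≤-trans (≤-reflexive (trans (l4 x (ι (3 ℕ.+ n))) (cong (_* x) (sym (trans (ι-* 2 (3 ℕ.+ n)) (cong (_* ι (3 ℕ.+ n)) ι-2)))))) key
      where
      l4 : ∀ x i → (1ℚ + 1ℚ) * x * i ≡ (1ℚ + 1ℚ) * i * x
      l4 = solve-∀ ℚ-ring
    0≤1-x : 0ℚ ≤ 1ℚ - x
    0≤1-x = diff≥0 (≤-trans (≤-trans (≤-reflexive (sym (*-identityˡ x))) (*-monoˡ (mass≥0 (u ℕ.* m) (u ℕ.* suc m)) (ι-≥1 {2 ℕ.* (3 ℕ.+ n)} (s≤s z≤n)))) key)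
    step : ι (2 ℕ.+ n) ≤ (1ℚ - x) * (1ℚ - x) * ι (3 ℕ.+ n)
    step = ≤-by ((1ℚ - (1ℚ + 1ℚ) * x * ι (3 ℕ.+ n)) + x * x * ι (3 ℕ.+ n)) (+-nonNeg (diff≥0 2x) (*-nonNeg (square-nonNeg x) (ι-≥0 (3 ℕ.+ n))))
      (trans (cong (λ z → (1ℚ - x) * (1ℚ - x) * z) (ι-suc (2 ℕ.+ n))) (trans (l5 x (ι (2 ℕ.+ n))) (cong (λ z → ι (2 ℕ.+ n) + ((1ℚ - (1ℚ + 1ℚ) * x * z) + x * x * z)) (sym (ι-suc (2 ℕ.+ n))))))
      where
      l5 : ∀ x i → (1ℚ - x) * (1ℚ - x) * (1ℚ + i) ≡ i + ((1ℚ - (1ℚ + 1ℚ) * x * (1ℚ + i)) + x * x * (1ℚ + i))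
      l5 = solve-∀ ℚ-ring

-- Sieve blocks, their losses and their costs

module SiftingBlocks where

  open import Data.Nat.Base as ℕ using (ℕ; zero; suc; z≤n; s≤s; _!)
  import Data.Nat.Properties as ℕₚ
  import Data.Nat.Tactic.RingSolver as ℕ-Solver
  import Data.Integer.Base as ℤ
  open import Data.List.Base using (List; []; _∷_)
  open import Data.Rational.Base using (ℚ; 0ℚ; 1ℚ; ½; _+_; _*_; _-_; -_; _≤_; _<_; _/_)
  open import Data.Rational.Properties
  open import Data.Product.Base using (_×_; _,_; proj₁; proj₂; ∃-syntax)
  open import Relation.Binary.PropositionalEquality
  open import Tactic.RingSolver using (solve-∀)
  open Rationals
  open Character using (1≤2^; n<2^n)
  open MertensModFour using (π3; ^-distribʳ-*)
  open BrunHooley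
  open TruncatedExp
  open SiftingDensity

  U-1 : ∀ β l → U β 1 l ≡ 1ℚ
  U-1 β zero = refl
  U-1 β (suc l) = trans (cong (_- β l * 0ℚ) (U-1 β l)) (lem (β l))
    where
    lem : ∀ b → 1ℚ - b * 0ℚ ≡ 1ℚ
    lem = solve-∀ ℚ-ring

  1/16 3/16 1/5 1/25 : ℚ
  1/16 = (ℤ.+ 1) / 16
  3/16 = (ℤ.+ 3) / 16
  1/5 = (ℤ.+ 1) / 5
  1/25 = (ℤ.+ 1) / 25

  -- Relative loss of a one-form block truncated at 2j events. The total 3/4 + (3/16)(1 + 1/16 +
  -- ...) is at most 3/4 + 1/5.
  θR : ℕ → ℚ
  θR zero    = ¾
  θR (suc j) = 3/16 * 1/16 ^^ j

  θR≥0 : ∀ j → 0ℚ ≤ θR j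
  θR≥0 zero = ≤ᵇ⇒≤ _
  θR≥0 (suc j) = *-nonNeg {3/16} (≤ᵇ⇒≤ _) (^^-nonNeg {1/16} (≤ᵇ⇒≤ _) j)

  -- An equality at j = 0, which is where 3/16 comes from. Raising j multiplies the left by 9/16 and
  -- the right by (n + 2)(n + 1)/16 with n ≥ 3.
  ¾-power : ∀ j → ¾ ^^ (3 ℕ.+ (j ℕ.+ j)) ≤ ι ((3 ℕ.+ (j ℕ.+ j)) !) * (θR (suc j) * ⅜)
  ¾-power zero = ≤-trans (≤ᵇ⇒≤ _) (≤-reflexive (cong (_* (3/16 * 1ℚ * ⅜)) (sym (ι-def 6))))
  ¾-power (suc j) = subst (λ z → ¾ ^^ (3 ℕ.+ z) ≤ ι ((3 ℕ.+ z) !) * (θR (suc (suc j)) * ⅜)) (cong suc (sym (ℕₚ.+-suc j j))) (begin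
    ¾ * (¾ * ¾ ^^ n)                                        ≡⟨ l1 (¾ ^^ n) ⟩
    9/16 * ¾ ^^ n                                           ≤⟨ *-monoʳ {9/16} (≤ᵇ⇒≤ _) (¾-power j) ⟩
    9/16 * (ι (n !) * (3/16 * q * ⅜))                       ≡⟨ l2 (ι (n !)) q ⟩
    9ℚ′ * (ι (n !) * (3/16 * (1/16 * q) * ⅜))               ≤⟨ *-monoˡ (*-nonNeg (ι-≥0 (n !)) (*-nonNeg (θR≥0 (suc (suc j))) (≤ᵇ⇒≤ {0ℚ} {⅜} _))) 9≤ ⟩
    ι (suc (suc n)) * ι (suc n) * (ι (n !) * (3/16 * (1/16 * q) * ⅜)) ≡⟨ trans (l3 (ι (suc (suc n))) (ι (suc n)) (ι (n !)) (3/16 * (1/16 * q) * ⅜)) (cong (_* (3/16 * (1/16 * q) * ⅜)) (sym (trans (ι-* (suc (suc n)) (suc n !)) (cong (ι (suc (suc n)) *_) (ι-* (suc n) (n !)))))) ⟩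
    ι (suc (suc n) !) * (3/16 * (1/16 * q) * ⅜)             ∎)
    where
    open ≤-Reasoning
    n = 3 ℕ.+ (j ℕ.+ j)
    q = 1/16 ^^ j
    9/16 9ℚ′ : ℚ
    9/16 = (ℤ.+ 9) / 16
    9ℚ′ = (ℤ.+ 9) / 1
    l1 : ∀ x → ¾ * (¾ * x) ≡ 9/16 * x
    l1 = solve-∀ ℚ-ring
    l2 : ∀ f q → 9/16 * (f * (3/16 * q * ⅜)) ≡ 9ℚ′ * (f * (3/16 * (1/16 * q) * ⅜))
    l2 = solve-∀ ℚ-ring
    l3 : ∀ a b f x → a * b * (f * x) ≡ a * (b * f) * x
    l3 = solve-∀ ℚ-ring
    9≤ : 9ℚ′ ≤ ι (suc (suc n)) * ι (suc n)
    9≤ = ≤-trans (≤-reflexive (sym (ι-def 9))) (≤-trans (ι-mono (ℕₚ.*-mono-≤ {3} {suc (suc n)} {3} {suc n} (s≤s (s≤s (s≤s z≤n))) (s≤s (s≤s (s≤s z≤n))))) (≤-reflexive (ι-* (suc (suc n)) (suc n))))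

  -- With no events U is 1 and E is the mass itself. Otherwise E ≤ (3/4)^(2j+1)/(2j+1)! is compared
  -- with U ≥ V ≥ 3/8.
  R-loss : ∀ {β} → Unit β → ∀ l → ∑ l β ≤ ¾ → ⅜ ≤ V β l → ∀ j → E β (suc (j ℕ.+ j)) l ≤ θR j * U β (suc (j ℕ.+ j)) l
  R-loss {β} u l S≤ V≥ zero = begin
    E β 1 l             ≡⟨ sym (trans (cong (_* E β 1 l) ι-1) (*-identityˡ (E β 1 l))) ⟩
    ι (1 !) * E β 1 l   ≤⟨ E-bound (λ i → proj₁ (u i)) 1 l ⟩
    ∑ l β * 1ℚ          ≡⟨ *-identityʳ (∑ l β) ⟩
    ∑ l β               ≤⟨ S≤ ⟩
    ¾                   ≡⟨ sym (trans (cong (¾ *_) (U-1 β l)) (*-identityʳ ¾)) ⟩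
    ¾ * U β 1 l         ∎
    where open ≤-Reasoning
  R-loss {β} u l S≤ V≥ (suc j) = subst (λ z → E β (suc z) l ≤ θR (suc j) * U β (suc z) l) (cong suc (sym (ℕₚ.+-suc j j))) (≤-trans
    (*-cancelˡ {ι (n !)} (ι->0 (1≤! n)) (≤-trans (E-bound (λ i → proj₁ (u i)) n l) (≤-trans (^^-mono (∑-nonNeg l (λ i _ → proj₁ (u i))) S≤ n) (¾-power j))))
    (*-monoʳ (θR≥0 (suc j)) (≤-trans V≥ (subst (λ z → V β l ≤ U β (suc z) l) (cong suc (ℕₚ.+-suc j j)) (proj₁ (T-bounds u (suc j) l))))))
    where
    n = 3 ℕ.+ (j ℕ.+ j)

  -- n! ≥ (n/4)^n ≥ (32 S)^n, and the spare 32^n = 2^(5n) pays for 4^(2S) 2^(j+10).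
  factorial-beats : ∀ S j n → 128 ℕ.* S ℕ.≤ n → 2 ℕ.* (2 ℕ.* S) ℕ.+ (j ℕ.+ 10) ℕ.≤ 5 ℕ.* n →
    S ℕ.^ n ℕ.* (4 ℕ.^ (2 ℕ.* S) ℕ.* 2 ℕ.^ (j ℕ.+ 10)) ℕ.≤ n !
  factorial-beats S j n 128S≤n expo = ℕₚ.*-cancelˡ-≤ (4 ℕ.^ n) {{ℕ.>-nonZero (ℕₚ.m^n>0 4 n)}} (begin
    4 ℕ.^ n ℕ.* (S ℕ.^ n ℕ.* (4 ℕ.^ (2 ℕ.* S) ℕ.* 2 ℕ.^ (j ℕ.+ 10)))  ≡⟨ l1 (4 ℕ.^ n) (S ℕ.^ n) (4 ℕ.^ (2 ℕ.* S) ℕ.* 2 ℕ.^ (j ℕ.+ 10)) ⟩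
    S ℕ.^ n ℕ.* (4 ℕ.^ n ℕ.* (4 ℕ.^ (2 ℕ.* S) ℕ.* 2 ℕ.^ (j ℕ.+ 10)))  ≡⟨ cong (S ℕ.^ n ℕ.*_) pow2 ⟩
    S ℕ.^ n ℕ.* 2 ℕ.^ (2 ℕ.* n ℕ.+ (2 ℕ.* (2 ℕ.* S) ℕ.+ (j ℕ.+ 10)))  ≤⟨ ℕₚ.*-monoʳ-≤ (S ℕ.^ n) (ℕₚ.^-monoʳ-≤ 2 (ℕₚ.≤-trans (ℕₚ.+-monoʳ-≤ (2 ℕ.* n) expo) (ℕₚ.≤-reflexive (sym (ℕₚ.*-distribʳ-+ n 2 5))))) ⟩
    S ℕ.^ n ℕ.* 2 ℕ.^ (7 ℕ.* n)                                       ≡⟨ cong (S ℕ.^ n ℕ.*_) (sym (ℕₚ.^-*-assoc 2 7 n)) ⟩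
    S ℕ.^ n ℕ.* 128 ℕ.^ n                                             ≡⟨ trans (ℕₚ.*-comm (S ℕ.^ n) (128 ℕ.^ n)) (sym (^-distribʳ-* n 128 S)) ⟩
    (128 ℕ.* S) ℕ.^ n                                                 ≤⟨ ℕₚ.^-monoˡ-≤ n 128S≤n ⟩
    n ℕ.^ n                                                           ≤⟨ self-power n ⟩
    4 ℕ.^ n ℕ.* n !                                                   ∎)
    where
    open ℕₚ.≤-Reasoning
    l1 : ∀ a b c → a ℕ.* (b ℕ.* c) ≡ b ℕ.* (a ℕ.* c)
    l1 = ℕ-Solver.solve-∀
    pow2 : 4 ℕ.^ n ℕ.* (4 ℕ.^ (2 ℕ.* S) ℕ.* 2 ℕ.^ (j ℕ.+ 10)) ≡ 2 ℕ.^ (2 ℕ.* n ℕ.+ (2 ℕ.* (2 ℕ.* S) ℕ.+ (j ℕ.+ 10)))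
    pow2 = trans (cong₂ (λ x y → x ℕ.* (y ℕ.* 2 ℕ.^ (j ℕ.+ 10))) (ℕₚ.^-*-assoc 2 2 n) (ℕₚ.^-*-assoc 2 2 (2 ℕ.* S)))
      (sym (trans (ℕₚ.^-distribˡ-+-* 2 (2 ℕ.* n) _) (cong (2 ℕ.^ (2 ℕ.* n) ℕ.*_) (ℕₚ.^-distribˡ-+-* 2 (2 ℕ.* (2 ℕ.* S)) (j ℕ.+ 10)))))

  module _ (S j : ℕ) (1≤S : 1 ℕ.≤ S) where

    private
      R = 64 ℕ.* S ℕ.+ j
      n = suc (R ℕ.+ R)

    128S≤n : 128 ℕ.* S ℕ.≤ n
    128S≤n = ℕₚ.≤-trans (ℕₚ.≤-reflexive (ℕₚ.*-distribʳ-+ S 64 64)) (ℕₚ.m≤n⇒m≤1+n (ℕₚ.+-mono-≤ (ℕₚ.m≤m+n (64 ℕ.* S) j) (ℕₚ.m≤m+n (64 ℕ.* S) j)))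

    128≤n : 128 ℕ.≤ n
    128≤n = ℕₚ.≤-trans (ℕₚ.*-monoʳ-≤ 128 1≤S) 128S≤n

    expo-bound : 2 ℕ.* (2 ℕ.* S) ℕ.+ (j ℕ.+ 10) ℕ.≤ 5 ℕ.* n
    expo-bound = ℕₚ.≤-trans (ℕₚ.+-mono-≤ 4S≤n (ℕₚ.+-mono-≤ j≤n 10≤n)) (ℕₚ.+-monoʳ-≤ n (ℕₚ.+-monoʳ-≤ n (ℕₚ.m≤m+n n _)))
      where
      4S≤n : 2 ℕ.* (2 ℕ.* S) ℕ.≤ n
      4S≤n = ℕₚ.≤-trans (ℕₚ.≤-reflexive (sym (ℕₚ.*-assoc 2 2 S))) (ℕₚ.≤-trans (ℕₚ.*-monoˡ-≤ S {4} {128} (s≤s (s≤s (s≤s (s≤s z≤n))))) 128S≤n)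
      j≤n : j ℕ.≤ n
      j≤n = ℕₚ.m≤n⇒m≤1+n (ℕₚ.≤-trans (ℕₚ.m≤n+m j (64 ℕ.* S)) (ℕₚ.m≤m+n R R))
      10≤n : 10 ℕ.≤ n
      10≤n = ℕₚ.≤-trans (ℕₚ.m≤m+n 10 118) 128≤n

  HalfUnit : (ℕ → ℚ) → Set
  HalfUnit β = ∀ i → 0ℚ ≤ β i × β i ≤ ½

  half-unit : ∀ {β} → HalfUnit β → Unit β
  half-unit h i = proj₁ (h i) , ≤-trans (proj₂ (h i)) ½≤1

  -- The mass S may be large and only V ≥ 4^(-2S) is known, so the number of events is taken
  -- proportional to S; the factorial in `E-bound` then wins.
  Q-loss : ∀ {β} → HalfUnit β → ∀ l S → 1 ℕ.≤ S → ∑ l β ≤ ι S → ∀ j → let n = suc ((64 ℕ.* S ℕ.+ j) ℕ.+ (64 ℕ.* S ℕ.+ j)) in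
    E β n l ≤ inv (2 ℕ.^ (j ℕ.+ 10)) * U β n l
  Q-loss {β} h l S 1≤S S≤ j = begin
    E β n l                                  ≤⟨ ≤-inv {X} 1≤X small ⟩
    1ℚ * inv X                               ≡⟨ *-identityˡ (inv X) ⟩
    inv X                                    ≡⟨ inv-* A C₁ ⟩
    inv A * inv C₁                           ≤⟨ *-monoˡ (inv-≥0 C₁) (≤-trans (≤-trans (≤-reflexive (sym (*-identityˡ (inv A)))) (*-monoˡ (inv-≥0 A) (V-exp h l S S≤))) (≤-reflexive cancel)) ⟩
    V β l * inv C₁                           ≤⟨ *-monoˡ (inv-≥0 C₁) (proj₁ (T-bounds (half-unit h) (64 ℕ.* S ℕ.+ j) l)) ⟩
    U β n l * inv C₁                         ≡⟨ *-comm (U β n l) (inv C₁) ⟩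
    inv C₁ * U β n l                         ∎
    where
    open ≤-Reasoning
    n = suc ((64 ℕ.* S ℕ.+ j) ℕ.+ (64 ℕ.* S ℕ.+ j))
    A = 4 ℕ.^ (2 ℕ.* S)
    C₁ = 2 ℕ.^ (j ℕ.+ 10)
    X = A ℕ.* C₁
    1≤A : 1 ℕ.≤ A
    1≤A = ℕₚ.m^n>0 4 (2 ℕ.* S)
    1≤X : 1 ℕ.≤ X
    1≤X = ℕₚ.*-mono-≤ 1≤A (1≤2^ (j ℕ.+ 10))
    cancel : V β l * ι A * inv A ≡ V β l
    cancel = trans (*-assoc (V β l) (ι A) (inv A)) (trans (cong (V β l *_) (ι*inv 1≤A)) (*-identityʳ (V β l)))
    lem : ∀ f x e → f * (x * e) ≡ x * (f * e)
    lem = solve-∀ ℚ-ring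
    small : ι X * E β n l ≤ 1ℚ
    small = *-cancelˡ {ι (n !)} (ι->0 (1≤! n)) (begin
      ι (n !) * (ι X * E β n l)   ≡⟨ lem (ι (n !)) (ι X) (E β n l) ⟩
      ι X * (ι (n !) * E β n l)   ≤⟨ *-monoʳ (ι-≥0 X) (E-bound (λ i → proj₁ (h i)) n l) ⟩
      ι X * (∑ l β) ^^ n          ≤⟨ *-monoʳ (ι-≥0 X) (^^-mono (∑-nonNeg l (λ i _ → proj₁ (h i))) S≤ n) ⟩
      ι X * ι S ^^ n              ≡⟨ trans (cong (ι X *_) (sym (ι-^ S n))) (trans (sym (ι-* X (S ℕ.^ n))) (cong ι (ℕₚ.*-comm X (S ℕ.^ n)))) ⟩
      ι (S ℕ.^ n ℕ.* X)           ≤⟨ ι-mono (factorial-beats S j n (128S≤n S j 1≤S) (expo-bound S j 1≤S)) ⟩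
      ι (n !)                     ≡⟨ sym (*-identityʳ (ι (n !))) ⟩
      ι (n !) * 1ℚ                ∎)

  -- The sifting ranges.  Below 2^(2^g) every form is sieved, in blocks (2^(2^i), 2^(2^(i+1))]; above, only one form,
  -- in blocks whose exponents grow by factors of 4.
  module Ranges (k s′ g : ℕ) (1≤k : 1 ℕ.≤ k) where

    S = 56 ℕ.* k

    1≤S : 1 ℕ.≤ S
    1≤S = ℕₚ.*-mono-≤ {1} {56} (s≤s z≤n) 1≤k

    τ : ℕ
    τ = 2 ℕ.^ g

    X : ℕ → ℕ
    X n = s′ ℕ.* 4 ℕ.^ suc n

    -- The lowest one-form block starts at τ instead of X 0, so as to join the blocks below, whose
    -- exponents are powers of 2.
    base : ℕ → ℕ
    base zero    = τ
    base (suc n) = X (suc n)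

    -- j counts blocks from the top, making the losses 2^(-j-10) summable however many blocks there
    -- are.
    Qs : ℕ → ℕ → List Block
    Qs zero    j = []
    Qs (suc i) j = block (64 ℕ.* S ℕ.+ j) (2 ℕ.^ (2 ℕ.^ i)) (width (2 ℕ.^ i) (2 ℕ.^ suc i)) ∷ Qs i (suc j)

    -- Used with j = 0: the block of the largest primes, whose events are the most expensive, is
    -- truncated at no event, and each lower one at two events more.
    Rs : ℕ → ℕ → List Block
    Rs zero    j = Qs g 0
    Rs (suc n) j = block j (2 ℕ.^ base n) (width (base n) (X (suc n))) ∷ Rs n (suc j)

    X-suc : ∀ n → X (suc n) ≡ s′ ℕ.* 4 ℕ.^ n ℕ.* 16
    X-suc n = lem s′ (4 ℕ.^ n)
      where
      lem : ∀ a b → a ℕ.* (4 ℕ.* (4 ℕ.* b)) ≡ a ℕ.* b ℕ.* 16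
      lem = ℕ-Solver.solve-∀

    X-4 : ∀ n → X n ≡ s′ ℕ.* 4 ℕ.^ n ℕ.* 4
    X-4 n = lem s′ (4 ℕ.^ n)
      where
      lem : ∀ a b → a ℕ.* (4 ℕ.* b) ≡ a ℕ.* b ℕ.* 4
      lem = ℕ-Solver.solve-∀

    X-mono : ∀ n → X n ℕ.≤ X (suc n)
    X-mono n = ℕₚ.*-monoʳ-≤ s′ (ℕₚ.^-monoʳ-≤ 4 (ℕₚ.n≤1+n (suc n)))

    module Estimates (δ : ℕ → ℚ) (hδ : HalfUnit δ) (low : ∀ q → q ℕ.≤ 2 ℕ.^ τ → δ q ≤ ι k * π3 q)
      (high : ∀ q → 2 ℕ.^ τ ℕ.< q → δ q ≤ π3 q) (s′-big : 11100 ℕ.≤ s′) (X0≤τ : X 0 ℕ.≤ τ) (τ≤X1 : τ ℕ.≤ X 1) where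

      δ-unit : Unit δ
      δ-unit = half-unit hδ

      Q-sum : ∀ i → i ℕ.< g → ∑ (width (2 ℕ.^ i) (2 ℕ.^ suc i)) (from δ (2 ℕ.^ i)) ≤ ι S
      Q-sum i i<g = begin
        ∑ W (from δ (2 ℕ.^ i))               ≤⟨ ∑-mono W (λ l l< → low (suc (2 ℕ.^ (2 ℕ.^ i) ℕ.+ l)) (inside l l<)) ⟩
        ∑ W (λ l → ι k * from π3 (2 ℕ.^ i) l) ≡⟨ ∑-*ˡ W (ι k) (from π3 (2 ℕ.^ i)) ⟩
        ι k * mass (2 ℕ.^ i) (2 ℕ.* 2 ℕ.^ i) ≤⟨ *-monoʳ (ι-≥0 k) (mass-doubling (2 ℕ.^ i) (1≤2^ i)) ⟩
        ι k * ι 56                           ≡⟨ trans (sym (ι-* k 56)) (cong ι (ℕₚ.*-comm k 56)) ⟩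
        ι S                                  ∎
        where
        open ≤-Reasoning
        W = width (2 ℕ.^ i) (2 ℕ.^ suc i)
        inside : ∀ l → l ℕ.< W → suc (2 ℕ.^ (2 ℕ.^ i) ℕ.+ l) ℕ.≤ 2 ℕ.^ τ
        inside l l< = ℕₚ.≤-trans (ℕₚ.+-monoʳ-< (2 ℕ.^ (2 ℕ.^ i)) l<) (ℕₚ.≤-trans (ℕₚ.≤-reflexive (ℕₚ.m+[n∸m]≡n (ℕₚ.^-monoʳ-≤ 2 (ℕₚ.^-monoʳ-≤ 2 (ℕₚ.n≤1+n i)))))
          (ℕₚ.^-monoʳ-≤ 2 (ℕₚ.^-monoʳ-≤ 2 i<g)))

      Q-Loss : ∀ i j → i ℕ.≤ g → ∃[ Θ ] (Loss δ-unit (Qs i j) Θ × Θ ≤ inv (2 ℕ.^ (j ℕ.+ 9)))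
      Q-Loss zero j _ = 0ℚ , [] , inv-≥0 (2 ℕ.^ (j ℕ.+ 9))
      Q-Loss (suc i) j si≤g = let Θ , L , Θ≤ = Q-Loss i (suc j) (ℕₚ.<⇒≤ si≤g) in inv (2 ℕ.^ (j ℕ.+ 10)) + Θ ,
          _∷_ {θ = inv (2 ℕ.^ (j ℕ.+ 10))} {Θ = Θ} (Q-loss (λ l → hδ (suc (2 ℕ.^ (2 ℕ.^ i) ℕ.+ l))) (width (2 ℕ.^ i) (2 ℕ.^ suc i)) S 1≤S (Q-sum i si≤g) j) L ,
          ≤-trans (+-monoʳ-≤ (inv (2 ℕ.^ (j ℕ.+ 10))) Θ≤) (≤-reflexive (trans (cong (λ z → inv (2 ℕ.^ z) + inv (2 ℕ.^ suc (j ℕ.+ 9))) (ℕₚ.+-suc j 9)) (halves (2 ℕ.^ (j ℕ.+ 9)))))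
        where
        lem : ∀ x → ½ * x + ½ * x ≡ x
        lem = solve-∀ ℚ-ring
        halves : ∀ m → inv (2 ℕ.* m) + inv (2 ℕ.* m) ≡ inv m
        halves m = trans (cong₂ _+_ (inv-2* m) (inv-2* m)) (lem (inv m))
          where
          inv-2* : ∀ m → inv (2 ℕ.* m) ≡ ½ * inv m
          inv-2* m = trans (inv-* 2 m) (cong (_* inv m) (inv-def 2))

      τ≤base : ∀ n → τ ℕ.≤ base n
      τ≤base zero = ℕₚ.≤-refl
      τ≤base (suc n) = ℕₚ.≤-trans τ≤X1 (up n)
        where
        up : ∀ n → X 1 ℕ.≤ X (suc n)
        up zero = ℕₚ.≤-refl
        up (suc n) = ℕₚ.≤-trans (up n) (X-mono (suc n))

      X≤base : ∀ n → X n ℕ.≤ base n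
      X≤base zero = X0≤τ
      X≤base (suc n) = ℕₚ.≤-refl

      base≤X : ∀ n → base n ℕ.≤ X (suc n)
      base≤X zero = τ≤X1
      base≤X (suc n) = X-mono (suc n)

      above : ∀ n l → from δ (base n) l ≤ from π3 (base n) l
      above n l = high (suc (2 ℕ.^ base n ℕ.+ l)) (s≤s (ℕₚ.≤-trans (ℕₚ.^-monoʳ-≤ 2 (τ≤base n)) (ℕₚ.m≤m+n (2 ℕ.^ base n) l)))

      big : ∀ n → 11100 ℕ.≤ s′ ℕ.* 4 ℕ.^ n
      big n = ℕₚ.≤-trans s′-big (ℕₚ.m≤m*n s′ (4 ℕ.^ n) {{ℕ.>-nonZero (ℕₚ.m^n>0 4 n)}})

      R-sum : ∀ n → ∑ (width (base n) (X (suc n))) (from δ (base n)) ≤ ¾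
      R-sum n = begin
        ∑ (width (base n) (X (suc n))) (from δ (base n))  ≤⟨ ∑-mono (width (base n) (X (suc n))) (λ l _ → above n l) ⟩
        mass (base n) (X (suc n))                         ≤⟨ ≤-by (mass (X n) (base n)) (mass≥0 (X n) (base n)) (trans (∑-range π3 (X≤base n) (base≤X n)) (+-comm (mass (X n) (base n)) (mass (base n) (X (suc n))))) ⟩
        mass (X n) (X (suc n))                            ≡⟨ cong₂ mass (X-4 n) (X-suc n) ⟩
        mass (s′ ℕ.* 4 ℕ.^ n ℕ.* 4) (s′ ℕ.* 4 ℕ.^ n ℕ.* 16) ≤⟨ mass-4 (s′ ℕ.* 4 ℕ.^ n) (big n) ⟩
        ¾                                                 ∎
        where open ≤-Reasoning

      drop-factor : ∀ {x y z} → 0ℚ ≤ y → x ≤ 1ℚ → z ≡ x * y → z ≤ y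
      drop-factor {x} {y} hy hx refl = ≤-trans (*-monoˡ hy hx) (≤-reflexive (*-identityˡ y))

      V3≤V : ∀ A n → A ℕ.≤ base n → V3 A (X (suc n)) ≤ V (from δ (base n)) (width (base n) (X (suc n)))
      V3≤V A n A≤ = ≤-trans (drop-factor (V3≥0 (base n) (X (suc n))) (proj₂ (V-unit (from-unit A) (width A (base n)))) (V-range π3 A≤ (base≤X n)))
        (V-anti (from-unit (base n)) (width (base n) (X (suc n))) (λ l _ → above n l))

      R-V : ∀ n → ⅜ ≤ V (from δ (base n)) (width (base n) (X (suc n)))
      R-V n = ≤-trans (V3-4 (s′ ℕ.* 4 ℕ.^ n) (big n)) (≤-trans (≤-reflexive (cong₂ V3 (sym (X-4 n)) (sym (X-suc n)))) (V3≤V (X n) n (X≤base n)))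

      R-Loss : ∀ n j → ∃[ Θ ] (Loss δ-unit (Rs n (suc j)) Θ × Θ ≤ 1/5 * 1/16 ^^ j + inv (2 ℕ.^ 9))
      R-Loss zero j = let Θ , L , Θ≤ = Q-Loss g 0 ℕₚ.≤-refl in Θ , L , ≤-trans Θ≤ (≤-by (1/5 * 1/16 ^^ j) (*-nonNeg {1/5} (≤ᵇ⇒≤ _) (^^-nonNeg {1/16} (≤ᵇ⇒≤ _) j)) (+-comm (1/5 * 1/16 ^^ j) (inv (2 ℕ.^ 9))))
      R-Loss (suc n) j = let Θ , L , Θ≤ = R-Loss n (suc j) in θR (suc j) + Θ ,
          _∷_ {θ = θR (suc j)} {Θ = Θ} (R-loss (λ l → δ-unit (suc (2 ℕ.^ base n ℕ.+ l))) (width (base n) (X (suc n))) (R-sum n) (R-V n) (suc j)) L ,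
          ≤-trans (+-monoʳ-≤ (θR (suc j)) Θ≤) (≤-reflexive (lem (1/16 ^^ j) (inv (2 ℕ.^ 9))))
        where
        lem : ∀ q x → 3/16 * q + (1/5 * (1/16 * q) + x) ≡ 1/5 * q + x
        lem = solve-∀ ℚ-ring

      -- 3/4 + 1/5 + 1/512 < 24/25: the top block, the other one-form blocks, and all blocks below
      -- τ.
      total-Loss : ∀ n → ∃[ Θ ] (Loss δ-unit (Rs (suc n) 0) Θ × 1/25 ≤ 1ℚ - Θ)
      total-Loss n = let Θ , L , Θ≤ = R-Loss n 0 in ¾ + Θ ,
        _∷_ {θ = ¾} {Θ = Θ} (R-loss (λ l → δ-unit (suc (2 ℕ.^ base n ℕ.+ l))) (width (base n) (X (suc n))) (R-sum n) (R-V n) 0) L ,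
        ≤-trans (≤ᵇ⇒≤ { 1/25} {1ℚ - (¾ + (1/5 * 1ℚ + (ℤ.+ 1) / 512))} _) (+-monoʳ-≤ 1ℚ (neg-antimono-≤ (+-monoʳ-≤ ¾ (≤-trans Θ≤ (≤-reflexive (cong (1/5 * 1ℚ +_) (inv-def 512)))))))

      Low-lower : ∀ n → 1/25 * Up (Rs (suc n) 0) δ ≤ Low (Rs (suc n) 0) δ
      Low-lower n = let Θ , L , h = total-Loss n in ≤-trans (*-monoˡ (Up≥0 δ-unit (Rs (suc n) 0)) h) (Loss⇒Low δ-unit L)

      Up-R : ∀ n j → V (from δ τ) (width τ (X (suc n))) * Up (Qs g 0) δ ≤ Up (Rs (suc n) j) δ
      Up-R zero j = *-monoˡ (Up≥0 δ-unit (Qs g 0)) (V≤T δ-unit (block j (2 ℕ.^ τ) (width τ (X 1))))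
      Up-R (suc n) j = begin
        V (from δ τ) (width τ (X (suc (suc n)))) * Up (Qs g 0) δ ≡⟨ cong (_* Up (Qs g 0) δ) (V-range δ (τ≤base (suc n)) (X-mono (suc n))) ⟩
        v * v′ * Up (Qs g 0) δ                                  ≡⟨ lem v v′ (Up (Qs g 0) δ) ⟩
        v′ * (v * Up (Qs g 0) δ)                                ≤⟨ *-mono (proj₁ (V-unit (λ l → δ-unit (suc (2 ℕ.^ X (suc n) ℕ.+ l))) (width (X (suc n)) (X (suc (suc n)))))) (V≤T δ-unit (block j (2 ℕ.^ X (suc n)) (width (X (suc n)) (X (suc (suc n))))))
                                                                     (*-nonNeg (proj₁ (V-unit (λ l → δ-unit (suc (2 ℕ.^ τ ℕ.+ l))) (width τ (X (suc n))))) (Up≥0 δ-unit (Qs g 0))) (Up-R n (suc j)) ⟩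
        Up (Rs (suc (suc n)) j) δ                               ∎
        where
        open ≤-Reasoning
        v = V (from δ τ) (width τ (X (suc n)))
        v′ = V (from δ (X (suc n))) (width (X (suc n)) (X (suc (suc n))))
        lem : ∀ a b c → a * b * c ≡ b * (a * c)
        lem = solve-∀ ℚ-ring

      -- The range is enlarged downwards to the exponent 4s′, where `V3-telescope` starts; it ends
      -- at s′ 4^(n+2), and the square root of 4^(n+2) appears.
      V-top : ∀ n → 111 ℕ.* 4 ℕ.^ suc (suc n) ℕ.≤ s′ → 1ℚ ≤ V (from δ τ) (width τ (X (suc n))) * ι (2 ℕ.^ suc (suc n))
      V-top n bg = square-cancel-≤ (*-nonNeg v≥0 (ι-≥0 (2 ℕ.^ suc (suc n)))) (begin
        1ℚ * 1ℚ                     ≤⟨ ≤-trans (≤ᵇ⇒≤ _) (V3-telescope s′ m (subst (λ z → 111 ℕ.* z ℕ.≤ s′) 4^≡ bg)) ⟩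
        y * y * ι (2 ℕ.+ m)         ≤⟨ *-mono (square-nonNeg y) (*-mono y≥0 y≤v y≥0 y≤v) (ι-≥0 (2 ℕ.+ m)) (ι-mono (ℕₚ.≤-trans (ℕₚ.m≤n+m (2 ℕ.+ m) 2) (ℕₚ.≤-reflexive (sym 4^≡)))) ⟩
        v * v * ι (4 ℕ.^ suc (suc n)) ≡⟨ cong (v * v *_) (trans (cong ι (^-distribʳ-* (suc (suc n)) 2 2)) (ι-* P₂ P₂)) ⟩
        v * v * (ι P₂ * ι P₂)       ≡⟨ lem v (ι P₂) ⟩
        v * ι P₂ * (v * ι P₂)       ∎)
        where
        open ≤-Reasoning
        P₂ = 2 ℕ.^ suc (suc n)
        v = V (from δ τ) (width τ (X (suc n)))
        v≥0 = proj₁ (V-unit (λ l → δ-unit (suc (2 ℕ.^ τ ℕ.+ l))) (width τ (X (suc n))))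
        m = 4 ℕ.^ suc (suc n) ℕ.∸ 4
        4^≡ : 4 ℕ.^ suc (suc n) ≡ 4 ℕ.+ m
        4^≡ = sym (ℕₚ.m+[n∸m]≡n (ℕₚ.^-monoʳ-≤ 4 {1} {suc (suc n)} (s≤s z≤n)))
        y = V3 (s′ ℕ.* 4) (s′ ℕ.* (4 ℕ.+ m))
        y≥0 = V3≥0 (s′ ℕ.* 4) (s′ ℕ.* (4 ℕ.+ m))
        lem : ∀ v p → v * v * (p * p) ≡ v * p * (v * p)
        lem = solve-∀ ℚ-ring
        up : ∀ n → τ ℕ.≤ X (suc n)
        up n = ℕₚ.≤-trans (τ≤base n) (base≤X n)
        y≤v : y ≤ v
        y≤v = ≤-trans (≤-reflexive (cong (λ z → V3 (s′ ℕ.* 4) (s′ ℕ.* z)) (sym 4^≡))) (≤-trans (drop-factor (V3≥0 τ (X (suc n))) (proj₂ (V-unit (from-unit (s′ ℕ.* 4)) (width (s′ ℕ.* 4) τ)))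
          (V-range π3 X0≤τ (up n))) (V-anti (from-unit τ) (width τ (X (suc n))) (λ l _ → above 0 l)))

      -- The price of sifting a single form from t up to z; n will be chosen so that it is of order
      -- k^(1/2).
      Up-top : ∀ n → 111 ℕ.* 4 ℕ.^ suc (suc n) ℕ.≤ s′ → Up (Qs g 0) δ ≤ Up (Rs (suc n) 0) δ * ι (2 ℕ.^ suc (suc n))
      Up-top n bg = begin
        u                            ≡⟨ sym (*-identityˡ u) ⟩
        1ℚ * u                       ≤⟨ *-monoˡ (Up≥0 δ-unit (Qs g 0)) (V-top n bg) ⟩
        v * p * u                    ≡⟨ lem v p u ⟩
        v * u * p                    ≤⟨ *-monoˡ (ι-≥0 (2 ℕ.^ suc (suc n))) (Up-R n 0) ⟩
        Up (Rs (suc n) 0) δ * p      ∎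
        where
        open ≤-Reasoning
        u = Up (Qs g 0) δ
        v = V (from δ τ) (width τ (X (suc n)))
        p = ι (2 ℕ.^ suc (suc n))
        lem : ∀ a b c → a * b * c ≡ a * c * b
        lem = solve-∀ ℚ-ring

      -- Crude: 2^(-O(kg)) with g of order log log x. For k ≤ (log x)^(1/5) this is far larger than
      -- exp(-(log x)^(1/2)).
      Up-Q : ∀ i j → i ℕ.≤ g → 1ℚ ≤ Up (Qs i j) δ * ι ((4 ℕ.^ (2 ℕ.* S)) ℕ.^ i)
      Up-Q zero j _ = ≤-reflexive (sym (trans (*-identityˡ (ι 1)) ι-1))
      Up-Q (suc i) j si≤g = begin
        1ℚ * 1ℚ                                ≤⟨ *-mono 0≤1 (V-exp (λ l → hδ (suc (2 ℕ.^ (2 ℕ.^ i) ℕ.+ l))) W S (Q-sum i si≤g)) 0≤1 (Up-Q i (suc j) (ℕₚ.<⇒≤ si≤g)) ⟩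
        v * ι Z * (u * ι (Z ℕ.^ i))            ≡⟨ trans (lem v (ι Z) u (ι (Z ℕ.^ i))) (cong (v * u *_) (sym (ι-* Z (Z ℕ.^ i)))) ⟩
        v * u * ι (Z ℕ.^ suc i)                ≤⟨ *-monoˡ (ι-≥0 (Z ℕ.^ suc i)) (*-monoˡ (Up≥0 δ-unit (Qs i (suc j))) (V≤T δ-unit (block (64 ℕ.* S ℕ.+ j) (2 ℕ.^ (2 ℕ.^ i)) W))) ⟩
        Up (Qs (suc i) j) δ * ι (Z ℕ.^ suc i)  ∎
        where
        open ≤-Reasoning
        Z = 4 ℕ.^ (2 ℕ.* S)
        W = width (2 ℕ.^ i) (2 ℕ.^ suc i)
        v = V (from δ (2 ℕ.^ i)) W
        u = Up (Qs i (suc j)) δ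
        lem : ∀ a b c d → a * b * (c * d) ≡ a * c * (b * d)
        lem = solve-∀ ℚ-ring

    module Costs (w₀ κ′ : ℕ) (2k≤ : 2 ℕ.* k ℕ.≤ 2 ℕ.^ κ′) where

      open Equidistribution w₀ k 1≤k using (C; Chain; []; _∷_; costUp; costLow)

      Qs-chain : ∀ i j → ∃[ Y ] (Y ℕ.≤ 2 ℕ.^ (2 ℕ.^ i) × Chain Y (Qs i j))
      Qs-chain zero j = 0 , z≤n , []
      Qs-chain (suc i) j = let Y , Y≤ , ch = Qs-chain i (suc j) in
        _ , ℕₚ.≤-reflexive (ℕₚ.m+[n∸m]≡n (ℕₚ.^-monoʳ-≤ 2 (ℕₚ.^-monoʳ-≤ 2 (ℕₚ.n≤1+n i)))) , Y≤ ∷ ch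

      Rs-chain : (∀ n → base n ℕ.≤ X (suc n)) → ∀ n j → ∃[ Y ] (Y ℕ.≤ 2 ℕ.^ base n × Chain Y (Rs n j))
      Rs-chain h zero j = Qs-chain g 0
      Rs-chain h (suc n) j = let Y , Y≤ , ch = Rs-chain h n (suc j) in
        _ , ℕₚ.≤-reflexive (ℕₚ.m+[n∸m]≡n (ℕₚ.^-monoʳ-≤ 2 (h n))) , Y≤ ∷ ch

      width< : ∀ A B → suc (width A B) ℕ.≤ 2 ℕ.^ B
      width< A B = ℕₚ.≤-trans (s≤s (ℕₚ.∸-monoʳ-≤ (2 ℕ.^ B) (1≤2^ A))) (ℕₚ.≤-reflexive (ℕₚ.m+[n∸m]≡n (1≤2^ B)))

      C-width : ∀ A B → C (width A B) ℕ.≤ 2 ℕ.^ (B ℕ.+ κ′)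
      C-width A B = begin
        suc (2 ℕ.* k ℕ.* width A B)            ≤⟨ ℕₚ.+-monoˡ-≤ (2 ℕ.* k ℕ.* width A B) (ℕₚ.≤-trans 1≤k (ℕₚ.m≤m+n k (k ℕ.+ 0))) ⟩
        2 ℕ.* k ℕ.+ 2 ℕ.* k ℕ.* width A B      ≡⟨ sym (ℕₚ.*-suc (2 ℕ.* k) (width A B)) ⟩
        2 ℕ.* k ℕ.* suc (width A B)            ≤⟨ ℕₚ.*-mono-≤ 2k≤ (width< A B) ⟩
        2 ℕ.^ κ′ ℕ.* 2 ℕ.^ B                   ≡⟨ trans (ℕₚ.*-comm (2 ℕ.^ κ′) (2 ℕ.^ B)) (sym (ℕₚ.^-distribˡ-+-* 2 B κ′)) ⟩
        2 ℕ.^ (B ℕ.+ κ′)                       ∎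
        where open ℕₚ.≤-Reasoning

      C-power : ∀ A B e → C (width A B) ℕ.^ e ℕ.≤ 2 ℕ.^ (e ℕ.* (B ℕ.+ κ′))
      C-power A B e = ℕₚ.≤-trans (ℕₚ.^-monoˡ-≤ e (C-width A B)) (ℕₚ.≤-reflexive (trans (ℕₚ.^-*-assoc 2 (B ℕ.+ κ′) e) (cong (2 ℕ.^_) (ℕₚ.*-comm (B ℕ.+ κ′) e))))

      combine : ∀ {x y} e f g → x ℕ.≤ 2 ℕ.^ e → y ℕ.≤ 2 ℕ.^ f → e ℕ.+ f ℕ.≤ g → x ℕ.* y ℕ.≤ 2 ℕ.^ g
      combine e f g hx hy h = ℕₚ.≤-trans (ℕₚ.*-mono-≤ hx hy) (ℕₚ.≤-trans (ℕₚ.≤-reflexive (sym (ℕₚ.^-distribˡ-+-* 2 e f))) (ℕₚ.^-monoʳ-≤ 2 h))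

      -- Closed majorant of the exponents 2(64S + j)(2^(i+1) + κ′) summed over the blocks. The first
      -- summand, geometric in 2^i, is the main one.
      fQ : ℕ → ℕ → ℕ
      fQ i j = 4 ℕ.* 2 ℕ.^ i ℕ.* (64 ℕ.* S ℕ.+ j ℕ.+ 1) ℕ.+ 2 ℕ.* i ℕ.* κ′ ℕ.* (64 ℕ.* S ℕ.+ j ℕ.+ i)

      Q-cost : ∀ i j → costUp (Qs i j) ℕ.≤ 2 ℕ.^ fQ i j
      Q-cost zero j = 1≤2^ (fQ 0 j)
      Q-cost (suc i) j = combine ((R ℕ.+ j ℕ.+ (R ℕ.+ j)) ℕ.* (2 ℕ.^ suc i ℕ.+ κ′)) (fQ i (suc j)) (fQ (suc i) j)
        (C-power (2 ℕ.^ i) (2 ℕ.^ suc i) (R ℕ.+ j ℕ.+ (R ℕ.+ j))) (Q-cost i (suc j)) (step R (2 ℕ.^ i))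
        where
        R = 64 ℕ.* S
        step : ∀ R p → (R ℕ.+ j ℕ.+ (R ℕ.+ j)) ℕ.* (2 ℕ.* p ℕ.+ κ′) ℕ.+ (4 ℕ.* p ℕ.* (R ℕ.+ suc j ℕ.+ 1) ℕ.+ 2 ℕ.* i ℕ.* κ′ ℕ.* (R ℕ.+ suc j ℕ.+ i)) ℕ.≤
          4 ℕ.* (2 ℕ.* p) ℕ.* (R ℕ.+ j ℕ.+ 1) ℕ.+ 2 ℕ.* suc i ℕ.* κ′ ℕ.* (R ℕ.+ j ℕ.+ suc i)
        step R p = ℕₚ.≤-trans (ℕₚ.m≤m+n _ (2 ℕ.* κ′ ℕ.* suc i)) (ℕₚ.≤-reflexive (lem R j p κ′ i))
          where
          lem : ∀ R j p κ′ i → (R ℕ.+ j ℕ.+ (R ℕ.+ j)) ℕ.* (2 ℕ.* p ℕ.+ κ′) ℕ.+ (4 ℕ.* p ℕ.* (R ℕ.+ suc j ℕ.+ 1) ℕ.+ 2 ℕ.* i ℕ.* κ′ ℕ.* (R ℕ.+ suc j ℕ.+ i)) ℕ.+ 2 ℕ.* κ′ ℕ.* suc i ≡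
            4 ℕ.* (2 ℕ.* p) ℕ.* (R ℕ.+ j ℕ.+ 1) ℕ.+ 2 ℕ.* suc i ℕ.* κ′ ℕ.* (R ℕ.+ j ℕ.+ suc i)
          lem = ℕ-Solver.solve-∀

      exR : ℕ → ℕ → ℕ
      exR zero    j = fQ g 0
      exR (suc n) j = (j ℕ.+ j) ℕ.* (X (suc n) ℕ.+ κ′) ℕ.+ exR n (suc j)

      R-cost : ∀ n j → costUp (Rs n j) ℕ.≤ 2 ℕ.^ exR n j
      R-cost zero j = Q-cost g 0
      R-cost (suc n) j = combine ((j ℕ.+ j) ℕ.* (X (suc n) ℕ.+ κ′)) (exR n (suc j)) (exR (suc n) j)
        (C-power (base n) (X (suc n)) (j ℕ.+ j)) (R-cost n (suc j)) ℕₚ.≤-refl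

      -- Down the blocks X shrinks by 4 while the events grow by two: the sum of 2(j + i) 4^(-i)
      -- over i ≥ 0 is (24j + 8)/9. At j = 0 the cost is 8/9 of the top exponent.
      exR-bound : ∀ n j → 9 ℕ.* exR n j ℕ.≤ X n ℕ.* (24 ℕ.* j ℕ.+ 8) ℕ.+ 18 ℕ.* n ℕ.* κ′ ℕ.* (j ℕ.+ n) ℕ.+ 9 ℕ.* fQ g 0
      exR-bound zero j = ℕₚ.m≤n+m (9 ℕ.* fQ g 0) (X 0 ℕ.* (24 ℕ.* j ℕ.+ 8) ℕ.+ 18 ℕ.* 0 ℕ.* κ′ ℕ.* (j ℕ.+ 0))
      exR-bound (suc n) j = begin
        9 ℕ.* (d ℕ.+ exR n (suc j))                   ≡⟨ ℕₚ.*-distribˡ-+ 9 d (exR n (suc j)) ⟩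
        9 ℕ.* d ℕ.+ 9 ℕ.* exR n (suc j)               ≤⟨ ℕₚ.+-monoʳ-≤ (9 ℕ.* d) (exR-bound n (suc j)) ⟩
        9 ℕ.* d ℕ.+ (X n ℕ.* (24 ℕ.* suc j ℕ.+ 8) ℕ.+ 18 ℕ.* n ℕ.* κ′ ℕ.* (suc j ℕ.+ n) ℕ.+ 9 ℕ.* fQ g 0) ≤⟨ step (4 ℕ.^ n) (9 ℕ.* fQ g 0) ⟩
        X (suc n) ℕ.* (24 ℕ.* j ℕ.+ 8) ℕ.+ 18 ℕ.* suc n ℕ.* κ′ ℕ.* (j ℕ.+ suc n) ℕ.+ 9 ℕ.* fQ g 0 ∎
        where
        open ℕₚ.≤-Reasoning
        d = (j ℕ.+ j) ℕ.* (X (suc n) ℕ.+ κ′)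
        step : ∀ p f → 9 ℕ.* ((j ℕ.+ j) ℕ.* (s′ ℕ.* (4 ℕ.* (4 ℕ.* p)) ℕ.+ κ′)) ℕ.+ (s′ ℕ.* (4 ℕ.* p) ℕ.* (24 ℕ.* suc j ℕ.+ 8) ℕ.+ 18 ℕ.* n ℕ.* κ′ ℕ.* (suc j ℕ.+ n) ℕ.+ f) ℕ.≤
          s′ ℕ.* (4 ℕ.* (4 ℕ.* p)) ℕ.* (24 ℕ.* j ℕ.+ 8) ℕ.+ 18 ℕ.* suc n ℕ.* κ′ ℕ.* (j ℕ.+ suc n) ℕ.+ f
        step p f = ℕₚ.≤-trans (ℕₚ.m≤m+n _ (18 ℕ.* κ′ ℕ.* suc n)) (ℕₚ.≤-reflexive (lem j s′ p κ′ n f))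
          where
          lem : ∀ j s′ p κ′ n f → 9 ℕ.* ((j ℕ.+ j) ℕ.* (s′ ℕ.* (4 ℕ.* (4 ℕ.* p)) ℕ.+ κ′)) ℕ.+ (s′ ℕ.* (4 ℕ.* p) ℕ.* (24 ℕ.* suc j ℕ.+ 8) ℕ.+ 18 ℕ.* n ℕ.* κ′ ℕ.* (suc j ℕ.+ n) ℕ.+ f) ℕ.+ 18 ℕ.* κ′ ℕ.* suc n ≡
            s′ ℕ.* (4 ℕ.* (4 ℕ.* p)) ℕ.* (24 ℕ.* j ℕ.+ 8) ℕ.+ 18 ℕ.* suc n ℕ.* κ′ ℕ.* (j ℕ.+ suc n) ℕ.+ f
          lem = ℕ-Solver.solve-∀

      sumC : List Block → ℕ
      sumC []       = 0
      sumC (B ∷ Bs) = C (len B) ℕ.+ sumC Bs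

      -- Every correction term of the lower bound uses one event more in a single block, hence one
      -- extra factor C of that block.
      costLow≤ : ∀ Bs → costLow Bs ℕ.≤ costUp Bs ℕ.* suc (sumC Bs)
      costLow≤ [] = ℕₚ.≤-refl
      costLow≤ (B ∷ Bs) = ℕₚ.≤-trans (ℕₚ.+-monoˡ-≤ (C (len B) ℕ.^ suc e ℕ.* costUp Bs) (ℕₚ.*-monoʳ-≤ (C (len B) ℕ.^ e) (costLow≤ Bs)))
        (ℕₚ.≤-reflexive (lem (C (len B) ℕ.^ e) (costUp Bs) (sumC Bs) (C (len B))))
        where
        e = r B ℕ.+ r B
        lem : ∀ p u s c → p ℕ.* (u ℕ.* suc s) ℕ.+ c ℕ.* p ℕ.* u ≡ p ℕ.* u ℕ.* suc (c ℕ.+ s)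
        lem = ℕ-Solver.solve-∀

      sumC-Q : ∀ i j → sumC (Qs i j) ℕ.≤ i ℕ.* 2 ℕ.^ (2 ℕ.^ i ℕ.+ κ′)
      sumC-Q zero j = z≤n
      sumC-Q (suc i) j = ℕₚ.+-mono-≤ (C-width (2 ℕ.^ i) (2 ℕ.^ suc i)) (ℕₚ.≤-trans (sumC-Q i (suc j))
        (ℕₚ.*-monoʳ-≤ i (ℕₚ.^-monoʳ-≤ 2 (ℕₚ.+-monoˡ-≤ κ′ (ℕₚ.^-monoʳ-≤ 2 (ℕₚ.n≤1+n i))))))

      sumC-R : ∀ n j → sumC (Rs n j) ℕ.≤ n ℕ.* 2 ℕ.^ (X n ℕ.+ κ′) ℕ.+ g ℕ.* 2 ℕ.^ (τ ℕ.+ κ′)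
      sumC-R zero j = sumC-Q g 0
      sumC-R (suc n) j = ℕₚ.≤-trans (ℕₚ.+-mono-≤ (C-width (base n) (X (suc n))) (ℕₚ.≤-trans (sumC-R n (suc j))
          (ℕₚ.+-monoˡ-≤ _ (ℕₚ.*-monoʳ-≤ n (ℕₚ.^-monoʳ-≤ 2 (ℕₚ.+-monoˡ-≤ κ′ (X-mono n)))))))
        (ℕₚ.≤-reflexive (sym (ℕₚ.+-assoc (2 ℕ.^ (X (suc n) ℕ.+ κ′)) (n ℕ.* 2 ℕ.^ (X (suc n) ℕ.+ κ′)) _)))


      Low-cost : ∀ n → τ ℕ.≤ X n → costLow (Rs n 0) ℕ.≤ 2 ℕ.^ (exR n 0 ℕ.+ (n ℕ.+ g ℕ.+ (X n ℕ.+ κ′)))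
      Low-cost n τ≤ = ℕₚ.≤-trans (costLow≤ (Rs n 0)) (combine (exR n 0) (n ℕ.+ g ℕ.+ (X n ℕ.+ κ′)) _ (R-cost n 0) (begin
        suc (sumC (Rs n 0))                                   ≤⟨ s≤s (sumC-R n 0) ⟩
        suc (n ℕ.* q ℕ.+ g ℕ.* 2 ℕ.^ (τ ℕ.+ κ′))              ≤⟨ ℕₚ.+-mono-≤ (1≤2^ (X n ℕ.+ κ′)) (ℕₚ.+-monoʳ-≤ (n ℕ.* q) (ℕₚ.*-monoʳ-≤ g (ℕₚ.^-monoʳ-≤ 2 (ℕₚ.+-monoˡ-≤ κ′ τ≤)))) ⟩
        q ℕ.+ (n ℕ.* q ℕ.+ g ℕ.* q)                           ≡⟨ cong (q ℕ.+_) (sym (ℕₚ.*-distribʳ-+ q n g)) ⟩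
        suc (n ℕ.+ g) ℕ.* q                                   ≤⟨ ℕₚ.*-monoˡ-≤ q (n<2^n (n ℕ.+ g)) ⟩
        2 ℕ.^ (n ℕ.+ g) ℕ.* q                                 ≡⟨ sym (ℕₚ.^-distribˡ-+-* 2 (n ℕ.+ g) (X n ℕ.+ κ′)) ⟩
        2 ℕ.^ (n ℕ.+ g ℕ.+ (X n ℕ.+ κ′))                      ∎) ℕₚ.≤-refl)
        where
        open ℕₚ.≤-Reasoning
        q = 2 ℕ.^ (X n ℕ.+ κ′)

-- Counting points with many sifted values

module SiftedCount where

  open import Data.Nat.Base as ℕ using (ℕ; zero; suc; z≤n; s≤s)
  import Data.Nat.Properties as ℕₚ
  open import Data.Nat.Divisibility
  open import Data.Nat.Primality
  import Data.Nat.Tactic.RingSolver as ℕ-Solver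
  import Data.Integer.Base as ℤ
  open import Data.List.Base using (List; filter; downFrom; length; map)
  open import Data.List.Relation.Unary.All as All using (All)
  import Data.List.Relation.Unary.All.Properties as Allₚ
  open import Data.List.Relation.Unary.Unique.Propositional using (Unique)
  import Data.List.Relation.Unary.Unique.Propositional.Properties as Uₚ
  open import Data.List.Membership.Propositional using (_∈_)
  open import Data.List.Membership.Propositional.Properties using (∈-filter⁻; ∈-downFrom⁻)
  open import Data.Rational.Base using (ℚ; 0ℚ; 1ℚ; ½; _+_; _*_; _-_; -_; _≤_; _<_; _/_)
  open import Data.Rational.Properties
  open import Data.Product.Base using (_×_; _,_; proj₁; proj₂; ∃-syntax)
  open import Data.Sum.Base using (_⊎_; inj₁; inj₂)
  open import Data.Empty using (⊥-elim)
  open import Relation.Nullary using (Dec; yes; no; ¬_; contradiction)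
  open import Relation.Nullary.Decidable using (_×-dec_)
  open import Relation.Unary using (Decidable)
  open import Relation.Binary.PropositionalEquality
  open import Tactic.RingSolver using (solve-∀)
  open Rationals
  open Character using (𝟙; 𝟙-yes; 𝟙-no; 𝟙-≥0; 𝟙-≤1; 1≤2^; ∑-head)
  open WeightedMertens using (ι-2)
  open MertensModFour using (P3; P3?; π3; π3≥0; ∑ₙ; ι-∑ₙ; bit; ι-bit; prime≥2)
  open BrunHooley
  open SiftingDensity
  open SiftingBlocks

  choose : {A : Set} → Dec A → ℚ → ℚ → ℚ
  choose (yes _) x y = x
  choose (no _)  x y = y

  choose-yes : {A : Set} (d : Dec A) {x y : ℚ} → A → choose d x y ≡ x
  choose-yes (yes _) a = refl
  choose-yes (no ¬a) a = contradiction a ¬a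

  Bin : ℚ → Set
  Bin x = x ≡ 0ℚ ⊎ x ≡ 1ℚ

  𝟙-bin : {A : Set} (d : Dec A) → Bin (𝟙 d)
  𝟙-bin (yes _) = inj₂ refl
  𝟙-bin (no _)  = inj₁ refl

  choose-bin : {A : Set} (d : Dec A) {x y : ℚ} → Bin x → Bin y → Bin (choose d x y)
  choose-bin (yes _) hx hy = hx
  choose-bin (no _)  hx hy = hy

  *-bin : ∀ {x y} → Bin x → Bin y → Bin (x * y)
  *-bin {y = y} (inj₁ refl) _ = inj₁ (*-zeroˡ y)
  *-bin {y = y} (inj₂ refl) (inj₁ refl) = inj₁ refl
  *-bin {y = y} (inj₂ refl) (inj₂ refl) = inj₂ refl

  bin-unit : ∀ {x} → Bin x → 0ℚ ≤ x × x ≤ 1ℚ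
  bin-unit (inj₁ refl) = ≤-refl , 0≤1
  bin-unit (inj₂ refl) = 0≤1 , ≤-refl

  length-filter : ∀ {P : ℕ → Set} (P? : Decidable P) n → length (filter P? (downFrom n)) ≡ ∑ₙ n (λ i → bit (P? i))
  length-filter P? zero = refl
  length-filter P? (suc n) with P? n
  ... | yes _ = trans (cong suc (length-filter P? n)) (ℕₚ.+-comm 1 (∑ₙ n (λ i → bit (P? i))))
  ... | no _  = trans (length-filter P? n) (sym (ℕₚ.+-identityʳ _))

  ι-length-filter : ∀ {P : ℕ → Set} (P? : Decidable P) n → ι (length (filter P? (downFrom n))) ≡ ∑ n (λ i → 𝟙 (P? i))
  ι-length-filter P? n = trans (cong ι (length-filter P? n)) (trans (ι-∑ₙ n (λ i → bit (P? i))) (∑-cong n (λ i _ → ι-bit (P? i))))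

  V-bin : ∀ {β} → (∀ i → Bin (β i)) → ∀ l → V β l ≡ 0ℚ ⊎ (V β l ≡ 1ℚ × (∀ i → i ℕ.< l → β i ≡ 0ℚ))
  V-bin h zero = inj₂ (refl , λ i ())
  V-bin {β} h (suc l) = go (V-bin h l) (h l)
    where
    go : V β l ≡ 0ℚ ⊎ (V β l ≡ 1ℚ × (∀ i → i ℕ.< l → β i ≡ 0ℚ)) → Bin (β l) →
      V β (suc l) ≡ 0ℚ ⊎ (V β (suc l) ≡ 1ℚ × (∀ i → i ℕ.< suc l → β i ≡ 0ℚ))
    go (inj₁ e) _ = inj₁ (trans (cong (_* (1ℚ - β l)) e) (*-zeroˡ (1ℚ - β l)))
    go (inj₂ _) (inj₂ e) = inj₁ (trans (cong (λ z → V β l * (1ℚ - z)) e) (*-zeroʳ (V β l)))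
    go (inj₂ (e , z)) (inj₁ e′) = inj₂ (cong₂ (λ x y → x * (1ℚ - y)) e e′ , all)
      where
      all : ∀ i → i ℕ.< suc l → β i ≡ 0ℚ
      all i i< with i ℕₚ.≟ l
      ... | yes refl = e′
      ... | no i≢l = z i (ℕₚ.≤∧≢⇒< (ℕₚ.≤-pred i<) i≢l)

  U-cong : ∀ {β γ} r l → (∀ i → i ℕ.< l → β i ≡ γ i) → U β r l ≡ U γ r l
  U-cong zero l h = refl
  U-cong (suc r) zero h = refl
  U-cong (suc r) (suc l) h = cong₂ _-_ (U-cong (suc r) l (λ i i< → h i (ℕₚ.m<n⇒m<1+n i<)))
    (cong₂ _*_ (h l ℕₚ.≤-refl) (U-cong r l (λ i i< → h i (ℕₚ.m<n⇒m<1+n i<))))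

  ∣-shift : ∀ q a b n j → q ∣ a ℕ.* (n ℕ.+ j ℕ.* q) ℕ.+ b → q ∣ a ℕ.* n ℕ.+ b
  ∣-shift q a b n j h = ∣m+n∣m⇒∣n (subst (q ∣_) (lem a b n j q) h) (divides (a ℕ.* j) refl)
    where
    lem : ∀ a b n j q → a ℕ.* (n ℕ.+ j ℕ.* q) ℕ.+ b ≡ a ℕ.* j ℕ.* q ℕ.+ (a ℕ.* n ℕ.+ b)
    lem = ℕ-Solver.solve-∀

  ∣-unshift : ∀ q a b n j → q ∣ a ℕ.* n ℕ.+ b → q ∣ a ℕ.* (n ℕ.+ j ℕ.* q) ℕ.+ b
  ∣-unshift q a b n j h = subst (q ∣_) (sym (lem a b n j q)) (∣m∣n⇒∣m+n (divides (a ℕ.* j) refl) h)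
    where
    lem : ∀ a b n j q → a ℕ.* (n ℕ.+ j ℕ.* q) ℕ.+ b ≡ a ℕ.* j ℕ.* q ℕ.+ (a ℕ.* n ℕ.+ b)
    lem = ℕ-Solver.solve-∀

  𝟙-cong : {A B : Set} (d : Dec A) (e : Dec B) → (A → B) → (B → A) → 𝟙 d ≡ 𝟙 e
  𝟙-cong (yes a) e f g = sym (𝟙-yes e (f a))
  𝟙-cong (no ¬a) e f g = sym (𝟙-no e (λ b → ¬a (g b)))

  root-count : ∀ {q} a b → Prime q → ¬ q ∣ a → ∑ q (λ m → 𝟙 (q ∣? a ℕ.* m ℕ.+ b)) ≡ 1ℚ
  root-count {q} a b pq q∤a = trans (∑-cong q (λ m _ → cong (λ z → 𝟙 (q ∣? z)) (ℕₚ.+-comm (a ℕ.* m) b)))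
    (trans (∑-permute pq q∤a b (λ n → 𝟙 (q ∣? n)) per) (count q pq))
    where
    per : Periodic q (λ n → 𝟙 (q ∣? n))
    per n k = 𝟙-cong (q ∣? n ℕ.+ k ℕ.* q) (q ∣? n) (λ h → ∣m+n∣m⇒∣n (subst (q ∣_) (ℕₚ.+-comm n (k ℕ.* q)) h) (divides k refl))
      (λ h → ∣m∣n⇒∣m+n h (divides k refl))
    count : ∀ q → Prime q → ∑ q (λ n → 𝟙 (q ∣? n)) ≡ 1ℚ
    count zero pq = ⊥-elim (ℕₚ.<⇒≱ (prime≥2 pq) z≤n)
    count q@(suc q′) pq = trans (∑-head q′ (λ n → 𝟙 (q ∣? n))) (cong₂ _+_ (𝟙-yes (q ∣? 0) (q ∣0))
      (trans (∑-cong q′ (λ i i< → 𝟙-no (q ∣? suc i) (λ h → ℕₚ.<⇒≱ (s≤s i<) (∣⇒≤ h)))) (∑-zero q′)))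

  module Counting (k s′ g w₀ : ℕ) (1≤k : 1 ℕ.≤ k) (2k≤w₀ : 2 ℕ.* k ℕ.≤ w₀) (a b : ℕ → ℕ)
    (a-coprime : ∀ i → i ℕ.< k → ∀ q → Prime q → w₀ ℕ.< q → ¬ q ∣ a i) where

    open Ranges k s′ g 1≤k
    open Equidistribution w₀ k 1≤k

    k≤w₀ : k ℕ.≤ w₀
    k≤w₀ = ℕₚ.≤-trans (ℕₚ.m≤m+n k (k ℕ.+ 0)) 2k≤w₀

    Sieving : ℕ → Set
    Sieving q = P3 q × w₀ ℕ.< q

    sieving? : ∀ q → Dec (Sieving q)
    sieving? q = P3? q ×-dec (w₀ ℕₚ.<? q)

    Hit : ℕ → ℕ → Set
    Hit q m = ∃[ j ] (j ℕ.< k × q ∣ a j ℕ.* m ℕ.+ b j)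

    hit? : ∀ q m → Dec (Hit q m)
    hit? q m = ℕₚ.anyUpTo? (λ j → q ∣? a j ℕ.* m ℕ.+ b j) k

    ν : ℕ → ℕ
    ν q = ∑ₙ q (λ m → bit (hit? q m))

    ι-ν : ∀ q → ι (ν q) ≡ ∑ q (λ m → 𝟙 (hit? q m))
    ι-ν q = trans (ι-∑ₙ q (λ m → bit (hit? q m))) (∑-cong q (λ m _ → ι-bit (hit? q m)))

    -- Union bound: each form has exactly one zero modulo q, its leading coefficient being prime to
    -- q.
    ν≤k : ∀ q → Sieving q → ν q ℕ.≤ k
    ν≤k q ((pq , _) , w<q) = ι-cancel (begin
      ι (ν q)                                           ≡⟨ ι-ν q ⟩
      ∑ q (λ m → 𝟙 (hit? q m))                          ≤⟨ ∑-mono q (λ m _ → union m (hit? q m)) ⟩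
      ∑ q (λ m → ∑ k (λ j → 𝟙 (q ∣? a j ℕ.* m ℕ.+ b j))) ≡⟨ ∑-swap q k (λ m j → 𝟙 (q ∣? a j ℕ.* m ℕ.+ b j)) ⟩
      ∑ k (λ j → ∑ q (λ m → 𝟙 (q ∣? a j ℕ.* m ℕ.+ b j))) ≡⟨ ∑-cong k (λ j j< → root-count (a j) (b j) pq (a-coprime j j< q pq w<q)) ⟩
      ∑ k (λ _ → 1ℚ)                                    ≡⟨ trans (∑-const k 1ℚ) (*-identityʳ (ι k)) ⟩
      ι k                                               ∎)
      where
      open ≤-Reasoning
      union : ∀ m (d : Dec (Hit q m)) → 𝟙 d ≤ ∑ k (λ j → 𝟙 (q ∣? a j ℕ.* m ℕ.+ b j))
      union m (no _) = ∑-nonNeg k (λ j _ → 𝟙-≥0 (q ∣? a j ℕ.* m ℕ.+ b j))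
      union m (yes (j , j<k , h)) = ≤-trans (≤-reflexive (sym (𝟙-yes (q ∣? a j ℕ.* m ℕ.+ b j) h)))
        (≤-trans (≤-by (∑ j F) (∑-nonNeg j (λ i _ → F≥0 i)) (+-comm (∑ j F) (F j))) (∑-extend F j<k F≥0))
        where
        F : ℕ → ℚ
        F j = 𝟙 (q ∣? a j ℕ.* m ℕ.+ b j)
        F≥0 : ∀ j → 0ℚ ≤ F j
        F≥0 j = 𝟙-≥0 (q ∣? a j ℕ.* m ℕ.+ b j)

    -- The k event systems agree up to 2^τ, which provides one common majorant `s` for all the
    -- indicators `t i`.
    ev : ℕ → ℕ → ℕ → ℚ
    ev i q m = 𝟙 (sieving? q) * choose (q ℕₚ.≤? 2 ℕ.^ τ) (𝟙 (hit? q m)) (𝟙 (q ∣? a i ℕ.* m ℕ.+ b i))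

    δ : ℕ → ℕ → ℚ
    δ i q = 𝟙 (sieving? q) * choose (q ℕₚ.≤? 2 ℕ.^ τ) (ι (ν q) * inv q) (inv q)

    ev-bin : ∀ i q m → Bin (ev i q m)
    ev-bin i q m = *-bin (𝟙-bin (sieving? q)) (choose-bin (q ℕₚ.≤? 2 ℕ.^ τ) (𝟙-bin (hit? q m)) (𝟙-bin (q ∣? a i ℕ.* m ℕ.+ b i)))

    hit-shift : ∀ q n j → 𝟙 (hit? q (n ℕ.+ j ℕ.* q)) ≡ 𝟙 (hit? q n)
    hit-shift q n j = 𝟙-cong (hit? q (n ℕ.+ j ℕ.* q)) (hit? q n) (λ (l , l< , h) → l , l< , ∣-shift q (a l) (b l) n j h)
      (λ (l , l< , h) → l , l< , ∣-unshift q (a l) (b l) n j h)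

    event : ∀ i → i ℕ.< k → ∀ q → Event q (ev i q) (δ i q)
    event i i<k q = go (sieving? q) (q ℕₚ.≤? 2 ℕ.^ τ)
      where
      go : (d : Dec (Sieving q)) (e : Dec (q ℕ.≤ 2 ℕ.^ τ)) →
        Event q (λ m → 𝟙 d * choose e (𝟙 (hit? q m)) (𝟙 (q ∣? a i ℕ.* m ℕ.+ b i))) (𝟙 d * choose e (ι (ν q) * inv q) (inv q))
      go (no _) e = never (λ m → *-zeroˡ (choose e (𝟙 (hit? q m)) (𝟙 (q ∣? a i ℕ.* m ℕ.+ b i)))) (*-zeroˡ (choose e (ι (ν q) * inv q) (inv q)))
      go (yes sv@((pq , _) , w<q)) (yes _) = mod (ν q) pq w<q (λ n j → cong (1ℚ *_) (hit-shift q n j))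
        (λ m → bin-unit (*-bin (inj₂ refl) (𝟙-bin (hit? q m)))) (ν≤k q sv)
        (trans (∑-cong q (λ m _ → *-identityˡ (𝟙 (hit? q m)))) (sym (ι-ν q))) (*-identityˡ (ι (ν q) * inv q))
      go (yes sv@((pq , _) , w<q)) (no _) = mod 1 pq w<q (λ n j → cong (1ℚ *_) (𝟙-cong (q ∣? a i ℕ.* (n ℕ.+ j ℕ.* q) ℕ.+ b i) (q ∣? a i ℕ.* n ℕ.+ b i)
          (∣-shift q (a i) (b i) n j) (∣-unshift q (a i) (b i) n j)))
        (λ m → bin-unit (*-bin (inj₂ refl) (𝟙-bin (q ∣? a i ℕ.* m ℕ.+ b i)))) 1≤k
        (trans (∑-cong q (λ m _ → *-identityˡ (𝟙 (q ∣? a i ℕ.* m ℕ.+ b i)))) (trans (root-count (a i) (b i) pq (a-coprime i i<k q pq w<q)) (sym ι-1)))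
        (trans (*-identityˡ (inv q)) (sym (trans (cong (_* inv q) ι-1) (*-identityˡ (inv q)))))

    ½-bound : ∀ q → Sieving q → ι k * inv q ≤ ½
    ½-bound q (_ , w<q) = *-cancelˡ {ι 2} (ι->0 {2} (s≤s z≤n)) (begin
      ι 2 * (ι k * inv q)    ≡⟨ trans (sym (*-assoc (ι 2) (ι k) (inv q))) (cong (_* inv q) (sym (ι-* 2 k))) ⟩
      ι (2 ℕ.* k) * inv q    ≤⟨ *-monoˡ (inv-≥0 q) (ι-mono (ℕₚ.≤-trans 2k≤w₀ (ℕₚ.<⇒≤ w<q))) ⟩
      ι q * inv q            ≡⟨ ι*inv (ℕₚ.≤-trans (s≤s z≤n) w<q) ⟩
      1ℚ                     ≡⟨ sym (trans (cong (_* ½) ι-2) refl) ⟩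
      ι 2 * ½                ∎)
      where open ≤-Reasoning

    δ-half : ∀ i q → 0ℚ ≤ δ i q × δ i q ≤ ½
    δ-half i q = go (sieving? q) (q ℕₚ.≤? 2 ℕ.^ τ)
      where
      go : (d : Dec (Sieving q)) (e : Dec (q ℕ.≤ 2 ℕ.^ τ)) → 0ℚ ≤ 𝟙 d * choose e (ι (ν q) * inv q) (inv q) × 𝟙 d * choose e (ι (ν q) * inv q) (inv q) ≤ ½
      go (no _) e = ≤-reflexive (sym (*-zeroˡ (choose e (ι (ν q) * inv q) (inv q)))) , ≤-trans (≤-reflexive (*-zeroˡ (choose e (ι (ν q) * inv q) (inv q)))) (≤ᵇ⇒≤ _)
      go (yes sv) (yes _) = ≤-trans (*-nonNeg (ι-≥0 (ν q)) (inv-≥0 q)) (≤-reflexive (sym (*-identityˡ (ι (ν q) * inv q)))) ,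
        ≤-trans (≤-reflexive (*-identityˡ (ι (ν q) * inv q))) (≤-trans (*-monoˡ (inv-≥0 q) (ι-mono (ν≤k q sv))) (½-bound q sv))
      go (yes sv) (no _) = ≤-trans (inv-≥0 q) (≤-reflexive (sym (*-identityˡ (inv q)))) ,
        ≤-trans (*-monoˡ (inv-≥0 q) (ι-≥1 1≤k)) (½-bound q sv)

    δ-low : ∀ i q → q ℕ.≤ 2 ℕ.^ τ → δ i q ≤ ι k * π3 q
    δ-low i q q≤ = go (sieving? q) (q ℕₚ.≤? 2 ℕ.^ τ)
      where
      go : (d : Dec (Sieving q)) (e : Dec (q ℕ.≤ 2 ℕ.^ τ)) → 𝟙 d * choose e (ι (ν q) * inv q) (inv q) ≤ ι k * π3 q
      go (no _) e = ≤-trans (≤-reflexive (*-zeroˡ (choose e (ι (ν q) * inv q) (inv q)))) (*-nonNeg (ι-≥0 k) (π3≥0 q))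
      go (yes sv) (no q≰) = contradiction q≤ q≰
      go (yes sv) (yes _) = ≤-trans (≤-reflexive (*-identityˡ (ι (ν q) * inv q))) (≤-trans (*-monoˡ (inv-≥0 q) (ι-mono (ν≤k q sv)))
        (≤-reflexive (cong (ι k *_) (sym (trans (cong (_* inv q) (𝟙-yes (P3? q) (proj₁ sv))) (*-identityˡ (inv q)))))))

    δ-high : ∀ i q → 2 ℕ.^ τ ℕ.< q → δ i q ≤ π3 q
    δ-high i q <q = go (sieving? q) (q ℕₚ.≤? 2 ℕ.^ τ)
      where
      go : (d : Dec (Sieving q)) (e : Dec (q ℕ.≤ 2 ℕ.^ τ)) → 𝟙 d * choose e (ι (ν q) * inv q) (inv q) ≤ π3 q
      go (no _) e = ≤-trans (≤-reflexive (*-zeroˡ (choose e (ι (ν q) * inv q) (inv q)))) (π3≥0 q)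
      go (yes sv) (yes q≤) = contradiction q≤ (ℕₚ.<⇒≱ <q)
      go (yes sv) (no _) = *-monoˡ (inv-≥0 q) (≤-reflexive (sym (𝟙-yes (P3? q) (proj₁ sv))))

    wt : ℕ → ℕ → ℕ → ℚ
    wt i m q = ev i q m

    wt-unit : ∀ i m → Unit (wt i m)
    wt-unit i m q = bin-unit (ev-bin i q m)

    -- 2 < q because the lowest block starts beyond 2^(2^0); the prime 2 is not congruent to 3.
    Zero : ℕ → ℕ → ℕ → Set
    Zero i m Y = ∀ q → 2 ℕ.< q → q ℕ.≤ Y → ev i q m ≡ 0ℚ

    -- x is the indicator of: no sieving event up to 2^A.
    Indicator : ℕ → ℕ → ℕ → ℚ → Set
    Indicator i m A x = x ≡ 0ℚ ⊎ (x ≡ 1ℚ × Zero i m (2 ℕ.^ A))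

    indicator-step : ∀ i m A B r → A ℕ.≤ B → ∀ x → Indicator i m A x →
      Indicator i m B (V⟨ block r (2 ℕ.^ A) (width A B) ⟩ (wt i m) * x)
    indicator-step i m A B r A≤B x (inj₁ refl) = inj₁ (*-zeroʳ (V⟨ block r (2 ℕ.^ A) (width A B) ⟩ (wt i m)))
    indicator-step i m A B r A≤B x (inj₂ (refl , z)) = go (V-bin (λ l → ev-bin i (suc (2 ℕ.^ A ℕ.+ l)) m) (width A B))
      where
      β = from (wt i m) A
      go : V β (width A B) ≡ 0ℚ ⊎ (V β (width A B) ≡ 1ℚ × (∀ l → l ℕ.< width A B → β l ≡ 0ℚ)) → Indicator i m B (V β (width A B) * 1ℚ)
      go (inj₁ e) = inj₁ (trans (*-identityʳ (V β (width A B))) e)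
      go (inj₂ (e , z′)) = inj₂ (trans (*-identityʳ (V β (width A B))) e , all)
        where
        all : Zero i m (2 ℕ.^ B)
        all q 2<q q≤ = pos (q ℕₚ.≤? 2 ℕ.^ A)
          where
          pos : Dec (q ℕ.≤ 2 ℕ.^ A) → ev i q m ≡ 0ℚ
          pos (yes q≤A) = z q 2<q q≤A
          pos (no q≰A) = subst (λ y → ev i y m ≡ 0ℚ) q≡ (z′ (q ℕ.∸ suc (2 ℕ.^ A)) l<)
            where
            q≡ : suc (2 ℕ.^ A ℕ.+ (q ℕ.∸ suc (2 ℕ.^ A))) ≡ q
            q≡ = ℕₚ.m+[n∸m]≡n (ℕₚ.≰⇒> q≰A)
            l< : q ℕ.∸ suc (2 ℕ.^ A) ℕ.< width A B
            l< = ℕₚ.+-cancelˡ-< (2 ℕ.^ A) (q ℕ.∸ suc (2 ℕ.^ A)) (width A B)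
              (subst₂ ℕ._≤_ (sym q≡) (sym (ℕₚ.m+[n∸m]≡n (ℕₚ.^-monoʳ-≤ 2 A≤B))) q≤)

    Q-indicator : ∀ i m n j → Indicator i m (2 ℕ.^ n) (None (Qs n j) (wt i m))
    Q-indicator i m zero j = inj₂ (refl , λ q 2<q q≤2 → contradiction q≤2 (ℕₚ.<⇒≱ 2<q))
    Q-indicator i m (suc n) j = indicator-step i m (2 ℕ.^ n) (2 ℕ.^ suc n) (64 ℕ.* S ℕ.+ j) (ℕₚ.^-monoʳ-≤ 2 (ℕₚ.n≤1+n n)) (None (Qs n (suc j)) (wt i m)) (Q-indicator i m n (suc j))

    R-indicator : (∀ n → base n ℕ.≤ X (suc n)) → ∀ i m n j → Indicator i m (base n) (None (Rs n j) (wt i m))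
    R-indicator h i m zero j = Q-indicator i m g 0
    R-indicator h i m (suc n) j = indicator-step i m (base n) (X (suc n)) j (h n) (None (Rs n (suc j)) (wt i m)) (R-indicator h i m n (suc j))

    None-R≤Q : ∀ i m n j → None (Rs n j) (wt i m) ≤ None (Qs g 0) (wt i m)
    None-R≤Q i m zero j = ≤-refl
    None-R≤Q i m (suc n) j = ≤-trans (*-monoˡ (None≥0 (wt-unit i m) (Rs n (suc j))) (proj₂ (V-unit (lu (wt-unit i m) (block j (2 ℕ.^ base n) (width (base n) (X (suc n))))) (width (base n) (X (suc n))))))
      (≤-trans (≤-reflexive (*-identityˡ (None (Rs n (suc j)) (wt i m)))) (None-R≤Q i m n (suc j)))

    ev-indep : ∀ i i′ q m → q ℕ.≤ 2 ℕ.^ τ → ev i q m ≡ ev i′ q m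
    ev-indep i i′ q m q≤ = cong (𝟙 (sieving? q) *_) (trans (choose-yes (q ℕₚ.≤? 2 ℕ.^ τ) q≤) (sym (choose-yes (q ℕₚ.≤? 2 ℕ.^ τ) q≤)))

    δ-indep : ∀ i i′ q → q ℕ.≤ 2 ℕ.^ τ → δ i q ≡ δ i′ q
    δ-indep i i′ q q≤ = cong (𝟙 (sieving? q) *_) (trans (choose-yes (q ℕₚ.≤? 2 ℕ.^ τ) q≤) (sym (choose-yes (q ℕₚ.≤? 2 ℕ.^ τ) q≤)))

    inside : ∀ n l → n ℕ.< g → l ℕ.< width (2 ℕ.^ n) (2 ℕ.^ suc n) → suc (2 ℕ.^ (2 ℕ.^ n) ℕ.+ l) ℕ.≤ 2 ℕ.^ τ
    inside n l n<g l< = ℕₚ.≤-trans (ℕₚ.+-monoʳ-< (2 ℕ.^ (2 ℕ.^ n)) l<) (ℕₚ.≤-trans (ℕₚ.≤-reflexive (ℕₚ.m+[n∸m]≡n (ℕₚ.^-monoʳ-≤ 2 (ℕₚ.^-monoʳ-≤ 2 (ℕₚ.n≤1+n n)))))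
      (ℕₚ.^-monoʳ-≤ 2 (ℕₚ.^-monoʳ-≤ 2 n<g)))

    Up-Q-cong : ∀ {w w′ : ℕ → ℚ} → (∀ q → q ℕ.≤ 2 ℕ.^ τ → w q ≡ w′ q) → ∀ n j → n ℕ.≤ g → Up (Qs n j) w ≡ Up (Qs n j) w′
    Up-Q-cong h zero j _ = refl
    Up-Q-cong h (suc n) j n<g = cong₂ _*_ (U-cong (suc ((64 ℕ.* S ℕ.+ j) ℕ.+ (64 ℕ.* S ℕ.+ j))) (width (2 ℕ.^ n) (2 ℕ.^ suc n)) (λ l l< → h (suc (2 ℕ.^ (2 ℕ.^ n) ℕ.+ l)) (inside n l n<g l<))) (Up-Q-cong h n (suc j) (ℕₚ.<⇒≤ n<g))

    None-Q-cong : ∀ {w w′ : ℕ → ℚ} → (∀ q → q ℕ.≤ 2 ℕ.^ τ → w q ≡ w′ q) → ∀ n j → n ℕ.≤ g → None (Qs n j) w ≡ None (Qs n j) w′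
    None-Q-cong h zero j _ = refl
    None-Q-cong h (suc n) j n<g = cong₂ _*_ (V-cong (width (2 ℕ.^ n) (2 ℕ.^ suc n)) (λ l l< → h (suc (2 ℕ.^ (2 ℕ.^ n) ℕ.+ l)) (inside n l n<g l<))) (None-Q-cong h n (suc j) (ℕₚ.<⇒≤ n<g))

    module Gain (n : ℕ) (s′-big : 11100 ℕ.≤ s′) (s′-big′ : 111 ℕ.* 4 ℕ.^ suc (suc n) ℕ.≤ s′) (X0≤τ : X 0 ℕ.≤ τ) (τ≤X1 : τ ℕ.≤ X 1)
      (I : ℕ → Set) (I? : ∀ i → Dec (I i)) (M r₀ L m′ : ℕ) (avoid : ∀ p → Prime p → w₀ ℕ.< p → ¬ p ∣ M)
      (I-many : k ℕ.≤ 4 ℕ.* length (filter I? (downFrom k))) (m′-small : m′ ℕ.* (8 ℕ.* (25 ℕ.* 2 ℕ.^ suc (suc n))) ℕ.≤ k) where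

      Bs = Rs (suc n) 0

      module Est (i : ℕ) = Estimates (δ i) (δ-half i) (δ-low i) (δ-high i) s′-big X0≤τ τ≤X1

      base≤ : ∀ l → base l ℕ.≤ X (suc l)
      base≤ = Est.base≤X 0

      -- `R-indicator` shows that this product is 0 or 1: it tells whether m survives the sieve
      -- system of form i.
      t : ℕ → ℕ → ℚ
      t i m = None Bs (wt i m)

      ok? : ∀ i m → Dec (t i m ≡ 1ℚ)
      ok? i m = t i m ≟ 1ℚ

      t-𝟙 : ∀ i m → t i m ≡ 𝟙 (ok? i m)
      t-𝟙 i m = go (R-indicator base≤ i m (suc n) 0)
        where
        go : Indicator i m (X (suc n)) (t i m) → t i m ≡ 𝟙 (ok? i m)
        go (inj₁ e) = trans e (sym (𝟙-no (ok? i m) (λ h → 1≢0 (trans (sym h) e))))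
        go (inj₂ (e , _)) = trans e (sym (𝟙-yes (ok? i m) e))

      sifted : ∀ i m → i ℕ.< k → t i m ≡ 1ℚ → ∀ q → P3 q → w₀ ℕ.< q → q ℕ.≤ 2 ℕ.^ X (suc n) → ¬ q ∣ a i ℕ.* m ℕ.+ b i
      sifted i m i<k e q p3 w<q q≤ q∣ = go (R-indicator base≤ i m (suc n) 0)
        where
        2<q : 2 ℕ.< q
        2<q = ℕₚ.≤∧≢⇒< (prime≥2 (proj₁ p3)) (λ { refl → contradiction (proj₂ p3) λ () })
        one : (d : Dec (Sieving q)) (f : Dec (q ℕ.≤ 2 ℕ.^ τ)) → 𝟙 d * choose f (𝟙 (hit? q m)) (𝟙 (q ∣? a i ℕ.* m ℕ.+ b i)) ≡ 1ℚ
        one (no ¬s) f = contradiction (p3 , w<q) ¬s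
        one (yes _) (yes _) = trans (*-identityˡ (𝟙 (hit? q m))) (𝟙-yes (hit? q m) (i , i<k , q∣))
        one (yes _) (no _) = trans (*-identityˡ (𝟙 (q ∣? a i ℕ.* m ℕ.+ b i))) (𝟙-yes (q ∣? a i ℕ.* m ℕ.+ b i) q∣)
        go : ¬ Indicator i m (X (suc n)) (t i m)
        go (inj₁ e′) = 1≢0 (trans (sym e) e′)
        go (inj₂ (_ , z)) = 1≢0 (trans (sym (one (sieving? q) (q ℕₚ.≤? 2 ℕ.^ τ))) (z q 2<q q≤))

      Pick : ℕ → ℕ → Set
      Pick m i = I i × t i m ≡ 1ℚ

      pick? : ∀ m i → Dec (Pick m i)
      pick? m i = I? i ×-dec ok? i m

      picks : ℕ → List ℕ
      picks m = filter (pick? m) (downFrom k)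

      Rich : ℕ → Set
      Rich m = suc m′ ℕ.≤ length (picks m)

      rich? : ∀ m → Dec (Rich m)
      rich? m = suc m′ ℕₚ.≤? length (picks m)

      pt : ℕ → ℕ
      pt j = r₀ ℕ.+ M ℕ.* j

      riches : List ℕ
      riches = filter (λ j → rich? (pt j)) (downFrom L)

      points : List ℕ
      points = map pt riches

      points-unique : 1 ℕ.≤ M → Unique points
      points-unique 1≤M = Uₚ.map⁺ (λ {x} {y} e → ℕₚ.*-cancelˡ-≡ x y M {{ℕ.>-nonZero 1≤M}} (ℕₚ.+-cancelˡ-≡ r₀ (M ℕ.* x) (M ℕ.* y) e)) (Uₚ.filter⁺ (λ j → rich? (pt j)) (Uₚ.downFrom⁺ L))

      points-all : (Q : ℕ → Set) → (∀ j → j ℕ.< L → Rich (pt j) → Q (pt j)) → All Q points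
      points-all Q h = Allₚ.map⁺ (All.tabulate (λ {j} j∈ → each j (∈-filter⁻ (λ j → rich? (pt j)) {j} {downFrom L} j∈)))
        where
        each : ∀ j → j ∈ downFrom L × Rich (pt j) → Q (pt j)
        each j (j∈ , rich) = h j (∈-downFrom⁻ j∈) rich

      -- Index 0 represents all forms, since up to 2^τ the events do not depend on it.
      s : ℕ → ℚ
      s m = None (Qs g 0) (wt 0 m)

      s≥0 : ∀ m → 0ℚ ≤ s m
      s≥0 m = None≥0 (wt-unit 0 m) (Qs g 0)

      t≤s : ∀ i m → t i m ≤ s m
      t≤s i m = ≤-trans (None-R≤Q i m (suc n) 0) (≤-reflexive (None-Q-cong (λ q q≤ → ev-indep i 0 q m q≤) g 0 ℕₚ.≤-refl))

      pick≤ : ∀ m i → 𝟙 (pick? m i) ≤ 𝟙 (pick? m i) * s m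
      pick≤ m i = go (pick? m i)
        where
        go : (d : Dec (Pick m i)) → 𝟙 d ≤ 𝟙 d * s m
        go (no _) = ≤-reflexive (sym (*-zeroˡ (s m)))
        go (yes (_ , e)) = ≤-trans (≤-reflexive (sym e)) (≤-trans (t≤s i m) (≤-reflexive (sym (*-identityˡ (s m)))))

      count≡ : ∀ m → ι (length (picks m)) ≡ ∑ k (λ i → 𝟙 (pick? m i))
      count≡ m = ι-length-filter (pick? m) k

      -- A point that is not rich has at most m′ picks, and a single pick already forces s m ≥ 1; a
      -- rich point has at most k picks.
      pointwise : ∀ m → ∑ k (λ i → 𝟙 (pick? m i)) - ι m′ * s m ≤ ι k * 𝟙 (rich? m)
      pointwise m = go (rich? m)
        where
        c≤k : ∑ k (λ i → 𝟙 (pick? m i)) ≤ ι k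
        c≤k = ≤-trans (∑-mono k (λ i _ → 𝟙-≤1 (pick? m i))) (≤-reflexive (trans (∑-const k 1ℚ) (*-identityʳ (ι k))))
        go : (d : Dec (Rich m)) → ∑ k (λ i → 𝟙 (pick? m i)) - ι m′ * s m ≤ ι k * 𝟙 d
        go (yes _) = ≤-trans (+-mono-≤ c≤k (neg-antimono-≤ (*-nonNeg (ι-≥0 m′) (s≥0 m)))) (≤-reflexive (lem (ι k)))
          where
          lem : ∀ x → x - 0ℚ ≡ x * 1ℚ
          lem = solve-∀ ℚ-ring
        go (no poor) = ≤-trans (+-monoˡ-≤ (- (ι m′ * s m)) le) (≤-reflexive (lem (ι m′ * s m) (ι k)))
          where
          lem : ∀ x y → x - x ≡ y * 0ℚ
          lem = solve-∀ ℚ-ring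
          le : ∑ k (λ i → 𝟙 (pick? m i)) ≤ ι m′ * s m
          le = ≤-trans (∑-mono k (λ i _ → pick≤ m i)) (≤-trans (≤-reflexive (trans (∑-*ʳ k (s m) (λ i → 𝟙 (pick? m i))) (cong (_* s m) (sym (count≡ m)))))
            (*-monoˡ (s≥0 m) (ι-mono (ℕₚ.≤-pred (ℕₚ.≰⇒> poor)))))

      up : ℚ
      up = Up (Qs g 0) (δ 0)

      up≥0 : 0ℚ ≤ up
      up≥0 = Up≥0 (Est.δ-unit 0) (Qs g 0)

      D : ℕ
      D = 25 ℕ.* 2 ℕ.^ suc (suc n)

      -- D combines the proportion 1/25 that the lower bound retains with the factor 2^(n+2) of
      -- `Up-top`.
      low-bound : ∀ i → up ≤ ι D * Low Bs (δ i)
      low-bound i = begin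
        up                                          ≡⟨ Up-Q-cong (λ q q≤ → δ-indep 0 i q q≤) g 0 ℕₚ.≤-refl ⟩
        Up (Qs g 0) (δ i)                           ≤⟨ Est.Up-top i n s′-big′ ⟩
        Up Bs (δ i) * p                             ≡⟨ lem (Up Bs (δ i)) p ⟩
        25ℚ * p * (1/25 * Up Bs (δ i))              ≤⟨ *-monoʳ (*-nonNeg {25ℚ} (≤ᵇ⇒≤ _) (ι-≥0 (2 ℕ.^ suc (suc n)))) (Est.Low-lower i n) ⟩
        25ℚ * p * Low Bs (δ i)                      ≡⟨ cong (λ z → z * p * Low Bs (δ i)) (sym (ι-def 25)) ⟩
        ι 25 * p * Low Bs (δ i)                     ≡⟨ cong (_* Low Bs (δ i)) (sym (ι-* 25 (2 ℕ.^ suc (suc n)))) ⟩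
        ι D * Low Bs (δ i)                          ∎
        where
        open ≤-Reasoning
        p = ι (2 ℕ.^ suc (suc n))
        25ℚ : ℚ
        25ℚ = (ℤ.+ 25) / 1
        lem : ∀ u p → u * p ≡ 25ℚ * p * (1/25 * u)
        lem = solve-∀ ℚ-ring

      avoids : ∀ Y → Avoids Y M
      avoids Y p pp w<p _ = avoid p pp w<p

      module Cost (κ′ : ℕ) (2k≤ : 2 ℕ.* k ℕ.≤ 2 ℕ.^ κ′) where
        open Costs w₀ κ′ 2k≤ public

        ηL ηU : ℚ
        ηL = ι (costLow Bs)
        ηU = ι (costUp (Qs g 0))

        lower : ∀ i → i ℕ.< k → Low Bs (δ i) * ι L - ηL ≤ ∑ L (λ j → t i (pt j))
        lower i i<k = ≤-trans (diff≥0⁻¹ (subst (0ℚ ≤_) (lem (∑ L (λ j → Low Bs (wt i (pt j)))) (Low Bs (δ i) * ι L) ηL) (diff≥0 (proj₁ w))))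
            (∑-mono L (λ j _ → Low≤None (wt-unit i (pt j)) Bs))
          where
          ch = Rs-chain base≤ (suc n) 0
          w = Good.dist (Good-Low k≤w₀ (ev i) (δ i) (event i i<k) (proj₂ (proj₂ ch))) M r₀ L (avoids (proj₁ ch))
          lem : ∀ x y e → (x - y) - - e ≡ x - (y - e)
          lem = solve-∀ ℚ-ring

        upper : ∑ L (λ j → s (pt j)) ≤ up * ι L + ηU
        upper = ≤-trans (∑-mono L (λ j _ → None≤Up (wt-unit 0 (pt j)) (Qs g 0))) (diff≥0⁻¹ (subst (0ℚ ≤_) (lem (∑ L (λ j → Up (Qs g 0) (wt 0 (pt j)))) (up * ι L) ηU) (diff≥0 (proj₂ w))))
          where
          ch = Qs-chain g 0
          w = Good.dist (Good-Up k≤w₀ (ev 0) (δ 0) (event 0 1≤k) (proj₂ (proj₂ ch))) M r₀ L (avoids (proj₁ ch))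
          lem : ∀ x y e → e - (x - y) ≡ (y + e) - x
          lem = solve-∀ ℚ-ring

        R : ℕ
        R = length riches

        ∑-riches : ∑ L (λ j → 𝟙 (rich? (pt j))) ≡ ι R
        ∑-riches = sym (ι-length-filter (λ j → rich? (pt j)) L)

        c : ℕ
        c = length (filter I? (downFrom k))

        c≤k : ι c ≤ ι k
        c≤k = ≤-trans (≤-reflexive (ι-length-filter I? k)) (≤-trans (∑-mono k (λ i _ → 𝟙-≤1 (I? i))) (≤-reflexive (trans (∑-const k 1ℚ) (*-identityʳ (ι k)))))

        8D = 8 ℕ.* D

        summed : ∑ k (λ i → 𝟙 (I? i) * ∑ L (λ j → t i (pt j))) - ι m′ * ∑ L (λ j → s (pt j)) ≤ ι k * ι R
        summed = begin
          ∑ k (λ i → 𝟙 (I? i) * ∑ L (λ j → t i (pt j))) - ι m′ * ∑ L (λ j → s (pt j))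
            ≡⟨ cong₂ _-_ (trans (∑-cong k (λ i _ → sym (∑-*ˡ L (𝟙 (I? i)) (λ j → t i (pt j))))) (∑-swap k L (λ i j → 𝟙 (I? i) * t i (pt j)))) (sym (∑-*ˡ L (ι m′) (λ j → s (pt j)))) ⟩
          ∑ L (λ j → ∑ k (λ i → 𝟙 (I? i) * t i (pt j))) - ∑ L (λ j → ι m′ * s (pt j))
            ≡⟨ sym (∑-- L (λ j → ∑ k (λ i → 𝟙 (I? i) * t i (pt j))) (λ j → ι m′ * s (pt j))) ⟩
          ∑ L (λ j → ∑ k (λ i → 𝟙 (I? i) * t i (pt j)) - ι m′ * s (pt j))
            ≤⟨ ∑-mono L (λ j _ → ≤-trans (≤-reflexive (cong (_- ι m′ * s (pt j)) (∑-cong k (λ i _ → both i (pt j))))) (pointwise (pt j))) ⟩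
          ∑ L (λ j → ι k * 𝟙 (rich? (pt j)))
            ≡⟨ trans (∑-*ˡ L (ι k) (λ j → 𝟙 (rich? (pt j)))) (cong (ι k *_) ∑-riches) ⟩
          ι k * ι R ∎
          where
          open ≤-Reasoning
          prod : ∀ {A B : Set} (x : Dec A) (y : Dec B) → 𝟙 x * 𝟙 y ≡ 𝟙 (x ×-dec y)
          prod (yes _) (yes _) = refl
          prod (yes _) (no _) = refl
          prod (no _) (yes _) = refl
          prod (no _) (no _) = refl
          both : ∀ i m → 𝟙 (I? i) * t i m ≡ 𝟙 (pick? m i)
          both i m = trans (cong (𝟙 (I? i) *_) (t-𝟙 i m)) (prod (I? i) (ok? i m))

        -- First moment: at least k/4 indices, each with main term up · L/D, give k · up · L/(4D)
        -- picks in all; points that are not rich hold at most m′ · up · L, which is at most half of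
        -- that. The rest lies on rich points, with at most k picks each.
        gain : up * ι L ≤ ι 8D * (ι R + (ηL + ηU))
        gain = *-cancelˡ {ι k} (ι->0 1≤k) (begin
          ι k * (up * ι L)
            ≤⟨ main ⟩
          ι 8D * (ι c * w) - ι 8D * (ι m′ * (up * ι L))
            ≡⟨ l1 (ι 8D) (ι c) (ι m′) w ηL ηU (up * ι L) ⟩
          ι 8D * ((ι c * (w - ηL) - ι m′ * (up * ι L + ηU)) + (ι c * ηL + ι m′ * ηU))
            ≤⟨ *-monoʳ (ι-≥0 8D) (+-mono-≤ (≤-trans (+-mono-≤ lowers (neg-antimono-≤ (*-monoʳ (ι-≥0 m′) upper))) summed)
                 (+-mono-≤ (*-monoˡ (ι-≥0 (costLow Bs)) c≤k) (*-monoˡ (ι-≥0 (costUp (Qs g 0))) m′≤k))) ⟩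
          ι 8D * (ι k * ι R + (ι k * ηL + ι k * ηU))
            ≡⟨ l2 (ι 8D) (ι k) (ι R) ηL ηU ⟩
          ι k * (ι 8D * (ι R + (ηL + ηU))) ∎)
          where
          open ≤-Reasoning
          -- w ≤ every Low · L, with 25·2^(n+2) w = up · L
          w = up * ι L * inv D
          1≤D : 1 ℕ.≤ D
          1≤D = ℕₚ.*-mono-≤ {1} {25} (s≤s z≤n) (1≤2^ (suc (suc n)))
          l1 : ∀ d c m w e f u → d * (c * w) - d * (m * u) ≡ d * ((c * (w - e) - m * (u + f)) + (c * e + m * f))
          l1 = solve-∀ ℚ-ring
          l2 : ∀ d k r e f → d * (k * r + (k * e + k * f)) ≡ k * (d * (r + (e + f)))
          l2 = solve-∀ ℚ-ring
          m′≤k : ι m′ ≤ ι k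
          m′≤k = ι-mono (ℕₚ.≤-trans (ℕₚ.m≤m*n m′ 8D {{ℕ.>-nonZero (ℕₚ.*-mono-≤ {1} {8} (s≤s z≤n) 1≤D)}}) m′-small)
          w≤ : ∀ i → w ≤ Low Bs (δ i) * ι L
          w≤ i = begin
            up * ι L * inv D                       ≤⟨ *-monoˡ (inv-≥0 D) (*-monoˡ (ι-≥0 L) (low-bound i)) ⟩
            ι D * Low Bs (δ i) * ι L * inv D       ≡⟨ l3 (ι D) (Low Bs (δ i)) (ι L) (inv D) ⟩
            ι D * inv D * (Low Bs (δ i) * ι L)     ≡⟨ trans (cong (_* (Low Bs (δ i) * ι L)) (ι*inv 1≤D)) (*-identityˡ (Low Bs (δ i) * ι L)) ⟩
            Low Bs (δ i) * ι L                     ∎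
            where
            l3 : ∀ d x l v → d * x * l * v ≡ d * v * (x * l)
            l3 = solve-∀ ℚ-ring
          lowers : ι c * (w - ηL) ≤ ∑ k (λ i → 𝟙 (I? i) * ∑ L (λ j → t i (pt j)))
          lowers = ≤-trans (≤-reflexive (trans (cong (_* (w - ηL)) (ι-length-filter I? k)) (sym (∑-*ʳ k (w - ηL) (λ i → 𝟙 (I? i))))))
            (∑-mono k (λ i i<k → *-monoʳ (𝟙-≥0 (I? i)) (≤-trans (+-monoˡ-≤ (- ηL) (w≤ i)) (lower i i<k))))
          uL≥0 : 0ℚ ≤ up * ι L
          uL≥0 = *-nonNeg up≥0 (ι-≥0 L)
          -- 8D c w = 8 c up L ≥ 2 k up L and 8D m′ up L ≤ k up L
          main : ι k * (up * ι L) ≤ ι 8D * (ι c * w) - ι 8D * (ι m′ * (up * ι L))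
          main = begin
            ι k * (up * ι L)                                 ≡⟨ l4 (ι k) (up * ι L) ⟩
            (1ℚ + 1ℚ) * ι k * (up * ι L) - ι k * (up * ι L)  ≤⟨ +-mono-≤ (*-monoˡ uL≥0 two-k) (neg-antimono-≤ (*-monoˡ uL≥0 small-m)) ⟩
            ι 8 * ι c * (up * ι L) - ι 8D * ι m′ * (up * ι L) ≡⟨ cong₂ _-_ (sym eight) (*-assoc (ι 8D) (ι m′) (up * ι L)) ⟩
            ι 8D * (ι c * w) - ι 8D * (ι m′ * (up * ι L))    ∎
            where
            l4 : ∀ k u → k * u ≡ (1ℚ + 1ℚ) * k * u - k * u
            l4 = solve-∀ ℚ-ring
            two-k : (1ℚ + 1ℚ) * ι k ≤ ι 8 * ι c
            two-k = ≤-trans (≤-reflexive (trans (cong (_* ι k) (sym ι-2)) (sym (ι-* 2 k)))) (≤-trans (ι-mono (ℕₚ.≤-trans (ℕₚ.*-monoʳ-≤ 2 I-many) (ℕₚ.≤-reflexive (sym (ℕₚ.*-assoc 2 4 c))))) (≤-reflexive (ι-* 8 c)))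
            small-m : ι 8D * ι m′ ≤ ι k
            small-m = ≤-trans (≤-reflexive (sym (ι-* 8D m′))) (ι-mono (subst (ℕ._≤ k) (ℕₚ.*-comm m′ 8D) m′-small))
            eight : ι 8D * (ι c * w) ≡ ι 8 * ι c * (up * ι L)
            eight = trans (cong (_* (ι c * w)) (ι-* 8 D)) (trans (l5 (ι 8) (ι D) (ι c) (up * ι L) (inv D)) (trans (cong (_* (ι 8 * ι c * (up * ι L))) (ι*inv 1≤D)) (*-identityˡ (ι 8 * ι c * (up * ι L)))))
              where
              l5 : ∀ e d c u v → e * d * (c * (u * v)) ≡ d * v * (e * c * u)
              l5 = solve-∀ ℚ-ring

        Z = 4 ℕ.^ (2 ℕ.* S)

        -- `Up-Q` removes the last rational quantity from `gain`; from here on everything is in ℕ.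
        L-bound : L ℕ.≤ Z ℕ.^ g ℕ.* (8D ℕ.* (R ℕ.+ (costLow Bs ℕ.+ costUp (Qs g 0))))
        L-bound = ι-cancel (begin
          ι L                                         ≡⟨ sym (*-identityˡ (ι L)) ⟩
          1ℚ * ι L                                    ≤⟨ *-monoˡ (ι-≥0 L) (Est.Up-Q 0 g 0 ℕₚ.≤-refl) ⟩
          up * z * ι L                                ≡⟨ lem up z (ι L) ⟩
          z * (up * ι L)                              ≤⟨ *-monoʳ (ι-≥0 (Z ℕ.^ g)) gain ⟩
          z * (ι 8D * (ι R + (ηL + ηU)))              ≡⟨ sym (trans (ι-* (Z ℕ.^ g) _) (cong (z *_) (trans (ι-* 8D _) (cong (ι 8D *_) (trans (ι-+ R _) (cong (ι R +_) (ι-+ (costLow Bs) (costUp (Qs g 0))))))))) ⟩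
          ι (Z ℕ.^ g ℕ.* (8D ℕ.* (R ℕ.+ (costLow Bs ℕ.+ costUp (Qs g 0))))) ∎)
          where
          open ≤-Reasoning
          z = ι (Z ℕ.^ g)
          lem : ∀ a b c → a * b * c ≡ b * (a * c)
          lem = solve-∀ ℚ-ring

-- The arithmetic progression in which n is sought

module Progressions where

  open import Data.Nat.Base
  open import Data.Nat.Properties
  open import Data.Nat.Divisibility
  open import Data.Nat.DivMod
  open import Data.Nat.Primality
  open import Data.List.Base using (filter; downFrom; length)
  open import Data.Product.Base using (_×_; _,_; proj₁; proj₂; ∃-syntax)
  open import Data.Sum.Base using (_⊎_; inj₁; inj₂)
  open import Data.Empty using (⊥-elim)
  open import Relation.Nullary using (Dec; yes; no; ¬_; contradiction)
  open import Relation.Binary.PropositionalEquality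
  import Data.Nat.Tactic.RingSolver as ℕ-Solver
  open Character using (n<2^n)
  open MertensModFour using (P3; P3?; ∑ₙ; bit; bit-yes; prime≥2)
  open TwoSquares using (cases4; %4-*)
  open BrunHooley using (linear-mod)
  open SiftedCount using (∣-shift; length-filter)

  %4-linear : ∀ a n b {x y z} → a % 4 ≡ x → n % 4 ≡ y → b % 4 ≡ z → (a * n + b) % 4 ≡ ((x * y) % 4 + z) % 4
  %4-linear a n b ex ey ez = trans (%-distribˡ-+ (a * n) b 4) (cong₂ (λ s t → (s + t) % 4) (%4-* a n ex ey) ez)

  %2-of-%4 : ∀ a c → a % 4 ≡ c → 2 ∣ c → 2 ∣ a
  %2-of-%4 a c e 2∣c = subst (2 ∣_) (sym (m≡m%n+[m/n]*n a 4)) (∣m∣n⇒∣m+n (subst (2 ∣_) (sym e) 2∣c) (∣n⇒∣m*n (a / 4) (divides 2 refl)))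

  -- An odd a is invertible modulo 4.
  solve-mod-4 : ∀ a b → ¬ 2 ∣ a → (a * 0 + b) % 4 ≡ 1 ⊎ (a * 1 + b) % 4 ≡ 1 ⊎ (a * 2 + b) % 4 ≡ 1 ⊎ (a * 3 + b) % 4 ≡ 1
  solve-mod-4 a b 2∤a = go (cases4 a) (cases4 b)
    where
    Four : ℕ → Set
    Four n = n % 4 ≡ 0 ⊎ n % 4 ≡ 1 ⊎ n % 4 ≡ 2 ⊎ n % 4 ≡ 3
    go : Four a → Four b → (a * 0 + b) % 4 ≡ 1 ⊎ (a * 1 + b) % 4 ≡ 1 ⊎ (a * 2 + b) % 4 ≡ 1 ⊎ (a * 3 + b) % 4 ≡ 1
    go (inj₁ e) _ = contradiction (%2-of-%4 a 0 e (divides 0 refl)) 2∤a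
    go (inj₂ (inj₂ (inj₁ e))) _ = contradiction (%2-of-%4 a 2 e (divides 1 refl)) 2∤a
    go (inj₂ (inj₁ e)) (inj₁ f) = inj₂ (inj₁ (%4-linear a 1 b e refl f))
    go (inj₂ (inj₁ e)) (inj₂ (inj₁ f)) = inj₁ (%4-linear a 0 b e refl f)
    go (inj₂ (inj₁ e)) (inj₂ (inj₂ (inj₁ f))) = inj₂ (inj₂ (inj₂ (%4-linear a 3 b e refl f)))
    go (inj₂ (inj₁ e)) (inj₂ (inj₂ (inj₂ f))) = inj₂ (inj₂ (inj₁ (%4-linear a 2 b e refl f)))
    go (inj₂ (inj₂ (inj₂ e))) (inj₁ f) = inj₂ (inj₂ (inj₂ (%4-linear a 3 b e refl f)))
    go (inj₂ (inj₂ (inj₂ e))) (inj₂ (inj₁ f)) = inj₁ (%4-linear a 0 b e refl f)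
    go (inj₂ (inj₂ (inj₂ e))) (inj₂ (inj₂ (inj₁ f))) = inj₂ (inj₁ (%4-linear a 1 b e refl f))
    go (inj₂ (inj₂ (inj₂ e))) (inj₂ (inj₂ (inj₂ f))) = inj₂ (inj₂ (inj₁ (%4-linear a 2 b e refl f)))

  module _ (a b : ℕ → ℕ) where

    One : ℕ → ℕ → Set
    One ρ i = (a i * ρ + b i) % 4 ≡ 1

    one? : ∀ ρ i → Dec (One ρ i)
    one? ρ i = (a i * ρ + b i) % 4 ≟ 1

    private
      c : ℕ → ℕ → ℕ
      c ρ k = ∑ₙ k (λ i → bit (one? ρ i))

    four-classes : ∀ k → (∀ i → i < k → ¬ 2 ∣ a i) → k ≤ c 0 k + c 1 k + c 2 k + c 3 k
    four-classes zero h = z≤n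
    four-classes (suc k) h = subst (_≤ c 0 (suc k) + c 1 (suc k) + c 2 (suc k) + c 3 (suc k)) (+-comm k 1) (≤-trans (+-mono-≤ (four-classes k (λ i i< → h i (m<n⇒m<1+n i<))) (hit (solve-mod-4 (a k) (b k) (h k ≤-refl))))
      (≤-reflexive (lem (c 0 k) (c 1 k) (c 2 k) (c 3 k) b₀ b₁ b₂ b₃)))
      where
      b₀ = bit (one? 0 k)
      b₁ = bit (one? 1 k)
      b₂ = bit (one? 2 k)
      b₃ = bit (one? 3 k)
      lem : ∀ p q r s x y z w → p + q + r + s + (x + y + z + w) ≡ p + x + (q + y) + (r + z) + (s + w)
      lem = ℕ-Solver.solve-∀
      hit : One 0 k ⊎ One 1 k ⊎ One 2 k ⊎ One 3 k → 1 ≤ b₀ + b₁ + b₂ + b₃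
      hit (inj₁ e) = ≤-trans (≤-reflexive (sym (bit-yes (one? 0 k) e))) (≤-trans (m≤m+n b₀ b₁) (≤-trans (m≤m+n (b₀ + b₁) b₂) (m≤m+n (b₀ + b₁ + b₂) b₃)))
      hit (inj₂ (inj₁ e)) = ≤-trans (≤-reflexive (sym (bit-yes (one? 1 k) e))) (≤-trans (m≤n+m b₁ b₀) (≤-trans (m≤m+n (b₀ + b₁) b₂) (m≤m+n (b₀ + b₁ + b₂) b₃)))
      hit (inj₂ (inj₂ (inj₁ e))) = ≤-trans (≤-reflexive (sym (bit-yes (one? 2 k) e))) (≤-trans (m≤n+m b₂ (b₀ + b₁)) (m≤m+n (b₀ + b₁ + b₂) b₃))
      hit (inj₂ (inj₂ (inj₂ e))) = ≤-trans (≤-reflexive (sym (bit-yes (one? 3 k) e))) (m≤n+m b₃ (b₀ + b₁ + b₂))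

    -- Pigeonhole over the four residues: every index is counted for at least one of them.
    quarter : ∀ k → (∀ i → i < k → ¬ 2 ∣ a i) → ∃[ ρ ] (ρ < 4 × k ≤ 4 * length (filter (one? ρ) (downFrom k)))
    quarter k h = go (k ≤? 4 * l 0) (k ≤? 4 * l 1) (k ≤? 4 * l 2) (k ≤? 4 * l 3)
      where
      l : ℕ → ℕ
      l ρ = length (filter (one? ρ) (downFrom k))
      total : k ≤ l 0 + l 1 + l 2 + l 3
      total = subst (k ≤_) (sym (cong₂ _+_ (cong₂ _+_ (cong₂ _+_ (e 0) (e 1)) (e 2)) (e 3))) (four-classes k h)
        where
        e : ∀ ρ → l ρ ≡ c ρ k
        e ρ = length-filter (one? ρ) k
      go : Dec (k ≤ 4 * l 0) → Dec (k ≤ 4 * l 1) → Dec (k ≤ 4 * l 2) → Dec (k ≤ 4 * l 3) → ∃[ ρ ] (ρ < 4 × k ≤ 4 * l ρ)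
      go (yes p) _ _ _ = 0 , s≤s z≤n , p
      go (no _) (yes p) _ _ = 1 , s≤s (s≤s z≤n) , p
      go (no _) (no _) (yes p) _ = 2 , s≤s (s≤s (s≤s z≤n)) , p
      go (no _) (no _) (no _) (yes p) = 3 , ≤-refl , p
      go (no p) (no q) (no r) (no s) = ⊥-elim (<⇒≱ (+-mono-< (+-mono-< (+-mono-< (≰⇒> p) (≰⇒> q)) (≰⇒> r)) (≰⇒> s))
        (≤-trans (≤-reflexive (lem k)) (≤-trans (*-monoʳ-≤ 4 total) (≤-reflexive (lem₂ (l 0) (l 1) (l 2) (l 3))))))
        where
        lem : ∀ k → k + k + k + k ≡ 4 * k
        lem = ℕ-Solver.solve-∀
        lem₂ : ∀ p q r s → 4 * (p + q + r + s) ≡ 4 * p + 4 * q + 4 * r + 4 * s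
        lem₂ = ℕ-Solver.solve-∀

  module Progression (k : ℕ) (a b : ℕ → ℕ) (ρ : ℕ) (ρ<4 : ρ < 4)
    (adm : ∀ p → P3 p → ∃[ c ] (c < p × (∀ i → i < k → ¬ p ∣ a i * c + b i))) where

    -- `large` keeps the modulus free of the sieving primes, so that the sieve stays equidistributed
    -- on the progression; p ≤ 2 is allowed there because of the factor 4.
    record AP (x w : ℕ) : Set where
      field
        m r   : ℕ
        1≤m   : 1 ≤ m
        r<m   : r < m
        mod4  : ∀ t → (r + m * t) % 4 ≡ ρ
        small : ∀ p → P3 p → p ≤ x → ∀ t i → i < k → ¬ p ∣ a i * (r + m * t) + b i
        large : ∀ p → Prime p → p ∣ m → p ≤ 2 ⊎ p ≤ x
        bound : m ≤ 4 * w ^ x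

    open AP

    -- The Chinese remainder theorem one prime at a time: t₀ moves r into the residue class that
    -- admissibility provides modulo p.
    ap : ∀ x w → x ≤ w → 1 ≤ w → AP x w
    ap zero w _ _ = record { m = 4 ; r = ρ ; 1≤m = s≤s z≤n ; r<m = ρ<4
      ; mod4 = λ t → trans (cong (_% 4) (cong (ρ +_) (*-comm 4 t))) (trans ([m+kn]%n≡m%n ρ t 4) (m<n⇒m%n≡m ρ<4))
      ; small = λ p (pp , _) p≤0 → contradiction (prime≥2 pp) (<⇒≱ (s≤s (≤-trans p≤0 z≤n)))
      ; large = λ p pp p∣4 → inj₁ (two p pp p∣4)
      ; bound = ≤-refl }
      where
      two : ∀ p → Prime p → p ∣ 4 → p ≤ 2
      two p pp p∣4 with euclidsLemma 2 2 pp p∣4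
      ... | inj₁ h = ∣⇒≤ h
      ... | inj₂ h = ∣⇒≤ h
    ap (suc x) w sx≤w 1≤w = extend (P3? (suc x)) (ap x w (<⇒≤ sx≤w) 1≤w)
      where
      p = suc x
      extend : Dec (P3 p) → AP x w → AP p w
      extend (no ¬p3) A = record { m = m A ; r = r A ; 1≤m = 1≤m A ; r<m = r<m A ; mod4 = mod4 A
        ; small = λ q q3 q≤ → small A q q3 (≤-pred (≤∧≢⇒< q≤ (λ e → ¬p3 (subst P3 e q3))))
        ; large = λ q pq q∣ → up (large A q pq q∣)
        ; bound = ≤-trans (bound A) (*-monoʳ-≤ 4 (^-monoʳ-≤ w {{>-nonZero 1≤w}} (n≤1+n x))) }
        where
        up : ∀ {q} → q ≤ 2 ⊎ q ≤ x → q ≤ 2 ⊎ q ≤ p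
        up (inj₁ h) = inj₁ h
        up (inj₂ h) = inj₂ (m≤n⇒m≤1+n h)
      extend (yes p3@(pp , pmod)) A = record { m = m A * p ; r = r′ ; 1≤m = *-mono-≤ (1≤m A) (s≤s (z≤n {x})) ; r<m = r′<
        ; mod4 = λ t → trans (cong (_% 4) (arg t)) (mod4 A (t₀ + p * t))
        ; small = λ q q3 q≤ t i i<k → small′ q q3 q≤ t i i<k (q ≟ p)
        ; large = λ q pq q∣ → large′ q pq (euclidsLemma (m A) p pq q∣)
        ; bound = ≤-trans (*-mono-≤ (bound A) sx≤w) (≤-reflexive (trans (*-assoc 4 (w ^ x) w) (cong (4 *_) (*-comm (w ^ x) w)))) }
        where
        p∤m : ¬ p ∣ m A
        p∤m h with large A p pp h
        ... | inj₂ p≤x = <⇒≱ ≤-refl p≤x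
        ... | inj₁ p≤2 = contradiction (trans (sym pmod) (cong (_% 4) (≤-antisym p≤2 (prime≥2 pp)))) λ ()
        c = proj₁ (adm p p3)
        sol = linear-mod pp p∤m (r A) c (proj₁ (proj₂ (adm p p3)))
        t₀ = proj₁ sol
        r′ = r A + m A * t₀
        r′< : r′ < m A * p
        r′< = <-≤-trans (+-monoˡ-< (m A * t₀) (r<m A)) (≤-trans (≤-reflexive (sym (*-suc (m A) t₀))) (*-monoʳ-≤ (m A) (proj₁ (proj₂ sol))))
        arg : ∀ t → r′ + m A * p * t ≡ r A + m A * (t₀ + p * t)
        arg t = lem (r A) (m A) t₀ p t
          where
          lem : ∀ r m t₀ p t → r + m * t₀ + m * p * t ≡ r + m * (t₀ + p * t)
          lem = ℕ-Solver.solve-∀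
        small′ : ∀ q → P3 q → q ≤ p → ∀ t i → i < k → Dec (q ≡ p) → ¬ q ∣ a i * (r′ + m A * p * t) + b i
        small′ q q3 q≤ t i i<k (no q≢p) h = small A q q3 (≤-pred (≤∧≢⇒< q≤ q≢p)) (t₀ + p * t) i i<k (subst (λ z → q ∣ a i * z + b i) (arg t) h)
        small′ q q3 q≤ t i i<k (yes refl) h = proj₂ (proj₂ (adm p p3)) i i<k (∣-shift p (a i) (b i) c (r′ / p + m A * t) (subst (λ z → p ∣ a i * z + b i) eq h))
          where
          eq : r′ + m A * p * t ≡ c + (r′ / p + m A * t) * p
          eq = trans (cong (_+ m A * p * t) (trans (m≡m%n+[m/n]*n r′ p) (cong (_+ r′ / p * p) (proj₂ (proj₂ sol))))) (lem c (r′ / p) p (m A) t)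
            where
            lem : ∀ c d p m t → c + d * p + m * p * t ≡ c + (d + m * t) * p
            lem = ℕ-Solver.solve-∀
        large′ : ∀ q → Prime q → q ∣ m A ⊎ q ∣ p → q ≤ 2 ⊎ q ≤ p
        large′ q pq (inj₂ q∣p) = inj₂ (∣⇒≤ q∣p)
        large′ q pq (inj₁ q∣m) with large A q pq q∣m
        ... | inj₁ h = inj₁ h
        ... | inj₂ h = inj₂ (m≤n⇒m≤1+n h)

  power-above : ∀ b → 2 ≤ b → ∀ x → 1 ≤ x → ∃[ J ] (x ≤ b ^ J × b ^ J ≤ b * x)
  power-above b 2≤b (suc zero) _ = 0 , ≤-refl , ≤-trans (<⇒≤ 2≤b) (≤-reflexive (sym (*-identityʳ b)))
  power-above b 2≤b (suc (suc x)) _ = go (power-above b 2≤b (suc x) (s≤s z≤n))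
    where
    go : ∃[ J ] (suc x ≤ b ^ J × b ^ J ≤ b * suc x) → ∃[ J ] (suc (suc x) ≤ b ^ J × b ^ J ≤ b * suc (suc x))
    go (J , lo , hi) = choose (suc (suc x) ≤? b ^ J)
      where
      choose : Dec (suc (suc x) ≤ b ^ J) → ∃[ J ] (suc (suc x) ≤ b ^ J × b ^ J ≤ b * suc (suc x))
      choose (yes h) = J , h , ≤-trans hi (*-monoʳ-≤ b (n≤1+n (suc x)))
      choose (no h) = suc J , ≤-trans (+-mono-≤ (≤-trans (s≤s z≤n) lo) lo) (≤-trans (≤-reflexive (cong (b ^ J +_) (sym (+-identityʳ (b ^ J))))) (*-monoˡ-≤ (b ^ J) 2≤b)) ,
        *-monoʳ-≤ b (<⇒≤ (≰⇒> h))

  ^-≤-2^ : ∀ v e → v ^ e ≤ 2 ^ (e * v)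
  ^-≤-2^ v e = ≤-trans (^-monoˡ-≤ e (<⇒≤ (n<2^n v))) (≤-reflexive (trans (^-*-assoc 2 v e) (cong (2 ^_) (*-comm v e))))

-- Choice of the parameters and the level of distribution

module Parameters where

  open import Data.Bool.Base using (T)
  open import Data.Nat.Base
  open import Data.Nat.Properties
  open import Data.Nat.DivMod
  open import Data.Product.Base using (_×_; _,_; ∃-syntax)
  open import Relation.Nullary using (contradiction)
  open import Relation.Binary.PropositionalEquality
  import Data.Nat.Tactic.RingSolver as ℕ-Solver
  open WeightedMertens using (2^-cancel-≤)
  open Progressions using (power-above; ^-≤-2^)
  open SiftingBlocks using (module Ranges)

  module Exists (ℓ v k : ℕ) (1≤k : 1 ≤ k) where

    -- 2^21 is the least power of 2 that passes the numerical test in `144fQ₁`.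
    pick-n : ∃[ n ] (2 ^ 21 * k ≤ 4 ^ suc n × 4 ^ suc n ≤ 4 * (2 ^ 21 * k))
    pick-n = go (power-above 4 (s≤s (s≤s z≤n)) (2 ^ 21 * k) (*-mono-≤ {1} {2 ^ 21} (m^n>0 2 21) 1≤k))
      where
      go : ∃[ J ] (2 ^ 21 * k ≤ 4 ^ J × 4 ^ J ≤ 4 * (2 ^ 21 * k)) → ∃[ n ] (2 ^ 21 * k ≤ 4 ^ suc n × 4 ^ suc n ≤ 4 * (2 ^ 21 * k))
      go (suc n , h) = n , h
      go (zero , h , _) = contradiction (≤-trans (*-monoʳ-≤ (2 ^ 21) 1≤k) h) (<⇒≱ (≤ᵇ⇒≤ 2 (2 ^ 21 * 1) _))

    -- With d = 8 · 4^(n+1) the product d s is the exponent of z², which has to reach ℓ + 8v since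
    -- the values lie below 2^(ℓ + 8v).
    pick-s : ∀ d → .{{_ : NonZero d}} → ∃[ s ] (1 ≤ s × ℓ + 8 * v ≤ d * s × d * s ≤ ℓ + (8 * v + d))
    pick-s d = suc (y / d) , s≤s z≤n ,
      ≤-trans (≤-reflexive (m≡m%n+[m/n]*n y d)) (≤-trans (+-monoˡ-≤ (y / d * d) (<⇒≤ (m%n<n y d))) (≤-reflexive (*-comm (suc (y / d)) d))) ,
      ≤-trans (≤-reflexive (*-comm d (suc (y / d)))) (≤-trans (+-monoʳ-≤ d (m/n*n≤m y d)) (≤-reflexive (trans (+-comm d y) (+-assoc ℓ (8 * v) d))))
      where y = ℓ + 8 * v

  module Choice (v ℓ k : ℕ) (v-big : 2 ^ 40 ≤ v) (ℓ-lo : v ^ 19 ≤ ℓ) (ℓ-hi : ℓ ≤ v ^ 20) (1≤k : 1 ≤ k) (k≤ : k ≤ v ^ 4)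
    (n s′ g : ℕ) (F-lo : 2 ^ 21 * k ≤ 4 ^ suc n) (F-hi′ : 4 ^ suc n ≤ 4 * (2 ^ 21 * k))
    (L-lo : ℓ + 8 * v ≤ 8 * 4 ^ suc n * s′) (L-hi : 8 * 4 ^ suc n * s′ ≤ ℓ + (8 * v + 8 * 4 ^ suc n))
    (X0≤τ′ : s′ * 4 ≤ 2 ^ g) (τ≤8s′ : 2 ^ g ≤ 2 * (s′ * 4)) where

    lit : ∀ c → T (c ≤ᵇ 2 ^ 40) → c ≤ v
    lit c h = ≤-trans (≤ᵇ⇒≤ c (2 ^ 40) h) v-big

    1≤v : 1 ≤ v
    1≤v = lit 1 _

    instance
      v≢0 : NonZero v
      v≢0 = >-nonZero 1≤v

    up : ∀ {x i} j → i ≤ j → x ≤ v ^ i → x ≤ v ^ j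
    up j i≤j h = ≤-trans h (^-monoʳ-≤ v i≤j)

    ≤v : ∀ {x} → x ≤ v → x ≤ v ^ 1
    ≤v h = ≤-trans h (≤-reflexive (sym (*-identityʳ v)))

    mul : ∀ {x y} i j → x ≤ v ^ i → y ≤ v ^ j → x * y ≤ v ^ (i + j)
    mul i j hx hy = ≤-trans (*-mono-≤ hx hy) (≤-reflexive (sym (^-distribˡ-+-* v i j)))

    -- As v ≥ 2^40, the estimates only count powers of v: a numerical factor costs one power, and so
    -- does a sum of two terms.
    scale : ∀ c {x} i → T (c ≤ᵇ 2 ^ 40) → x ≤ v ^ i → c * x ≤ v ^ suc i
    scale c i h hx = *-mono-≤ (lit c h) hx

    add : ∀ {x y} i → x ≤ v ^ i → y ≤ v ^ i → x + y ≤ v ^ suc i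
    add i hx hy = ≤-trans (+-mono-≤ hx hy) (≤-trans (≤-reflexive (cong (v ^ i +_) (sym (+-identityʳ (v ^ i))))) (*-monoˡ-≤ (v ^ i) (lit 2 _)))

    F = 4 ^ suc n

    F-hi : F ≤ v ^ 5
    F-hi = ≤-trans F-hi′ (≤-trans (≤-reflexive (sym (*-assoc 4 (2 ^ 21) k))) (scale (4 * 2 ^ 21) 4 _ k≤))

    1≤F : 1 ≤ F
    1≤F = m^n>0 4 (suc n)

    L = 8 * F * s′

    8F≤ : 8 * F ≤ v ^ 6
    8F≤ = scale 8 5 _ F-hi

    -- Otherwise 8 F s′ ≤ v^16 could not reach ℓ ≥ v^19.
    s′-big : v ^ 10 ≤ s′
    s′-big = ≮⇒≥ (λ s′< → <⇒≱ (≤-<-trans (≤-trans L-lo (mul 6 10 8F≤ (<⇒≤ s′<))) (^-monoʳ-< v (lit 2 _) {16} {19} (≤ᵇ⇒≤ 17 19 _))) (≤-trans ℓ-lo (m≤m+n ℓ (8 * v))))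

    s′≥11100 : 11100 ≤ s′
    s′≥11100 = ≤-trans (≤v (lit 11100 _)) (≤-trans (^-monoʳ-≤ v {1} {10} (s≤s z≤n)) s′-big)

    s′≥111 : 111 * 4 ^ suc (suc n) ≤ s′
    s′≥111 = ≤-trans (scale 111 6 _ (scale 4 5 _ F-hi)) (≤-trans (^-monoʳ-≤ v {7} {10} (≤ᵇ⇒≤ 7 10 _)) s′-big)

    open Ranges k s′ g 1≤k public

    X0≤τ : X 0 ≤ τ
    X0≤τ = X0≤τ′

    τ≤X1 : τ ≤ X 1
    τ≤X1 = ≤-trans τ≤8s′ (≤-trans (≤-reflexive (lem s′)) (*-monoʳ-≤ s′ {8} {16} (≤ᵇ⇒≤ 8 16 _)))
      where
      lem : ∀ s → 2 * (s * 4) ≡ s * 8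
      lem = ℕ-Solver.solve-∀

    2X≡L : 2 * X (suc n) ≡ L
    2X≡L = lem s′ F
      where
      lem : ∀ s f → 2 * (s * (4 * f)) ≡ 8 * f * s
      lem = ℕ-Solver.solve-∀

    g≤ : g ≤ 21 * v
    g≤ = 2^-cancel-≤ (≤-trans τ≤8s′ (≤-trans (≤-reflexive (lem s′)) (≤-trans (*-monoˡ-≤ s′ {8} {8 * F} (≤-trans (≤-reflexive (sym (*-identityʳ 8))) (*-monoʳ-≤ 8 1≤F)))
      (≤-trans L-hi (≤-trans (+-mono-≤ ℓ-hi (up 20 (≤ᵇ⇒≤ 7 20 _) (add 6 (up 6 (≤ᵇ⇒≤ 2 6 _) (scale 8 1 _ (≤v ≤-refl))) 8F≤))) (≤-trans (add 20 ≤-refl ≤-refl) (^-≤-2^ v 21)))))))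
      where
      lem : ∀ s → 2 * (s * 4) ≡ 8 * s
      lem = ℕ-Solver.solve-∀

    J≤ : suc n ≤ 5 * v
    J≤ = 2^-cancel-≤ (≤-trans (^-monoˡ-≤ (suc n) {2} {4} (s≤s (s≤s z≤n))) (≤-trans F-hi (^-≤-2^ v 5)))

    κ′ = suc (4 * v)

    2k≤ : 2 * k ≤ 2 ^ κ′
    2k≤ = *-monoʳ-≤ 2 (≤-trans k≤ (^-≤-2^ v 4))

    g≤v² : g ≤ v ^ 2
    g≤v² = ≤-trans g≤ (scale 21 1 _ (≤v ≤-refl))

    J≤v² : suc n ≤ v ^ 2
    J≤v² = ≤-trans J≤ (scale 5 1 _ (≤v ≤-refl))

    κ′≤ : κ′ ≤ v ^ 3
    κ′≤ = add 2 (up 2 z≤n (≤-refl {1})) (scale 4 1 _ (≤v ≤-refl))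

    S≤ : S ≤ v ^ 5
    S≤ = scale 56 4 _ k≤

    -- Bounds log₂ of the modulus, which is at most 4 w^w for w = v^7.
    m₁ = 2 + 7 * v * v ^ 7

    -- Exponent of all losses other than the sieve error: the density of the all-forms sieve, the
    -- factor 8D, the modulus, and some absolute constants.
    G = 4 * S * g + (suc n + (m₁ + 13))

    G≤ : G ≤ v ^ 9
    G≤ = ≤-trans (+-mono-≤ (mul 6 2 (scale 4 5 _ S≤) g≤v²) (+-mono-≤ (up 8 (≤ᵇ⇒≤ 2 8 _) J≤v²) (+-mono-≤ (+-mono-≤ (up {2} 8 (s≤s z≤n) (≤v (lit 2 _))) (≤-reflexive (*-assoc 7 v (v ^ 7)))) (up {13} 8 (s≤s z≤n) (≤v (lit 13 _))))))
      (≤-trans (≤-reflexive (lem (v ^ 8))) (*-monoˡ-≤ (v ^ 8) (lit 11 _)))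
      where
      lem : ∀ x → x + (x + ((x + 7 * x) + x)) ≡ 11 * x
      lem = ℕ-Solver.solve-∀

    module _ (fQ₁ fQ₂ fQ exR : ℕ) (fQ≡ : fQ ≡ fQ₁ + fQ₂) (fQ₁≡ : fQ₁ ≡ 4 * τ * (64 * S + 0 + 1)) (fQ₂≡ : fQ₂ ≡ 2 * g * κ′ * (64 * S + 0 + g))
      (exR≤ : 9 * exR ≤ X (suc n) * (24 * 0 + 8) + 18 * suc n * κ′ * (0 + suc n) + 9 * fQ) where

      64S+1≤ : 64 * S + 0 + 1 ≤ 3585 * k
      64S+1≤ = ≤-trans (+-mono-≤ (≤-reflexive (trans (+-identityʳ (64 * S)) (sym (*-assoc 64 56 k)))) 1≤k) (≤-reflexive (+-comm (3584 * k) k))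

      -- The all-forms sieve may spend one 144th of the level. This inequality determines 2^21; 3585
      -- is 64 · 56 + 1.
      144fQ₁ : 144 * fQ₁ ≤ L
      144fQ₁ = begin
        144 * fQ₁                                 ≡⟨ cong (144 *_) fQ₁≡ ⟩
        144 * (4 * τ * (64 * S + 0 + 1))          ≤⟨ *-monoʳ-≤ 144 (*-mono-≤ (*-monoʳ-≤ 4 (≤-trans τ≤8s′ (≤-reflexive (trans (cong (2 *_) (*-comm s′ 4)) (sym (*-assoc 2 4 s′)))))) 64S+1≤) ⟩
        144 * (4 * (8 * s′) * (3585 * k))         ≡⟨ lem 144 4 8 3585 s′ k ⟩
        (144 * 4 * 8 * 3585) * k * s′             ≤⟨ *-monoˡ-≤ s′ (*-monoˡ-≤ k (≤ᵇ⇒≤ (144 * 4 * 8 * 3585) (8 * 2 ^ 21) _)) ⟩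
        (8 * 2 ^ 21) * k * s′                     ≡⟨ cong (_* s′) (*-assoc 8 (2 ^ 21) k) ⟩
        8 * (2 ^ 21 * k) * s′                     ≤⟨ *-monoˡ-≤ s′ (*-monoʳ-≤ 8 F-lo) ⟩
        8 * F * s′                                ∎
        where
        open ≤-Reasoning
        lem : ∀ p q r t s k → p * (q * (r * s) * (t * k)) ≡ (p * q * r * t) * k * s
        lem = ℕ-Solver.solve-∀

      E = exR + (suc n + g + (X (suc n) + κ′))

      Rest = 16 * (18 * suc n * κ′ * (0 + suc n)) + 144 * fQ₂ + 144 * (G + (suc n + g + κ′))

      Rest≤ : Rest ≤ v ^ 16
      Rest≤ = add 15 (add 14 (up 14 (≤ᵇ⇒≤ 9 14 _) (scale 16 8 _ (mul 6 2 (mul 3 3 (scale 18 2 _ J≤v²) κ′≤) J≤v²)))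
          (scale 144 13 _ (≤-trans (≤-reflexive fQ₂≡) (up 13 (≤ᵇ⇒≤ 13 13 _) (mul 6 7 (mul 3 3 (scale 2 2 _ g≤v²) κ′≤) (add 6 (≤-trans (≤-reflexive (+-identityʳ (64 * S))) (scale 64 5 _ S≤)) (up 6 (≤ᵇ⇒≤ 2 6 _) g≤v²)))))))
        (up 15 (≤ᵇ⇒≤ 11 15 _) (scale 144 10 _ (add 9 G≤ (up 9 (≤ᵇ⇒≤ 5 9 _) (add 4 (up 4 (≤ᵇ⇒≤ 3 4 _) (add 2 J≤v² g≤v²)) (up 4 (≤ᵇ⇒≤ 3 4 _) κ′≤))))))

      -- In units of ℓ/144, where L is close to ℓ: 64 for the truncated one-form blocks, 72 for the
      -- extra event of the lower bound, 1 for the blocks below τ. The remaining 7 absorb the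
      -- lower-order terms.
      level : G + E ≤ ℓ
      level = *-cancelˡ-≤ 144 (begin
        144 * (G + (exR + (suc n + g + (x + κ′))))          ≡⟨ d₁ 144 G exR (suc n + g) x κ′ ⟩
        144 * exR + (144 * x + 144 * (G + (suc n + g + κ′))) ≡⟨ cong (_+ (144 * x + c)) (*-assoc 16 9 exR) ⟩
        16 * (9 * exR) + (144 * x + c)                      ≤⟨ +-monoˡ-≤ (144 * x + c) (*-monoʳ-≤ 16 exR≤) ⟩
        16 * (x * 8 + b + 9 * fQ) + (144 * x + c)           ≡⟨ cong (λ z → 16 * (x * 8 + b + 9 * z) + (144 * x + c)) fQ≡ ⟩
        16 * (x * 8 + b + 9 * (fQ₁ + fQ₂)) + (144 * x + c)  ≡⟨ d₂ 16 8 9 144 x b fQ₁ fQ₂ c ⟩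
        (16 * 8 + 144) * x + (16 * 9 * fQ₁ + (16 * b + 16 * 9 * fQ₂ + c)) ≡⟨ cong (_+ (144 * fQ₁ + Rest)) (trans (*-assoc 136 2 x) (cong (136 *_) 2X≡L)) ⟩
        136 * L + (144 * fQ₁ + Rest)                        ≤⟨ +-monoʳ-≤ (136 * L) (+-monoˡ-≤ Rest 144fQ₁) ⟩
        136 * L + (L + Rest)                                ≡⟨ trans (sym (+-assoc (136 * L) L Rest)) (cong (_+ Rest) (+-comm (136 * L) L)) ⟩
        137 * L + Rest                                      ≤⟨ +-monoˡ-≤ Rest (*-monoʳ-≤ 137 L-hi) ⟩
        137 * (ℓ + (8 * v + 8 * F)) + Rest                  ≡⟨ d₃ 137 ℓ (8 * v + 8 * F) Rest ⟩
        137 * ℓ + (137 * (8 * v + 8 * F) + Rest)            ≤⟨ +-monoʳ-≤ (137 * ℓ) (≤-trans (add 16 (up 16 (≤ᵇ⇒≤ 8 16 _) (scale 137 7 _ (add 6 (up 6 (≤ᵇ⇒≤ 2 6 _) (scale 8 1 _ (≤v ≤-refl))) 8F≤))) Rest≤) (≤-trans (^-monoʳ-≤ v {17} {19} (≤ᵇ⇒≤ 17 19 _)) (≤-trans ℓ-lo (m≤m+n ℓ (6 * ℓ))))) ⟩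
        137 * ℓ + 7 * ℓ                                     ≡⟨ sym (*-distribʳ-+ ℓ 137 7) ⟩
        144 * ℓ                                             ∎)
        where
        open ≤-Reasoning
        x = X (suc n)
        b = 18 * suc n * κ′ * (0 + suc n)
        c = 144 * (G + (suc n + g + κ′))
        d₁ : ∀ c G e j x κ → c * (G + (e + (j + (x + κ)))) ≡ c * e + (c * x + c * (G + (j + κ)))
        d₁ = ℕ-Solver.solve-∀
        d₂ : ∀ s e n m x b p q c → s * (x * e + b + n * (p + q)) + (m * x + c) ≡ (s * e + m) * x + (s * n * p + (s * b + s * n * q + c))
        d₂ = ℕ-Solver.solve-∀
        d₃ : ∀ c l y r → c * (l + y) + r ≡ c * l + (c * y + r)
        d₃ = ℕ-Solver.solve-∀

-- The theorem for integers

module IntegerForm where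

  open import Data.Nat.Base
  open import Data.Nat.Properties
  open import Data.Nat.Divisibility
  open import Data.Nat.DivMod
  open import Data.Nat.Primality
  open import Data.List.Base using (filter; downFrom; length)
  open import Data.List.Properties using (length-map)
  open import Data.List.Relation.Unary.All as All using (All)
  open import Data.List.Relation.Unary.Unique.Propositional using (Unique)
  import Data.List.Relation.Unary.Unique.Propositional.Properties as Uₚ
  open import Data.List.Membership.Propositional using (_∈_)
  open import Data.List.Membership.Propositional.Properties using (∈-filter⁻; ∈-downFrom⁻)
  open import Data.Product.Base using (_×_; _,_; proj₁; proj₂; ∃-syntax)
  open import Data.Sum.Base using (inj₁; inj₂)
  open import Relation.Nullary using (Dec; yes; no; ¬_)
  open import Relation.Binary.PropositionalEquality
  import Data.Nat.Tactic.RingSolver as ℕ-Solver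
  open MertensModFour using (P3; ^-distribʳ-*)
  open TwoSquares using (SumSq; sifted⇒sumSq)
  open SiftedCount using (module Counting)
  open Progressions
  open BrunHooley using (module Equidistribution)
  open Parameters

  opaque
    -- 400 = 8 · 25 · 2 collects the counting factor; 2^12 is the next power of 2 after the square
    -- root of 4 · 2^21, from the rounding in 4^(n+1) ≤ 4 · 2^21 k.
    C₀ : ℕ
    C₀ = 400 * 2 ^ 12

    C₀-large : 400 * 400 * (4 * 2 ^ 21) ≤ C₀ * C₀
    C₀-large = ≤ᵇ⇒≤ (400 * 400 * (4 * 2 ^ 21)) (400 * 2 ^ 12 * (400 * 2 ^ 12)) _

    1≤C₀ : 1 ≤ C₀
    1≤C₀ = ≤ᵇ⇒≤ 1 (400 * 2 ^ 12) _

  -- The margins N + 1 and 2N - 2 place m in [x, 2x] although x is only known to satisfy |x - N| <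
  -- 1.
  Many : (k : ℕ) (a b : ℕ → ℕ) (N m′ m : ℕ) → Set
  Many k a b N m′ m = suc N ≤ m × 2 + m ≤ N + N ×
    ∃[ js ] (Unique js × All (λ j → j < k × SumSq (a j * m + b j)) js × suc m′ ≤ length js)

  count-bound : ∀ N M L R m w e → N ≤ 2 * (M * L) → M ≤ 2 ^ m → L ≤ 2 * (2 ^ w * R) → 1 ≤ N → 3 + (m + w) ≤ e → suc N ≤ R * 2 ^ e
  count-bound N M L R m w e N≤ M≤ L≤ 1≤N h = begin
    suc N                            ≤⟨ +-monoˡ-≤ N 1≤N ⟩
    N + N                            ≤⟨ +-mono-≤ N≤′ N≤′ ⟩
    2 * (2 ^ m * (2 * (2 ^ w * R))) + 2 * (2 ^ m * (2 * (2 ^ w * R))) ≡⟨ lem (2 ^ m) (2 ^ w) R ⟩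
    R * (8 * (2 ^ m * 2 ^ w))        ≡⟨ cong (λ z → R * (8 * z)) (sym (^-distribˡ-+-* 2 m w)) ⟩
    R * (8 * 2 ^ (m + w))            ≡⟨ cong (R *_) (sym (^-distribˡ-+-* 2 3 (m + w))) ⟩
    R * 2 ^ (3 + (m + w))            ≤⟨ *-monoʳ-≤ R (^-monoʳ-≤ 2 h) ⟩
    R * 2 ^ e                        ∎
    where
    open ≤-Reasoning
    N≤′ : N ≤ 2 * (2 ^ m * (2 * (2 ^ w * R)))
    N≤′ = ≤-trans N≤ (*-monoʳ-≤ 2 (*-mono-≤ M≤ L≤))
    lem : ∀ m w r → 2 * (m * (2 * (w * r))) + 2 * (m * (2 * (w * r))) ≡ r * (8 * (m * w))
    lem = ℕ-Solver.solve-∀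

  value-bound : ∀ a m b N ℓ w e x → a ≤ w → m ≤ N + N → b ≤ N → N ≤ 2 ^ suc ℓ → 1 ≤ w → 8 * w ≤ 2 ^ e → ℓ + e ≤ x + x →
    a * m + b ≤ 2 ^ x * 2 ^ x
  value-bound a m b N ℓ w e x a≤ m≤ b≤ N≤ 1≤w w≤ h = begin
    a * m + b                         ≤⟨ +-mono-≤ (*-mono-≤ a≤ m≤) b≤ ⟩
    w * (N + N) + N                   ≤⟨ +-monoʳ-≤ (w * (N + N)) (≤-trans (m≤m+n N N) (≤-trans (≤-reflexive (sym (*-identityˡ (N + N)))) (*-monoˡ-≤ (N + N) 1≤w))) ⟩
    w * (N + N) + w * (N + N)         ≤⟨ +-mono-≤ (*-monoʳ-≤ w NN) (*-monoʳ-≤ w NN) ⟩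
    w * (4 * 2 ^ ℓ) + w * (4 * 2 ^ ℓ) ≡⟨ lem w (2 ^ ℓ) ⟩
    8 * w * 2 ^ ℓ                     ≤⟨ *-monoˡ-≤ (2 ^ ℓ) w≤ ⟩
    2 ^ e * 2 ^ ℓ                     ≡⟨ trans (*-comm (2 ^ e) (2 ^ ℓ)) (sym (^-distribˡ-+-* 2 ℓ e)) ⟩
    2 ^ (ℓ + e)                       ≤⟨ ^-monoʳ-≤ 2 h ⟩
    2 ^ (x + x)                       ≡⟨ ^-distribˡ-+-* 2 x x ⟩
    2 ^ x * 2 ^ x                     ∎
    where
    open ≤-Reasoning
    NN : N + N ≤ 4 * 2 ^ ℓ
    NN = ≤-trans (+-mono-≤ N≤ N≤) (≤-reflexive (lem₂ (2 ^ ℓ)))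
      where
      lem₂ : ∀ x → 2 * x + 2 * x ≡ 4 * x
      lem₂ = ℕ-Solver.solve-∀
    lem : ∀ x y → x * (4 * y) + x * (4 * y) ≡ 8 * x * y
    lem = ℕ-Solver.solve-∀

  point-bound : ∀ N M r t q → r ≤ M + (M + suc N) → 1 ≤ M → suc t + 4 ≤ q → q * M ≤ N → 2 + (r + M * t) ≤ N + N
  point-bound N M r t q r≤ 1≤M t≤ q≤ = begin
    2 + (r + M * t)                       ≤⟨ +-monoʳ-≤ 2 (+-monoˡ-≤ (M * t) r≤) ⟩
    2 + (M + (M + suc N) + M * t)         ≡⟨ lem M N (M * t) ⟩
    N + (3 * 1 + (M + M) + M * t)         ≤⟨ +-monoʳ-≤ N (+-monoˡ-≤ (M * t) (+-monoˡ-≤ (M + M) (*-monoʳ-≤ 3 1≤M))) ⟩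
    N + (3 * M + (M + M) + M * t)         ≡⟨ cong (N +_) (lem₂ M t) ⟩
    N + (suc t + 4) * M                   ≤⟨ +-monoʳ-≤ N (≤-trans (*-monoˡ-≤ M t≤) q≤) ⟩
    N + N                                 ∎
    where
    open ≤-Reasoning
    lem : ∀ m n x → 2 + (m + (m + suc n) + x) ≡ n + (3 * 1 + (m + m) + x)
    lem = ℕ-Solver.solve-∀
    lem₂ : ∀ m t → 3 * m + (m + m) + m * t ≡ (suc t + 4) * m
    lem₂ = ℕ-Solver.solve-∀

  mod-transfer : ∀ a b m ρ → m % 4 ≡ ρ % 4 → (a * ρ + b) % 4 ≡ 1 → (a * m + b) % 4 ≡ 1
  mod-transfer a b m ρ e h = trans (%4-linear a m b refl e refl) (trans (sym (%4-linear a ρ b refl refl refl)) h)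

  -- Squaring k ≤ s e p and inserting p² ≤ c k leaves one factor k to cancel. This is how s ≫
  -- k^(1/2) is obtained without roots.
  square-bound : ∀ k s D e p F c C → 1 ≤ k → k ≤ s * D → D ≡ e * p → p * p ≡ F → F ≤ c * k → e * e * c ≤ C * C → k ≤ (s * C) * (s * C)
  square-bound k s D e p F c C 1≤k k≤ refl refl F≤ ec≤ = *-cancelʳ-≤ k _ k {{>-nonZero 1≤k}} (begin
    k * k                               ≤⟨ *-mono-≤ k≤ k≤ ⟩
    s * (e * p) * (s * (e * p))         ≡⟨ lem s e p ⟩
    s * s * (e * e * (p * p))           ≤⟨ *-monoʳ-≤ (s * s) (*-monoʳ-≤ (e * e) F≤) ⟩
    s * s * (e * e * (c * k))           ≡⟨ cong (s * s *_) (sym (*-assoc (e * e) c k)) ⟩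
    s * s * (e * e * c * k)             ≤⟨ *-monoʳ-≤ (s * s) (*-monoˡ-≤ k ec≤) ⟩
    s * s * (C * C * k)                 ≡⟨ lem₂ s C k ⟩
    s * C * (s * C) * k                 ∎)
    where
    open ≤-Reasoning
    lem : ∀ s e p → s * (e * p) * (s * (e * p)) ≡ s * s * (e * e * (p * p))
    lem = ℕ-Solver.solve-∀
    lem₂ : ∀ s c k → s * s * (c * c * k) ≡ s * c * (s * c) * k
    lem₂ = ℕ-Solver.solve-∀

  module Assembly (N ℓ v k : ℕ) (a b : ℕ → ℕ) (v-big : 2 ^ 40 ≤ v) (ℓ-lo : v ^ 19 ≤ ℓ) (ℓ-hi : ℓ ≤ v ^ 20) (N-lo : 2 ^ ℓ ≤ N) (N-hi : N ≤ 2 ^ suc ℓ)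
    (1≤k : 1 ≤ k) (k≤ : k ≤ v ^ 4) (a-pos : ∀ i → i < k → 1 ≤ a i) (a≤ : ∀ i → i < k → a i ≤ v ^ 7) (a-odd : ∀ i → i < k → ¬ 2 ∣ a i) (b≤ : ∀ i → i < k → b i ≤ N)
    (adm : ∀ p → P3 p → ∃[ c ] (c < p × (∀ i → i < k → ¬ p ∣ a i * c + b i)))
    (n s′ g : ℕ) (F-lo : 2 ^ 21 * k ≤ 4 ^ suc n) (F-hi′ : 4 ^ suc n ≤ 4 * (2 ^ 21 * k))
    (L-lo : ℓ + 8 * v ≤ 8 * 4 ^ suc n * s′) (L-hi : 8 * 4 ^ suc n * s′ ≤ ℓ + (8 * v + 8 * 4 ^ suc n))
    (X0≤τ′ : s′ * 4 ≤ 2 ^ g) (τ≤8s′ : 2 ^ g ≤ 2 * (s′ * 4)) where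

    open Choice v ℓ k v-big ℓ-lo ℓ-hi 1≤k k≤ n s′ g F-lo F-hi′ L-lo L-hi X0≤τ′ τ≤8s′

    w₀ = v ^ 7

    1≤w₀ : 1 ≤ w₀
    1≤w₀ = m^n>0 v 7

    2≤w₀ : 2 ≤ w₀
    2≤w₀ = up {2} 7 (s≤s z≤n) (≤v (lit 2 _))

    2k≤w₀ : 2 * k ≤ w₀
    2k≤w₀ = up 7 (≤ᵇ⇒≤ 5 7 _) (scale 2 4 _ k≤)

    a-coprime : ∀ i → i < k → ∀ q → Prime q → w₀ < q → ¬ q ∣ a i
    a-coprime i i<k q pq w<q q∣ = <⇒≱ w<q (≤-trans (∣⇒≤ {{>-nonZero (a-pos i i<k)}} q∣) (a≤ i i<k))

    opaque
      class : ∃[ ρ ] (ρ < 4 × k ≤ 4 * length (filter (one? a b ρ) (downFrom k)))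
      class = quarter a b k a-odd

    ρ = proj₁ class

    module P = Progression k a b ρ (proj₁ (proj₂ class)) adm

    opaque
      A : P.AP w₀ w₀
      A = P.ap w₀ w₀ ≤-refl 1≤w₀

    open P.AP A using (r) renaming (m to M)
    module A = P.AP A

    instance
      M≢0 : NonZero M
      M≢0 = >-nonZero A.1≤m

    avoid : ∀ p → Prime p → w₀ < p → ¬ p ∣ M
    avoid p pp w<p p∣M with A.large p pp p∣M
    ... | inj₁ p≤2 = <⇒≱ w<p (≤-trans p≤2 2≤w₀)
    ... | inj₂ p≤w = <⇒≱ w<p p≤w

    M≤ : M ≤ 2 ^ m₁
    M≤ = ≤-trans A.bound (≤-trans (*-monoʳ-≤ 4 (≤-trans (^-monoˡ-≤ w₀ (^-≤-2^ v 7)) (≤-reflexive (^-*-assoc 2 (7 * v) w₀)))) (≤-reflexive (sym (^-distribˡ-+-* 2 2 (7 * v * w₀)))))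

    q = N / M

    -- Four terms fewer than fit into N: room for the offset of `r₀` beyond N and for the margin 2
    -- at the upper end.
    Len = q ∸ 4

    r₀ = r + M * suc (suc N / M)

    r₀-lo : suc N ≤ r₀
    r₀-lo = ≤-trans (<⇒≤ (m<[1+n/m]*m (suc N))) (≤-trans (≤-reflexive (*-comm (suc (suc N / M)) M)) (m≤n+m _ r))
      where
      m<[1+n/m]*m : ∀ x → x < suc (x / M) * M
      m<[1+n/m]*m x = ≤-trans (≤-reflexive (cong suc (m≡m%n+[m/n]*n x M))) (+-monoˡ-≤ (x / M * M) (m%n<n x M))

    r₀-hi : r₀ ≤ M + (M + suc N)
    r₀-hi = +-mono-≤ (<⇒≤ A.r<m) (≤-trans (≤-reflexive (*-suc M (suc N / M))) (+-monoʳ-≤ M (≤-trans (≤-reflexive (*-comm M (suc N / M))) (m/n*n≤m (suc N) M))))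

    D₀ = 25 * 2 ^ suc (suc n)
    8D₀ = 8 * D₀

    instance
      8D₀≢0 : NonZero 8D₀
      8D₀≢0 = >-nonZero (*-mono-≤ {1} {8} (s≤s z≤n) (*-mono-≤ {1} {25} (s≤s z≤n) (m^n>0 2 (suc (suc n)))))

    m′ = k / 8D₀

    module Gn = Counting.Gain k s′ g w₀ 1≤k 2k≤w₀ a b a-coprime n s′≥11100 s′≥111 X0≤τ τ≤X1 (One a b ρ) (one? a b ρ) M r₀ Len m′ avoid (proj₂ (proj₂ class)) (m/n*n≤m k 8D₀)
    module Cs = Gn.Cost κ′ 2k≤

    E′ = Cs.exR (suc n) 0 + (suc n + g + (X (suc n) + κ′))

    level′ : G + E′ ≤ ℓ
    level′ = level _ _ (Cs.fQ g 0) (Cs.exR (suc n) 0) refl refl refl (Cs.exR-bound (suc n) 0)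

    exR≥fQ : ∀ i j → Cs.fQ g 0 ≤ Cs.exR i j
    exR≥fQ zero j = ≤-refl
    exR≥fQ (suc i) j = ≤-trans (exR≥fQ i (suc j)) (m≤n+m _ _)

    τ≤XJ : τ ≤ X (suc n)
    τ≤XJ = ≤-trans τ≤X1 (*-monoʳ-≤ s′ (^-monoʳ-≤ 4 {2} {suc (suc n)} (s≤s (s≤s z≤n))))

    open Equidistribution w₀ k 1≤k using (costUp; costLow)

    cL = costLow (Rs (suc n) 0)
    cU = costUp (Qs g 0)

    costs≤ : cL + cU ≤ 2 ^ suc E′
    costs≤ = ≤-trans (+-mono-≤ (Cs.Low-cost (suc n) τ≤XJ) (≤-trans (Cs.Q-cost g 0) (^-monoʳ-≤ 2 (≤-trans (exR≥fQ (suc n) 0) (m≤m+n _ _)))))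
      (≤-reflexive (cong (2 ^ E′ +_) (sym (+-identityʳ (2 ^ E′)))))

    R = length Gn.riches

    W = 4 * S * g + (n + 10)

    factor≤ : Cs.Z ^ g * 8D₀ ≤ 2 ^ W
    factor≤ = ≤-trans (*-mono-≤ (≤-reflexive Zg) 8D≤) (≤-reflexive (sym (^-distribˡ-+-* 2 (4 * S * g) (n + 10))))
      where
      Zg : Cs.Z ^ g ≡ 2 ^ (4 * S * g)
      Zg = trans (cong (_^ g) (^-*-assoc 2 2 (2 * S))) (trans (^-*-assoc 2 (2 * (2 * S)) g) (cong (λ z → 2 ^ (z * g)) (sym (*-assoc 2 2 S))))
      8D≤ : 8D₀ ≤ 2 ^ (n + 10)
      8D≤ = begin
        8 * (25 * 2 ^ suc (suc n))    ≡⟨ sym (*-assoc 8 25 (2 ^ suc (suc n))) ⟩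
        200 * 2 ^ suc (suc n)         ≤⟨ *-monoˡ-≤ (2 ^ suc (suc n)) (≤ᵇ⇒≤ 200 (2 ^ 8) _) ⟩
        2 ^ 8 * 2 ^ suc (suc n)       ≡⟨ sym (^-distribˡ-+-* 2 8 (suc (suc n))) ⟩
        2 ^ (8 + suc (suc n))         ≡⟨ cong (2 ^_) (lem n) ⟩
        2 ^ (n + 10)                  ∎
        where
        open ≤-Reasoning
        lem : ∀ n → 8 + suc (suc n) ≡ n + 10
        lem = ℕ-Solver.solve-∀

    exponents : 3 + (W + E′) + m₁ ≤ ℓ
    exponents = ≤-trans (≤-trans (m≤m+n (3 + (W + E′) + m₁) 1) (≤-reflexive (lem (4 * S * g) n m₁ E′))) level′
      where
      lem : ∀ w n m e → 3 + (w + (n + 10) + e) + m + 1 ≡ w + (suc n + (m + 13)) + e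
      lem = ℕ-Solver.solve-∀

    16M≤N : 16 * M ≤ N
    16M≤N = ≤-trans (*-monoʳ-≤ 16 M≤) (≤-trans (≤-reflexive (sym (^-distribˡ-+-* 2 4 m₁))) (≤-trans (^-monoʳ-≤ 2 (≤-trans (≤-trans (+-monoˡ-≤ m₁ (≤ᵇ⇒≤ 4 12 _)) (+-monoˡ-≤ m₁ 12≤)) exponents)) N-lo))
      where
      12≤ : 12 ≤ 3 + (W + E′)
      12≤ = +-mono-≤ (≤ᵇ⇒≤ 2 3 _) (≤-trans (≤-trans (m≤n+m 10 n) (m≤n+m (n + 10) (4 * S * g))) (m≤m+n W E′))

    N<Mq : N < suc q * M
    N<Mq = ≤-trans (≤-reflexive (cong suc (m≡m%n+[m/n]*n N M))) (+-monoˡ-≤ (q * M) (m%n<n N M))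

    16≤q : 16 ≤ q
    16≤q = ≤-pred (*-cancelʳ-< M 16 (suc q) (≤-<-trans 16M≤N N<Mq))

    Len+4 : Len + 4 ≡ q
    Len+4 = m∸n+n≡m (≤-trans (≤ᵇ⇒≤ 4 16 _) 16≤q)

    N≤ : N ≤ 2 * (M * Len)
    N≤ = ≤-trans (<⇒≤ N<Mq) (≤-trans (*-monoˡ-≤ M sq≤) (≤-reflexive (lem Len M)))
      where
      lem : ∀ l m → (l + l) * m ≡ 2 * (m * l)
      lem = ℕ-Solver.solve-∀
      5≤Len : 5 ≤ Len
      5≤Len = +-cancelʳ-≤ 4 5 Len (≤-trans (≤ᵇ⇒≤ 9 16 _) (≤-trans 16≤q (≤-reflexive (sym Len+4))))
      sq≤ : suc q ≤ Len + Len
      sq≤ = ≤-trans (≤-reflexive (trans (cong suc (sym Len+4)) (sym (+-suc Len 4)))) (+-monoʳ-≤ Len 5≤Len)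

    -- The factor 2 reserves half of `Len` for the main term.
    errors : 2 * (Cs.Z ^ g * 8D₀ * (cL + cU)) ≤ Len
    errors = *-cancelʳ-≤ _ Len (2 * 2 ^ m₁) {{>-nonZero (*-mono-≤ {1} {2} (s≤s z≤n) (m^n>0 2 m₁))}} (begin
      2 * (Cs.Z ^ g * 8D₀ * (cL + cU)) * (2 * 2 ^ m₁)    ≤⟨ *-monoˡ-≤ (2 * 2 ^ m₁) (*-monoʳ-≤ 2 (*-mono-≤ factor≤ costs≤)) ⟩
      2 * (2 ^ W * 2 ^ suc E′) * (2 * 2 ^ m₁)            ≡⟨ lem (2 ^ W) (2 ^ E′) (2 ^ m₁) ⟩
      8 * (2 ^ W * 2 ^ E′) * 2 ^ m₁                      ≡⟨ cong (λ z → 8 * z * 2 ^ m₁) (sym (^-distribˡ-+-* 2 W E′)) ⟩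
      8 * 2 ^ (W + E′) * 2 ^ m₁                          ≡⟨ cong (_* 2 ^ m₁) (sym (^-distribˡ-+-* 2 3 (W + E′))) ⟩
      2 ^ (3 + (W + E′)) * 2 ^ m₁                        ≡⟨ sym (^-distribˡ-+-* 2 (3 + (W + E′)) m₁) ⟩
      2 ^ (3 + (W + E′) + m₁)                            ≤⟨ ^-monoʳ-≤ 2 exponents ⟩
      2 ^ ℓ                                              ≤⟨ N-lo ⟩
      N                                                  ≤⟨ N≤ ⟩
      2 * (M * Len)                                      ≤⟨ *-monoʳ-≤ 2 (*-monoˡ-≤ Len M≤) ⟩
      2 * (2 ^ m₁ * Len)                                 ≡⟨ lem₂ (2 ^ m₁) Len ⟩
      Len * (2 * 2 ^ m₁)                                 ∎)
      where
      open ≤-Reasoning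
      lem : ∀ w e m → 2 * (w * (2 * e)) * (2 * m) ≡ 8 * (w * e) * m
      lem = ℕ-Solver.solve-∀
      lem₂ : ∀ m l → 2 * (m * l) ≡ l * (2 * m)
      lem₂ = ℕ-Solver.solve-∀

    Len≤ : Len ≤ 2 * (2 ^ W * R)
    Len≤ = +-cancelʳ-≤ Len Len (2 * (2 ^ W * R)) (begin
      Len + Len                                          ≡⟨ cong (Len +_) (sym (+-identityʳ Len)) ⟩
      2 * Len                                            ≤⟨ *-monoʳ-≤ 2 Cs.L-bound ⟩
      2 * (Cs.Z ^ g * (8D₀ * (R + (cL + cU))))           ≡⟨ lem (Cs.Z ^ g) 8D₀ R (cL + cU) ⟩
      2 * (Cs.Z ^ g * 8D₀ * R) + 2 * (Cs.Z ^ g * 8D₀ * (cL + cU)) ≤⟨ +-mono-≤ (*-monoʳ-≤ 2 (*-monoˡ-≤ R factor≤)) errors ⟩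
      2 * (2 ^ W * R) + Len                              ∎)
      where
      open ≤-Reasoning
      lem : ∀ z d r c → 2 * (z * (d * (r + c))) ≡ 2 * (z * d * r) + 2 * (z * d * c)
      lem = ℕ-Solver.solve-∀

    count : suc N ≤ length Gn.points * 2 ^ (v ^ 9)
    count = subst (λ z → suc N ≤ z * 2 ^ (v ^ 9)) (sym (length-map Gn.pt Gn.riches))
      (count-bound N M Len R m₁ W (v ^ 9) N≤ M≤ Len≤ (≤-trans (m^n>0 2 ℓ) N-lo) (≤-trans (≤-trans (m≤m+n (3 + (m₁ + W)) 1) (≤-reflexive (lem m₁ (4 * S * g) n))) G≤))
      where
      lem : ∀ m w n → 3 + (m + (w + (n + 10))) + 1 ≡ w + (suc n + (m + 13))
      lem = ℕ-Solver.solve-∀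

    z = 2 ^ X (suc n)

    value≤ : ∀ m i → i < k → 2 + m ≤ N + N → a i * m + b i ≤ z * z
    value≤ m i i<k m≤ = value-bound (a i) m (b i) N ℓ (v ^ 7) (8 * v) (X (suc n)) (a≤ i i<k) (≤-trans (m≤n+m m 2) m≤) (b≤ i i<k) N-hi 1≤w₀
      (≤-trans (scale 8 7 _ ≤-refl) (^-≤-2^ v 8)) (≤-trans L-lo (≤-trans (≤-reflexive (sym 2X≡L)) (≤-reflexive (cong (X (suc n) +_) (+-identityʳ (X (suc n)))))))

    pt-hi : ∀ t → t < Len → 2 + Gn.pt t ≤ N + N
    pt-hi t t< = point-bound N M r₀ t q r₀-hi A.1≤m (≤-trans (+-monoˡ-≤ 4 t<) (≤-reflexive Len+4)) (m/n*n≤m N M)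

    many : ∀ t → t < Len → Gn.Rich (Gn.pt t) → Many k a b N m′ (Gn.pt t)
    many t t< rich = ≤-trans r₀-lo (m≤m+n r₀ (M * t)) , pt-hi t t< , Gn.picks m ,
      Uₚ.filter⁺ (Gn.pick? m) (Uₚ.downFrom⁺ k) , All.tabulate (λ {j} j∈ → good j (∈-filter⁻ (Gn.pick? m) {j} {downFrom k} j∈)) , rich
      where
      m = Gn.pt t
      t′ = suc (suc N / M) + t
      m≡ : m ≡ r + M * t′
      m≡ = trans (+-assoc r (M * suc (suc N / M)) (M * t)) (cong (r +_) (sym (*-distribˡ-+ M (suc (suc N / M)) t)))
      good : ∀ j → j ∈ downFrom k × Gn.Pick m j → j < k × SumSq (a j * m + b j)
      good j (j∈ , one , e) = j<k , sifted⇒sumSq (a j * m + b j) z mod1 (value≤ m j j<k (pt-hi t t<)) sift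
        where
        j<k = ∈-downFrom⁻ j∈
        mod1 : (a j * m + b j) % 4 ≡ 1
        mod1 = mod-transfer (a j) (b j) m ρ (trans (cong (_% 4) m≡) (trans (A.mod4 t′) (sym (m<n⇒m%n≡m (proj₁ (proj₂ class)))))) one
        sift : ∀ p → P3 p → p ≤ z → ¬ p ∣ a j * m + b j
        sift p p3 p≤z = side (p ≤? w₀)
          where
          -- Primes up to v^7 are excluded by the progression, those from v^7 to z by the sieve.
          side : Dec (p ≤ w₀) → ¬ p ∣ a j * m + b j
          side (yes p≤w) h = A.small p p3 p≤w t′ j j<k (subst (λ y → p ∣ a j * y + b j) m≡ h)
          side (no p≰w) = Gn.sifted j m j<k e p p3 (≰⇒> p≰w) p≤z

    k≤square : k ≤ (suc m′ * C₀) * (suc m′ * C₀)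
    k≤square = square-bound k (suc m′) 8D₀ 400 (2 ^ suc n) (4 ^ suc n) (4 * 2 ^ 21) C₀ 1≤k
      (≤-trans (≤-reflexive (m≡m%n+[m/n]*n k 8D₀)) (+-monoˡ-≤ (m′ * 8D₀) (<⇒≤ (m%n<n k 8D₀))))
      (lem 8 25 2 (2 ^ suc n)) (sym (^-distribʳ-* (suc n) 2 2)) (≤-trans F-hi′ (≤-reflexive (sym (*-assoc 4 (2 ^ 21) k))))
      C₀-large
      where
      lem : ∀ x y z p → x * (y * (z * p)) ≡ x * y * z * p
      lem = ℕ-Solver.solve-∀

    conclusion : ∃[ m′ ] (k ≤ (suc m′ * C₀) * (suc m′ * C₀) × ∃[ ms ] (Unique ms × All (Many k a b N m′) ms × suc N ≤ length ms * 2 ^ (v ^ 9)))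
    conclusion = m′ , k≤square , Gn.points , Gn.points-unique A.1≤m , Gn.points-all (Many k a b N m′) many , count

  core : ∀ N ℓ v k (a b : ℕ → ℕ) → 2 ^ 40 ≤ v → v ^ 19 ≤ ℓ → ℓ ≤ v ^ 20 → 2 ^ ℓ ≤ N → N ≤ 2 ^ suc ℓ → 1 ≤ k → k ≤ v ^ 4 →
    (∀ i → i < k → 1 ≤ a i) → (∀ i → i < k → a i ≤ v ^ 7) → (∀ i → i < k → ¬ 2 ∣ a i) → (∀ i → i < k → b i ≤ N) →
    (∀ p → P3 p → ∃[ c ] (c < p × (∀ i → i < k → ¬ p ∣ a i * c + b i))) →
    ∃[ m′ ] (k ≤ (suc m′ * C₀) * (suc m′ * C₀) × ∃[ ms ] (Unique ms × All (Many k a b N m′) ms × suc N ≤ length ms * 2 ^ (v ^ 9)))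
  core N ℓ v k a b v-big ℓ-lo ℓ-hi N-lo N-hi 1≤k k≤ a-pos a≤ a-odd b≤ adm = with-n (Exists.pick-n ℓ v k 1≤k)
    where
    Result = ∃[ m′ ] (k ≤ (suc m′ * C₀) * (suc m′ * C₀) × ∃[ ms ] (Unique ms × All (Many k a b N m′) ms × suc N ≤ length ms * 2 ^ (v ^ 9)))
    with-n : ∃[ n ] (2 ^ 21 * k ≤ 4 ^ suc n × 4 ^ suc n ≤ 4 * (2 ^ 21 * k)) → Result
    with-n (n , F-lo , F-hi) = with-s (Exists.pick-s ℓ v k 1≤k (8 * 4 ^ suc n))
      where
      instance _ = >-nonZero (*-mono-≤ {1} {8} (s≤s z≤n) (m^n>0 4 (suc n)))
      with-s : ∃[ s ] (1 ≤ s × ℓ + 8 * v ≤ 8 * 4 ^ suc n * s × 8 * 4 ^ suc n * s ≤ ℓ + (8 * v + 8 * 4 ^ suc n)) → Result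
      with-s (s , 1≤s , L-lo , L-hi) = with-g (power-above 2 ≤-refl (s * 4) (*-mono-≤ {1} {s} {1} {4} 1≤s (s≤s z≤n)))
        where
        with-g : ∃[ g ] (s * 4 ≤ 2 ^ g × 2 ^ g ≤ 2 * (s * 4)) → Result
        with-g (g , lo , hi) = Assembly.conclusion N ℓ v k a b v-big ℓ-lo ℓ-hi N-lo N-hi 1≤k k≤ a-pos a≤ a-odd b≤ adm n s g F-lo F-hi L-lo L-hi lo hi

-- An upper bound for the exponential series at negative arguments

module NegativeExp where

  open import Data.Nat.Base as ℕ using (ℕ; zero; suc; z≤n; s≤s; _!)
  import Data.Nat.Properties as ℕₚ
  open import Data.Integer.Base as ℤ using (ℤ; +_; -[1+_])
  import Data.Integer.Properties as ℤₚ
  open import Data.Rational.Base using (ℚ; mkℚ; 0ℚ; 1ℚ; ½; _+_; _*_; _-_; -_; _≤_; _<_; *≤*; *<*; toℚᵘ; ↥_)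
  open import Data.Rational.Properties
  import Data.Rational.Unnormalised.Base as ℚᵘ
  import Data.Rational.Unnormalised.Properties as ℚᵘₚ
  open import Data.Product.Base using (_×_; _,_; proj₁; proj₂; ∃-syntax)
  open import Relation.Binary.PropositionalEquality
  open import Tactic.RingSolver using (solve-∀)
  open Rationals
  open Character using (1≤suc; 1≤2^; n<2^n)
  open WeightedMertens using (ι-2)
  open BrunHooley using (Within; W-*; W-neg)
  open TruncatedExp

  ceiling : ∀ q → ∃[ n ] q ≤ ι n
  ceiling q = ℤ.∣ ↥ q ∣ , subst (q ≤_) (sym (ι-def ℤ.∣ ↥ q ∣)) (toℚᵘ-cancel-≤ (ℚᵘₚ.≤-respʳ-≃ (ℚᵘₚ.≃-sym (toℚᵘ-fromℚᵘ (ℚᵘ.mkℚᵘ (+ ℤ.∣ ↥ q ∣) 0))) (num q)))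
    where
    num : ∀ q → toℚᵘ q ℚᵘ.≤ ℚᵘ.mkℚᵘ (+ ℤ.∣ ↥ q ∣) 0
    num (mkℚ (+ n) d _) = ℚᵘ.*≤* (subst₂ ℤ._≤_ (sym (ℤₚ.*-identityʳ (+ n))) (ℤₚ.pos-* n (suc d)) (ℤ.+≤+ (ℕₚ.m≤m*n n (suc d))))
    num (mkℚ -[1+ n ] d _) = ℚᵘ.*≤* ℤ.-≤+

  small-inverse : ∀ ε → 0ℚ < ε → ∃[ m ] (1 ℕ.≤ m × inv m ≤ ε)
  small-inverse ε@(mkℚ (+ suc n) d _) _ = suc d , s≤s z≤n , subst (_≤ ε) (sym (inv-def (suc d)))
    (toℚᵘ-cancel-≤ (ℚᵘₚ.≤-respˡ-≃ (ℚᵘₚ.≃-sym (toℚᵘ-fromℚᵘ (ℚᵘ.mkℚᵘ (+ 1) d))) (ℚᵘ.*≤* (ℤₚ.*-monoʳ-≤-nonNeg (+ suc d) (ℤ.+≤+ (s≤s (z≤n {n})))))))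
  small-inverse (mkℚ (+ zero) d _) (*<* (ℤ.+<+ ()))
  small-inverse (mkℚ -[1+ n ] d _) (*<* ())

  power-within : ∀ {a} → 0ℚ ≤ a → ∀ n → Within ((- a) ^^ n) (a ^^ n)
  power-within h zero = ≤ᵇ⇒≤ _ , ≤-refl
  power-within {a} h (suc n) = subst (λ z → Within z (a * a ^^ n)) (lem a ((- a) ^^ n)) (W-neg (W-* h (power-within h n)))
    where
    lem : ∀ a x → - (a * x) ≡ - a * x
    lem = solve-∀ ℚ-ring

  t-neg≤ : ∀ {a} → 0ℚ ≤ a → ∀ i → t (- a) i ≤ t a i
  t-neg≤ h i = *-monoˡ (inv-≥0 (i !)) (proj₂ (power-within h i))

  ∑-tail-≤ : ∀ {f g : ℕ → ℚ} → (∀ i → f i ≤ g i) → ∀ m n → m ℕ.≤ n → ∑ n f - ∑ m f ≤ ∑ n g - ∑ m g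
  ∑-tail-≤ {f} {g} h m n m≤n = subst₂ _≤_ (tail f) (tail g) (∑-mono (n ℕ.∸ m) (λ i _ → h (m ℕ.+ i)))
    where
    lem : ∀ x y → y ≡ (x + y) - x
    lem = solve-∀ ℚ-ring
    tail : ∀ f → ∑ (n ℕ.∸ m) (λ i → f (m ℕ.+ i)) ≡ ∑ n f - ∑ m f
    tail f = trans (lem (∑ m f) (∑ (n ℕ.∸ m) (λ i → f (m ℕ.+ i)))) (cong (_- ∑ m f) (trans (sym (∑-split m (n ℕ.∸ m) f)) (cong (λ z → ∑ z f) (ℕₚ.m+[n∸m]≡n m≤n))))

  ex-square : ∀ {a} → 0ℚ ≤ a → ∀ N → ex a N * ex a N ≤ ex (a + a) (N ℕ.+ N)
  ex-square {a} h N = begin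
    ex a N * ex a N                                          ≡⟨ sym (∑-*ʳ (suc N) (ex a N) (t a)) ⟩
    ∑ (suc N) (λ i → t a i * ex a N)                         ≤⟨ ∑-mono (suc N) (λ i i< → *-monoʳ (t-nonNeg h i) (∑-extend (t a) (le i (ℕₚ.≤-pred i<)) (t-nonNeg h))) ⟩
    ∑ (suc N) (λ i → t a i * ∑ (suc (N ℕ.+ N) ℕ.∸ i) (t a))  ≤⟨ ∑-extend {suc N} {suc (N ℕ.+ N)} (λ i → t a i * ∑ (suc (N ℕ.+ N) ℕ.∸ i) (t a)) (s≤s (ℕₚ.m≤m+n N N)) (λ i → *-nonNeg (t-nonNeg h i) (∑-nonNeg (suc (N ℕ.+ N) ℕ.∸ i) (λ j _ → t-nonNeg h j))) ⟩
    ∑ (suc (N ℕ.+ N)) (λ i → t a i * ∑ (suc (N ℕ.+ N) ℕ.∸ i) (t a)) ≡⟨ sym (ex-+ a a (N ℕ.+ N)) ⟩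
    ex (a + a) (N ℕ.+ N)                                     ∎
    where
    open ≤-Reasoning
    le : ∀ i → i ℕ.≤ N → suc N ℕ.≤ suc (N ℕ.+ N) ℕ.∸ i
    le i i≤N = ℕₚ.≤-trans (ℕₚ.≤-reflexive (sym (trans (ℕₚ.+-∸-assoc 1 (ℕₚ.m≤m+n N N)) (cong suc (ℕₚ.m+n∸m≡n N N))))) (ℕₚ.∸-monoʳ-≤ (suc (N ℕ.+ N)) i≤N)

  -- The product differs from the truncated series at 0 by the terms t(a, i) t(-a, j) with i + j >
  -- N. They are at most t(a, i) t(a, j), whose sum is bounded by a tail of the series at 2a.
  ex-neg : ∀ {a} → 0ℚ ≤ a → ∀ N → ex a N * ex (- a) N ≤ 1ℚ + (ex (a + a) (N ℕ.+ N) - ex (a + a) N)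
  ex-neg {a} h N = begin
    ex a N * ex (- a) N                         ≡⟨ lem (ex a N * ex (- a) N) (ex (a + - a) N) ⟩
    ex (a + - a) N + (ex a N * ex (- a) N - ex (a + - a) N) ≡⟨ cong₂ _+_ (trans (cong (λ z → ex z N) (+-inverseʳ a)) (ex-0 N)) (gap (- a)) ⟩
    1ℚ + ∑ (suc N) (λ i → t a i * (ex (- a) N - ∑ (suc N ℕ.∸ i) (t (- a)))) ≤⟨ +-monoʳ-≤ 1ℚ (∑-mono (suc N) (λ i _ → *-monoʳ (t-nonNeg h i) (∑-tail-≤ (t-neg≤ h) (suc N ℕ.∸ i) (suc N) (ℕₚ.m∸n≤m (suc N) i)))) ⟩
    1ℚ + ∑ (suc N) (λ i → t a i * (ex a N - ∑ (suc N ℕ.∸ i) (t a))) ≡⟨ cong (λ z → 1ℚ + z) (sym (gap a)) ⟩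
    1ℚ + (ex a N * ex a N - ex (a + a) N)       ≤⟨ +-monoʳ-≤ 1ℚ (+-monoˡ-≤ (- ex (a + a) N) (ex-square h N)) ⟩
    1ℚ + (ex (a + a) (N ℕ.+ N) - ex (a + a) N)  ∎
    where
    open ≤-Reasoning
    lem : ∀ x y → x ≡ y + (x - y)
    lem = solve-∀ ℚ-ring
    l2 : ∀ x y z → x * y - x * z ≡ x * (y - z)
    l2 = solve-∀ ℚ-ring
    gap : ∀ b → ex a N * ex b N - ex (a + b) N ≡ ∑ (suc N) (λ i → t a i * (ex b N - ∑ (suc N ℕ.∸ i) (t b)))
    gap b = trans (cong₂ _-_ (sym (∑-*ʳ (suc N) (ex b N) (t a))) (ex-+ a b N))
      (trans (sym (∑-- (suc N) (λ i → t a i * ex b N) (λ i → t a i * ∑ (suc N ℕ.∸ i) (t b)))) (∑-cong (suc N) (λ i _ → l2 (t a i) (ex b N) (∑ (suc N ℕ.∸ i) (t b)))))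

  module Tail (c : ℚ) (0≤c : 0ℚ ≤ c) where

    K = suc (2 ℕ.* proj₁ (ceiling c))

    2c≤ : ∀ m → K ℕ.≤ m → (1ℚ + 1ℚ) * c ≤ ι (suc m)
    2c≤ m K≤m = ≤-trans (*-monoʳ {1ℚ + 1ℚ} (≤ᵇ⇒≤ _) (proj₂ (ceiling c))) (≤-trans (≤-reflexive (sym (trans (ι-* 2 (proj₁ (ceiling c))) (cong (_* ι (proj₁ (ceiling c))) ι-2))))
      (ι-mono (ℕₚ.≤-trans (ℕₚ.n≤1+n _) (ℕₚ.m≤n⇒m≤1+n K≤m))))

    -- Beyond 2c the ratio c/(m + 1) of consecutive terms is at most 1/2, so tails are geometric.
    halving : ∀ m → K ℕ.≤ m → t c (suc m) ≤ ½ * t c m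
    halving m K≤m = *-cancelˡ {ι (suc m)} (ι->0 {suc m} 1≤suc) (begin
      ι (suc m) * t c (suc m)       ≡⟨ t-suc c m ⟩
      c * t c m                     ≡⟨ l1 c (t c m) ⟩
      (1ℚ + 1ℚ) * c * (½ * t c m)   ≤⟨ *-monoˡ (*-nonNeg {½} (≤ᵇ⇒≤ _) (t-nonNeg 0≤c m)) (2c≤ m K≤m) ⟩
      ι (suc m) * (½ * t c m)       ∎)
      where
      open ≤-Reasoning
      l1 : ∀ c x → c * x ≡ (1ℚ + 1ℚ) * c * (½ * x)
      l1 = solve-∀ ℚ-ring

    geometric : ∀ m → K ℕ.≤ m → ∀ l → ∑ l (λ j → t c (m ℕ.+ j)) ≤ (1ℚ + 1ℚ) * t c m - (1ℚ + 1ℚ) * t c (m ℕ.+ l)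
    geometric m K≤m zero = ≤-reflexive (sym (trans (cong (λ z → (1ℚ + 1ℚ) * t c m - (1ℚ + 1ℚ) * t c z) (ℕₚ.+-identityʳ m)) (+-inverseʳ ((1ℚ + 1ℚ) * t c m))))
    geometric m K≤m (suc l) = begin
      ∑ l (λ j → t c (m ℕ.+ j)) + x              ≤⟨ +-monoˡ-≤ x (geometric m K≤m l) ⟩
      (1ℚ + 1ℚ) * t c m - (1ℚ + 1ℚ) * x + x      ≤⟨ ≤-by ((1ℚ + 1ℚ) * (½ * x - y)) (*-nonNeg {1ℚ + 1ℚ} (≤ᵇ⇒≤ _) (diff≥0 (halving (m ℕ.+ l) (ℕₚ.≤-trans K≤m (ℕₚ.m≤m+n m l))))) (l1 (t c m) x y) ⟩
      (1ℚ + 1ℚ) * t c m - (1ℚ + 1ℚ) * y          ≡⟨ cong (λ z → (1ℚ + 1ℚ) * t c m - (1ℚ + 1ℚ) * t c z) (sym (ℕₚ.+-suc m l)) ⟩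
      (1ℚ + 1ℚ) * t c m - (1ℚ + 1ℚ) * t c (m ℕ.+ suc l) ∎
      where
      open ≤-Reasoning
      x = t c (m ℕ.+ l)
      y = t c (suc (m ℕ.+ l))
      l1 : ∀ a x y → (1ℚ + 1ℚ) * a - (1ℚ + 1ℚ) * y ≡ (1ℚ + 1ℚ) * a - (1ℚ + 1ℚ) * x + x + (1ℚ + 1ℚ) * (½ * x - y)
      l1 = solve-∀ ℚ-ring

    decay : ∀ j → ι (2 ℕ.^ j) * t c (K ℕ.+ j) ≤ t c K
    decay zero = ≤-reflexive (trans (cong₂ _*_ ι-1 (cong (t c) (ℕₚ.+-identityʳ K))) (*-identityˡ (t c K)))
    decay (suc j) = begin
      ι (2 ℕ.* 2 ℕ.^ j) * t c (K ℕ.+ suc j)            ≡⟨ cong₂ _*_ (trans (ι-* 2 (2 ℕ.^ j)) (cong (_* ι (2 ℕ.^ j)) ι-2)) (cong (t c) (ℕₚ.+-suc K j)) ⟩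
      (1ℚ + 1ℚ) * ι (2 ℕ.^ j) * t c (suc (K ℕ.+ j))    ≤⟨ *-monoʳ (*-nonNeg {1ℚ + 1ℚ} (≤ᵇ⇒≤ _) (ι-≥0 (2 ℕ.^ j))) (halving (K ℕ.+ j) (ℕₚ.m≤m+n K j)) ⟩
      (1ℚ + 1ℚ) * ι (2 ℕ.^ j) * (½ * t c (K ℕ.+ j))    ≡⟨ l1 (ι (2 ℕ.^ j)) (t c (K ℕ.+ j)) ⟩
      ι (2 ℕ.^ j) * t c (K ℕ.+ j)                      ≤⟨ decay j ⟩
      t c K                                            ∎
      where
      open ≤-Reasoning
      l1 : ∀ p x → (1ℚ + 1ℚ) * p * (½ * x) ≡ p * x
      l1 = solve-∀ ℚ-ring

    tail-bound : ∀ n j → suc n ≡ K ℕ.+ j → ι (2 ℕ.^ j) * (ex c (n ℕ.+ n) - ex c n) ≤ (1ℚ + 1ℚ) * t c K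
    tail-bound n j e = begin
      ι (2 ℕ.^ j) * (ex c (n ℕ.+ n) - ex c n)                 ≡⟨ cong (λ z → ι (2 ℕ.^ j) * z) gap ⟩
      ι (2 ℕ.^ j) * ∑ n (λ i → t c (suc n ℕ.+ i))             ≤⟨ *-monoʳ (ι-≥0 (2 ℕ.^ j)) (≤-trans (geometric (suc n) (ℕₚ.≤-trans (ℕₚ.m≤m+n K j) (ℕₚ.≤-reflexive (sym e))) n) drop) ⟩
      ι (2 ℕ.^ j) * ((1ℚ + 1ℚ) * t c (suc n))                 ≡⟨ l2 (ι (2 ℕ.^ j)) (t c (suc n)) ⟩
      (1ℚ + 1ℚ) * (ι (2 ℕ.^ j) * t c (suc n))                 ≤⟨ *-monoʳ {1ℚ + 1ℚ} (≤ᵇ⇒≤ _) (≤-trans (≤-reflexive (cong (λ z → ι (2 ℕ.^ j) * t c z) e)) (decay j)) ⟩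
      (1ℚ + 1ℚ) * t c K                                       ∎
      where
      open ≤-Reasoning
      l0 : ∀ x y → (x + y) - x ≡ y
      l0 = solve-∀ ℚ-ring
      l2 : ∀ p x → p * ((1ℚ + 1ℚ) * x) ≡ (1ℚ + 1ℚ) * (p * x)
      l2 = solve-∀ ℚ-ring
      l3 : ∀ x y → x ≡ x - y + y
      l3 = solve-∀ ℚ-ring
      gap : ex c (n ℕ.+ n) - ex c n ≡ ∑ n (λ i → t c (suc n ℕ.+ i))
      gap = trans (cong (_- ex c n) (∑-split (suc n) n (t c))) (l0 (ex c n) (∑ n (λ i → t c (suc n ℕ.+ i))))
      drop : (1ℚ + 1ℚ) * t c (suc n) - (1ℚ + 1ℚ) * t c (suc n ℕ.+ n) ≤ (1ℚ + 1ℚ) * t c (suc n)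
      drop = ≤-by ((1ℚ + 1ℚ) * t c (suc n ℕ.+ n)) (*-nonNeg {1ℚ + 1ℚ} (≤ᵇ⇒≤ _) (t-nonNeg 0≤c (suc n ℕ.+ n))) (l3 ((1ℚ + 1ℚ) * t c (suc n)) ((1ℚ + 1ℚ) * t c (suc n ℕ.+ n)))

    vanishing : ∀ ε → 0ℚ < ε → ∀ n₀ → ∃[ n ] (n₀ ℕ.≤ n × ex c (n ℕ.+ n) - ex c n ≤ ε)
    vanishing ε 0<ε n₀ = n , n₀≤n , *-cancelˡ {ι (2 ℕ.^ j)} (ι->0 (1≤2^ j)) (≤-trans (tail-bound n j (cong suc refl)) (begin
      (1ℚ + 1ℚ) * t c K             ≤⟨ proj₂ top ⟩
      ι (proj₁ top)                 ≡⟨ trans (sym (*-identityʳ (ι (proj₁ top)))) (cong (ι (proj₁ top) *_) (sym (ι*inv (proj₁ (proj₂ sm))))) ⟩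
      ι (proj₁ top) * (ι m * inv m) ≡⟨ trans (sym (*-assoc (ι (proj₁ top)) (ι m) (inv m))) (cong (_* inv m) (sym (ι-* (proj₁ top) m))) ⟩
      ι (proj₁ top ℕ.* m) * inv m   ≤⟨ *-mono (ι-≥0 (proj₁ top ℕ.* m)) (ι-mono (ℕₚ.≤-trans (ℕₚ.m≤m+n (proj₁ top ℕ.* m) n₀) (ℕₚ.<⇒≤ (n<2^n j)))) (inv-≥0 m) (proj₂ (proj₂ sm)) ⟩
      ι (2 ℕ.^ j) * ε               ∎))
      where
      open ≤-Reasoning
      top = ceiling ((1ℚ + 1ℚ) * t c K)
      sm = small-inverse ε 0<ε
      m = proj₁ sm
      j = proj₁ top ℕ.* m ℕ.+ n₀
      n = 2 ℕ.* proj₁ (ceiling c) ℕ.+ j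
      n₀≤n : n₀ ℕ.≤ n
      n₀≤n = ℕₚ.≤-trans (ℕₚ.m≤n+m n₀ (proj₁ top ℕ.* m)) (ℕₚ.m≤n+m j (2 ℕ.* proj₁ (ceiling c)))

  2^≤ex : ∀ n N → n ℕ.≤ N → ι (2 ℕ.^ n) ≤ ex (ι n) N
  2^≤ex n N n≤N = begin
    ι (2 ℕ.^ n)          ≡⟨ sym (two n) ⟩
    ∏⁺ n (λ _ → 1ℚ)      ≤⟨ ∏⁺-≤ n (λ _ → 1ℚ) (λ _ → 0≤1) ⟩
    ex (∑ n (λ _ → 1ℚ)) n ≡⟨ cong (λ z → ex z n) (trans (∑-const n 1ℚ) (*-identityʳ (ι n))) ⟩
    ex (ι n) n           ≤⟨ ex-mono-N (ι-≥0 n) n≤N ⟩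
    ex (ι n) N           ∎
    where
    open ≤-Reasoning
    two : ∀ n → ∏⁺ n (λ _ → 1ℚ) ≡ ι (2 ℕ.^ n)
    two zero = sym ι-1
    two (suc n) = trans (cong (_* (1ℚ + 1ℚ)) (two n)) (trans (*-comm (ι (2 ℕ.^ n)) (1ℚ + 1ℚ)) (sym (trans (ι-* 2 (2 ℕ.^ n)) (cong (_* ι (2 ℕ.^ n)) ι-2))))

  -- Partial sums at ρ are at least 2^h, and their products with those at -ρ exceed 1 by an amount
  -- that tends to 0. The gap c′ - c, which the definition of a limit as a cut supplies, absorbs
  -- that excess.
  exp-neg-bound : ∀ {ρ c c′} h n₀ → ι h ≤ ρ → 0ℚ ≤ c → c < c′ → (∀ n → n₀ ℕ.≤ n → c′ ≤ ex (- ρ) n) → ι (2 ℕ.^ h) * c ≤ 1ℚ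
  exp-neg-bound {ρ} {c} {c′} h n₀ h≤ρ 0≤c c<c′ ev = go (Tail.vanishing (ρ + ρ) (+-nonNeg 0≤ρ 0≤ρ) (c′ - c) (diff>0 c<c′) (n₀ ℕ.+ h))
    where
    0≤ρ = ≤-trans (ι-≥0 h) h≤ρ
    go : ∃[ n ] (n₀ ℕ.+ h ℕ.≤ n × ex (ρ + ρ) (n ℕ.+ n) - ex (ρ + ρ) n ≤ c′ - c) → ι (2 ℕ.^ h) * c ≤ 1ℚ
    go (n , n≥ , small) = begin
      p * c                                     ≡⟨ l1 p c c′ ⟩
      p * c′ - p * (c′ - c)                     ≤⟨ +-mono-≤ big (neg-antimono-≤ (≤-trans (≤-reflexive (sym (*-identityˡ (c′ - c)))) (*-monoˡ (<⇒≤ (diff>0 c<c′)) (ι-≥1 (1≤2^ h))))) ⟩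
      (1ℚ + (c′ - c)) - (c′ - c)                ≡⟨ l2 (c′ - c) ⟩
      1ℚ                                        ∎
      where
      open ≤-Reasoning
      p = ι (2 ℕ.^ h)
      l1 : ∀ p c c′ → p * c ≡ p * c′ - p * (c′ - c)
      l1 = solve-∀ ℚ-ring
      l2 : ∀ x → (1ℚ + x) - x ≡ 1ℚ
      l2 = solve-∀ ℚ-ring
      big : p * c′ ≤ 1ℚ + (c′ - c)
      big = ≤-trans (*-mono (ι-≥0 (2 ℕ.^ h)) (≤-trans (2^≤ex h n (ℕₚ.≤-trans (ℕₚ.m≤n+m h n₀) n≥)) (ex-mono (ι-≥0 h) h≤ρ n)) (≤-trans 0≤c (<⇒≤ c<c′)) (ev n (ℕₚ.≤-trans (ℕₚ.m≤m+n n₀ h) n≥)))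
        (≤-trans (ex-neg 0≤ρ n) (+-monoʳ-≤ 1ℚ small))

-- Estimates for cuts: logarithms, roots and the exponential

module RealBounds where

  open import Defs hiding (a; b)
  open import Data.Nat.Base as ℕ using (ℕ; zero; suc; z≤n; s≤s; _!)
  import Data.Nat.Properties as ℕₚ
  open import Data.Nat.Divisibility using (_∣_; ∣⇒≤; ∣-trans; m∣m*n; ∣m+n∣m⇒∣n; m≤n⇒m!∣n!)
  open import Data.Nat.Primality using (Prime; prime⇒nonZero)
  open import Data.Nat.Primality.Factorisation using (factorise; PrimeFactorisation)
  open import Data.Nat.ListAction using (product)
  open import Data.Integer.Base using (+_)
  open import Data.Rational.Base as ℚ using (ℚ; 0ℚ; 1ℚ; ½)
  open import Data.Rational.Properties as ℚₚ using (≤-trans; ≤-refl; ≤-reflexive; <-≤-trans; ≤-<-trans; <-trans; <⇒≤)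
  open import Algebra.Definitions.RawSemiring ℚ.+-*-rawSemiring using () renaming (_^_ to _^ᵣ_)
  open import Data.List.Base using ([]; _∷_)
  open import Data.List.Relation.Unary.All using ([]; _∷_)
  open import Data.Product.Base using (_×_; _,_; proj₁; proj₂; ∃-syntax)
  open import Data.Sum.Base using (_⊎_; inj₁; inj₂)
  open import Data.Empty using (⊥-elim)
  open import Relation.Nullary using (Dec; yes; no; contradiction)
  open import Relation.Binary.PropositionalEquality
  open import Relation.Binary.Definitions using (tri<; tri≈; tri>)
  open import Tactic.RingSolver using (solve-∀)
  open Rationals
  open WeightedMertens using (ι-2)
  open MertensModFour using (prime≥2)
  open TruncatedExp using (t; ex; t-0; ex-mono; ex-≤4^; 1≤!; ex-mono-N)
  open NegativeExp using (ceiling; 2^≤ex; exp-neg-bound)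

  ^ᵣ≡ : ∀ q n → q ^ᵣ n ≡ q ^^ n
  ^ᵣ≡ q zero = refl
  ^ᵣ≡ q (suc n) = cong (q ℚ.*_) (^ᵣ≡ q n)

  partialSum≡ : ∀ r n → expPartialSum r n ≡ ex r n
  partialSum≡ r n = go n
    where
    term : ∀ i → expTerm r i ≡ t r i
    term i = cong₂ ℚ._*_ (^ᵣ≡ r i) (sym (inv-def (i !) {{i ℕₚ.!≢0}}))
    go : ∀ n → expPartialSum r n ≡ ex r n
    go zero = trans (term 0) (sym (ℚₚ.+-identityˡ (t r 0)))
    go (suc n) = cong₂ ℚ._+_ (go n) (term (suc n))

  rational : ℚ → ℝ
  rational p = record { cut = fromℚ p ; isDedekind = record
    { lower-inhabited = p ℚ.- 1ℚ , <-by 1ℚ 0<1 (lem p)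
    ; upper-inhabited = p ℚ.+ 1ℚ , <-by 1ℚ 0<1 refl
    ; lower-closed = <-trans
    ; upper-closed = λ q<r p<q → <-trans p<q q<r
    ; lower-open = λ q<p → let r , q<r , r<p = ℚₚ.<-dense q<p in r , q<r , r<p
    ; upper-open = λ p<r → let q , p<q , q<r = ℚₚ.<-dense p<r in q , q<r , p<q
    ; disjoint = λ (q<p , p<q) → ℚₚ.<-asym q<p p<q
    ; located = λ {q} {r} q<r → split q r q<r (q ℚₚ.<? p)
    } }
    where
    lem : ∀ p → p ≡ p ℚ.- 1ℚ ℚ.+ 1ℚ
    lem = solve-∀ ℚ-ring
    split : ∀ q r → q ℚ.< r → Dec (q ℚ.< p) → q ℚ.< p ⊎ p ℚ.< r
    split q r q<r (yes h) = inj₁ h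
    split q r q<r (no h) = inj₂ (≤-<-trans (ℚₚ.≮⇒≥ h) q<r)

  -- Euclid: a prime factor of n! + 1.
  large-prime : ∀ n → ∃[ p ] (Prime p × n ℕ.< p)
  large-prime n = go (factorise (suc (n !)))
    where
    instance _ = ℕ.>-nonZero (s≤s (z≤n {n !}))
    go : PrimeFactorisation (suc (n !)) → ∃[ p ] (Prime p × n ℕ.< p)
    go record { factors = [] ; isFactorisation = e ; factorsPrime = _ } = contradiction (ℕₚ.suc-injective e) (ℕₚ.>⇒≢ (1≤! n))
    go record { factors = p ∷ ps ; isFactorisation = e ; factorsPrime = pp ∷ _ } = p , pp , ℕₚ.≰⇒> λ p≤n →
      ℕₚ.<⇒≱ (prime≥2 pp) (∣⇒≤ (∣m+n∣m⇒∣n (subst (p ∣_) (trans (sym e) (ℕₚ.+-comm 1 (n !))) (m∣m*n (product ps))) (∣-trans (self p (prime⇒nonZero pp)) (m≤n⇒m!∣n! p≤n))))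
      where
      self : ∀ p → ℕ.NonZero p → p ∣ p !
      self (suc p) _ = m∣m*n (p !)

  integer-root : ∀ d → 1 ℕ.≤ d → ∀ ℓ → ∃[ u ] ∃[ v ] (v ≡ suc u × u ℕ.^ d ℕ.≤ ℓ × ℓ ℕ.< v ℕ.^ d)
  integer-root (suc d) _ zero = 0 , 1 , refl , z≤n , ℕₚ.m^n>0 1 (suc d)
  integer-root d@(suc _) 1≤d (suc ℓ) = step (integer-root d 1≤d ℓ)
    where
    step : ∃[ u ] ∃[ v ] (v ≡ suc u × u ℕ.^ d ℕ.≤ ℓ × ℓ ℕ.< v ℕ.^ d) → ∃[ u ] ∃[ v ] (v ≡ suc u × u ℕ.^ d ℕ.≤ suc ℓ × suc ℓ ℕ.< v ℕ.^ d)
    step (u , v , v≡ , lo , hi) = choose (suc ℓ ℕₚ.<? v ℕ.^ d)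
      where
      choose : Dec (suc ℓ ℕ.< v ℕ.^ d) → ∃[ u ] ∃[ v ] (v ≡ suc u × u ℕ.^ d ℕ.≤ suc ℓ × suc ℓ ℕ.< v ℕ.^ d)
      choose (yes h) = u , v , v≡ , ℕₚ.m≤n⇒m≤1+n lo , h
      choose (no h) = v , suc v , refl , ℕₚ.≮⇒≥ h , ℕₚ.≤-<-trans hi (ℕₚ.^-monoˡ-< d ℕₚ.≤-refl)

  ^-cancelˡ-< : ∀ d m n → m ℕ.^ d ℕ.< n ℕ.^ d → m ℕ.< n
  ^-cancelˡ-< d m n h = ℕₚ.≰⇒> (λ n≤m → ℕₚ.<⇒≱ h (ℕₚ.^-monoˡ-≤ d n≤m))

  -- Opaque, so that these numbers are never evaluated.
  opaque
    Λ₀ : ℕ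
    Λ₀ = (2 ℕ.^ 40) ℕ.^ 20

    Λ₀-large : ∀ ℓ v → Λ₀ ℕ.≤ ℓ → ℓ ℕ.< v ℕ.^ 20 → 2 ℕ.^ 40 ℕ.< v
    Λ₀-large ℓ v lo hi = ^-cancelˡ-< 20 (2 ℕ.^ 40) v (ℕₚ.≤-<-trans lo hi)

  opaque
    X₀ : ℕ
    X₀ = suc (2 ℕ.^ Λ₀)

    X₀-def : X₀ ≡ suc (2 ℕ.^ Λ₀)
    X₀-def = refl

  module Dedekind (x : Cut) (D : IsDedekind x) where
    open IsDedekind D

    below : ∀ {q r} → lower x q → upper x r → q ℚ.< r
    below {q} {r} lq ur with ℚₚ.<-cmp q r
    ... | tri< q<r _ _ = q<r
    ... | tri≈ _ refl _ = ⊥-elim (disjoint (lq , ur))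
    ... | tri> _ _ r<q = ⊥-elim (disjoint (lq , upper-closed r<q ur))

    -- Locatedness only decides between overlapping half-lines, so instead of the integer part a
    -- descent from an upper bound finds N with N - 1 < x < N + 1.
    approximate : lower x 0ℚ → ∃[ N ] (lower x (ι N ℚ.- 1ℚ) × upper x (ι (suc N)))
    approximate l0 = search (proj₁ top) (upper-closed′ (proj₂ top))
      where
      q₀ = proj₁ upper-inhabited
      top = ceiling q₀
      upper-closed′ : q₀ ℚ.≤ ι (proj₁ top) → upper x (ι (suc (proj₁ top)))
      upper-closed′ h = upper-closed (≤-<-trans h (ι-mono-< {proj₁ top} ℕₚ.≤-refl)) (proj₂ upper-inhabited)
      pred< : ∀ q → q ℚ.- 1ℚ ℚ.< q
      pred< q = <-by 1ℚ 0<1 (lem q)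
        where
        lem : ∀ q → q ≡ q ℚ.- 1ℚ ℚ.+ 1ℚ
        lem = solve-∀ ℚ-ring
      search : ∀ B → upper x (ι (suc B)) → ∃[ N ] (lower x (ι N ℚ.- 1ℚ) × upper x (ι (suc N)))
      search zero u = 0 , lower-closed (subst (ι 0 ℚ.- 1ℚ ℚ.<_) ι-0 (pred< (ι 0))) l0 , u
      search (suc B) u = decide (located (pred< (ι (suc B))))
        where
        decide : lower x (ι (suc B) ℚ.- 1ℚ) ⊎ upper x (ι (suc B)) → ∃[ N ] (lower x (ι N ℚ.- 1ℚ) × upper x (ι (suc N)))
        decide (inj₁ h) = suc B , h , u
        decide (inj₂ h) = search B h

  module Bounds (x : Cut) (D : IsDedekind x) (N : ℕ) (N-below : lower x (ι N ℚ.- 1ℚ)) (N-above : upper x (ι (suc N))) where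
    open IsDedekind D
    open Dedekind x D

    lower< : ∀ {q} → lower x q → q ℚ.< ι (suc N)
    lower< h = below h N-above

    exp-power : ∀ K {u} → upper (expℚ (ι K)) u → ι (2 ℕ.^ K) ℚ.< u
    exp-power K (r , r<u , n₀ , h) = ≤-<-trans (≤-trans (2^≤ex K (n₀ ℕ.+ K) (ℕₚ.m≤n+m K n₀)) (≤-trans (≤-reflexive (sym (partialSum≡ (ι K) (n₀ ℕ.+ K)))) (h (n₀ ℕ.+ K) (ℕₚ.m≤m+n n₀ K)))) r<u

    exp-above : ∀ {r u} → 0ℚ ℚ.≤ r → upper (expℚ r) u → r ℚ.< u
    exp-above {r} 0≤r (s , s<u , n₀ , h) = ≤-<-trans (≤-trans (≤-by 1ℚ 0≤1 (trans first2 (ℚₚ.+-comm 1ℚ r))) (≤-trans (ex-mono-N {r} {1} {suc n₀} 0≤r (s≤s z≤n)) (≤-trans (≤-reflexive (sym (partialSum≡ r (suc n₀)))) (h (suc n₀) (ℕₚ.n≤1+n n₀))))) s<u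
      where
      t-1 : t r 1 ≡ r
      t-1 = trans (cong (r ℚ.* 1ℚ ℚ.*_) (inv-def 1)) (trans (ℚₚ.*-identityʳ (r ℚ.* 1ℚ)) (ℚₚ.*-identityʳ r))
      first2 : ex r 1 ≡ 1ℚ ℚ.+ r
      first2 = cong₂ ℚ._+_ (trans (ℚₚ.+-identityˡ (t r 0)) (t-0 r)) t-1

    -- One unit is given up, m + 1 against m, because a cut controls only the rationals strictly
    -- below it. The base e is lowered to 2.
    root-bound : ∀ d .{{_ : ℕ.NonZero d}} m → fromℕ (suc m) ≤ᵣ root d (log x) → 2 ℕ.^ (m ℕ.^ d) ℕ.≤ N
    root-bound d m h = go (h (ι m) (subst (ι m ℚ.<_) (ι-def (suc m)) (ι-mono-< {m} ℕₚ.≤-refl)))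
      where
      go : ι m ℚ.< 0ℚ ⊎ (0ℚ ℚ.≤ ι m × lower (log x) (ι m ^ᵣ d)) → 2 ℕ.^ (m ℕ.^ d) ℕ.≤ N
      go (inj₁ neg) = contradiction (ι-≥0 m) (<⇒≱ neg)
      go (inj₂ (_ , u , up , lo)) = ℕₚ.≤-pred (ℕₚ.≰⇒> (λ le → <⇒≱ (<-trans (exp-power (m ℕ.^ d) (subst (λ z → upper (expℚ z) u) (trans (^ᵣ≡ (ι m) d) (sym (ι-^ m d))) up)) (lower< lo)) (ι-mono le)))

    -- Two applications of y < exp y give log (log x) < x < N + 1.
    loglog : ∀ {q} → lower (cut (rational 1ℚ) *ᵣ log (log x)) q → q ℚ.< ι (suc N)
    loglog {q} (a₁ , b₁ , c₁ , d₁ , a<1 , 1<b , (e , ce , f , ef , lf) , _ , q<ac , _ , q<bc , _) = sign (ℚₚ.≤-total 0ℚ c₁)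
      where
      sign : 0ℚ ℚ.≤ c₁ ⊎ c₁ ℚ.≤ 0ℚ → q ℚ.< ι (suc N)
      sign (inj₁ 0≤c) = <-trans (<-≤-trans q<ac (≤-trans (*-monoˡ 0≤c (<⇒≤ a<1)) (≤-reflexive (ℚₚ.*-identityˡ c₁)))) (<-trans c<e (<-trans (exp-above (<⇒≤ (≤-<-trans 0≤c c<e)) ef) (lower< lf)))
        where c<e = exp-above 0≤c ce
      sign (inj₂ c≤0) = <-≤-trans q<bc (≤-trans (ℚₚ.*-monoˡ-≤-nonNeg b₁ {{ℚ.nonNegative (<⇒≤ (<-trans 0<1 1<b))}} c≤0) (≤-trans (≤-reflexive (ℚₚ.*-zeroʳ b₁)) (ι-≥0 (suc N))))

    ≥x : ∀ m → suc N ℕ.≤ m → x ≤ᵣ fromℤ (+ m)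
    ≥x m h q lq = subst (q ℚ.<_) (ι-def m) (<-≤-trans (lower< lq) (ι-mono h))

    -- m ≤ 2(N - 1) < 2x; as the product of cuts is an interval product, a rational strictly below
    -- the factor 2 must be exhibited.
    ≤2x : ∀ m → 1 ℕ.≤ N → 2 ℕ.+ m ℕ.≤ N ℕ.+ N → fromℤ (+ m) ≤ᵣ fromℕ 2 *ᵣ x
    ≤2x m 1≤N h q q<m = sign (q ℚₚ.<? 0ℚ)
      where
      c = ι N ℚ.- 1ℚ
      c≥0 : 0ℚ ℚ.≤ c
      c≥0 = diff≥0 (ι-≥1 1≤N)
      d = ι (suc N)
      2ℚ = (+ 2) ℚ./ 1
      3ℚ = (+ 3) ℚ./ 1
      2<3 : 2ℚ ℚ.< 3ℚ
      2<3 = <-by 1ℚ 0<1 refl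
      c≤d : c ℚ.≤ d
      c≤d = <⇒≤ (below N-below N-above)
      fits : ∀ a → a ℚ.< 2ℚ → 0ℚ ℚ.≤ a → q ℚ.< a ℚ.* c → lower (fromℕ 2 *ᵣ x) q
      fits a a<2 0≤a q<ac = a , 3ℚ , c , d , a<2 , 2<3 , N-below , N-above , q<ac , <-≤-trans q<ac (*-monoʳ 0≤a c≤d) ,
        <-≤-trans q<ac (*-monoˡ c≥0 a≤3) , <-≤-trans q<ac (*-mono 0≤a a≤3 c≥0 c≤d)
        where a≤3 = <⇒≤ (<-trans a<2 2<3)
      q<2c : q ℚ.< 2ℚ ℚ.* c
      q<2c = <-≤-trans (subst (q ℚ.<_) (sym (ι-def m)) q<m) (≤-trans (diff≥0⁻¹ (subst (0ℚ ℚ.≤_) (trans (cong₂ ℚ._-_ (ι-+ N N) (trans (ι-+ 2 m) (cong (ℚ._+ ι m) ι-2))) (l1 (ι N) (ι m))) (diff≥0 (ι-mono h)))) ≤-refl)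
        where
        l1 : ∀ n m → (n ℚ.+ n) ℚ.- (1ℚ ℚ.+ 1ℚ ℚ.+ m) ≡ 2ℚ ℚ.* (n ℚ.- 1ℚ) ℚ.- m
        l1 = solve-∀ ℚ-ring
      sign : Dec (q ℚ.< 0ℚ) → lower (fromℕ 2 *ᵣ x) q
      sign (yes q<0) = 0ℚ , 3ℚ , c , d , <-trans 0<1 (<-by 1ℚ 0<1 refl) , 2<3 , N-below , N-above , zero-product c , zero-product d ,
          <-≤-trans q<0 (*-nonNeg {3ℚ} (≤ᵇ⇒≤′ _) c≥0) , <-≤-trans q<0 (*-nonNeg {3ℚ} (≤ᵇ⇒≤′ _) (ι-≥0 (suc N)))
        where
        ≤ᵇ⇒≤′ = ℚₚ.≤ᵇ⇒≤ {0ℚ} {3ℚ}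
        zero-product : ∀ y → q ℚ.< 0ℚ ℚ.* y
        zero-product y = <-≤-trans q<0 (≤-reflexive (sym (ℚₚ.*-zeroˡ y)))
      -- a is chosen so that a c is the midpoint of q and 2 c
      sign (no q≮0) = fits a a<2 0≤a q<ac
        where
        0≤q = ℚₚ.≮⇒≥ q≮0
        c>0 : 0ℚ ℚ.< c
        c>0 = ℚₚ.*-cancelˡ-<-nonNeg 2ℚ (≤-<-trans (≤-trans (≤-reflexive (ℚₚ.*-zeroʳ 2ℚ)) 0≤q) q<2c)
        instance
          _ = ℚ.positive c>0
          _ = ℚₚ.pos⇒nonZero c
        i = ℚ.1/ c
        ci : c ℚ.* i ≡ 1ℚ
        ci = ℚₚ.*-inverseʳ c
        i>0 : 0ℚ ℚ.< i
        i>0 = ℚₚ.positive⁻¹ i {{ℚₚ.1/pos⇒pos c}}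
        a = ½ ℚ.* (q ℚ.+ 2ℚ ℚ.* c) ℚ.* i
        ac≡ : a ℚ.* c ≡ ½ ℚ.* (q ℚ.+ 2ℚ ℚ.* c)
        ac≡ = trans (l2 (½ ℚ.* (q ℚ.+ 2ℚ ℚ.* c)) i c) (trans (cong (½ ℚ.* (q ℚ.+ 2ℚ ℚ.* c) ℚ.*_) ci) (ℚₚ.*-identityʳ (½ ℚ.* (q ℚ.+ 2ℚ ℚ.* c))))
          where
          l2 : ∀ e i c → e ℚ.* i ℚ.* c ≡ e ℚ.* (c ℚ.* i)
          l2 = solve-∀ ℚ-ring
        gap>0 : 0ℚ ℚ.< ½ ℚ.* (2ℚ ℚ.* c ℚ.- q)
        gap>0 = *-positive (ℚₚ.positive⁻¹ ½) (diff>0 q<2c)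
        q<ac : q ℚ.< a ℚ.* c
        q<ac = <-by (½ ℚ.* (2ℚ ℚ.* c ℚ.- q)) gap>0 (trans ac≡ (l3 q (2ℚ ℚ.* c)))
          where
          l3 : ∀ q y → ½ ℚ.* (q ℚ.+ y) ≡ q ℚ.+ ½ ℚ.* (y ℚ.- q)
          l3 = solve-∀ ℚ-ring
        a<2 : a ℚ.< 2ℚ
        a<2 = ℚₚ.*-cancelʳ-<-nonNeg c {{ℚ.nonNegative c≥0}} (<-by (½ ℚ.* (2ℚ ℚ.* c ℚ.- q)) gap>0 (trans (l4 q (2ℚ ℚ.* c)) (cong (ℚ._+ ½ ℚ.* (2ℚ ℚ.* c ℚ.- q)) (sym ac≡))))
          where
          l4 : ∀ q y → y ≡ ½ ℚ.* (q ℚ.+ y) ℚ.+ ½ ℚ.* (y ℚ.- q)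
          l4 = solve-∀ ℚ-ring
        0≤a : 0ℚ ℚ.≤ a
        0≤a = *-nonNeg (*-nonNeg {½} (<⇒≤ (ℚₚ.positive⁻¹ ½)) (+-nonNeg 0≤q (≤-trans 0≤q (<⇒≤ q<2c)))) (<⇒≤ i>0)

    module Count (h : ℕ) (h-small : 4 ℕ.^ (h ℕ.* h) ℕ.< N) where

      -- For ρ < h the partial sums of exp (ρ²) stay below 4^(h²) ≤ N - 1 < x, against ρ² being
      -- above log x.
      ρ-large : ∀ {ρ} → 0ℚ ℚ.< ρ → upper (log x) (ρ ^ᵣ 2) → ι h ℚ.≤ ρ
      ρ-large {ρ} 0<ρ (q , uq , r , q<r , n₀ , ev) = ℚₚ.≮⇒≥ λ ρ<h → <⇒≱ (<-≤-trans (below N-below uq) (<⇒≤ q<r)) (≤-trans (ev n₀ ℕₚ.≤-refl)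
          (≤-trans (≤-reflexive (partialSum≡ (ρ ^ᵣ 2) n₀)) (≤-trans (ex-mono sq≥0 (sq ρ<h) n₀) (≤-trans (ex-≤4^ (h ℕ.* h) n₀) Z≤))))
        where
        Z≤ : ι (4 ℕ.^ (h ℕ.* h)) ℚ.≤ ι N ℚ.- 1ℚ
        Z≤ = diff≥0⁻¹ (subst (0ℚ ℚ.≤_) (trans (cong (λ z → ι N ℚ.- z) (ι-suc (4 ℕ.^ (h ℕ.* h)))) (lem (ι N) (ι (4 ℕ.^ (h ℕ.* h))))) (diff≥0 (ι-mono h-small)))
          where
          lem : ∀ n z → n ℚ.- (1ℚ ℚ.+ z) ≡ n ℚ.- 1ℚ ℚ.- z
          lem = solve-∀ ℚ-ring
        sq≥0 : 0ℚ ℚ.≤ ρ ^ᵣ 2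
        sq≥0 = subst (0ℚ ℚ.≤_) (sym (^ᵣ≡ ρ 2)) (^^-nonNeg (<⇒≤ 0<ρ) 2)
        sq : ρ ℚ.< ι h → ρ ^ᵣ 2 ℚ.≤ ι (h ℕ.* h)
        sq ρ<h = ≤-trans (≤-reflexive (trans (^ᵣ≡ ρ 2) (cong (ρ ℚ.*_) (ℚₚ.*-identityʳ ρ)))) (≤-trans (*-mono (<⇒≤ 0<ρ) (<⇒≤ ρ<h) (<⇒≤ 0<ρ) (<⇒≤ ρ<h)) (≤-reflexive (sym (ι-* h h))))

      -- h is at most the square root of log x, so the left side is at most (N + 1) 2^(-h).
      density-bound : ∀ len → suc N ℕ.≤ len ℕ.* 2 ℕ.^ h → x *ᵣ exp (-ᵣ root 2 (log x)) ≤ᵣ fromℕ len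
      density-bound len N< q (a , b , c , d , la , ub , (r , (0<-r , up) , c′ , c<c′ , n₀ , ev) , _ , q<ac , _ , q<bc , _) = subst (q ℚ.<_) (ι-def len) (sign (ℚₚ.≤-total 0ℚ c))
        where
        0≤b : 0ℚ ℚ.≤ b
        0≤b = ≤-trans (diff≥0 (ι-≥1 (ℕₚ.≤-trans (s≤s z≤n) h-small))) (<⇒≤ (below N-below ub))
        neg-neg : ∀ r → r ≡ ℚ.- (ℚ.- r)
        neg-neg = solve-∀ ℚ-ring
        small : 0ℚ ℚ.≤ c → ι (2 ℕ.^ h) ℚ.* c ℚ.≤ 1ℚ
        small 0≤c = exp-neg-bound h n₀ (ρ-large 0<-r up) 0≤c c<c′ (λ n n₀≤n → ≤-trans (ev n n₀≤n) (≤-reflexive (trans (partialSum≡ r n) (cong (λ z → ex z n) (neg-neg r)))))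
        lem : ∀ l z c → l ℚ.* z ℚ.* c ≡ l ℚ.* (z ℚ.* c)
        lem = solve-∀ ℚ-ring
        sign : 0ℚ ℚ.≤ c ⊎ c ℚ.≤ 0ℚ → q ℚ.< ι len
        sign (inj₁ 0≤c) = <-≤-trans q<ac (begin
          a ℚ.* c                          ≤⟨ *-monoˡ 0≤c (≤-trans (<⇒≤ (lower< la)) (ι-mono N<)) ⟩
          ι (len ℕ.* 2 ℕ.^ h) ℚ.* c        ≡⟨ cong (ℚ._* c) (ι-* len (2 ℕ.^ h)) ⟩
          ι len ℚ.* ι (2 ℕ.^ h) ℚ.* c      ≡⟨ lem (ι len) (ι (2 ℕ.^ h)) c ⟩
          ι len ℚ.* (ι (2 ℕ.^ h) ℚ.* c)    ≤⟨ *-monoʳ (ι-≥0 len) (small 0≤c) ⟩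
          ι len ℚ.* 1ℚ                     ≡⟨ ℚₚ.*-identityʳ (ι len) ⟩
          ι len                            ∎)
          where open ℚₚ.≤-Reasoning
        sign (inj₂ c≤0) = <-≤-trans q<bc (≤-trans (*-monoʳ 0≤b c≤0) (≤-trans (≤-reflexive (ℚₚ.*-zeroʳ b)) (ι-≥0 len)))

  -- For lower approximations a of the root of k and c of 1/C, a ≤ s C and c C ≤ 1 give a c ≤ s; a
  -- negative a or c makes a product of endpoints nonpositive.
  root-quotient-bound : ∀ k C s len → k ℕ.≤ (s ℕ.* C) ℕ.* (s ℕ.* C) → s ℕ.≤ len → root 2 (fromℕ k) /ᵣ fromℚ (ι C) ≤ᵣ fromℕ len
  root-quotient-bound k C s len k≤ s≤ q (a , b , c , d , la , (0<b , _) , (e , C<e , ce<1) , _ , q<ac , _ , q<bc , _) =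
    subst (q ℚ.<_) (ι-def len) (<-≤-trans (sign (ℚₚ.≤-total 0ℚ c)) (ι-mono s≤))
    where
    lem : ∀ s C c → s ℚ.* C ℚ.* c ≡ s ℚ.* (c ℚ.* C)
    lem = solve-∀ ℚ-ring
    a≤ : a ^ᵣ 2 ℚ.< (+ k) ℚ./ 1 → a ℚ.≤ ι (s ℕ.* C)
    a≤ h = square-cancel-≤ (ι-≥0 (s ℕ.* C)) (begin
      a ℚ.* a                            ≡⟨ cong (a ℚ.*_) (sym (ℚₚ.*-identityʳ a)) ⟩
      a ℚ.* (a ℚ.* 1ℚ)                   ≡⟨ sym (^ᵣ≡ a 2) ⟩
      a ^ᵣ 2                             ≤⟨ <⇒≤ h ⟩
      (+ k) ℚ./ 1                        ≡⟨ sym (ι-def k) ⟩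
      ι k                                ≤⟨ ι-mono k≤ ⟩
      ι ((s ℕ.* C) ℕ.* (s ℕ.* C))        ≡⟨ ι-* (s ℕ.* C) (s ℕ.* C) ⟩
      ι (s ℕ.* C) ℚ.* ι (s ℕ.* C)        ∎)
      where open ℚₚ.≤-Reasoning
    positive : 0ℚ ℚ.≤ c → a ℚ.< 0ℚ ⊎ (0ℚ ℚ.≤ a × a ^ᵣ 2 ℚ.< (+ k) ℚ./ 1) → q ℚ.< ι s
    positive 0≤c (inj₁ a<0) = <-≤-trans q<ac (≤-trans (*-monoˡ 0≤c (<⇒≤ a<0)) (≤-trans (≤-reflexive (ℚₚ.*-zeroˡ c)) (ι-≥0 s)))
    positive 0≤c (inj₂ (_ , a²<k)) = <-≤-trans q<ac (begin
      a ℚ.* c                   ≤⟨ *-monoˡ 0≤c (a≤ a²<k) ⟩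
      ι (s ℕ.* C) ℚ.* c         ≡⟨ trans (cong (ℚ._* c) (ι-* s C)) (lem (ι s) (ι C) c) ⟩
      ι s ℚ.* (c ℚ.* ι C)       ≤⟨ *-monoʳ (ι-≥0 s) (≤-trans (*-monoʳ 0≤c (<⇒≤ C<e)) (<⇒≤ ce<1)) ⟩
      ι s ℚ.* 1ℚ                ≡⟨ ℚₚ.*-identityʳ (ι s) ⟩
      ι s                       ∎)
      where open ℚₚ.≤-Reasoning
    sign : 0ℚ ℚ.≤ c ⊎ c ℚ.≤ 0ℚ → q ℚ.< ι s
    sign (inj₁ 0≤c) = positive 0≤c la
    sign (inj₂ c≤0) = <-≤-trans q<bc (≤-trans (*-monoʳ (<⇒≤ 0<b) c≤0) (≤-trans (≤-reflexive (ℚₚ.*-zeroʳ b)) (ι-≥0 s)))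

-- Passage from integers to the statement over the reals

open import Defs
open import Data.Nat.Base as ℕ using (ℕ; zero; suc; z≤n; s≤s)
import Data.Nat.Properties as ℕₚ
import Data.Nat.GCD as ℕ-GCD
import Data.Nat.Divisibility as ℕ-Div
open import Data.Nat.Primality using (Prime; prime⇒nonZero)
open import Data.Integer.Base as ℤ using (ℤ; +_; 0ℤ; 1ℤ; ∣_∣)
import Data.Integer.Properties as ℤₚ
import Data.Integer.DivMod as ℤ-DivMod
import Data.Integer.Divisibility.Signed as ℤ-Div
open import Data.Integer.GCD using (gcd)
open import Data.Rational.Base as ℚ using (ℚ; 0ℚ; 1ℚ)
open import Data.Rational.Properties as ℚₚ using (≤-trans; <-≤-trans; <-trans; <⇒≤)
open import Data.Fin.Base using (Fin; zero; suc; fromℕ<; toℕ)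
import Data.Fin.Properties as Finₚ
open import Data.List.Base using ([]; _∷_; length; map)
open import Data.List.Properties using (length-map)
open import Data.List.Relation.Unary.All as All using (All; []; _∷_)
import Data.List.Relation.Unary.All.Properties as Allₚ
open import Data.List.Relation.Unary.AllPairs as AllPairs using ([]; _∷_)
import Data.List.Relation.Unary.AllPairs.Properties as AllPairsₚ
open import Data.List.Relation.Unary.Unique.Propositional using (Unique)
import Data.List.Relation.Unary.Unique.Propositional.Properties as Uₚ
open import Data.Product.Base using (_×_; _,_; proj₁; proj₂; Σ-syntax; ∃-syntax)
open import Relation.Nullary using (Dec; yes; no; ¬_; contradiction)
open import Relation.Binary.PropositionalEquality
import Data.Integer.Tactic.RingSolver as ℤ-Solver
open Rationals
open Character using (1≤2^)
open MertensModFour using (lg; P3; prime≥2; ^-distribʳ-*)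
open TwoSquares using (SumSq)
open IntegerForm using (core; Many; C₀; 1≤C₀)
open RealBounds

-- The integer form indexes functions by ℕ; beyond k a dummy value is returned.
coefficient : ∀ {k} → (Fin k → ℤ) → ℕ → ℕ
coefficient {k} f i = pick (i ℕₚ.<? k)
  where
  pick : Dec (i ℕ.< k) → ℕ
  pick (yes i<k) = ∣ f (fromℕ< i<k) ∣
  pick (no _)    = 1

coefficient-toℕ : ∀ {k} (f : Fin k → ℤ) j → coefficient f (toℕ j) ≡ ∣ f j ∣
coefficient-toℕ {k} f j with toℕ j ℕₚ.<? k
... | yes p = cong (λ i → ∣ f i ∣) (Finₚ.fromℕ<-toℕ j p)
... | no ¬p = contradiction (Finₚ.toℕ<n j) ¬p

below-bound : ∀ {k} (P : ℕ → Set) → (∀ (j : Fin k) → P (toℕ j)) → ∀ i → i ℕ.< k → P i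
below-bound P h i i<k = subst P (Finₚ.toℕ-fromℕ< i<k) (h (fromℕ< i<k))

indices : ∀ k (P : ℕ → Set) js → All (λ j → j ℕ.< k × P j) js → ∃[ xs ] map (toℕ {k}) xs ≡ js
indices k P [] [] = [] , refl
indices k P (j ∷ js) ((j<k , _) ∷ h) = let xs , e = indices k P js h in
  fromℕ< j<k ∷ xs , cong₂ _∷_ (Finₚ.toℕ-fromℕ< j<k) e

pos-abs : ∀ {z} → 0ℤ ℤ.< z → + ∣ z ∣ ≡ z
pos-abs h = ℤₚ.0≤i⇒+∣i∣≡i (ℤₚ.<⇒≤ h)

pos-abs≥1 : ∀ {z} → 0ℤ ℤ.< z → 1 ℕ.≤ ∣ z ∣
pos-abs≥1 h = ℤₚ.drop‿+<+ (subst (0ℤ ℤ.<_) (sym (pos-abs h)) h)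

value : ∀ L → 0ℤ ℤ.< a L → 0ℤ ℤ.< b L → ∀ m → L ⟨ + m ⟩ ≡ + (∣ a L ∣ ℕ.* m ℕ.+ ∣ b L ∣)
value L 0<a 0<b m = sym (trans (ℤₚ.pos-+ (∣ a L ∣ ℕ.* m) ∣ b L ∣) (cong₂ ℤ._+_ (trans (ℤₚ.pos-* ∣ a L ∣ m) (cong (ℤ._* + m) (pos-abs 0<a))) (pos-abs 0<b)))

∣∏ : ∀ {k} p (f : Fin k → ℤ) i → p ℕ-Div.∣ ∣ f i ∣ → p ℕ-Div.∣ ∣ ∏ f ∣
∣∏ {suc k} p f zero h = subst (p ℕ-Div.∣_) (sym (ℤₚ.abs-* (f zero) (∏ (λ j → f (suc j))))) (ℕ-Div.∣m⇒∣m*n ∣ ∏ (λ j → f (suc j)) ∣ h)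
∣∏ {suc k} p f (suc i) h = subst (p ℕ-Div.∣_) (sym (ℤₚ.abs-* (f zero) (∏ (λ j → f (suc j))))) (ℕ-Div.∣n⇒∣m*n ∣ f zero ∣ (∣∏ p (λ j → f (suc j)) i h))

gcd≡1⇒∤ : ∀ i j {d} → 2 ℕ.≤ d → gcd i j ≡ 1ℤ → d ℕ-Div.∣ ∣ i ∣ → ¬ d ℕ-Div.∣ ∣ j ∣
gcd≡1⇒∤ i j {d} 2≤d e di dj = ℕₚ.<⇒≱ 2≤d (ℕ-Div.∣⇒≤ (subst (d ℕ-Div.∣_) (ℤₚ.+-injective e) (ℕ-GCD.gcd-greatest di dj)))

-- The integer given by admissibility may be negative or large; reduction modulo p does not affect
-- divisibility of the values by p.
avoided-residue : ∀ {k} (L : Fin k → LinearFunction) → P₃-Admissible L → ∀ p → P3 p →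
  ∃[ c ] (c ℕ.< p × (∀ i → ¬ p ℕ-Div.∣ ∣ a (L i) ∣ ℕ.* c ℕ.+ ∣ b (L i) ∣))
avoided-residue L adm p (pp , p%4) = c , ℤ-DivMod.n%ℕd<d n p , λ i h → gcd≡1⇒∤ (∏ (λ i → L i ⟨ n ⟩)) (+ p) (prime≥2 pp) coprime (∣∏ p (λ i → L i ⟨ n ⟩) i (divides-value i h)) ℕ-Div.∣-refl
  where
  open P₃-Admissible adm
  instance _ = prime⇒nonZero pp
  n = proj₁ (admissible p pp p%4)
  coprime = proj₂ (admissible p pp p%4)
  c = n ℤ.%ℕ p
  quot = n ℤ./ℕ p
  lem : ∀ a b c q p → a ℤ.* (c ℤ.+ q ℤ.* p) ℤ.+ b ≡ (a ℤ.* c ℤ.+ b) ℤ.+ (a ℤ.* q) ℤ.* p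
  lem = ℤ-Solver.solve-∀
  divides-value : ∀ i → p ℕ-Div.∣ ∣ a (L i) ∣ ℕ.* c ℕ.+ ∣ b (L i) ∣ → p ℕ-Div.∣ ∣ L i ⟨ n ⟩ ∣
  divides-value i h = ℤ-Div.∣⇒∣ᵤ (subst (+ p ℤ-Div.∣_) (sym shifted)
    (ℤ-Div.∣m∣n⇒∣m+n {+ p} {L i ⟨ + c ⟩} {a (L i) ℤ.* quot ℤ.* + p} (subst (+ p ℤ-Div.∣_) (sym (value (L i) (proj₁ (positive i)) (proj₂ (positive i)) c)) (ℤ-Div.∣ᵤ⇒∣ {+ p} {+ (∣ a (L i) ∣ ℕ.* c ℕ.+ ∣ b (L i) ∣)} h)) (ℤ-Div.divides (a (L i) ℤ.* quot) refl)))
    where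
    shifted : L i ⟨ n ⟩ ≡ L i ⟨ + c ⟩ ℤ.+ (a (L i) ℤ.* quot) ℤ.* + p
    shifted = trans (cong (L i ⟨_⟩) (ℤ-DivMod.a≡a%ℕn+[a/ℕn]*n n p)) (lem (a (L i)) (b (L i)) (+ c) quot (+ p))

^-cancelʳ-< : ∀ m n → 2 ℕ.^ m ℕ.< 2 ℕ.^ n → m ℕ.< n
^-cancelʳ-< m n h = ℕₚ.≰⇒> (λ n≤m → ℕₚ.<⇒≱ h (ℕₚ.^-monoʳ-≤ 2 n≤m))

^-exchange : ∀ d u v → v ℕ.≤ 2 ℕ.* u → 2 ℕ.^ d ℕ.≤ u → v ℕ.^ d ℕ.≤ u ℕ.^ suc d
^-exchange d u v v≤ h = ℕₚ.≤-trans (ℕₚ.^-monoˡ-≤ d v≤) (ℕₚ.≤-trans (ℕₚ.≤-reflexive (^-distribʳ-* d 2 u)) (ℕₚ.*-monoˡ-≤ (u ℕ.^ d) h))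

2*square< : ∀ d v → 2 ℕ.< v → 2 ℕ.* (v ℕ.^ d ℕ.* v ℕ.^ d) ℕ.< v ℕ.^ suc (d ℕ.+ d)
2*square< d v@(suc _) 2<v = subst (λ z → 2 ℕ.* z ℕ.< v ℕ.* v ℕ.^ (d ℕ.+ d)) (ℕₚ.^-distribˡ-+-* v d d) (ℕₚ.*-monoˡ-< (v ℕ.^ (d ℕ.+ d)) {{ℕ.>-nonZero (ℕₚ.m^n>0 v (d ℕ.+ d))}} 2<v)

-- For large x: an integer N with |x - N| < 1, ℓ = ⌊log₂ N⌋, and v = u + 1 where u = ⌊ℓ^(1/20)⌋.
record Scale (x : Cut) (D : IsDedekind x) : Set where
  field
    N ℓ u v : ℕ
    N-below : lower x (ι N ℚ.- 1ℚ)
    N-above : upper x (ι (suc N))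
    2^ℓ≤N   : 2 ℕ.^ ℓ ℕ.≤ N
    N<2^    : N ℕ.< 2 ℕ.^ suc ℓ
    v≡      : v ≡ suc u
    v-large : 2 ℕ.^ 40 ℕ.< v
    u^20≤ℓ  : u ℕ.^ 20 ℕ.≤ ℓ
    ℓ<v^20  : ℓ ℕ.< v ℕ.^ 20

  2^≤u : ∀ e → e ℕ.≤ 40 → 2 ℕ.^ e ℕ.≤ u
  2^≤u e h = ℕₚ.≤-pred (subst (2 ℕ.^ e ℕ.<_) v≡ (ℕₚ.≤-<-trans (ℕₚ.^-monoʳ-≤ 2 h) v-large))

  -- v = u + 1 ≤ 2u, and the resulting 2^19 is traded for one more power of u.
  v^19≤ℓ : v ℕ.^ 19 ℕ.≤ ℓ
  v^19≤ℓ = ℕₚ.≤-trans (^-exchange 19 u v v≤2u (2^≤u 19 (ℕₚ.≤ᵇ⇒≤ 19 40 _))) u^20≤ℓ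
    where
    v≤2u : v ℕ.≤ 2 ℕ.* u
    v≤2u = subst (ℕ._≤ 2 ℕ.* u) (sym v≡) (ℕₚ.≤-trans (ℕₚ.+-monoˡ-≤ u (2^≤u 0 z≤n)) (ℕₚ.≤-reflexive (cong (u ℕ.+_) (sym (ℕₚ.+-identityʳ u)))))

  1≤v : 1 ℕ.≤ v
  1≤v = subst (1 ℕ.≤_) (sym v≡) (s≤s z≤n)

  1≤v^ : ∀ e → 1 ℕ.≤ v ℕ.^ e
  1≤v^ e = ℕₚ.m^n>0 v {{ℕ.>-nonZero 1≤v}} e

  1≤N : 1 ℕ.≤ N
  1≤N = ℕₚ.≤-trans (1≤2^ ℓ) 2^ℓ≤N

  -- 2 v^18 < v^19 ≤ ℓ. This makes v^9 admissible as the h of `Count`, so that a factor 2^(v^9) may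
  -- be lost.
  4^<N : 4 ℕ.^ (v ℕ.^ 9 ℕ.* v ℕ.^ 9) ℕ.< N
  4^<N = ℕₚ.<-≤-trans (ℕₚ.≤-<-trans (ℕₚ.≤-reflexive (ℕₚ.^-*-assoc 2 2 (v ℕ.^ 9 ℕ.* v ℕ.^ 9)))
    (ℕₚ.^-monoʳ-< 2 ℕₚ.≤-refl (ℕₚ.<-≤-trans (2*square< 9 v (subst (2 ℕ.<_) (sym v≡) (s≤s (2^≤u 1 (s≤s z≤n))))) v^19≤ℓ))) 2^ℓ≤N

  open Bounds x D N N-below N-above public

  -- On the scale where log x is at most about v^20, the fifth root gives k ≤ v^4 and the cube root,
  -- with 7 · 3 ≥ 20, gives coefficients up to v^7.
  root-bound-v : ∀ d e .{{_ : ℕ.NonZero d}} m → 20 ℕ.≤ e ℕ.* d → fromℕ m ≤ᵣ root d (log x) → m ℕ.≤ v ℕ.^ e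
  root-bound-v d e zero _ _ = z≤n
  root-bound-v d e (suc m) 20≤ h = ^-cancelˡ-< d m (v ℕ.^ e) (ℕₚ.≤-<-trans
    (ℕₚ.≤-pred (^-cancelʳ-< (m ℕ.^ d) (suc ℓ) (ℕₚ.≤-<-trans (root-bound d m h) N<2^)))
    (ℕₚ.<-≤-trans ℓ<v^20 (ℕₚ.≤-trans (ℕₚ.^-monoʳ-≤ v {{ℕ.>-nonZero 1≤v}} 20≤) (ℕₚ.≤-reflexive (sym (ℕₚ.^-*-assoc v e d))))))

  scaled-core : ∀ k (a b : ℕ → ℕ) → 1 ℕ.≤ k → k ℕ.≤ v ℕ.^ 4 → _
  scaled-core k a b 1≤k k≤ = core N ℓ v k a b (ℕₚ.<⇒≤ v-large) v^19≤ℓ (ℕₚ.<⇒≤ ℓ<v^20) 2^ℓ≤N (ℕₚ.<⇒≤ N<2^) 1≤k k≤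

scale : ∀ x (D : IsDedekind x) → fromℚ (ι X₀) ≤ᵣ x → Scale x D
scale x D h = assemble (approximate lower-0)
  where
  open IsDedekind D
  open Dedekind x D
  lower-Λ : lower x (ι (2 ℕ.^ Λ₀))
  lower-Λ = h _ (subst (λ z → ι (2 ℕ.^ Λ₀) ℚ.< ι z) (sym X₀-def) (ι-mono-< {2 ℕ.^ Λ₀} ℕₚ.≤-refl))
  lower-0 : lower x 0ℚ
  lower-0 = lower-closed (<-≤-trans 0<1 (ι-≥1 (1≤2^ Λ₀))) lower-Λ
  assemble : ∃[ N ] (lower x (ι N ℚ.- 1ℚ) × upper x (ι (suc N))) → Scale x D
  assemble (N , lo , up) = take-log (lg N (ℕₚ.≤-trans (1≤2^ Λ₀) 2^Λ≤N))
    where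
    2^Λ≤N : 2 ℕ.^ Λ₀ ℕ.≤ N
    2^Λ≤N = ℕₚ.≤-pred (ℕₚ.≰⇒> (λ le → <⇒≱ (below lower-Λ up) (ι-mono le)))
    take-log : ∃[ ℓ ] (2 ℕ.^ ℓ ℕ.≤ N × N ℕ.< 2 ℕ.^ suc ℓ) → Scale x D
    take-log (ℓ , 2^ℓ≤N , N<) = take-root (integer-root 20 (s≤s z≤n) ℓ)
      where
      take-root : ∃[ u ] ∃[ v ] (v ≡ suc u × u ℕ.^ 20 ℕ.≤ ℓ × ℓ ℕ.< v ℕ.^ 20) → Scale x D
      take-root (u , v , v≡ , u≤ , <v) = record
        { N = N ; ℓ = ℓ ; u = u ; v = v ; N-below = lo ; N-above = up ; 2^ℓ≤N = 2^ℓ≤N ; N<2^ = N< ; v≡ = v≡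
        ; v-large = Λ₀-large ℓ v (ℕₚ.≤-pred (^-cancelʳ-< Λ₀ (suc ℓ) (ℕₚ.≤-<-trans 2^Λ≤N N<))) <v
        ; u^20≤ℓ = u≤ ; ℓ<v^20 = <v }

Conclusion : (x : Cut) (k : ℕ) → (Fin k → LinearFunction) → Set
Conclusion x k L = # (λ (n : ℤ) → x ≤ᵣ fromℤ n × fromℤ n ≤ᵣ fromℕ 2 *ᵣ x ×
    # (λ (i : Fin k) → 𝒮 (L i ⟨ n ⟩)) ≥ (root 2 (fromℕ k) /ᵣ fromℚ (ι C₀)))
    ≥ (x *ᵣ exp (-ᵣ root 2 (log x)))

module Conclude (x : Cut) (D : IsDedekind x) (S : Scale x D) where
  open Scale S

  transfer : ∀ {k} (L : Fin k → LinearFunction) {P : ℕ → Set} →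
    (∀ m → P m → suc N ℕ.≤ m × 2 ℕ.+ m ℕ.≤ N ℕ.+ N × # (λ (i : Fin k) → 𝒮 (L i ⟨ + m ⟩)) ≥ (root 2 (fromℕ k) /ᵣ fromℚ (ι C₀))) →
    ∃[ ms ] (Unique ms × All P ms × suc N ℕ.≤ length ms ℕ.* 2 ℕ.^ (v ℕ.^ 9)) → Conclusion x k L
  transfer L h (ms , unique , all , long) = map +_ ms , Uₚ.map⁺ ℤₚ.+-injective unique ,
    Allₚ.map⁺ (All.map (λ {m} Pm → let lo , hi , many = h m Pm in ≥x m lo , ≤2x m 1≤N hi , many) all) ,
    subst (λ z → x *ᵣ exp (-ᵣ root 2 (log x)) ≤ᵣ fromℕ z) (sym (length-map +_ ms)) (Count.density-bound (v ℕ.^ 9) 4^<N (length ms) long)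

  -- The claim still asks for many n in [x, 2x]. They come from the single form n + 1, whose values
  -- are then forgotten.
  no-functions : (L : Fin 0 → LinearFunction) → Conclusion x 0 L
  no-functions L = transfer L (λ m (lo , hi , _) → lo , hi , [] , [] , [] , root-quotient-bound 0 C₀ 0 0 z≤n z≤n)
    (proj₂ (proj₂ (scaled-core 1 (λ _ → 1) (λ _ → 1) ℕₚ.≤-refl (1≤v^ 4) (λ _ _ → ℕₚ.≤-refl) (λ _ _ → 1≤v^ 7)
      (λ _ _ 2∣1 → ℕₚ.<⇒≱ ℕₚ.≤-refl (ℕ-Div.∣⇒≤ 2∣1)) (λ _ _ → 1≤N)
      (λ p (pp , _) → 0 , ℕₚ.≤-trans (s≤s z≤n) (prime≥2 pp) , λ _ _ p∣1 → ℕₚ.<⇒≱ (prime≥2 pp) (ℕ-Div.∣⇒≤ p∣1)))))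

  module _ {k : ℕ} (1≤k : 1 ℕ.≤ k) (k≤ : fromℕ k ≤ᵣ root 5 (log x)) (p₀ : ℕ) (L : Fin k → LinearFunction) (adm : P₃-Admissible L)
    (a≤ : ∀ i → fromℤ (a (L i)) ≤ᵣ root 3 (log x)) (coprime : ∀ i → gcd (+ 2 ℤ.* + p₀) (a (L i)) ≡ 1ℤ)
    (b< : ∀ i → fromℤ (b (L i)) <ᵣ x) where
    open P₃-Admissible adm

    A B : ℕ → ℕ
    A = coefficient (λ i → a (L i))
    B = coefficient (λ i → b (L i))

    0<a : ∀ i → 0ℤ ℤ.< a (L i)
    0<a i = proj₁ (positive i)

    0<b : ∀ i → 0ℤ ℤ.< b (L i)
    0<b i = proj₂ (positive i)

    A-elim : ∀ (P : ℕ → Set) → (∀ j → P ∣ a (L j) ∣) → ∀ i → i ℕ.< k → P (A i)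
    A-elim P h = below-bound (λ i → P (A i)) (λ j → subst P (sym (coefficient-toℕ (λ i → a (L i)) j)) (h j))

    value≡ : ∀ j m → A (toℕ j) ℕ.* m ℕ.+ B (toℕ j) ≡ ∣ a (L j) ∣ ℕ.* m ℕ.+ ∣ b (L j) ∣
    value≡ j m = cong₂ (λ a b → a ℕ.* m ℕ.+ b) (coefficient-toℕ (λ i → a (L i)) j) (coefficient-toℕ (λ i → b (L i)) j)

    -- Being prime to 2 p₀ makes the coefficient odd, which lets each form take values congruent to
    -- 1 modulo 4.
    odd : ∀ j → ¬ 2 ℕ-Div.∣ ∣ a (L j) ∣
    odd j = gcd≡1⇒∤ (+ 2 ℤ.* + p₀) (a (L j)) ℕₚ.≤-refl (coprime j) (subst (2 ℕ-Div.∣_) (sym (ℤₚ.abs-* (+ 2) (+ p₀))) (ℕ-Div.m∣m*n p₀))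

    b≤N : ∀ j → ∣ b (L j) ∣ ℕ.≤ N
    b≤N j = let q , b<q , lq = b< j in
      ℕₚ.≤-pred (ℕₚ.≰⇒> (λ le → <⇒≱ (<-trans (subst (ℚ._< q) (trans (cong (ℚ._/ 1) (sym (pos-abs (0<b j)))) (sym (ι-def ∣ b (L j) ∣))) b<q) (lower< lq)) (ι-mono le)))

    avoid : ∀ p → P3 p → ∃[ c ] (c ℕ.< p × (∀ i → i ℕ.< k → ¬ p ℕ-Div.∣ A i ℕ.* c ℕ.+ B i))
    avoid p P3p = let c , c<p , h = avoided-residue L adm p P3p in
      c , c<p , below-bound (λ i → ¬ p ℕ-Div.∣ A i ℕ.* c ℕ.+ B i) (λ j d → h j (subst (p ℕ-Div.∣_) (value≡ j c) d))

    sum-of-squares : ∀ m j → SumSq (A (toℕ j) ℕ.* m ℕ.+ B (toℕ j)) → 𝒮 (L j ⟨ + m ⟩)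
    sum-of-squares m j (s , t , e) = subst 𝒮 (sym (trans (value (L j) (0<a j) (0<b j) m) (cong +_ (sym (value≡ j m)))))
      (ℤ.+<+ (ℕₚ.≤-trans (ℕₚ.≤-trans (pos-abs≥1 (0<b j)) (ℕₚ.≤-reflexive (sym (coefficient-toℕ (λ i → b (L i)) j)))) (ℕₚ.m≤n+m (B (toℕ j)) (A (toℕ j) ℕ.* m))) , s , t , e)

    many : ∀ m′ → k ℕ.≤ (suc m′ ℕ.* C₀) ℕ.* (suc m′ ℕ.* C₀) → ∀ m → Many k A B N m′ m →
      suc N ℕ.≤ m × 2 ℕ.+ m ℕ.≤ N ℕ.+ N × # (λ (i : Fin k) → 𝒮 (L i ⟨ + m ⟩)) ≥ (root 2 (fromℕ k) /ᵣ fromℚ (ι C₀))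
    many m′ k≤□ m (lo , hi , js , unique , all , long) = lo , hi , xs ,
      AllPairs.map (λ ne e → ne (cong toℕ e)) (AllPairsₚ.map⁻ (subst Unique (sym xs≡) unique)) ,
      All.map (λ {j} (_ , sq) → sum-of-squares m j sq) (Allₚ.map⁻ (subst (All (λ j → j ℕ.< k × SumSq (A j ℕ.* m ℕ.+ B j))) (sym xs≡) all)) ,
      root-quotient-bound k C₀ (suc m′) (length xs) k≤□ (ℕₚ.≤-trans long (ℕₚ.≤-reflexive (trans (cong length (sym xs≡)) (length-map toℕ xs))))
      where
      found = indices k (λ j → SumSq (A j ℕ.* m ℕ.+ B j)) js all
      xs = proj₁ found
      xs≡ = proj₂ found

    conclusion : Conclusion x k L
    conclusion = finish (scaled-core k A B 1≤k (root-bound-v 5 4 k ℕₚ.≤-refl k≤)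
        (A-elim (1 ℕ.≤_) (λ j → pos-abs≥1 (0<a j)))
        (A-elim (ℕ._≤ v ℕ.^ 7) (λ j → root-bound-v 3 7 ∣ a (L j) ∣ (ℕₚ.n≤1+n 20) (subst (λ z → fromℤ z ≤ᵣ root 3 (log x)) (sym (pos-abs (0<a j))) (a≤ j))))
        (A-elim (λ z → ¬ 2 ℕ-Div.∣ z) odd)
        (below-bound (λ i → B i ℕ.≤ N) (λ j → subst (ℕ._≤ N) (sym (coefficient-toℕ (λ i → b (L i)) j)) (b≤N j)))
        avoid)
      where
      finish : ∃[ m′ ] (k ℕ.≤ (suc m′ ℕ.* C₀) ℕ.* (suc m′ ℕ.* C₀) × ∃[ ms ] (Unique ms × All (Many k A B N m′) ms × suc N ℕ.≤ length ms ℕ.* 2 ℕ.^ (v ℕ.^ 9))) → Conclusion x k L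
      finish (m′ , k≤□ , found) = transfer L (many m′ k≤□) found

theorem3 : Σ[ C ∈ ℝ ] Σ[ c ∈ ℝ ] Σ[ x₀ ∈ ℝ ] (0ᵣ <ᵣ cut C × 0ᵣ <ᵣ cut c ×
    ((x′ : ℝ) → let x = cut x′ in cut x₀ ≤ᵣ x →
    (k : ℕ) → fromℕ k ≤ᵣ root 5 (log x) →
    Σ[ p₀ ∈ ℕ ] (Prime p₀ × cut c *ᵣ log (log x) ≤ᵣ fromℕ p₀ ×
    ((L : Fin k → LinearFunction) → P₃-Admissible L →
    ((i : Fin k) → 0ℤ ℤ.< a (L i) × fromℤ (a (L i)) ≤ᵣ root 3 (log x)) →
    ((i : Fin k) → gcd (+ 2 ℤ.* + p₀) (a (L i)) ≡ 1ℤ) →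
    ((i : Fin k) → 0ℤ ℤ.< b (L i) × fromℤ (b (L i)) <ᵣ x) →
    # (λ (n : ℤ) → x ≤ᵣ fromℤ n × fromℤ n ≤ᵣ fromℕ 2 *ᵣ x ×
    # (λ (i : Fin k) → 𝒮 (L i ⟨ n ⟩)) ≥ (root 2 (fromℕ k) /ᵣ cut C))
    ≥ (x *ᵣ exp (-ᵣ root 2 (log x)))))))
theorem3 = rational (ι C₀) , rational 1ℚ , rational (ι X₀) , ℚₚ.<-dense (<-≤-trans 0<1 (ι-≥1 1≤C₀)) , ℚₚ.<-dense 0<1 , λ x′ x₀≤x k k≤ →
  let x = cut x′
      D = ℝ.isDedekind x′
      S = scale x D x₀≤x
      open Scale S
      p₀ , p₀-prime , p₀> = large-prime (suc N)
  in p₀ , p₀-prime , (λ q h → subst (q ℚ.<_) (ι-def p₀) (<-≤-trans (loglog h) (ι-mono (ℕₚ.<⇒≤ p₀>)))) , λ L adm a≤ coprime b< →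
    by-size x D S k k≤ p₀ L adm (λ i → proj₂ (a≤ i)) coprime (λ i → proj₂ (b< i))
  where
  by-size : ∀ x D (S : Scale x D) k → fromℕ k ≤ᵣ root 5 (log x) → ∀ p₀ (L : Fin k → LinearFunction) → P₃-Admissible L →
    (∀ i → fromℤ (a (L i)) ≤ᵣ root 3 (log x)) → (∀ i → gcd (+ 2 ℤ.* + p₀) (a (L i)) ≡ 1ℤ) → (∀ i → fromℤ (b (L i)) <ᵣ x) → Conclusion x k L
  -- The empty family is treated apart, as the sieve works with k ≥ 1.
  by-size x D S zero k≤ p₀ L adm a≤ coprime b< = Conclude.no-functions x D S L
  by-size x D S (suc k) k≤ p₀ L adm a≤ coprime b< = Conclude.conclusion x D S (s≤s z≤n) k≤ p₀ L adm a≤ coprime b<
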